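{- Let $s,t$ be coprime integers greater than $1$, let $\sigma,\tau$ be $(s,t)$-cores and $n\ge0$ an integer. Then the set of partitions of $n$ with $s$-core $\sigma$ and $t$-core $\tau$ contains exactly one self-conjugate partition if and only if $\sigma'=\sigma$, $\tau'=\tau$ and one of the following holds: (C1) $\sigma=\tau$ and $n=|\sigma|$; (C2) $t$ is odd, $\sigma\rightharpoondown_{s,t}\tau$, and $n=|\tau|+t$; (C3) $s$ is odd, $\tau\rightharpoondown_{t,s}\sigma$, and $n=|\sigma|+s$; (C4) $s$ and $t$ are both odd, $\sigma\leftrightharpoons_{s,t}\tau$, and $n=|\sigma\star\tau|+s+t$; (C5) $s$ and $t$ are both odd, $\sigma=\tau=\kappa_{s,t}$, and $n=|\kappa_{s,t}|+st$.
   Context: Partitions, size $|\lambda|$; beta-set $\mathcal B(\lambda)=\{\lambda_r-r:r\ge1\}$. The conjugate $\lambda'$ is given by $\lambda'_r=|\{c:\lambda_c\ge r\}|$; $\lambda$ is self-conjugate if $\lambda'=\lambda$. A rim $s$-hook is a connected set of $s$ nodes of the rim of the Young diagram (nodes $(r,c)$ with $(r+1,c+1)$ not a node) whose removal leaves a partition's diagram; $\lambda$ is an $s$-core if it has no rim $s$-hook, and the $s$-core of $\lambda$ is obtained by repeatedly removing rim $s$-hooks. An $(s,t)$-core is both an $s$-core and a $t$-core; $\kappa_{s,t}$ denotes the unique $(s,t)$-core of largest size. For $b\in\mathbb Z$ write $\bar b=-1-b$. For partitions $\alpha,\beta$ and positive integers $p,q$, write $\alpha\rightharpoondown_{p,q}\beta$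 if there is an integer $b\in\mathcal B(\beta)\setminus\mathcal B(\alpha)$ with $\bar b-b\equiv q\pmod{2p}$ and $\mathcal B(\alpha)=(\mathcal B(\beta)\setminus\{b\})\cup\{\bar b\}$. Write $\sigma\leftrightharpoons_{s,t}\tau$ if there are distinct integers $b,c\in\mathcal B(\tau)\setminus\mathcal B(\sigma)$ with $\bar b-b\equiv t\pmod{2s}$, $\bar c-c\equiv -s\pmod{2t}$ and $\mathcal B(\sigma)=(\mathcal B(\tau)\setminus\{b,c\})\cup\{\bar b,\bar c\}$; in that case $\sigma\star\tau$ denotes the partition with beta-set $(\mathcal B(\tau)\setminus\{c\})\cup\{\bar c\}$. -}

module Defs where

open import Data.Nat as ℕ using (ℕ; zero; suc; _≤_; _<_; _≤?_; _∸_)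
open import Data.Nat.Divisibility as ℕD using ()
open import Data.Integer as ℤ using (ℤ; +_; _-_)
open import Data.Integer.Divisibility as ℤD using ()
open import Data.List using (List; []; _∷_; length; filter)
open import Data.Nat.ListAction using (sum)
open import Data.List.Relation.Unary.All using (All)
open import Data.List.Relation.Unary.Linked using (Linked)
open import Data.Product using (Σ; _×_; ∃; ∃-syntax; _,_)
open import Data.Sum using (_⊎_)
open import Relation.Nullary using (¬_)
open import Relation.Binary.PropositionalEquality using (_≡_; _≢_)
open import Relation.Binary.Construct.Closure.ReflexiveTransitive using (Star)
open import Function.Bundles using (_⇔_)

record Partition : Set where
  constructor mkPartition
  field
    parts    : List ℕ
    decr     : Linked ℕ._≥_ parts
    positive : All (0 <_) parts
open Partition public

nth : List ℕ → ℕ → ℕ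
nth []       _       = 0
nth (x ∷ xs) zero    = x
nth (x ∷ xs) (suc i) = nth xs i

-- λ_r for r ≥ 1 (only used with r ≥ 1); λ_r = 0 beyond the length
part : Partition → ℕ → ℕ
part λ′ r = nth (parts λ′) (r ∸ 1)

size : Partition → ℕ
size λ′ = sum (parts λ′)

_≈P_ : Partition → Partition → Set
α ≈P β = parts α ≡ parts β

_∈B_ : ℤ → Partition → Set
b ∈B λ′ = ∃[ r ] (1 ≤ r × b ≡ (+ part λ′ r) - (+ r))

bar : ℤ → ℤ
bar b = ℤ.-[1+ 0 ] - b

_≡_[modℤ_] : ℤ → ℤ → ℕ → Set
x ≡ y [modℤ m ] = (+ m) ℤD.∣ (x - y)

conjPart : Partition → ℕ → ℕ
conjPart λ′ r = length (filter (r ≤?_) (parts λ′))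

SelfConj : Partition → Set
SelfConj λ′ = ∀ r → 1 ≤ r → conjPart λ′ r ≡ part λ′ r

Node : Partition → ℕ → ℕ → Set
Node λ′ r c = 1 ≤ r × 1 ≤ c × c ≤ part λ′ r

Rim : Partition → ℕ → ℕ → Set
Rim λ′ r c = Node λ′ r c × ¬ Node λ′ (suc r) (suc c)

Adj : ℕ → ℕ → ℕ → ℕ → Set
Adj r c r′ c′ = (r ≡ r′ × (suc c ≡ c′ ⊎ c ≡ suc c′))
              ⊎ (c ≡ c′ × (suc r ≡ r′ ⊎ r ≡ suc r′))

data Path (P : ℕ → ℕ → Set) : ℕ → ℕ → ℕ → ℕ → Set where
  here : ∀ {r c} → P r c → Path P r c r c
  step : ∀ {r c r′ c′ r″ c″} → P r c → Adj r c r′ c′ →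
         Path P r′ c′ r″ c″ → Path P r c r″ c″

Skew : Partition → Partition → ℕ → ℕ → Set
Skew λ′ μ r c = Node λ′ r c × ¬ Node μ r c

-- μ is obtained from λ by removing a rim s-hook H = λ \ μ:
-- H ⊆ rim of λ, |H| = s, H connected, and the remaining diagram is
-- that of the partition μ.
RemoveRimHook : ℕ → Partition → Partition → Set
RemoveRimHook s λ′ μ =
    (∀ r c → Node μ r c → Node λ′ r c)
  × size λ′ ≡ size μ ℕ.+ s
  × (∀ r c → Skew λ′ μ r c → Rim λ′ r c)
  × (∀ r c r′ c′ → Skew λ′ μ r c → Skew λ′ μ r′ c′ → Path (Skew λ′ μ) r c r′ c′)

IsCore : ℕ → Partition → Set
IsCore s λ′ = ¬ (Σ Partition λ μ → RemoveRimHook s λ′ μ)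

CoreOf : ℕ → Partition → Partition → Set
CoreOf s λ′ κ = Star (RemoveRimHook s) λ′ κ × IsCore s κ

IsKappa : ℕ → ℕ → Partition → Set
IsKappa s t κ = IsCore s κ × IsCore t κ
              × (∀ μ → IsCore s μ → IsCore t μ → size μ ≤ size κ)

Rharp : ℕ → ℕ → Partition → Partition → Set
Rharp p q α β = ∃[ b ]
    ( b ∈B β × ¬ (b ∈B α)
    × (bar b - b) ≡ (+ q) [modℤ (2 ℕ.* p) ]
    × (∀ x → x ∈B α ⇔ ((x ∈B β × x ≢ b) ⊎ x ≡ bar b)))

LRharpWith : ℕ → ℕ → Partition → Partition → ℤ → ℤ → Set
LRharpWith s t σ τ b c =
    b ≢ c
  × b ∈B τ × ¬ (b ∈B σ)
  × c ∈B τ × ¬ (c ∈B σ)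
  × (bar b - b) ≡ (+ t) [modℤ (2 ℕ.* s) ]
  × (bar c - c) ≡ ℤ.- (+ s) [modℤ (2 ℕ.* t) ]
  × (∀ x → x ∈B σ ⇔ ((x ∈B τ × x ≢ b × x ≢ c) ⊎ (x ≡ bar b ⊎ x ≡ bar c)))

-- ρ = σ ⋆ τ (for the witness c): B(ρ) = (B(τ) \ {c}) ∪ {bar c}
IsStar : Partition → ℤ → Partition → Set
IsStar τ c ρ = ∀ x → x ∈B ρ ⇔ ((x ∈B τ × x ≢ c) ⊎ x ≡ bar c)

GoodSC : ℕ → ℕ → Partition → Partition → ℕ → Partition → Set
GoodSC s t σ τ n λ′ = size λ′ ≡ n × CoreOf s λ′ σ × CoreOf t λ′ τ × SelfConj λ′

ExactlyOneSC : ℕ → ℕ → Partition → Partition → ℕ → Set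
ExactlyOneSC s t σ τ n =
  Σ Partition λ λ′ → GoodSC s t σ τ n λ′ × (∀ μ → GoodSC s t σ τ n μ → μ ≈P λ′)

Odd : ℕ → Set
Odd m = ¬ (2 ℕD.∣ m)

C1 : ℕ → ℕ → Partition → Partition → ℕ → Set
C1 s t σ τ n = σ ≈P τ × n ≡ size σ

C2 : ℕ → ℕ → Partition → Partition → ℕ → Set
C2 s t σ τ n = Odd t × Rharp s t σ τ × n ≡ size τ ℕ.+ t

C3 : ℕ → ℕ → Partition → Partition → ℕ → Set
C3 s t σ τ n = Odd s × Rharp t s τ σ × n ≡ size σ ℕ.+ s

C4 : ℕ → ℕ → Partition → Partition → ℕ → Set
C4 s t σ τ n = Odd s × Odd t ×
  (∃[ b ] ∃[ c ] (LRharpWith s t σ τ b c ×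
     Σ Partition λ ρ → IsStar τ c ρ × n ≡ size ρ ℕ.+ s ℕ.+ t))

C5 : ℕ → ℕ → Partition → Partition → ℕ → Set
C5 s t σ τ n = Odd s × Odd t × σ ≈P τ × IsKappa s t σ × n ≡ size σ ℕ.+ s ℕ.* t

{-# OPTIONS --safe #-}
-- Encode a partition by the indicator function I of its beta-set. Removing a rim s-hook moves a bead
-- from x to x - s, so the s-core of λ is determined by the numbers of beads in the classes modulo s,
-- and λ is self-conjugate iff exactly one of x and bar x is a bead. In terms of H x = 2x + 1, which
-- bar negates, a self-conjugate λ is a finite set of positive odd numbers with sum |λ|.
--
-- Necessity. Let x, y - c be beads and x - c, y gaps with s ∣ c and t ∣ y - x. Swapping this rectangle
-- together with its mirror image changes neither core nor the size, so if λ is unique, each such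
-- rectangle meets its mirror image. As the t-core of λ is an s-core, every bead x with a gap at x - c
-- lies in such a rectangle. This forces all inversions to involve the positions whose H is a multiple
-- of s or t, and the only beads x ≥ 0 of this kind have H x ∈ {s, t, s t}. Moving these beads to their
-- mirror images leaves an (s,t)-core, and (C1)-(C5) list the possible combinations.
--
-- Sufficiency. If the weight of μ with respect to s (or t) is odd, then μ has a bead x ≥ 0 with H x
-- divisible by s (or t). Removing such beads and comparing sizes with those of the resulting cores
-- leaves a single μ. In (C5) one needs that κ is the core containing the position with
-- H x = s t - s - t: the tops u of the t-classes of a core have fixed sum, its size is Σ u² / 2t up to
-- a constant, and the differences u (x + k s) - u x lie in [-(t - k) s, k s], and all of them are
-- endpoints only for κ.
module Submission where

open import Defs
open import Data.Nat as ℕ using (ℕ; zero; suc; z≤n; s≤s; _∸_; _<_)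
import Data.Nat.Properties as ℕₚ
import Data.Nat.Divisibility as ℕᵈ
open import Data.Nat.Coprimality as Coprimality using (Coprime; coprime-divisor)
open import Data.Nat.GCD using (module Bézout)
open import Data.Nat.Induction using (<-wellFounded)
open import Data.Nat.ListAction using (sum)
open import Data.Integer as ℤ using (ℤ; +_; -[1+_]; 0ℤ; 1ℤ; -1ℤ; _+_; _*_; _-_; -_; _≤_; _≟_; _≤?_)
open import Data.Integer.Properties as ℤₚ using (≤-refl; ≤-trans; ≤-reflexive; +-identityʳ; +-identityˡ)
open import Data.Integer.Divisibility.Signed using (_∣_; divides; _∣?_; ∣m∣n⇒∣m+n; ∣m∣n⇒∣m-n; ∣m⇒∣-m; ∣n⇒∣m*n; ∣⇒∣ᵤ; ∣ᵤ⇒∣)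
open import Data.Integer.DivMod using (_%ℕ_; _/ℕ_; n%ℕd<d; a≡a%ℕn+[a/ℕn]*n)
open import Data.Integer.Tactic.RingSolver using (solve-∀)
open import Data.List using (List; []; _∷_; length; filter)
open import Data.List.Properties using (filter-accept; filter-reject)
open import Data.List.Relation.Unary.All as All using (All; []; _∷_)
open import Data.List.Relation.Unary.AllPairs using (AllPairs; []; _∷_)
open import Data.List.Relation.Unary.Linked as Linked using (Linked; []; [-]; _∷_)
open import Data.Product using (Σ; _×_; ∃; ∃-syntax; _,_; proj₁; proj₂)
open import Data.Sum using (_⊎_; inj₁; inj₂; [_,_]′)
open import Data.Empty using (⊥; ⊥-elim)
open import Function using (_∋_; _$_)
open import Function.Bundles using (_⇔_; mk⇔; Equivalence)
open import Induction.WellFounded using (Acc; acc)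
open import Relation.Binary using (tri<; tri≈; tri>)
open import Relation.Binary.Construct.Closure.ReflexiveTransitive using (Star; ε; _◅_)
open import Relation.Binary.PropositionalEquality using (_≡_; _≢_; refl; sym; trans; cong; cong₂; subst; subst₂; module ≡-Reasoning)
open import Relation.Nullary using (¬_; Dec; yes; no)

-- Finitely supported sums over ℤ

-- Two counting facts carry the argument. (1) If s divides c, the sum of `I (y - c) - I y` over a
-- class modulo t depends only on the t-core. For a core that is also an s-core every term is
-- nonnegative, so in λ the inversions of the class (bead y, gap y - c) are matched by at least as
-- many reversed pairs (gap y, bead y - c). One inversion and one reversed pair form a rectangle;
-- surplus pairs make it possible to avoid the degenerate ones. (2) Among the partitions with given
-- class numbers modulo s, the s-core is the only one of smallest size. So rearranging a solution
-- until it has the class numbers of a known core gives an inequality of sizes, and equality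
-- identifies the result. The obstacle in (C5) is that κ is given by the maximality of its size,
-- while the argument needs one particular bead. The bridge is a defect: the sum, over all pairs of
-- t-classes, of the product of the two slacks in the bounds for the difference of their tops. It is
-- nonnegative, decreases linearly as the size of the core grows, and is zero for the self-conjugate
-- core that has the bead.

≤-by : ∀ {a b} d → 0ℤ ≤ d → b - a ≡ d → a ≤ b
≤-by d 0≤d e = ℤₚ.0≤i-j⇒j≤i (subst (0ℤ ≤_) (sym e) 0≤d)

≤⇒0≤ : ∀ {a b} → a ≤ b → 0ℤ ≤ b - a
≤⇒0≤ = ℤₚ.i≤j⇒0≤j-i

0≤+ : ∀ {a b} → 0ℤ ≤ a → 0ℤ ≤ b → 0ℤ ≤ a + b
0≤+ = ℤₚ.+-mono-≤

0≤* : ∀ {a b} → 0ℤ ≤ a → 0ℤ ≤ b → 0ℤ ≤ a * b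
0≤* {+ a} {+ b} _ _ = subst (0ℤ ≤_) (ℤₚ.pos-* a b) (ℤ.+≤+ z≤n)

0≤+n : ∀ {n} → 0ℤ ≤ + n
0≤+n = ℤ.+≤+ z≤n

≤-lin : ∀ {a b c d e f} → c ≤ d → e ≤ f → b - a ≡ (d - c) + (f - e) → a ≤ b
≤-lin p q = ≤-by _ (0≤+ (≤⇒0≤ p) (≤⇒0≤ q))

≤-lin₁ : ∀ {a b c d} → c ≤ d → b - a ≡ d - c → a ≤ b
≤-lin₁ p = ≤-by _ (≤⇒0≤ p)

≰⇒1+≤ : ∀ {a b} → ¬ (a ≤ b) → 1ℤ + b ≤ a
≰⇒1+≤ n = ℤₚ.i<j⇒suc[i]≤j (ℤₚ.≰⇒> n)

1+≰ : ∀ {a} → ¬ (1ℤ + a ≤ a)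
1+≰ {a} p with subst (0ℤ ≤_) (((∀ a → a - (1ℤ + a) ≡ -1ℤ) ∋ solve-∀) a) (≤⇒0≤ p)
... | ()

Supp : ℕ → (ℤ → ℤ) → Set
Supp M f = (∀ n → M ℕ.≤ n → f (+ n) ≡ 0ℤ) × (∀ n → M ℕ.≤ n → f -[1+ n ] ≡ 0ℤ)

-- The window from - n to n - 1 is stable under `bar`, so a reflected sum agrees term by term; only
-- shifts need an argument about the ends.
W : ℕ → (ℤ → ℤ) → ℤ
W zero    f = 0ℤ
W (suc n) f = W n f + (f (+ n) + f -[1+ n ])

record HasSum (f : ℤ → ℤ) (v : ℤ) : Set where
  constructor hasSum
  field
    bound : ℕ
    supp  : Supp bound f
    value : W bound f ≡ v

W-cong : ∀ N {f g} → (∀ x → f x ≡ g x) → W N f ≡ W N g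
W-cong zero    e = refl
W-cong (suc N) e = cong₂ _+_ (W-cong N e) (cong₂ _+_ (e _) (e _))

W-+ : ∀ N f g → W N (λ x → f x + g x) ≡ W N f + W N g
W-+ zero    f g = refl
W-+ (suc N) f g = trans (cong (λ z → z + ((f (+ N) + g (+ N)) + (f -[1+ N ] + g -[1+ N ]))) (W-+ N f g))
  (((∀ a b c d e h → (a + b) + ((c + d) + (e + h)) ≡ (a + (c + e)) + (b + (d + h))) ∋ solve-∀)
    (W N f) (W N g) (f (+ N)) (g (+ N)) (f -[1+ N ]) (g -[1+ N ]))

W-* : ∀ N k f → W N (λ x → k * f x) ≡ k * W N f
W-* zero    k f = sym (ℤₚ.*-zeroʳ k)
W-* (suc N) k f = trans (cong (λ z → z + (k * f (+ N) + k * f -[1+ N ])) (W-* N k f))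
  (((∀ k a b c → k * a + (k * b + k * c) ≡ k * (a + (b + c))) ∋ solve-∀) k (W N f) (f (+ N)) (f -[1+ N ]))

W-stable : ∀ {M f} k → Supp M f → W (k ℕ.+ M) f ≡ W M f
W-stable zero    _ = refl
W-stable {M} (suc k) sp@(hi , lo)
  rewrite hi (k ℕ.+ M) (ℕₚ.m≤n+m M k) | lo (k ℕ.+ M) (ℕₚ.m≤n+m M k) =
  trans (+-identityʳ _) (W-stable k sp)

hs-at : ∀ {f v} (h : HasSum f v) {N} → HasSum.bound h ℕ.≤ N → W N f ≡ v
hs-at (hasSum M sp e) {N} p =
  trans (cong (λ n → W n _) (sym (ℕₚ.m∸n+n≡m p))) (trans (W-stable (N ∸ M) sp) e)

hs-unique : ∀ {f v w} → HasSum f v → HasSum f w → v ≡ w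
hs-unique h k = trans (sym (hs-at h (ℕₚ.m≤m⊔n _ _))) (hs-at k (ℕₚ.m≤n⊔m (HasSum.bound h) _))

hs-cong : ∀ {f g v} → (∀ x → f x ≡ g x) → HasSum f v → HasSum g v
hs-cong e (hasSum M (hi , lo) q) =
  hasSum M ((λ n p → trans (sym (e _)) (hi n p)) , (λ n p → trans (sym (e _)) (lo n p)))
    (trans (W-cong M (λ x → sym (e x))) q)

hs-val : ∀ {f v w} → v ≡ w → HasSum f v → HasSum f w
hs-val refl h = h

hs-+ : ∀ {f g v w} → HasSum f v → HasSum g w → HasSum (λ x → f x + g x) (v + w)
hs-+ {f} {g} h@(hasSum M sp _) k@(hasSum N sq _) = hasSum (M ℕ.⊔ N)
  ( (λ n p → cong₂ _+_ (proj₁ sp n (ℕₚ.≤-trans (ℕₚ.m≤m⊔n M N) p)) (proj₁ sq n (ℕₚ.≤-trans (ℕₚ.m≤n⊔m M N) p)))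
  , (λ n p → cong₂ _+_ (proj₂ sp n (ℕₚ.≤-trans (ℕₚ.m≤m⊔n M N) p)) (proj₂ sq n (ℕₚ.≤-trans (ℕₚ.m≤n⊔m M N) p))))
  (trans (W-+ (M ℕ.⊔ N) f g) (cong₂ _+_ (hs-at h (ℕₚ.m≤m⊔n M N)) (hs-at k (ℕₚ.m≤n⊔m M N))))

hs-* : ∀ {f v} k → HasSum f v → HasSum (λ x → k * f x) (k * v)
hs-* k (hasSum M (hi , lo) e) = hasSum M
  ((λ n p → trans (cong (k *_) (hi n p)) (ℤₚ.*-zeroʳ k)) , (λ n p → trans (cong (k *_) (lo n p)) (ℤₚ.*-zeroʳ k)))
  (trans (W-* M k _) (cong (k *_) e))

hs-neg : ∀ {f v} → HasSum f v → HasSum (λ x → - f x) (- v)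
hs-neg h = hs-val (ℤₚ.-1*i≡-i _) (hs-cong (λ x → ℤₚ.-1*i≡-i _) (hs-* -1ℤ h))

hs-∸ : ∀ {f g v w} → HasSum f v → HasSum g w → HasSum (λ x → f x - g x) (v - w)
hs-∸ h k = hs-+ h (hs-neg k)

hs-0 : HasSum (λ _ → 0ℤ) 0ℤ
hs-0 = hasSum 0 ((λ _ _ → refl) , (λ _ _ → refl)) refl

hs-bound : ∀ {f} M → Supp M f → HasSum f (W M f)
hs-bound M sp = hasSum M sp refl

bar-+ : ∀ n → bar (+ n) ≡ -[1+ n ]
bar-+ zero    = refl
bar-+ (suc n) = refl

bar-bar : ∀ x → bar (bar x) ≡ x
bar-bar = (∀ x → -1ℤ - (-1ℤ - x) ≡ x) ∋ solve-∀

hs-bar : ∀ {f v} → HasSum f v → HasSum (λ x → f (bar x)) v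
hs-bar {f} (hasSum M (hi , lo) e) = hasSum M
  ((λ n p → trans (cong f (bar-+ n)) (lo n p)) , (λ n p → hi n p)) (trans (go M) e)
  where
  go : ∀ M → W M (λ x → f (bar x)) ≡ W M f
  go zero    = refl
  go (suc n) = cong₂ _+_ (go n) (trans (cong (λ z → f z + f (+ n)) (bar-+ n)) (ℤₚ.+-comm (f -[1+ n ]) (f (+ n))))

hs-shift1 : ∀ {f v} → HasSum f v → HasSum (λ x → f (x + 1ℤ)) v
hs-shift1 {f} h@(hasSum M (hi , lo) e) = hasSum (suc M)
  ( (λ n p → trans (cong (λ m → f (+ m)) (ℕₚ.+-comm n 1))
      (hi (suc n) (ℕₚ.≤-trans (ℕₚ.≤-trans (ℕₚ.n≤1+n M) p) (ℕₚ.n≤1+n n))))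
  , λ { (suc n) (s≤s p) → lo n p })
  (trans (sym (+-identityʳ _))
    (trans (cong (λ z → W (suc M) (λ x → f (x + 1ℤ)) + z) (sym (lo M ℕₚ.≤-refl)))
      (trans (go (suc M)) (trans (cong₂ _+_ (hs-at h (ℕₚ.n≤1+n M)) (hi (suc M) (ℕₚ.n≤1+n M))) (+-identityʳ _)))))
  where
  -- Shifting the window loses the term at - M and gains the one at M. Outside the support both
  -- vanish.
  go : ∀ M → W M (λ x → f (x + 1ℤ)) + f (- (+ M)) ≡ W M f + f (+ M)
  neg : ∀ n → -[1+ n ] + 1ℤ ≡ - (+ n)
  neg zero = refl
  neg (suc n) = refl
  go zero    = refl
  go (suc n) = trans (cong (λ z → (W n (λ x → f (x + 1ℤ)) + (f (+ n + 1ℤ) + z)) + f -[1+ n ]) (cong f (neg n)))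
    (trans (((∀ a b c d → (a + (b + c)) + d ≡ (a + c) + (b + d)) ∋ solve-∀) (W n (λ x → f (x + 1ℤ))) (f (+ n + 1ℤ))
        (f (- (+ n))) (f -[1+ n ]))
      (trans (cong (_+ (f (+ n + 1ℤ) + f -[1+ n ])) (go n))
       (trans (((∀ a b c d → (a + b) + (c + d) ≡ (a + (b + d)) + c) ∋ solve-∀) (W n f) (f (+ n)) (f (+ n + 1ℤ))
           (f -[1+ n ]))
        (cong (λ z → (W n f + (f (+ n) + f -[1+ n ])) + f (+ z)) (ℕₚ.+-comm n 1)))))

hs-shift₋1 : ∀ {f v} → HasSum f v → HasSum (λ x → f (x - 1ℤ)) v
hs-shift₋1 {f} h = hs-cong (λ x → cong f (((∀ x → -1ℤ - ((-1ℤ - x) + 1ℤ) ≡ x - 1ℤ) ∋ solve-∀) x))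
    (hs-bar (hs-shift1 (hs-bar h)))

hs-shift : ∀ {f v} k → HasSum f v → HasSum (λ x → f (x + k)) v
hs-shift {f} (+ zero) h = hs-cong (λ x → cong f (sym (+-identityʳ x))) h
hs-shift {f} (+ suc n) h =
  hs-cong (λ x → cong f (ℤₚ.+-assoc x 1ℤ (+ n))) (hs-shift1 (hs-shift (+ n) h))
hs-shift {f} -[1+ zero ] h = hs-shift₋1 h
hs-shift {f} -[1+ suc n ] h = hs-cong (λ x → cong f (ℤₚ.+-assoc x -1ℤ -[1+ n ])) (hs-shift₋1 (hs-shift -[1+ n ] h))

hs-≥0 : ∀ {f v} → (∀ x → 0ℤ ≤ f x) → HasSum f v → 0ℤ ≤ v
hs-≥0 {f} p (hasSum M _ e) = subst (0ℤ ≤_) e (go M)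
  where
  go : ∀ N → 0ℤ ≤ W N f
  go zero    = ≤-refl
  go (suc N) = 0≤+ (go N) (0≤+ (p _) (p _))

hs-mono : ∀ {f g v w} → (∀ x → f x ≤ g x) → HasSum f v → HasSum g w → v ≤ w
hs-mono p h k = ℤₚ.0≤i-j⇒j≤i (hs-≥0 (λ x → ≤⇒0≤ (p x)) (hs-∸ k h))

hs-pos : ∀ {f v} → HasSum f v → ¬ (v ≤ 0ℤ) → ∃[ y ] ¬ (f y ≤ 0ℤ)
hs-pos {f} (hasSum M _ refl) = go M
  where
  go : ∀ N → ¬ (W N f ≤ 0ℤ) → ∃[ y ] ¬ (f y ≤ 0ℤ)
  go zero    p = ⊥-elim (p ≤-refl)
  go (suc N) p with f (+ N) ≤? 0ℤ | f -[1+ N ] ≤? 0ℤ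
  ... | no q  | _     = _ , q
  ... | yes _ | no q  = _ , q
  ... | yes a | yes b = go N (λ w → p (ℤₚ.+-mono-≤ w (ℤₚ.+-mono-≤ a b)))

δ : ℤ → ℤ → ℤ
δ a x with x ≟ a
... | yes _ = 1ℤ
... | no  _ = 0ℤ

δ-refl : ∀ a → δ a a ≡ 1ℤ
δ-refl a with a ≟ a
... | yes _ = refl
... | no  q = ⊥-elim (q refl)

δ-≢ : ∀ {a x} → x ≢ a → δ a x ≡ 0ℤ
δ-≢ {a} {x} q with x ≟ a
... | yes p = ⊥-elim (q p)
... | no  _ = refl

δ-≡ : ∀ {a x} → x ≡ a → δ a x ≡ 1ℤ
δ-≡ refl = δ-refl _

δ-inj : ∀ {a x b y} → (x ≡ a → y ≡ b) → (y ≡ b → x ≡ a) → δ a x ≡ δ b y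
δ-inj {a} {x} {b} {y} f g with x ≟ a | y ≟ b
... | yes _ | yes _ = refl
... | no  _ | no  _ = refl
... | yes p | no  q = ⊥-elim (q (f p))
... | no  p | yes q = ⊥-elim (p (g q))

δ-≥0 : ∀ a x → 0ℤ ≤ δ a x
δ-≥0 a x with x ≟ a
... | yes _ = 0≤+n
... | no  _ = 0≤+n

hs-δ : ∀ a → HasSum (δ a) 1ℤ
hs-δ a = hs-cong (λ x → δ-inj (λ e → trans (((∀ x a → x ≡ (x + - a) + a) ∋ solve-∀) x a)
    (trans (cong (_+ a) e) (+-identityˡ a)))
                              (λ { refl → ℤₚ.+-inverseʳ x })) (hs-shift (- a) hs-δ0)
  where
  hs-δ0 : HasSum (δ 0ℤ) 1ℤ
  hs-δ0 = hasSum 1 ((λ { (suc n) _ → refl }) , (λ _ _ → refl)) refl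

hs-1≤ : ∀ {f v} → HasSum f v → (∀ x → 0ℤ ≤ f x) → ∀ a → 1ℤ ≤ f a → 1ℤ ≤ v
hs-1≤ {f} h p a q = hs-mono le (hs-δ a) h
  where
  le : ∀ x → δ a x ≤ f x
  le x with x ≟ a
  ... | yes refl = q
  ... | no  _    = p x

-- Beta-sets of partitions

hs-mul : ∀ {f v} (g : ℤ → ℤ) → HasSum f v → ∃[ w ] HasSum (λ x → g x * f x) w
hs-mul g (hasSum M (hi , lo) e) = _ , hs-bound M
  ( (λ n p → trans (cong (g (+ n) *_) (hi n p)) (ℤₚ.*-zeroʳ (g (+ n))))
  , (λ n p → trans (cong (g -[1+ n ] *_) (lo n p)) (ℤₚ.*-zeroʳ (g -[1+ n ]))))

pos : ℤ → ℕ
pos (+ n)    = n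
pos -[1+ n ] = 0

pos-to : ∀ {r} z → + suc r ≤ z → suc r ℕ.≤ pos z
pos-to (+ n) (ℤ.+≤+ p) = p

pos-from : ∀ {r} z → suc r ℕ.≤ pos z → + suc r ≤ z
pos-from (+ n) p = ℤ.+≤+ p

-- The number of indices r ≥ 0 with q ≤ nth xs r - r, for a weakly decreasing list xs.
above : List ℕ → ℤ → ℕ
above []       q = pos (1ℤ - q)
above (x ∷ xs) q with q ≤? + x
... | yes _ = suc (above xs (q + 1ℤ))
... | no  _ = 0

nth-≤head : ∀ {x xs} → Linked ℕ._≥_ (x ∷ xs) → ∀ r → nth xs r ℕ.≤ x
nth-≤head [-]     r       = z≤n
nth-≤head (p ∷ l) zero    = p
nth-≤head (p ∷ l) (suc r) = ℕₚ.≤-trans (nth-≤head l r) p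

nth-anti : ∀ {xs} → Linked ℕ._≥_ xs → ∀ r → nth xs (suc r) ℕ.≤ nth xs r
nth-anti []      r       = z≤n
nth-anti [-]     r       = z≤n
nth-anti (p ∷ l) zero    = p
nth-anti (p ∷ l) (suc r) = nth-anti l r

tail-linked : ∀ {x xs} → Linked ℕ._≥_ (x ∷ xs) → Linked ℕ._≥_ xs
tail-linked [-]     = []
tail-linked (_ ∷ l) = l

above-to : ∀ {xs} → Linked ℕ._≥_ xs → ∀ q r → q ≤ + nth xs r - + r → r ℕ.< above xs q
above-to {[]} l q r p = pos-to (1ℤ - q) (≤-lin₁ p (((∀ q r → (1ℤ - q) - (1ℤ + r) ≡ (0ℤ - r) - q) ∋ solve-∀) q (+ r)))
above-to {x ∷ xs} l q r p with q ≤? + x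
above-to {x ∷ xs} l q zero    p | yes _ = s≤s z≤n
above-to {x ∷ xs} l q (suc r) p | yes _ =
  s≤s (above-to (tail-linked l) (q + 1ℤ) r
    (≤-lin₁ p (((∀ n q r → (n - r) - (q + 1ℤ) ≡ (n - (1ℤ + r)) - q) ∋ solve-∀) (+ nth xs r) q (+ r))))
above-to {x ∷ xs} l q r p | no q≰x = ⊥-elim (q≰x (≤-trans p (bnd r)))
  where
  bnd : ∀ r → + nth (x ∷ xs) r - + r ≤ + x
  bnd zero    = ≤-reflexive (+-identityʳ _)
  bnd (suc r) = ≤-lin {c = + nth xs r} {d = + x} {e = 0ℤ} {f = + suc r} (ℤ.+≤+ (nth-≤head l r)) 0≤+n
    (((∀ x n r → x - (n - r) ≡ (x - n) + (r - 0ℤ)) ∋ solve-∀) (+ x) (+ nth xs r) (+ suc r))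

above-from : ∀ xs q r → r ℕ.< above xs q → q ≤ + nth xs r - + r
above-from [] q r p = ≤-lin₁ (pos-from (1ℤ - q) p) (((∀ q r → (0ℤ - r) - q ≡ (1ℤ - q) - (1ℤ + r)) ∋ solve-∀) q (+ r))
above-from (x ∷ xs) q r p with q ≤? + x
above-from (x ∷ xs) q zero    p       | yes q≤x = subst (q ≤_) (sym (+-identityʳ _)) q≤x
above-from (x ∷ xs) q (suc r) (s≤s p) | yes _ =
  ≤-lin₁ (above-from xs (q + 1ℤ) r p)
    (((∀ n q r → (n - (1ℤ + r)) - q ≡ (n - r) - (q + 1ℤ)) ∋ solve-∀) (+ nth xs r) q (+ r))

above-anti : ∀ {xs} → Linked ℕ._≥_ xs → ∀ q → above xs (q + 1ℤ) ℕ.≤ above xs q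
above-anti {xs} l q = ℕₚ.≮⇒≥ λ p →
  ℕₚ.<-irrefl refl (above-to l q (above xs q)
    (≤-trans (≤-lin₁ {c = 0ℤ} {d = 1ℤ} 0≤+n (((∀ q → (q + 1ℤ) - q ≡ 1ℤ - 0ℤ) ∋ solve-∀) q))
        (above-from xs (q + 1ℤ) _ p)))

above-step : ∀ {xs} → Linked ℕ._≥_ xs → ∀ q → above xs q ℕ.≤ suc (above xs (q + 1ℤ))
above-step {xs} l q = ℕₚ.≮⇒≥ λ p →
  ℕₚ.<-irrefl refl (above-to l (q + 1ℤ) (above xs (q + 1ℤ))
    (≤-lin (above-from xs q _ p) (ℤ.+≤+ (nth-anti l (above xs (q + 1ℤ))))
      (((∀ a b r q → (a - r) - (q + 1ℤ) ≡ ((b - (1ℤ + r)) - q) + (a - b)) ∋ solve-∀) (+ nth xs (above xs (q + 1ℤ)))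
          (+ nth xs (suc (above xs (q + 1ℤ)))) (+ above xs (q + 1ℤ)) q)))

above-low : ∀ xs n → length xs ℕ.≤ n → above xs (1ℤ - + n) ≡ n
above-low [] n _ = cong pos (((∀ n → 1ℤ - (1ℤ - n) ≡ n) ∋ solve-∀) (+ n))
above-low (x ∷ xs) (suc n) (s≤s p) with (1ℤ - + suc n) ≤? + x
... | yes _ = cong suc (trans (cong (above xs) (((∀ n → (1ℤ - (1ℤ + n)) + 1ℤ ≡ 1ℤ - n) ∋ solve-∀) (+ n)))
    (above-low xs n p))
... | no ¬p = ⊥-elim (¬p (≤-lin {e = 0ℤ} {f = + n} (0≤+n {x}) 0≤+n
    (((∀ x n → x - (1ℤ - (1ℤ + n)) ≡ (x - 0ℤ) + (n - 0ℤ)) ∋ solve-∀) (+ x) (+ n))))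

above-high : ∀ xs n → nth xs 0 ℕ.≤ n → above xs (1ℤ + + n) ≡ 0
above-high xs n p = ℕₚ.n≤0⇒n≡0 (ℕₚ.≮⇒≥ λ q →
  ℕₚ.1+n≰n (ℕₚ.≤-trans (ℤₚ.drop‿+≤+ (subst (1ℤ + + n ≤_) (+-identityʳ _) (above-from xs (1ℤ + + n) 0 q))) p))

box : ℕ → ℤ → ℤ
box zero    q = 0ℤ
box (suc x) q = box x q + δ (+ suc x) q

hs-box : ∀ x → HasSum (box x) (+ x)
hs-box zero    = hs-0
hs-box (suc x) = hs-val (cong +_ (ℕₚ.+-comm x 1)) (hs-+ (hs-box x) (hs-δ (+ suc x)))

box-low : ∀ x q → q ≤ 0ℤ → box x q ≡ 0ℤ
box-low zero    q p = refl
box-low (suc x) q p = cong₂ _+_ (box-low x q p) (δ-≢ λ { refl → case p })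
  where case : ¬ (+ suc x ≤ 0ℤ)
        case (ℤ.+≤+ ())

box-high : ∀ x n → x ℕ.< n → box x (+ n) ≡ 0ℤ
box-high zero    n p = refl
box-high (suc x) n p = cong₂ _+_ (box-high x n (ℕₚ.≤-trans (ℕₚ.n≤1+n _) p)) (δ-≢ λ { refl → ℕₚ.<-irrefl refl p })

box-in : ∀ x n → suc n ℕ.≤ x → box x (+ suc n) ≡ 1ℤ
box-in (suc x) n (s≤s p) with ℕₚ.m≤n⇒m<n∨m≡n p
... | inj₁ q    = cong₂ _+_ (box-in x n q) (δ-≢ λ { refl → ℕₚ.<-irrefl refl q })
... | inj₂ refl = cong₂ _+_ (box-high x (suc x) ℕₚ.≤-refl) (δ-refl (+ suc x))

pos-neg : ∀ n → pos (1ℤ - + suc n) ≡ 0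
pos-neg zero    = refl
pos-neg (suc n) = refl

-- The first row is counted for q ≤ x and an empty row for q ≤ 0, which leaves `box x`. For the
-- later rows the index, and with it the threshold, moves by one.
above-cons : ∀ {x xs} → Linked ℕ._≥_ (x ∷ xs) → ∀ q →
  (+ above xs (q + 1ℤ) - + above [] (q + 1ℤ)) + box x q ≡ + above (x ∷ xs) q - + above [] q
above-cons {x} {xs} l q with q ≤? + x
above-cons {x} {xs} l (+ zero) | yes p rewrite box-low x 0ℤ ≤-refl =
  ((∀ a → (a - 0ℤ) + 0ℤ ≡ (1ℤ + a) - 1ℤ) ∋ solve-∀) (+ above xs (+ 1))
above-cons {x} {xs} l -[1+ n ] | yes p rewrite box-low x -[1+ n ] ℤ.-≤+
  | ((∀ n → 1ℤ - (- (1ℤ + n) + 1ℤ) ≡ 1ℤ + n) ∋ solve-∀) (+ n) =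
  ((∀ a n → (a - (1ℤ + n)) + 0ℤ ≡ (1ℤ + a) - (1ℤ + (1ℤ + n))) ∋ solve-∀) (+ above xs (-[1+ n ] + 1ℤ)) (+ n)
above-cons {x} {xs} l (+ suc n) | yes (ℤ.+≤+ p) rewrite box-in x n p | ℕₚ.+-comm n 1 | pos-neg n =
  ((∀ a → (a - 0ℤ) + 1ℤ ≡ (1ℤ + a) - 0ℤ) ∋ solve-∀) (+ above xs (+ (suc (suc n))))
above-cons {x} {xs} l (+ zero)  | no p = ⊥-elim (p 0≤+n)
above-cons {x} {xs} l -[1+ n ]  | no p = ⊥-elim (p ℤ.-≤+)
above-cons {x} {xs} l (+ suc n) | no p
  rewrite box-high x (suc n) (ℕₚ.≰⇒> (λ q → p (ℤ.+≤+ q))) | ℕₚ.+-comm n 1 | pos-neg n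
    | above-high xs (suc n) (ℕₚ.≤-trans (nth-≤head l 0) (ℕₚ.<⇒≤ (ℕₚ.≰⇒> (λ q → p (ℤ.+≤+ q))))) = refl

opaque
  hs-above : ∀ {xs} → Linked ℕ._≥_ xs → HasSum (λ q → + above xs q - + above [] q) (+ sum xs)
  hs-above {[]}     l = hs-cong (λ q → sym (ℤₚ.+-inverseʳ (+ above [] q))) hs-0
  hs-above {x ∷ xs} l = hs-cong (above-cons l)
    (hs-val (cong +_ (ℕₚ.+-comm (sum xs) x)) (hs-+ (hs-shift1 (hs-above (tail-linked l))) (hs-box x)))

-- C λ p counts the elements of the beta-set of λ that are ≥ p.
C : Partition → ℤ → ℕ
C λ′ p = above (parts λ′) (p + 1ℤ)

-- The indicator function of the beta-set.
opaque
  I : Partition → ℤ → ℤ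
  I λ′ x = + C λ′ x - + C λ′ (x + 1ℤ)

  I-def : ∀ λ′ x → I λ′ x ≡ + C λ′ x - + C λ′ (x + 1ℤ)
  I-def λ′ x = refl

Is01 : (ℤ → ℤ) → Set
Is01 f = ∀ x → f x ≡ 0ℤ ⊎ f x ≡ 1ℤ

vac : ℤ → ℤ
vac (+ n)    = 0ℤ
vac -[1+ n ] = 1ℤ

opaque
  unfolding I
  I-01 : ∀ λ′ → Is01 (I λ′)
  I-01 λ′ x with ℕₚ.m≤n⇒m<n∨m≡n (above-anti (decr λ′) (x + 1ℤ))
  ... | inj₂ e rewrite e = inj₁ (ℤₚ.+-inverseʳ (+ C λ′ x))
  ... | inj₁ p rewrite ℕₚ.≤-antisym (above-step (decr λ′) (x + 1ℤ)) p =
    inj₂ (((∀ a → (1ℤ + a) - a ≡ 1ℤ) ∋ solve-∀) (+ C λ′ (x + 1ℤ)))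

-- With `node-C` this is the dictionary between diagram and beads: a position with positive
-- coordinates is a node exactly when its row is at most `C λ′` of its diagonal c - r.
C-node : ∀ λ′ r c → 1 ℕ.≤ r → c ℕ.≤ part λ′ r → r ℕ.≤ C λ′ (+ c - + r)
C-node λ′ (suc r) c _ p = above-to (decr λ′) _ r
  (≤-lin₁ {c = + c} {d = + nth (parts λ′) r} (ℤ.+≤+ p)
      (((∀ n r c → (n - r) - ((c - (1ℤ + r)) + 1ℤ) ≡ n - c) ∋ solve-∀) (+ nth (parts λ′) r) (+ r) (+ c)))

node-C : ∀ λ′ r c → 1 ℕ.≤ r → r ℕ.≤ C λ′ (+ c - + r) → c ℕ.≤ part λ′ r
node-C λ′ (suc r) c _ p = ℤₚ.drop‿+≤+
  (≤-lin₁ (above-from (parts λ′) _ r p) (((∀ n r c → n - c ≡ (n - r) - ((c - (1ℤ + r)) + 1ℤ)) ∋ solve-∀)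
      (+ nth (parts λ′) r) (+ r) (+ c)))

opaque
  unfolding I
  ∈B⇒I : ∀ λ′ x → x ∈B λ′ → I λ′ x ≡ 1ℤ
  ∈B⇒I λ′ x (suc r , _ , e) with I-01 λ′ x
  ... | inj₂ q = q
  ... | inj₁ q = ⊥-elim (1+≰ (≤-trans (≤-reflexive (ℤₚ.+-comm 1ℤ (x + 1ℤ)))
      (≤-trans (above-from (parts λ′) (x + 1ℤ + 1ℤ) r
      (subst (r ℕ.<_) (ℤₚ.+-injective (ℤₚ.i-j≡0⇒i≡j _ _ q)) (above-to (decr λ′) (x + 1ℤ) r (≤-reflexive eq))))
          (≤-reflexive (sym eq)))))
    where
    eq : x + 1ℤ ≡ + nth (parts λ′) r - + r
    eq = trans (cong (_+ 1ℤ) e) (((∀ n r → (n - (1ℤ + r)) + 1ℤ ≡ n - r) ∋ solve-∀) (+ nth (parts λ′) r) (+ r))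

opaque
  unfolding I
  I⇒∈B : ∀ λ′ x → I λ′ x ≡ 1ℤ → x ∈B λ′
  I⇒∈B λ′ x e = suc c , s≤s z≤n , ℤₚ.≤-antisym
      (≤-lin₁ (above-from (parts λ′) (x + 1ℤ) c (ℕₚ.≤-reflexive (sym e′)))
        (((∀ n r x → (n - (1ℤ + r)) - x ≡ (n - r) - (x + 1ℤ)) ∋ solve-∀) (+ nth (parts λ′) c) (+ c) x))
      (≤-lin₁ (≰⇒1+≤ λ p → ℕₚ.<-irrefl refl (above-to (decr λ′) (x + 1ℤ + 1ℤ) c p))
        (((∀ n r x → x - (n - (1ℤ + r)) ≡ (x + 1ℤ + 1ℤ) - (1ℤ + (n - r))) ∋ solve-∀) (+ nth (parts λ′) c) (+ c) x))
    where
    c : ℕ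
    c = C λ′ (x + 1ℤ)
    e′ : C λ′ x ≡ suc c
    e′ = ℤₚ.+-injective (trans (((∀ a b → a ≡ (a - b) + b) ∋ solve-∀) (+ C λ′ x) (+ c)) (cong (_+ + c) e))

C-high : ∀ λ′ n → nth (parts λ′) 0 ℕ.≤ n → C λ′ (+ n) ≡ 0
C-high λ′ n p = trans (cong (above (parts λ′)) (ℤₚ.+-comm (+ n) 1ℤ)) (above-high (parts λ′) n p)

C-low : ∀ λ′ n → length (parts λ′) ℕ.≤ n → C λ′ (- (+ n)) ≡ n
C-low λ′ n p = trans (cong (above (parts λ′)) (ℤₚ.+-comm (- (+ n)) 1ℤ)) (above-low (parts λ′) n p)

C-vac : ∀ x → + above [] (x + 1ℤ) - + above [] (x + 1ℤ + 1ℤ) ≡ vac x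
C-vac (+ n) rewrite ℕₚ.+-comm n 1 | ℕₚ.+-comm n 1 | pos-neg n = refl
C-vac -[1+ n ] = trans (cong₂ (λ a b → + pos a - + pos b)
    (((∀ n → 1ℤ - (- (1ℤ + n) + 1ℤ) ≡ 1ℤ + n) ∋ solve-∀) (+ n))
        (((∀ n → 1ℤ - (- (1ℤ + n) + 1ℤ + 1ℤ) ≡ n) ∋ solve-∀) (+ n)))
  (((∀ n → (1ℤ + n) - n ≡ 1ℤ) ∋ solve-∀) (+ n))

-- The length of the diagonal p: the second term discards those of the rows 1 to `C λ′ p` in which
-- the diagonal has not yet reached column 1.
excess : Partition → ℤ → ℤ
excess λ′ p = + C λ′ p - + above [] (p + 1ℤ)

opaque
  hs-excess : ∀ λ′ → HasSum (excess λ′) (+ size λ′)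
  hs-excess λ′ = hs-shift1 (hs-above (decr λ′))

opaque
  unfolding I
  I-vac : ∀ λ′ x → excess λ′ x - excess λ′ (x + 1ℤ) ≡ I λ′ x - vac x
  I-vac λ′ x = trans
    (((∀ a b c d → (a - b) - (c - d) ≡ (a - c) - (b - d)) ∋ solve-∀) (+ C λ′ x) (+ above [] (x + 1ℤ))
        (+ C λ′ (x + 1ℤ)) (+ above [] (x + 1ℤ + 1ℤ)))
    (cong (λ z → I λ′ x - z) (C-vac x))

opaque
  hs-charge : ∀ λ′ → HasSum (λ x → I λ′ x - vac x) 0ℤ
  hs-charge λ′ = hs-cong (I-vac λ′)
      (hs-val (ℤₚ.+-inverseʳ (+ size λ′)) (hs-∸ (hs-excess λ′) (hs-shift1 (hs-excess λ′))))

-- Summation by parts turns the sum of the diagonal lengths into a first moment.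
opaque
  hs-size : ∀ λ′ → HasSum (λ x → x * (I λ′ x - vac x)) (+ size λ′)
  hs-size λ′ with hs-mul (λ x → x) (hs-excess λ′)
  ... | w , h = hs-cong
    (λ x → trans (((∀ x a b → (x * a - (x + 1ℤ) * b) + b ≡ x * (a - b)) ∋ solve-∀) x (excess λ′ x)
        (excess λ′ (x + 1ℤ))) (cong (x *_) (I-vac λ′ x)))
    (hs-val (((∀ w s → (w - w) + s ≡ s) ∋ solve-∀) w (+ size λ′))
        (hs-+ (hs-∸ h (hs-shift1 h)) (hs-shift1 (hs-excess λ′))))

const-up : ∀ (e : ℤ → ℤ) → (∀ p → e p ≡ e (p + 1ℤ)) → ∀ k p → e p ≡ e (p + + k)
const-up e s zero    p = cong e (sym (+-identityʳ p))
const-up e s (suc k) p = trans (s p) (trans (const-up e s k (p + 1ℤ)) (cong e (ℤₚ.+-assoc p 1ℤ (+ k))))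

-- Identities between counting functions are reduced by this to equal differences and agreement far
-- to the right.
const-0 : ∀ (e : ℤ → ℤ) → (∀ p → e p ≡ e (p + 1ℤ)) → ∀ M → (∀ n → M ℕ.≤ n → e (+ n) ≡ 0ℤ) → ∀ p → e p ≡ 0ℤ
const-0 e s M z (+ n) = trans (const-up e s M (+ n)) (z (n ℕ.+ M) (ℕₚ.m≤n+m M n))
const-0 e s M z -[1+ n ] = trans (const-up e s (suc n ℕ.+ M) -[1+ n ])
  (trans (cong e (((∀ n m → - (1ℤ + n) + ((1ℤ + n) + m) ≡ m) ∋ solve-∀) (+ n) (+ M))) (z M ℕₚ.≤-refl))

opaque
  unfolding I
  C-of-I : ∀ λ′ x → + C λ′ x ≡ + C λ′ (x + 1ℤ) + I λ′ x
  C-of-I λ′ x = ((∀ a b → a ≡ b + (a - b)) ∋ solve-∀) (+ C λ′ x) (+ C λ′ (x + 1ℤ))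

opaque
  unfolding I
  C-ext : ∀ λ′ μ → (∀ x → I λ′ x ≡ I μ x) → ∀ p → C λ′ p ≡ C μ p
  C-ext λ′ μ e p = ℤₚ.+-injective (ℤₚ.i-j≡0⇒i≡j _ _ (const-0 (λ q → + C λ′ q - + C μ q)
    (λ q → trans (((∀ a b c d → a - b ≡ (c - d) + ((a - c) - (b - d))) ∋ solve-∀) (+ C λ′ q) (+ C μ q)
        (+ C λ′ (q + 1ℤ)) (+ C μ (q + 1ℤ)))
       (trans (cong (λ z → (+ C λ′ (q + 1ℤ) - + C μ (q + 1ℤ)) + (z - I μ q)) (e q))
         (((∀ a b → a + (b - b) ≡ a) ∋ solve-∀) (+ C λ′ (q + 1ℤ) - + C μ (q + 1ℤ)) (I μ q))))
    (nth (parts λ′) 0 ℕ.⊔ nth (parts μ) 0)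
    (λ n q → cong₂ (λ a b → + a - + b) (C-high λ′ n (ℕₚ.m⊔n≤o⇒m≤o _ _ q))
        (C-high μ n (ℕₚ.m⊔n≤o⇒n≤o (nth (parts λ′) 0) _ q))) p))

nth-ext : ∀ {xs ys} → All (0 ℕ.<_) xs → All (0 ℕ.<_) ys → (∀ r → nth xs r ≡ nth ys r) → xs ≡ ys
nth-ext []       []       e = refl
nth-ext (p ∷ ps) []       e = ⊥-elim (ℕₚ.<-irrefl (sym (e 0)) p)
nth-ext []       (q ∷ qs) e = ⊥-elim (ℕₚ.<-irrefl (e 0) q)
nth-ext (p ∷ ps) (q ∷ qs) e = cong₂ _∷_ (e 0) (nth-ext ps qs (λ r → e (suc r)))

parts-inj : ∀ {λ′ μ} → λ′ ≈P μ → λ′ ≡ μ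
parts-inj {mkPartition xs d p} {mkPartition .xs d′ p′} refl =
  cong₂ (mkPartition xs) (Linked.irrelevant ℕₚ.≤-irrelevant d d′) (All.irrelevant ℕₚ.≤-irrelevant p p′)

part-C-ext : ∀ λ′ μ → (∀ p → C λ′ p ≡ C μ p) → λ′ ≡ μ
part-C-ext λ′ μ e = parts-inj (nth-ext (positive λ′) (positive μ) λ r → ℕₚ.≤-antisym (le λ′ μ e r)
    (le μ λ′ (λ p → sym (e p)) r))
  where
  le : ∀ λ′ μ → (∀ p → C λ′ p ≡ C μ p) → ∀ r → nth (parts λ′) r ℕ.≤ nth (parts μ) r
  le λ′ μ e r = node-C μ (suc r) _ (s≤s z≤n)
      (subst (suc r ℕ.≤_) (e (+ nth (parts λ′) r - + suc r)) (C-node λ′ (suc r) _ (s≤s z≤n) ℕₚ.≤-refl))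

I-inj : ∀ {λ′ μ} → (∀ x → I λ′ x ≡ I μ x) → λ′ ≡ μ
I-inj {λ′} {μ} e = part-C-ext λ′ μ (C-ext λ′ μ e)

count-to : ∀ {xs} r → Linked ℕ._≥_ xs → 1 ℕ.≤ r → ∀ i → r ℕ.≤ nth xs i → i ℕ.< length (filter (r ℕ.≤?_) xs)
count-to {[]} r l 1≤r i p = ⊥-elim (ℕₚ.<-irrefl refl (ℕₚ.≤-trans 1≤r p))
count-to {x ∷ xs} r l 1≤r i p with r ℕ.≤? x
... | no r≰x = ⊥-elim (r≰x (bnd i p))
  where
  bnd : ∀ i → r ℕ.≤ nth (x ∷ xs) i → r ℕ.≤ x
  bnd zero    q = q
  bnd (suc i) q = ℕₚ.≤-trans q (nth-≤head l i)
... | yes r≤x rewrite filter-accept (r ℕ.≤?_) {x} {xs} r≤x = go i p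
  where
  go : ∀ i → r ℕ.≤ nth (x ∷ xs) i → i ℕ.< suc (length (filter (r ℕ.≤?_) xs))
  go zero    _ = s≤s z≤n
  go (suc i) q = s≤s (count-to r (tail-linked l) 1≤r i q)

count-from : ∀ {xs} r → Linked ℕ._≥_ xs → ∀ i → i ℕ.< length (filter (r ℕ.≤?_) xs) → r ℕ.≤ nth xs i
count-from {x ∷ xs} r l i p with r ℕ.≤? x
... | no r≰x rewrite filter-reject (r ℕ.≤?_) {x} {xs} r≰x =
  ⊥-elim (r≰x (ℕₚ.≤-trans (count-from r (tail-linked l) i p) (nth-≤head l i)))
... | yes r≤x rewrite filter-accept (r ℕ.≤?_) {x} {xs} r≤x = go i p
  where
  go : ∀ i → i ℕ.< suc (length (filter (r ℕ.≤?_) xs)) → r ℕ.≤ nth (x ∷ xs) i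
  go zero    _       = r≤x
  go (suc i) (s≤s q) = count-from r (tail-linked l) i q

C-≥ : ∀ λ′ p → 0ℤ ≤ + C λ′ p + p
C-≥ λ′ (+ n)    = 0≤+n
C-≥ λ′ -[1+ n ] = ≤-lin₁ {c = + suc n} {d = + C λ′ -[1+ n ]} (ℤ.+≤+ (C-node λ′ (suc n) 0 (s≤s z≤n) z≤n))
  (((∀ a n → (a + - n) - 0ℤ ≡ a - n) ∋ solve-∀) (+ C λ′ -[1+ n ]) (+ suc n))

Sym : (ℤ → ℤ) → Set
Sym f = ∀ x → f (bar x) ≡ 1ℤ - f x

-- Transposing the diagram negates diagonals.
SymC : Partition → Set
SymC λ′ = ∀ p → + C λ′ (- p) ≡ + C λ′ p + p

selfConj⇒SymC : ∀ λ′ → SelfConj λ′ → SymC λ′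
selfConj⇒SymC λ′ sc = go
  where
  flip-node : ∀ r c → 1 ℕ.≤ r → 1 ℕ.≤ c → r ℕ.≤ C λ′ (+ c - + r) → c ℕ.≤ C λ′ (+ r - + c)
  flip-node r (suc c) 1≤r 1≤c p = C-node λ′ (suc c) r 1≤c
    (count-from r (decr λ′) c (subst (suc c ℕ.≤_) (sym (sc r 1≤r)) (node-C λ′ r (suc c) 1≤r p)))
  d₁ : ∀ r n → + (r ℕ.+ n) - + r ≡ + n
  d₁ r n = ((∀ r n → (r + n) - r ≡ n) ∋ solve-∀) (+ r) (+ n)
  d₂ : ∀ r n → + r - + (r ℕ.+ n) ≡ - (+ n)
  d₂ r n = ((∀ r n → r - (r + n) ≡ - n) ∋ solve-∀) (+ r) (+ n)
  lower : ∀ n m → m ≡ C λ′ (+ n) → m ℕ.+ n ℕ.≤ C λ′ (- (+ n))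
  lower n zero    e = ℤₚ.drop‿+≤+
      (≤-lin₁ (C-≥ λ′ (- (+ n))) (((∀ a n → a - n ≡ (a + - n) - 0ℤ) ∋ solve-∀) (+ C λ′ (- (+ n))) (+ n)))
  -- The last node on diagonal n is (m + 1, m + 1 + n), and its transpose lies on diagonal - n.
  lower n (suc m) e = subst (λ z → suc m ℕ.+ n ℕ.≤ C λ′ z) (d₂ (suc m) n)
    (flip-node (suc m) (suc m ℕ.+ n) (s≤s z≤n) (s≤s z≤n)
        (subst (λ z → suc m ℕ.≤ C λ′ z) (sym (d₁ (suc m) n)) (ℕₚ.≤-reflexive e)))
  upper : ∀ n → C λ′ (- (+ n)) ℕ.≤ C λ′ (+ n) ℕ.+ n
  upper n = ℕₚ.≮⇒≥ λ p → ℕₚ.1+n≰n (subst (λ z → suc (C λ′ (+ n)) ℕ.≤ C λ′ z) (d₁ (suc (C λ′ (+ n))) n)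
    (flip-node (suc (C λ′ (+ n)) ℕ.+ n) (suc (C λ′ (+ n))) (s≤s z≤n) (s≤s z≤n)
      (subst (λ z → suc (C λ′ (+ n)) ℕ.+ n ℕ.≤ C λ′ z) (sym (d₂ (suc (C λ′ (+ n))) n)) p)))
  nat : ∀ n → C λ′ (- (+ n)) ≡ C λ′ (+ n) ℕ.+ n
  nat n = ℕₚ.≤-antisym (upper n) (lower n _ refl)
  go : SymC λ′
  go (+ n)    = cong +_ (nat n)
  go -[1+ n ] = trans (((∀ a n → a ≡ (a + n) + - n) ∋ solve-∀) (+ C λ′ (+ suc n)) (+ suc n))
      (cong (λ z → + z + -[1+ n ]) (sym (nat (suc n))))

SymC⇒selfConj : ∀ λ′ → SymC λ′ → SelfConj λ′
SymC⇒selfConj λ′ h (suc r) 1≤r = ℕₚ.≤-antisym (go (conjPart λ′ (suc r)) ℕₚ.≤-refl) (back (part λ′ (suc r)) ℕₚ.≤-refl)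
  where
  flip-node : ∀ r c → r ℕ.≤ C λ′ (+ c - + r) → c ℕ.≤ C λ′ (+ r - + c)
  flip-node r c p = ℤₚ.drop‿+≤+ (≤-lin₁ (ℤ.+≤+ p) (trans (cong (λ z → z - + c)
      (trans (cong (λ z → + C λ′ z) (((∀ r c → r - c ≡ - (c - r)) ∋ solve-∀) (+ r) (+ c))) (h (+ c - + r))))
    (((∀ a r c → (a + (c - r)) - c ≡ a - r) ∋ solve-∀) (+ C λ′ (+ c - + r)) (+ r) (+ c))))
  go : ∀ c → c ℕ.≤ conjPart λ′ (suc r) → c ℕ.≤ part λ′ (suc r)
  go zero    p = z≤n
  go (suc c) p = node-C λ′ (suc r) (suc c) 1≤r
    (flip-node (suc c) (suc r) (C-node λ′ (suc c) (suc r) (s≤s z≤n) (count-from (suc r) (decr λ′) c p)))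
  back : ∀ c → c ℕ.≤ part λ′ (suc r) → c ℕ.≤ conjPart λ′ (suc r)
  back zero    p = z≤n
  back (suc c) p = count-to (suc r) (decr λ′) 1≤r c
    (node-C λ′ (suc c) (suc r) (s≤s z≤n) (flip-node (suc r) (suc c) (C-node λ′ (suc r) (suc c) 1≤r p)))

selfConj⇒Sym : ∀ λ′ → SelfConj λ′ → Sym (I λ′)
selfConj⇒Sym λ′ sc x =
  trans (I-def λ′ (bar x))
    (trans (cong₂ (λ a b → + C λ′ a - + C λ′ b) (((∀ x → -1ℤ - x ≡ - (x + 1ℤ)) ∋ solve-∀) x)
        (((∀ x → (-1ℤ - x) + 1ℤ ≡ - x) ∋ solve-∀) x))
    (trans (cong₂ _-_ (h (x + 1ℤ)) (h x))
    (trans (((∀ a b x → (a + (x + 1ℤ)) - (b + x) ≡ 1ℤ - (b - a)) ∋ solve-∀) (+ C λ′ (x + 1ℤ)) (+ C λ′ x) x)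
      (cong (λ z → 1ℤ - z) (sym (I-def λ′ x))))))
  where h = selfConj⇒SymC λ′ sc

Sym⇒selfConj : ∀ λ′ → Sym (I λ′) → SelfConj λ′
Sym⇒selfConj λ′ h = SymC⇒selfConj λ′ λ p → ℤₚ.i-j≡0⇒i≡j _ _ (const-0 e stp M zero′ p)
  where
  e : ℤ → ℤ
  e p = + C λ′ (- p) - (+ C λ′ p + p)
  M = nth (parts λ′) 0 ℕ.⊔ length (parts λ′)
  zero′ : ∀ n → M ℕ.≤ n → e (+ n) ≡ 0ℤ
  zero′ n p rewrite C-low λ′ n (ℕₚ.m⊔n≤o⇒n≤o (nth (parts λ′) 0) _ p) | C-high λ′ n
      (ℕₚ.m⊔n≤o⇒m≤o _ (length (parts λ′)) p) =
    ℤₚ.+-inverseʳ (+ n)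
  stp : ∀ p → e p ≡ e (p + 1ℤ)
  stp p = trans (cong (λ z → z - (+ C λ′ p + p)) (trans q (cong (λ z → + C λ′ (- (p + 1ℤ)) - (1ℤ - z)) (I-def λ′ p))))
    (((∀ a b c p → (a - (1ℤ - (b - c))) - (b + p) ≡ a - (c + (p + 1ℤ))) ∋ solve-∀) (+ C λ′ (- (p + 1ℤ))) (+ C λ′ p)
        (+ C λ′ (p + 1ℤ)) p)
    where
    q : + C λ′ (- p) ≡ + C λ′ (- (p + 1ℤ)) - (1ℤ - I λ′ p)
    q = trans (((∀ a b → b ≡ a - (a - b)) ∋ solve-∀) (+ C λ′ (- (p + 1ℤ))) (+ C λ′ (- p)))
      (cong (λ z → + C λ′ (- (p + 1ℤ)) - z) (trans (cong₂ (λ a b → + C λ′ a - + C λ′ b)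
         (((∀ x → - (x + 1ℤ) ≡ -1ℤ - x) ∋ solve-∀) p) (((∀ x → - x ≡ (-1ℤ - x) + 1ℤ) ∋ solve-∀) p))
             (trans (sym (I-def λ′ (bar p))) (h p))))

-- Rim hooks as bead moves

-- Indicator of x, x - 1, ..., x - k + 1: the diagonals met by the rim hook whose removal moves a
-- bead from x to x - k.
run : ℕ → ℤ → ℤ → ℤ
run zero    x p = 0ℤ
run (suc k) x p = run k x p + δ (x - + k) p

δ-shift : ∀ a p → δ a (p + 1ℤ) ≡ δ (a - 1ℤ) p
δ-shift a p = δ-inj
  (λ e → trans (((∀ p → p ≡ (p + 1ℤ) - 1ℤ) ∋ solve-∀) p) (cong (_- 1ℤ) e))
  (λ e → trans (cong (_+ 1ℤ) e) (((∀ a → (a - 1ℤ) + 1ℤ ≡ a) ∋ solve-∀) a))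

run-diff : ∀ k x p → run k x p - run k x (p + 1ℤ) ≡ δ x p - δ (x - + k) p
run-diff zero    x p = sym (trans (cong (λ z → δ x p - δ z p) (+-identityʳ x)) (ℤₚ.+-inverseʳ (δ x p)))
run-diff (suc k) x p = trans
  (((∀ a b c d → (a + b) - (c + d) ≡ (a - c) + (b - d)) ∋ solve-∀) (run k x p) (δ (x - + k) p) (run k x (p + 1ℤ))
      (δ (x - + k) (p + 1ℤ)))
  (trans (cong₂ (λ a b → a + (δ (x - + k) p - b)) (run-diff k x p)
     (trans (δ-shift (x - + k) p) (cong (λ z → δ z p) (((∀ x k → (x - k) - 1ℤ ≡ x - (1ℤ + k)) ∋ solve-∀) x (+ k)))))
   (((∀ a b c → (a - b) + (b - c) ≡ a - c) ∋ solve-∀) (δ x p) (δ (x - + k) p) (δ (x - + suc k) p)))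

hs-run : ∀ k x → HasSum (run k x) (+ k)
hs-run zero    x = hs-0
hs-run (suc k) x = hs-val (cong +_ (ℕₚ.+-comm k 1)) (hs-+ (hs-run k x) (hs-δ (x - + k)))

sub-inj : ∀ x {i j} → x - + i ≡ x - + j → i ≡ j
sub-inj x {i} {j} e = ℤₚ.+-injective (trans (((∀ x i → i ≡ x - (x - i)) ∋ solve-∀) x (+ i))
  (trans (cong (λ z → x - z) e) (((∀ x i → x - (x - i) ≡ i) ∋ solve-∀) x (+ j))))

run-out : ∀ k x i → k ℕ.≤ i → run k x (x - + i) ≡ 0ℤ
run-out zero    x i p = refl
run-out (suc k) x i p = cong₂ _+_ (run-out k x i (ℕₚ.≤-trans (ℕₚ.n≤1+n k) p))
  (δ-≢ λ e → ℕₚ.<-irrefl (sym (sub-inj x e)) p)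

run-in : ∀ k x i → i ℕ.< k → run k x (x - + i) ≡ 1ℤ
run-in (suc k) x i (s≤s p) with ℕₚ.m≤n⇒m<n∨m≡n p
... | inj₁ q    = cong₂ _+_ (run-in k x i q) (δ-≢ λ e → ℕₚ.<-irrefl (sub-inj x e) q)
... | inj₂ refl = cong₂ _+_ (run-out k x k ℕₚ.≤-refl) (δ-refl (x - + k))

run-above : ∀ k x i → run k x (x + + suc i) ≡ 0ℤ
run-above zero    x i = refl
run-above (suc k) x i = cong₂ _+_ (run-above k x i) (δ-≢ λ e → case (trans
    (((∀ x i → i ≡ (x + i) - x) ∋ solve-∀) x (+ suc i))
        (trans (cong (_- x) e) (((∀ x k → (x - k) - x ≡ - k) ∋ solve-∀) x (+ k)))))
  where case : ∀ {k} → + suc i ≢ - (+ k)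
        case {zero} ()
        case {suc k} ()

compare-to : ∀ x p → (∃[ i ] p ≡ x - + i) ⊎ (∃[ i ] p ≡ x + + suc i)
compare-to x p = go (p - x) (((∀ p x → p ≡ x + (p - x)) ∋ solve-∀) p x)
  where
  go : ∀ d → p ≡ x + d → (∃[ i ] p ≡ x - + i) ⊎ (∃[ i ] p ≡ x + + suc i)
  go (+ zero)  e = inj₁ (0 , e)
  go (+ suc n) e = inj₂ (n , e)
  go -[1+ n ]  e = inj₁ (suc n , e)

run-≥0 : ∀ k x p → 0ℤ ≤ run k x p
run-≥0 zero    x p = ≤-refl
run-≥0 (suc k) x p = 0≤+ (run-≥0 k x p) (δ-≥0 (x - + k) p)

Moved : ℕ → Partition → Partition → Set
Moved s λ′ μ = ∃[ x ] (I λ′ x ≡ 1ℤ × I λ′ (x - + s) ≡ 0ℤ × (∀ p → I μ p ≡ (I λ′ p - δ x p) + δ (x - + s) p))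

path-trans : ∀ {P r c r′ c′ r″ c″} → Path P r c r′ c′ → Path P r′ c′ r″ c″ → Path P r c r″ c″
path-trans (here _)     q = q
path-trans (step a b p) q = step a b (path-trans p q)

adj-sym : ∀ {r c r′ c′} → Adj r c r′ c′ → Adj r′ c′ r c
adj-sym (inj₁ (e , inj₁ d)) = inj₁ (sym e , inj₂ (sym d))
adj-sym (inj₁ (e , inj₂ d)) = inj₁ (sym e , inj₁ (sym d))
adj-sym (inj₂ (e , inj₁ d)) = inj₂ (sym e , inj₂ (sym d))
adj-sym (inj₂ (e , inj₂ d)) = inj₂ (sym e , inj₁ (sym d))

path-start : ∀ {P r c r′ c′} → Path P r c r′ c′ → P r c
path-start (here p)     = p
path-start (step p _ _) = p

path-sym : ∀ {P r c r′ c′} → Path P r c r′ c′ → Path P r′ c′ r c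
path-sym (here p)     = here p
path-sym (step p a q) = path-trans (path-sym q) (step (path-start q) (adj-sym a) (here p))

-- The witness is the last node of λ on the diagonal p, in column `C λ′ p + p`. The column is
-- positive because `C μ p + p` is already nonnegative.
skew-at : ∀ λ′ μ p → C μ p ℕ.< C λ′ p → ∃[ c ] (+ c ≡ + C λ′ p + p × Skew λ′ μ (C λ′ p) c)
skew-at λ′ μ p lt = c , ec , (1≤r , 1≤c , node-C λ′ _ c 1≤r (ℕₚ.≤-reflexive (cong (C λ′) (sym diag))))
    , λ { (_ , _ , q) → ℕₚ.<-irrefl refl (ℕₚ.≤-trans lt (subst (λ z → C λ′ p ℕ.≤ C μ z) diag (C-node μ _ c 1≤r q))) }
  where
  pos₁ : 1ℤ ≤ + C λ′ p + p
  pos₁ = ≤-lin (C-≥ μ p) (ℤ.+≤+ lt) (((∀ a b p → (a + p) - 1ℤ ≡ ((b + p) - 0ℤ) + (a - (1ℤ + b))) ∋ solve-∀)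
      (+ C λ′ p) (+ C μ p) p)
  c : ℕ
  c = pos (+ C λ′ p + p)
  ec : + c ≡ + C λ′ p + p
  ec = pos-id (≤-trans 0≤+n pos₁)
    where pos-id : ∀ {z} → 0ℤ ≤ z → + pos z ≡ z
          pos-id {+ n} _ = refl
  1≤r : 1 ℕ.≤ C λ′ p
  1≤r = ℕₚ.≤-trans (s≤s z≤n) lt
  1≤c : 1 ℕ.≤ c
  1≤c = ℤₚ.drop‿+≤+ (subst (1ℤ ≤_) (sym ec) pos₁)
  diag : + c - + C λ′ p ≡ p
  diag = trans (cong (λ z → z - + C λ′ p) ec) (((∀ a p → (a + p) - a ≡ p) ∋ solve-∀) (+ C λ′ p) p)

skew-C : ∀ λ′ μ r c → Skew λ′ μ r c → C μ (+ c - + r) ℕ.< r × r ℕ.≤ C λ′ (+ c - + r)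
skew-C λ′ μ r c ((1≤r , 1≤c , p) , q) =
  ℕₚ.≰⇒> (λ w → q (1≤r , 1≤c , node-C μ r c 1≤r w)) , C-node λ′ r c 1≤r p

hs-C-diff : ∀ λ′ μ → HasSum (λ p → + C λ′ p - + C μ p) (+ size λ′ - + size μ)
hs-C-diff λ′ μ = hs-cong (λ p → ((∀ a b v → (a - v) - (b - v) ≡ a - b) ∋ solve-∀) (+ C λ′ p) (+ C μ p)
    (+ above [] (p + 1ℤ)))
  (hs-∸ (hs-excess λ′) (hs-excess μ))

opaque
  -- The counting functions differ by `run s x`, so exactly the last node is lost on each of s
  -- consecutive diagonals. On neighbouring diagonals p and p + 1 these nodes are adjacent,
  -- horizontally if p is a gap of λ and vertically if it is a bead.
  moved⇒remove : ∀ s λ′ μ → Moved s λ′ μ → RemoveRimHook s λ′ μ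
  moved⇒remove s λ′ μ (x , _ , _ , move) = contained , sizes , rim , connected
    where
    e : ℤ → ℤ
    e p = (+ C λ′ p - + C μ p) - run s x p
    stp : ∀ p → e p ≡ e (p + 1ℤ)
    stp p = ℤₚ.i-j≡0⇒i≡j _ _ (trans
      (((∀ a b j a′ b′ j′ → ((a - b) - j) - ((a′ - b′) - j′) ≡ ((a - a′) - (b - b′)) - (j - j′)) ∋ solve-∀)
        (+ C λ′ p) (+ C μ p) (run s x p) (+ C λ′ (p + 1ℤ)) (+ C μ (p + 1ℤ)) (run s x (p + 1ℤ)))
      (trans (cong₂ (λ a b → (a - b) - (run s x p - run s x (p + 1ℤ))) (sym (I-def λ′ p)) (sym (I-def μ p)))
      (trans (cong₂ (λ a b → (I λ′ p - a) - b) (move p) (run-diff s x p))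
        (((∀ i d d′ → (i - ((i - d) + d′)) - (d - d′) ≡ 0ℤ) ∋ solve-∀) (I λ′ p) (δ x p) (δ (x - + s) p)))))
    hs-e : HasSum e ((+ size λ′ - + size μ) - + s)
    hs-e = hs-∸ (hs-C-diff λ′ μ) (hs-run s x)
    e≡0 : ∀ p → e p ≡ 0ℤ
    e≡0 = const-0 e stp (HasSum.bound hs-e) (proj₁ (HasSum.supp hs-e))
    C-eq : ∀ p → + C λ′ p ≡ + C μ p + run s x p
    C-eq p = trans (((∀ a b j → a ≡ ((a - b) - j) + (b + j)) ∋ solve-∀) (+ C λ′ p) (+ C μ p) (run s x p))
      (trans (cong (_+ (+ C μ p + run s x p)) (e≡0 p)) (+-identityˡ _))
    C-≤ : ∀ p → C μ p ℕ.≤ C λ′ p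
    C-≤ p = ℤₚ.drop‿+≤+ (≤-by _ (run-≥0 s x p)
        (trans (cong (_- + C μ p) (C-eq p)) (((∀ a b → (a + b) - a ≡ b) ∋ solve-∀) (+ C μ p) (run s x p))))
    contained : ∀ r c → Node μ r c → Node λ′ r c
    contained r c (1≤r , 1≤c , p) = 1≤r , 1≤c , node-C λ′ r c 1≤r (ℕₚ.≤-trans (C-node μ r c 1≤r p) (C-≤ (+ c - + r)))
    sizes : size λ′ ≡ size μ ℕ.+ s
    sizes = ℤₚ.+-injective (trans (((∀ a b → a ≡ b + (a - b)) ∋ solve-∀) (+ size λ′) (+ size μ))
      (cong (λ z → + size μ + z) (ℤₚ.i-j≡0⇒i≡j (+ size λ′ - + size μ) (+ s)
          (hs-unique hs-e (hs-cong (λ p → sym (e≡0 p)) hs-0)))))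
    in-run : ∀ p → run s x p ≡ 1ℤ → C λ′ p ≡ suc (C μ p)
    in-run p j = ℤₚ.+-injective (trans (C-eq p) (trans (cong (λ z → + C μ p + z) j) (ℤₚ.+-comm (+ C μ p) 1ℤ)))
    off-run : ∀ p → run s x p ≡ 0ℤ → C λ′ p ≡ C μ p
    off-run p j = ℤₚ.+-injective (trans (C-eq p) (trans (cong (λ z → + C μ p + z) j) (+-identityʳ _)))
    skew-inv : ∀ r c → Skew λ′ μ r c → ∃[ i ] (i ℕ.< s × + c - + r ≡ x - + i × r ≡ C λ′ (+ c - + r))
    skew-inv r c sk with skew-C λ′ μ r c sk | compare-to x (+ c - + r)
    ... | lo , hi | inj₂ (i , q) = ⊥-elim (ℕₚ.<-irrefl refl (ℕₚ.≤-trans lo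
      (subst (r ℕ.≤_) (off-run _ (trans (cong (run s x) q) (run-above s x i))) hi)))
    ... | lo , hi | inj₁ (i , q) with i ℕ.<? s
    ...   | no i≥s = ⊥-elim (ℕₚ.<-irrefl refl (ℕₚ.≤-trans lo
      (subst (r ℕ.≤_) (off-run _ (trans (cong (run s x) q) (run-out s x i (ℕₚ.≮⇒≥ i≥s)))) hi)))
    ...   | yes i<s = i , i<s , q , ℕₚ.≤-antisym hi
      (subst (ℕ._≤ r) (sym (in-run _ (trans (cong (run s x) q) (run-in s x i i<s)))) lo)
    rim : ∀ r c → Skew λ′ μ r c → Rim λ′ r c
    rim r c sk@(nd , _) = nd , λ { (1≤r , _ , p) → ℕₚ.1+n≰n (ℕₚ.≤-trans
      (subst (λ z → suc r ℕ.≤ C λ′ z) (((∀ c r → (1ℤ + c) - (1ℤ + r) ≡ c - r) ∋ solve-∀) (+ c) (+ r))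
          (C-node λ′ (suc r) (suc c) 1≤r p))
      (ℕₚ.≤-reflexive (sym (proj₂ (proj₂ (proj₂ (skew-inv r c sk))))))) }
    lt-at : ∀ i → i ℕ.< s → C μ (x - + i) ℕ.< C λ′ (x - + i)
    lt-at i i<s = ℕₚ.≤-reflexive (sym (in-run _ (run-in s x i i<s)))
    H : ℕ → ℕ → Set
    H = Skew λ′ μ
    skat : ∀ i → i ℕ.< s → ∃[ c ] (+ c ≡ + C λ′ (x - + i) + (x - + i) × Skew λ′ μ (C λ′ (x - + i)) c)
    skat i i<s = skew-at λ′ μ (x - + i) (lt-at i i<s)
    c-unique : ∀ {c c′ z} → + c ≡ z → + c′ ≡ z → c ≡ c′
    c-unique p q = ℤₚ.+-injective (trans p (sym q))
    to-top : ∀ i (i<s : i ℕ.< s) (0<s : 0 ℕ.< s) → Path H (C λ′ (x - + i)) (proj₁ (skat i i<s))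
               (C λ′ (x - 0ℤ)) (proj₁ (skat 0 0<s))
    to-top zero i<s 0<s with ℕₚ.≤-irrelevant i<s 0<s
    ... | refl = here (proj₂ (proj₂ (skat 0 0<s)))
    to-top (suc i) i<s 0<s = step (proj₂ (proj₂ sk)) adj (to-top i i<s′ 0<s)
      where
      i<s′ : i ℕ.< s
      i<s′ = ℕₚ.≤-trans (ℕₚ.n≤1+n _) i<s
      p p′ : ℤ
      p = x - + suc i
      p′ = x - + i
      sk : ∃[ c ] (+ c ≡ + C λ′ p + p × Skew λ′ μ (C λ′ p) c)
      sk = skat (suc i) i<s
      sk′ : ∃[ c ] (+ c ≡ + C λ′ p′ + p′ × Skew λ′ μ (C λ′ p′) c)
      sk′ = skat i i<s′
      p+1 : p + 1ℤ ≡ p′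
      p+1 = ((∀ x i → (x - (1ℤ + i)) + 1ℤ ≡ x - i) ∋ solve-∀) x (+ i)
      cp : + C λ′ p ≡ + C λ′ p′ + I λ′ p
      cp = trans (C-of-I λ′ p) (cong (λ z → + C λ′ z + I λ′ p) p+1)
      adj : Adj (C λ′ p) (proj₁ sk) (C λ′ p′) (proj₁ sk′)
      adj with I-01 λ′ p
      ... | inj₁ z = inj₁ (rr , inj₁ (c-unique {z = + C λ′ p′ + p′}
          (trans (cong (λ z → 1ℤ + z) (trans (proj₁ (proj₂ sk)) (cong (λ z → + z + p) rr)))
              (trans (((∀ a p → 1ℤ + (a + p) ≡ a + (p + 1ℤ)) ∋ solve-∀) (+ C λ′ p′) p)
              (cong (λ z → + C λ′ p′ + z) p+1)))
          (proj₁ (proj₂ sk′))))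
        where rr : C λ′ p ≡ C λ′ p′
              rr = ℤₚ.+-injective (trans cp (trans (cong (λ z → + C λ′ p′ + z) z) (+-identityʳ _)))
      ... | inj₂ o = inj₂ (c-unique {z = + C λ′ p′ + p′}
          (trans (proj₁ (proj₂ sk)) (trans (cong (λ z → + z + p) rr)
              (trans (((∀ a p → (1ℤ + a) + p ≡ a + (p + 1ℤ)) ∋ solve-∀) (+ C λ′ p′) p)
              (cong (λ z → + C λ′ p′ + z) p+1))))
          (proj₁ (proj₂ sk′)) , inj₂ rr)
        where rr : C λ′ p ≡ suc (C λ′ p′)
              rr = ℤₚ.+-injective (trans cp (trans (cong (λ z → + C λ′ p′ + z) o) (ℤₚ.+-comm (+ C λ′ p′) 1ℤ)))
    from-skew : ∀ r c → H r c → (0<s : 0 ℕ.< s) → Path H r c (C λ′ (x - 0ℤ)) (proj₁ (skat 0 0<s))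
    from-skew r c sk 0<s with skew-inv r c sk
    ... | i , i<s , q , w = subst₂ (λ a b → Path H a b (C λ′ (x - 0ℤ)) (proj₁ (skat 0 0<s)))
        (sym (trans w (cong (C λ′) q)))
        (c-unique {z = + r + (x - + i)}
            (trans (proj₁ (proj₂ (skat i i<s))) (cong (λ z → + z + (x - + i)) (sym (trans w (cong (C λ′) q)))))
          (trans (((∀ c r → c ≡ r + (c - r)) ∋ solve-∀) (+ c) (+ r)) (cong (λ z → + r + z) q)))
        (to-top i i<s 0<s)
    connected : ∀ r c r′ c′ → H r c → H r′ c′ → Path H r c r′ c′
    connected r c r′ c′ sk sk′ = path-trans (from-skew r c sk 0<s) (path-sym (from-skew r′ c′ sk′ 0<s))
      where
      0<s : 0 ℕ.< s
      0<s = ℕₚ.≤-trans (s≤s z≤n) (proj₁ (proj₂ (skew-inv r c sk)))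

-- A step to an adjacent node changes c - r by one, so a path meets every diagonal between those of
-- its ends. Hence the diagonals of a connected hook form an interval.
path-through : ∀ {P r c r′ c′} q → Path P r c r′ c′ → + c - + r ≤ q → q ≤ + c′ - + r′ → ∃[ r″ ] ∃[ c″ ]
    (P r″ c″ × + c″ - + r″ ≡ q)
path-through q (here {r} {c} p) lo hi = r , c , p , ℤₚ.≤-antisym lo hi
path-through {r = r} {c} q (step {r′ = r′} {c′} p adj path) lo hi with (+ c - + r) ≟ q
... | yes e = r , c , p , e
... | no ne = path-through q path (≤-trans (next adj) (ℤₚ.i<j⇒suc[i]≤j (ℤₚ.≤∧≢⇒< lo ne))) hi
  where
  next : ∀ {r c r′ c′} → Adj r c r′ c′ → + c′ - + r′ ≤ 1ℤ + (+ c - + r)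
  next {r} {c} (inj₁ (refl , inj₁ refl)) = ≤-reflexive (((∀ c r → (1ℤ + c) - r ≡ 1ℤ + (c - r)) ∋ solve-∀) (+ c) (+ r))
  next {r} {_} {_} {c} (inj₁ (refl , inj₂ refl)) = ≤-lin₁ {c = 0ℤ} {d = + 2} 0≤+n
      (((∀ c r → (1ℤ + ((1ℤ + c) - r)) - (c - r) ≡ + 2 - 0ℤ) ∋ solve-∀) (+ c) (+ r))
  next {r} {c} (inj₂ (refl , inj₁ refl)) = ≤-lin₁ {c = 0ℤ} {d = + 2} 0≤+n
      (((∀ c r → (1ℤ + (c - r)) - (c - (1ℤ + r)) ≡ + 2 - 0ℤ) ∋ solve-∀) (+ c) (+ r))
  next {_} {c} {r} (inj₂ (refl , inj₂ refl)) = ≤-reflexive (((∀ c r → c - r ≡ 1ℤ + (c - (1ℤ + r))) ∋ solve-∀) (+ c)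
      (+ r))

least : ∀ {P : ℕ → Set} → (∀ n → Dec (P n)) → ∀ n → P n → ∃[ m ] (P m × (∀ i → i ℕ.< m → ¬ P i))
least {P} P? n pn = go n 0 (λ _ ()) (ℕₚ.+-identityʳ n)
  where
  go : ∀ k m → (∀ i → i ℕ.< m → ¬ P i) → k ℕ.+ m ≡ n → ∃[ m ] (P m × (∀ i → i ℕ.< m → ¬ P i))
  go zero    m below refl = m , pn , below
  go (suc k) m below e with P? m
  ... | yes pm = m , pm , below
  ... | no ¬pm = go k (suc m) below′ (trans (ℕₚ.+-suc k m) e)
    where
    below′ : ∀ i → i ℕ.< suc m → ¬ P i
    below′ i (s≤s p) with ℕₚ.m≤n⇒m<n∨m≡n p
    ... | inj₁ q    = below i q
    ... | inj₂ refl = ¬pm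

hs-vanish-up : ∀ {f v} → HasSum f v → ∀ p → ∃[ k ] f (p + + k) ≡ 0ℤ
hs-vanish-up {f} (hasSum M (hi , _) _) (+ n)    = M , hi (n ℕ.+ M) (ℕₚ.m≤n+m M n)
hs-vanish-up {f} (hasSum M (hi , _) _) -[1+ n ] = suc n ℕ.+ M ,
  trans (cong f (((∀ n m → - (1ℤ + n) + ((1ℤ + n) + m) ≡ m) ∋ solve-∀) (+ n) (+ M))) (hi M ℕₚ.≤-refl)

hs-vanish-down : ∀ {f v} → HasSum f v → ∀ p → ∃[ k ] f (p - + k) ≡ 0ℤ
hs-vanish-down {f} h p with hs-vanish-up (hs-bar h) (bar p)
... | k , e = k , trans (cong f (((∀ p k → p - k ≡ -1ℤ - ((-1ℤ - p) + k)) ∋ solve-∀) p (+ k))) e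

01-≢0 : ∀ {f} → Is01 f → ∀ x → f x ≢ 0ℤ → f x ≡ 1ℤ
01-≢0 z x ne with z x
... | inj₁ e = ⊥-elim (ne e)
... | inj₂ e = e

0≢1 : ∀ {z} → z ≡ 0ℤ → z ≢ 1ℤ
0≢1 refl ()

search-top : ∀ (e : ℤ → ℤ) → Is01 e → ∀ k p → e p ≡ 1ℤ → e (p + + k) ≡ 0ℤ → ∃[ x ] (e x ≡ 1ℤ × e (x + 1ℤ) ≡ 0ℤ)
search-top e e01 zero    p a z = ⊥-elim (0≢1 z (trans (cong e (+-identityʳ p)) a))
search-top e e01 (suc k) p a z with e01 (p + 1ℤ)
... | inj₁ q = p , a , q
... | inj₂ q = search-top e e01 k (p + 1ℤ) q (trans (cong e (ℤₚ.+-assoc p 1ℤ (+ k))) z)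

opaque
  interval-run : ∀ (e : ℤ → ℤ) s → Is01 e → 1 ℕ.≤ s → HasSum e (+ s) →
    (∀ p q p′ → e p ≡ 1ℤ → e p′ ≡ 1ℤ → p ≤ q → q ≤ p′ → e q ≡ 1ℤ) → ∃[ x ] (∀ p → e p ≡ run s x p)
  interval-run e s e-01 1≤s hs-e interval = go start
    where
    start : ∃[ p ] ¬ (e p ≤ 0ℤ)
    start = hs-pos hs-e λ { (ℤ.+≤+ q) → ℕₚ.<-irrefl refl (ℕₚ.≤-trans 1≤s q) }
    finish : ∀ x L → e x ≡ 1ℤ → e (x + 1ℤ) ≡ 0ℤ → e (x - + L) ≡ 0ℤ → (∀ i → i ℕ.< L → e (x - + i) ≢ 0ℤ) → ∃[ x ]
        (∀ p → e p ≡ run s x p)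
    finish x L ex ex+1 eL low = x , λ p → trans (e≡run p) (cong (λ l → run l x p) L≡s)
      where
      e≡run : ∀ p → e p ≡ run L x p
      e≡run p with compare-to x p
      ... | inj₂ (i , refl) = trans z (sym (run-above L x i))
        where
        z : e (x + + suc i) ≡ 0ℤ
        z with e-01 (x + + suc i)
        ... | inj₁ q = q
        ... | inj₂ q = ⊥-elim (0≢1 ex+1 (interval x (x + 1ℤ) (x + + suc i) ex q
                (≤-lin₁ {c = 0ℤ} {d = 1ℤ} 0≤+n (((∀ x → (x + 1ℤ) - x ≡ 1ℤ - 0ℤ) ∋ solve-∀) x))
                (≤-lin₁ {c = 0ℤ} {d = + i} 0≤+n (((∀ x i → (x + (1ℤ + i)) - (x + 1ℤ) ≡ i - 0ℤ) ∋ solve-∀) x (+ i)))))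
      ... | inj₁ (i , refl) with i ℕ.<? L
      ...   | yes i<L = trans (01-≢0 e-01 (x - + i) (low i i<L)) (sym (run-in L x i i<L))
      ...   | no  i≮L = trans z (sym (run-out L x i (ℕₚ.≮⇒≥ i≮L)))
        where
        z : e (x - + i) ≡ 0ℤ
        z with e-01 (x - + i)
        ... | inj₁ q = q
        ... | inj₂ q = ⊥-elim (0≢1 eL (interval (x - + i) (x - + L) x q ex
                (≤-lin₁ {c = + L} {d = + i} (ℤ.+≤+ (ℕₚ.≮⇒≥ i≮L))
                    (((∀ x i l → (x - l) - (x - i) ≡ i - l) ∋ solve-∀) x (+ i) (+ L)))
                (≤-lin₁ {c = 0ℤ} {d = + L} 0≤+n (((∀ x l → x - (x - l) ≡ l - 0ℤ) ∋ solve-∀) x (+ L)))))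
      L≡s : L ≡ s
      L≡s = ℤₚ.+-injective (hs-unique (hs-run L x) (hs-cong e≡run hs-e))
    from-top : ∃[ x ] (e x ≡ 1ℤ × e (x + 1ℤ) ≡ 0ℤ) → ∃[ x ] (∀ p → e p ≡ run s x p)
    from-top (x , ex , ex+1) with hs-vanish-down hs-e x
    ... | k , z with least {λ k → e (x - + k) ≡ 0ℤ} (λ k → e (x - + k) ≟ 0ℤ) k z
    ...   | L , eL , low = finish x L ex ex+1 eL low
    go : ∃[ p ] ¬ (e p ≤ 0ℤ) → ∃[ x ] (∀ p → e p ≡ run s x p)
    go (p , pos-p) with hs-vanish-up hs-e p
    ... | k , z = from-top (search-top e e-01 k p (01-≢0 e-01 p λ z → pos-p (≤-reflexive z)) z)

01-drop : ∀ {a b} → a ≡ 0ℤ ⊎ a ≡ 1ℤ → b ≡ 0ℤ ⊎ b ≡ 1ℤ → b ≡ (a - 1ℤ) + 0ℤ → a ≡ 1ℤ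
01-drop (inj₂ e)    _           _  = e
01-drop (inj₁ refl) (inj₁ refl) ()
01-drop (inj₁ refl) (inj₂ refl) ()

01-rise : ∀ {a b} → a ≡ 0ℤ ⊎ a ≡ 1ℤ → b ≡ 0ℤ ⊎ b ≡ 1ℤ → b ≡ (a - 0ℤ) + 1ℤ → a ≡ 0ℤ
01-rise (inj₁ e)    _           _  = e
01-rise (inj₂ refl) (inj₁ refl) ()
01-rise (inj₂ refl) (inj₂ refl) ()

opaque
  run-moved : ∀ s λ′ μ x → 1 ℕ.≤ s → (∀ p → + C λ′ p - + C μ p ≡ run s x p) → Moved s λ′ μ
  run-moved s λ′ μ x 1≤s e≡run = x , Ix , Iy , move
    where
    diff : ∀ p → I λ′ p - I μ p ≡ δ x p - δ (x - + s) p
    diff p = trans (cong₂ _-_ (I-def λ′ p) (I-def μ p)) $ trans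
        (((∀ a a′ b b′ → (a - a′) - (b - b′) ≡ (a - b) - (a′ - b′)) ∋ solve-∀) (+ C λ′ p) (+ C λ′ (p + 1ℤ)) (+ C μ p)
        (+ C μ (p + 1ℤ)))
      (trans (cong₂ _-_ (e≡run p) (e≡run (p + 1ℤ))) (run-diff s x p))
    move : ∀ p → I μ p ≡ (I λ′ p - δ x p) + δ (x - + s) p
    move p = trans (((∀ i j → j ≡ i - (i - j)) ∋ solve-∀) (I λ′ p) (I μ p))
      (trans (cong (λ z → I λ′ p - z) (diff p)) (((∀ i d d′ → i - (d - d′) ≡ (i - d) + d′) ∋ solve-∀) (I λ′ p)
          (δ x p) (δ (x - + s) p)))
    x≢ : x ≢ x - + s
    x≢ q = ℕₚ.<-irrefl (sub-inj x {0} {s} (trans (+-identityʳ x) q)) 1≤s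
    Ix : I λ′ x ≡ 1ℤ
    Ix = 01-drop {I λ′ x} {I μ x} (I-01 λ′ x) (I-01 μ x)
        (trans (move x) (cong₂ (λ a b → (I λ′ x - a) + b) (δ-refl x) (δ-≢ {x - + s} {x} x≢)))
    Iy : I λ′ (x - + s) ≡ 0ℤ
    Iy = 01-rise {I λ′ (x - + s)} {I μ (x - + s)} (I-01 λ′ (x - + s)) (I-01 μ (x - + s))
        (trans (move (x - + s)) (cong₂ (λ a b → (I λ′ (x - + s) - a) + b) (δ-≢ {x} {x - + s} (λ w → x≢ (sym w)))
        (δ-refl (x - + s))))

opaque
  contained-C-≤ : ∀ λ′ μ → (∀ r c → Node μ r c → Node λ′ r c) → ∀ p → C μ p ℕ.≤ C λ′ p
  contained-C-≤ λ′ μ sub p = ℕₚ.≮⇒≥ λ lt → let (c , ec , nd , out) = skew-at μ λ′ p lt in out (sub _ _ nd)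

opaque
  -- If two nodes were removed from one diagonal, the last but one node of λ on it would be removed
  -- without lying on the rim.
  rim-C-≤1 : ∀ λ′ μ → (∀ r c → Skew λ′ μ r c → Rim λ′ r c) → ∀ p → C λ′ p ℕ.≤ suc (C μ p)
  rim-C-≤1 λ′ μ rim p = ℕₚ.≮⇒≥ λ lt → let
      (c , ec , (1≤r , 1≤c , nd) , out) = skew-at λ′ μ p (ℕₚ.≤-trans (ℕₚ.n≤1+n _) lt)
      r = C λ′ p
      diag : + c - + r ≡ p
      diag = trans (cong (λ z → z - + r) ec) (((∀ a p → (a + p) - a ≡ p) ∋ solve-∀) (+ r) p)
      r′ = ℕ.pred r
      c′ = ℕ.pred c
      er : suc r′ ≡ r
      er = ℕₚ.suc-pred r {{ℕ.>-nonZero 1≤r}}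
      1≤r′ : 1 ℕ.≤ r′
      1≤r′ = ℕₚ.≤-pred (subst (2 ℕ.≤_) (sym er) (ℕₚ.≤-trans (s≤s (s≤s z≤n)) lt))
      2≤c : 2 ℕ.≤ c
      2≤c = ℤₚ.drop‿+≤+ (subst (+ 2 ≤_) (sym ec) (≤-lin (C-≥ μ p) (ℤ.+≤+ lt)
        (((∀ a b p → (a + p) - + 2 ≡ ((b + p) - 0ℤ) + (a - (1ℤ + (1ℤ + b)))) ∋ solve-∀) (+ r) (+ C μ p) p)))
      ecc : suc c′ ≡ c
      ecc = ℕₚ.suc-pred c {{ℕ.>-nonZero 1≤c}}
      1≤c′ : 1 ℕ.≤ c′
      1≤c′ = ℕₚ.≤-pred (subst (2 ℕ.≤_) (sym ecc) 2≤c)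
      diag′ : + c′ - + r′ ≡ p
      diag′ = trans (((∀ c r → c - r ≡ (1ℤ + c) - (1ℤ + r)) ∋ solve-∀) (+ c′) (+ r′))
          (trans (cong₂ (λ a b → + a - + b) ecc er) diag)
      nd′ : Node λ′ r′ c′
      nd′ = 1≤r′ , 1≤c′ , node-C λ′ r′ c′ 1≤r′ (subst (λ z → r′ ℕ.≤ C λ′ z) (sym diag′) (ℕₚ.pred[n]≤n {r}))
      out′ : ¬ Node μ r′ c′
      out′ = λ { (_ , _ , q) → ℕₚ.<-irrefl refl (ℕₚ.≤-trans (ℕₚ.≤-pred (subst (suc (suc (C μ p)) ℕ.≤_) (sym er) lt))
                 (subst (λ z → r′ ℕ.≤ C μ z) diag′ (C-node μ r′ c′ 1≤r′ q))) }
    in proj₂ (rim r′ c′ (nd′ , out′)) (s≤s z≤n , s≤s z≤n , subst₂ (λ a b → a ℕ.≤ part λ′ b) (sym ecc) (sym er) nd)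

opaque
  remove⇒moved : ∀ s λ′ μ → 1 ℕ.≤ s → RemoveRimHook s λ′ μ → Moved s λ′ μ
  remove⇒moved s λ′ μ 1≤s (sub , sz , rim , conn) = run-moved s λ′ μ (proj₁ found) 1≤s (proj₂ found)
    where
    e : ℤ → ℤ
    e p = + C λ′ p - + C μ p
    C-≤ : ∀ p → C μ p ℕ.≤ C λ′ p
    C-≤ = contained-C-≤ λ′ μ sub
    C-≤1 : ∀ p → C λ′ p ℕ.≤ suc (C μ p)
    C-≤1 = rim-C-≤1 λ′ μ rim
    e-01 : Is01 e
    e-01 p with ℕₚ.m≤n⇒m<n∨m≡n (C-≤ p)
    ... | inj₂ q rewrite q = inj₁ (ℤₚ.+-inverseʳ (+ C λ′ p))
    ... | inj₁ q rewrite ℕₚ.≤-antisym (C-≤1 p) q = inj₂ (((∀ a → (1ℤ + a) - a ≡ 1ℤ) ∋ solve-∀) (+ C μ p))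
    hs-e : HasSum e (+ s)
    hs-e = hs-val (trans (cong (λ z → + z - + size μ) sz) (((∀ a s → (a + s) - a ≡ s) ∋ solve-∀) (+ size μ) (+ s)))
        (hs-C-diff λ′ μ)
    e⇒lt : ∀ p → e p ≡ 1ℤ → C μ p ℕ.< C λ′ p
    e⇒lt p q = ℤₚ.drop‿+≤+ (≤-by 0ℤ ≤-refl
        (trans (((∀ a b → a - (1ℤ + b) ≡ (a - b) - 1ℤ) ∋ solve-∀) (+ C λ′ p) (+ C μ p)) (cong (_- 1ℤ) q)))
    lt⇒e : ∀ p → C μ p ℕ.< C λ′ p → e p ≡ 1ℤ
    lt⇒e p lt = 01-≢0 e-01 p λ z → ℕₚ.<-irrefl (sym (ℤₚ.+-injective (ℤₚ.i-j≡0⇒i≡j (+ C λ′ p) (+ C μ p) z))) lt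
    interval : ∀ p q p′ → e p ≡ 1ℤ → e p′ ≡ 1ℤ → p ≤ q → q ≤ p′ → e q ≡ 1ℤ
    interval p q p′ ep ep′ p≤q q≤p′ = between
        (path-through q (conn (C λ′ p) (proj₁ sk) (C λ′ p′) (proj₁ sk′) (proj₂ (proj₂ sk)) (proj₂ (proj₂ sk′)))
        (subst (_≤ q) (sym (dg p (proj₁ sk) (proj₁ (proj₂ sk)))) p≤q)
            (subst (q ≤_) (sym (dg p′ (proj₁ sk′) (proj₁ (proj₂ sk′)))) q≤p′))
      where
      dg : ∀ p c → + c ≡ + C λ′ p + p → + c - + C λ′ p ≡ p
      dg p c ec = trans (cong (λ z → z - + C λ′ p) ec) (((∀ a p → (a + p) - a ≡ p) ∋ solve-∀) (+ C λ′ p) p)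
      sk : ∃[ c ] (+ c ≡ + C λ′ p + p × Skew λ′ μ (C λ′ p) c)
      sk = skew-at λ′ μ p (e⇒lt p ep)
      sk′ : ∃[ c ] (+ c ≡ + C λ′ p′ + p′ × Skew λ′ μ (C λ′ p′) c)
      sk′ = skew-at λ′ μ p′ (e⇒lt p′ ep′)
      between : ∃[ r ] ∃[ c ] (Skew λ′ μ r c × + c - + r ≡ q) → e q ≡ 1ℤ
      between (r , c , sk″ , refl) = lt⇒e q (ℕₚ.≤-trans (proj₁ (skew-C λ′ μ r c sk″)) (proj₂ (skew-C λ′ μ r c sk″)))
    found : ∃[ x ] (∀ p → e p ≡ run s x p)
    found = interval-run e s e-01 1≤s hs-e interval

-- Partitions from bead configurations

cons⁺ : ℕ → List ℕ → List ℕ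
cons⁺ zero    xs = xs
cons⁺ (suc n) xs = suc n ∷ xs

nth-cons⁺ : ∀ n xs → (∀ r → nth xs r ℕ.≤ n) → ∀ r → nth (cons⁺ n xs) (suc r) ≡ nth xs r × nth (cons⁺ n xs) 0 ≡ n
nth-cons⁺ zero    xs h r = trans (ℕₚ.n≤0⇒n≡0 (h (suc r))) (sym (ℕₚ.n≤0⇒n≡0 (h r))) , ℕₚ.n≤0⇒n≡0 (h 0)
nth-cons⁺ (suc n) xs h r = refl , refl

cons⁺-positive : ∀ n {xs} → All (0 ℕ.<_) xs → All (0 ℕ.<_) (cons⁺ n xs)
cons⁺-positive zero    ps = ps
cons⁺-positive (suc n) ps = s≤s z≤n ∷ ps

cons⁺-linked : ∀ n {xs} → nth xs 0 ℕ.≤ n → Linked ℕ._≥_ xs → Linked ℕ._≥_ (cons⁺ n xs)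
cons⁺-linked zero    h l = l
cons⁺-linked (suc n) {[]}     h l = [-]
cons⁺-linked (suc n) {x ∷ xs} h l = h ∷ l

nth-≤nth0 : ∀ {xs} → Linked ℕ._≥_ xs → ∀ r → nth xs r ℕ.≤ nth xs 0
nth-≤nth0 l zero    = ℕₚ.≤-refl
nth-≤nth0 l (suc r) = ℕₚ.≤-trans (nth-anti l r) (nth-≤nth0 l r)

seg : (ℤ → ℤ) → ℤ → ℕ → ℤ
seg f a zero    = 0ℤ
seg f a (suc n) = seg f a n + f (a + + n)

seg-front : ∀ f a n → seg f a (suc n) ≡ f a + seg f (a + 1ℤ) n
seg-front f a zero = trans (+-identityˡ _) (trans (cong f (+-identityʳ a)) (sym (+-identityʳ _)))
seg-front f a (suc n) = trans (cong₂ _+_ (seg-front f a n) (cong f (sym (ℤₚ.+-assoc a 1ℤ (+ n)))))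
  (ℤₚ.+-assoc (f a) (seg f (a + 1ℤ) n) (f (a + 1ℤ + + n)))

seg-W : ∀ f M → seg f (- (+ M)) (M ℕ.+ M) ≡ W M f
seg-W f zero    = refl
seg-W f (suc M) = trans (cong (λ n → seg f -[1+ M ] (suc n)) (ℕₚ.+-suc M M))
  (trans (seg-front f -[1+ M ] (suc (M ℕ.+ M)))
  (trans (cong (λ z → f -[1+ M ] + z)
      (trans (cong (λ a → seg f a (suc (M ℕ.+ M))) (((∀ m → - (1ℤ + m) + 1ℤ ≡ - m) ∋ solve-∀) (+ M)))
     (cong₂ _+_ (seg-W f M) (cong f (((∀ m → - m + (m + m) ≡ m) ∋ solve-∀) (+ M))))))
   (((∀ a b c → a + (b + c) ≡ b + (c + a)) ∋ solve-∀) (f -[1+ M ]) (W M f) (f (+ M)))))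

W-vac : ∀ M → W M vac ≡ + M
W-vac zero    = refl
W-vac (suc M) = trans (cong (_+ 1ℤ) (W-vac M)) (cong +_ (ℕₚ.+-comm M 1))

module FromBeads (f : ℤ → ℤ) (f01 : Is01 f) (N : ℕ) (low : ∀ n → N ℕ.≤ n → f -[1+ n ] ≡ 1ℤ) where

  bead? : ∀ i → Dec (f (- (+ N) + + i) ≡ 1ℤ)
  bead? i = f (- (+ N) + + i) ≟ 1ℤ

  gaps : ℕ → ℕ
  gaps zero    = 0
  gaps (suc i) with bead? i
  ... | yes _ = gaps i
  ... | no  _ = suc (gaps i)

  -- The part belonging to a bead is the number of gaps below it.
  rows : ℕ → List ℕ
  rows zero    = []
  rows (suc i) with bead? i
  ... | yes _ = cons⁺ (gaps i) (rows i)
  ... | no  _ = rows i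

  rows-good : ∀ i → Linked ℕ._≥_ (rows i) × All (0 ℕ.<_) (rows i) × (∀ r → nth (rows i) r ℕ.≤ gaps i)
  rows-good zero    = [] , [] , λ _ → z≤n
  rows-good (suc i) with bead? i | rows-good i
  ... | no  _ | l , p , h = l , p , λ r → ℕₚ.≤-trans (h r) (ℕₚ.n≤1+n _)
  ... | yes _ | l , p , h = l′ , cons⁺-positive (gaps i) p ,
      λ r → ℕₚ.≤-trans (nth-≤nth0 l′ r) (ℕₚ.≤-reflexive (proj₂ (nth-cons⁺ (gaps i) (rows i) h 0)))
    where l′ = cons⁺-linked (gaps i) (h 0) l

  gaps-seg : ∀ i → + gaps i ≡ + i - seg f (- (+ N)) i
  gaps-seg zero    = refl
  gaps-seg (suc i) with bead? i
  ... | yes e rewrite e = trans (gaps-seg i) (((∀ i s → i - s ≡ (1ℤ + i) - (s + 1ℤ)) ∋ solve-∀) (+ i)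
      (seg f (- (+ N)) i))
  ... | no ne with f01 (- (+ N) + + i)
  ...   | inj₁ e rewrite e = trans (cong (λ z → 1ℤ + z) (gaps-seg i))
      (((∀ i s → 1ℤ + (i - s) ≡ (1ℤ + i) - (s + 0ℤ)) ∋ solve-∀) (+ i) (seg f (- (+ N)) i))
  ...   | inj₂ e = ⊥-elim (ne e)

  -- After i positions the list describes the configuration up to a translation by
  -- `seg f (- N) i - N`. Charge zero means N beads in the whole window, and then the translation is
  -- zero.
  rows-bead : ∀ i r → f ((+ nth (rows i) r - + suc r) + (seg f (- (+ N)) i - + N)) ≡ 1ℤ
  rows-bead zero r = trans (cong f (((∀ r n → (0ℤ - (1ℤ + r)) + (0ℤ - n) ≡ - (1ℤ + (n + r))) ∋ solve-∀) (+ r) (+ N)))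
      (low (N ℕ.+ r) (ℕₚ.m≤m+n N r))
  rows-bead (suc i) r with bead? i
  ... | no ne with f01 (- (+ N) + + i)
  ...   | inj₁ e rewrite e = trans (cong (λ z → f ((+ nth (rows i) r - + suc r) + (z - + N)))
      (+-identityʳ (seg f (- (+ N)) i))) (rows-bead i r)
  ...   | inj₂ e = ⊥-elim (ne e)
  rows-bead (suc i) zero | yes e rewrite proj₂ (nth-cons⁺ (gaps i) (rows i) (proj₂ (proj₂ (rows-good i))) 0) =
    trans (cong f (trans (cong (λ z → (z - 1ℤ) + ((seg f (- (+ N)) i + f (- (+ N) + + i)) - + N)) (gaps-seg i))
        (trans (cong (λ z → ((+ i - seg f (- (+ N)) i) - 1ℤ) + ((seg f (- (+ N)) i + z) - + N)) e)
       (((∀ i s n → ((i - s) - 1ℤ) + ((s + 1ℤ) - n) ≡ - n + i) ∋ solve-∀) (+ i) (seg f (- (+ N)) i) (+ N))))) e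
  rows-bead (suc i) (suc r) | yes e rewrite proj₁ (nth-cons⁺ (gaps i) (rows i) (proj₂ (proj₂ (rows-good i))) r) =
    trans (cong f (trans (cong (λ z → (+ nth (rows i) r - + suc (suc r)) + ((seg f (- (+ N)) i + z) - + N)) e)
      (((∀ a r s n → (a - (1ℤ + r)) + ((s + 1ℤ) - n) ≡ (a - r) + (s - n)) ∋ solve-∀) (+ nth (rows i) r) (+ suc r)
          (seg f (- (+ N)) i) (+ N)))) (rows-bead i r)

fromBeads : ∀ f → Is01 f → HasSum (λ x → f x - vac x) 0ℤ → ∃[ λ′ ] (∀ x → I λ′ x ≡ f x)
fromBeads f f01 h@(hasSum N (hi , lo) e) = λ′ , λ x → sym (ℤₚ.i-j≡0⇒i≡j _ _ (diff≡0 x))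
  where
  low : ∀ n → N ℕ.≤ n → f -[1+ n ] ≡ 1ℤ
  low n p = ℤₚ.i-j≡0⇒i≡j _ _ (lo n p)
  open FromBeads f f01 N low
  λ′ : Partition
  λ′ = mkPartition (rows (N ℕ.+ N)) (proj₁ (rows-good (N ℕ.+ N))) (proj₁ (proj₂ (rows-good (N ℕ.+ N))))
  total : seg f (- (+ N)) (N ℕ.+ N) ≡ + N
  total = trans (seg-W f N) (trans (W-cong N (λ x → ((∀ a b → a ≡ (a - b) + b) ∋ solve-∀) (f x) (vac x)))
    (trans (W-+ N (λ x → f x - vac x) vac) (trans (cong₂ _+_ e (W-vac N)) (+-identityˡ _))))
  bead : ∀ x → x ∈B λ′ → f x ≡ 1ℤ
  bead x (suc r , _ , refl) = trans
      (cong f (sym (trans (cong (λ z → x + (z - + N)) total) (((∀ x n → x + (n - n) ≡ x) ∋ solve-∀) x (+ N)))))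
      (rows-bead (N ℕ.+ N) r)
  -- So far only the inclusion of the beta-set in f is known. It is an equality because the
  -- nonnegative differences sum to zero.
  hs-diff : HasSum (λ x → f x - I λ′ x) 0ℤ
  hs-diff = hs-cong (λ x → ((∀ a b v → (a - v) - (b - v) ≡ a - b) ∋ solve-∀) (f x) (I λ′ x) (vac x))
      (hs-∸ h (hs-charge λ′))
  nonneg : ∀ x → 0ℤ ≤ f x - I λ′ x
  nonneg x with I-01 λ′ x | f01 x
  ... | inj₂ q | _      rewrite q | bead x (I⇒∈B λ′ x q) = ≤-refl
  ... | inj₁ q | inj₁ r rewrite q | r = ≤-refl
  ... | inj₁ q | inj₂ r rewrite q | r = 0≤+n
  diff≡0 : ∀ x → f x - I λ′ x ≡ 0ℤ
  diff≡0 x = hs-zero x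
    where
    hs-zero : ∀ x → f x - I λ′ x ≡ 0ℤ
    hs-zero x with (f x - I λ′ x) ≟ 0ℤ
    ... | yes z = z
    ... | no nz = ⊥-elim (case (hs-1≤ hs-diff nonneg x (pos-1 (nonneg x) nz)))
      where
      case : ¬ (1ℤ ≤ 0ℤ)
      case (ℤ.+≤+ ())
      pos-1 : ∀ {z} → 0ℤ ≤ z → z ≢ 0ℤ → 1ℤ ≤ z
      pos-1 {+ zero}  _ n = ⊥-elim (n refl)
      pos-1 {+ suc k} _ _ = ℤ.+≤+ (s≤s z≤n)

symmetric-charge : ∀ f → Sym f → ∀ M → (∀ n → M ℕ.≤ n → f (+ n) ≡ 0ℤ) → HasSum (λ x → f x - vac x) 0ℤ
symmetric-charge f sf M hi = hasSum M
  ( (λ n p → trans (+-identityʳ _) (hi n p))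
  , (λ n p → trans (cong (_- 1ℤ) (sf′ n)) (trans (cong (λ z → (1ℤ - z) - 1ℤ) (hi n p)) refl)))
  (go M)
  where
  sf′ : ∀ n → f -[1+ n ] ≡ 1ℤ - f (+ n)
  sf′ n = trans (cong f (sym (bar-+ n))) (sf (+ n))
  go : ∀ M → W M (λ x → f x - vac x) ≡ 0ℤ
  go zero    = refl
  go (suc n) = cong₂ _+_ (go n) (trans (cong (λ z → (f (+ n) - 0ℤ) + (z - 1ℤ)) (sf′ n))
      (((∀ a → (a - 0ℤ) + ((1ℤ - a) - 1ℤ) ≡ 0ℤ) ∋ solve-∀) (f (+ n))))

opaque
  fromSym : ∀ f → Is01 f → Sym f → ∀ M → (∀ n → M ℕ.≤ n → f (+ n) ≡ 0ℤ) → ∃[ λ′ ] (∀ x → I λ′ x ≡ f x)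
  fromSym f f01 sf M hi = fromBeads f f01 (symmetric-charge f sf M hi)

-- Charges and cores

∣-≡ : ∀ {k a b} → a ≡ b → k ∣ a → k ∣ b
∣-≡ refl d = d

on : ℕ → ℤ → ℤ → ℤ
on s r x with + s ∣? x - r
... | yes _ = 1ℤ
... | no  _ = 0ℤ

on-yes : ∀ s r x → + s ∣ x - r → on s r x ≡ 1ℤ
on-yes s r x d with + s ∣? x - r
... | yes _ = refl
... | no ¬d = ⊥-elim (¬d d)

on-cong : ∀ s r a b → + s ∣ a - b → on s r a ≡ on s r b
on-cong s r a b d with + s ∣? a - r | + s ∣? b - r
... | yes _ | yes _ = refl
... | no  _ | no  _ = refl
... | yes p | no  q = ⊥-elim (q (∣-≡ (((∀ a b r → (a - r) - (a - b) ≡ b - r) ∋ solve-∀) a b r) (∣m∣n⇒∣m-n p d)))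
... | no  p | yes q = ⊥-elim (p (∣-≡ (((∀ a b r → (b - r) + (a - b) ≡ a - r) ∋ solve-∀) a b r) (∣m∣n⇒∣m+n q d)))

record ZeroCharge (s : ℕ) (f : ℤ → ℤ) : Set where
  constructor zeroCharge
  field class-sum : ∀ r → HasSum (λ x → on s r x * f x) 0ℤ
open ZeroCharge

zc-cong : ∀ {s f g} → (∀ x → f x ≡ g x) → ZeroCharge s f → ZeroCharge s g
zc-cong {s} e z = zeroCharge λ r → hs-cong (λ x → cong (on s r x *_) (e x)) (class-sum z r)

zc-+ : ∀ {s f g} → ZeroCharge s f → ZeroCharge s g → ZeroCharge s (λ x → f x + g x)
zc-+ {s} {f} {g} z w = zeroCharge λ r →
  hs-cong (λ x → sym (ℤₚ.*-distribˡ-+ (on s r x) (f x) (g x))) (hs-+ (class-sum z r) (class-sum w r))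

zc-neg : ∀ {s f} → ZeroCharge s f → ZeroCharge s (λ x → - f x)
zc-neg {s} {f} z = zeroCharge λ r → hs-cong (λ x → ℤₚ.neg-distribʳ-* (on s r x) (f x)) (hs-neg (class-sum z r))

zc-0 : ∀ {s} → ZeroCharge s (λ _ → 0ℤ)
zc-0 {s} = zeroCharge λ r → hs-cong (λ x → sym (ℤₚ.*-zeroʳ (on s r x))) hs-0

mul-δ : ∀ (g : ℤ → ℤ) a x → g a * δ a x ≡ g x * δ a x
mul-δ g a x with x ≟ a
... | yes refl = refl
... | no  _    = trans (ℤₚ.*-zeroʳ (g a)) (sym (ℤₚ.*-zeroʳ (g x)))

hs-mul-δ : ∀ (g : ℤ → ℤ) a → HasSum (λ x → g x * δ a x) (g a)
hs-mul-δ g a = hs-val (ℤₚ.*-identityʳ (g a)) (hs-cong (mul-δ g a) (hs-* (g a) (hs-δ a)))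

zc-δ : ∀ s a b → + s ∣ a - b → ZeroCharge s (λ x → δ a x - δ b x)
zc-δ s a b d = zeroCharge λ r → hs-cong (λ x → ((∀ o a b → o * a - o * b ≡ o * (a - b)) ∋ solve-∀) (on s r x) (δ a x)
    (δ b x))
  (hs-val (trans (cong (_- on s r b) (on-cong s r a b d)) (ℤₚ.+-inverseʳ (on s r b)))
    (hs-∸ (hs-mul-δ (on s r) a) (hs-mul-δ (on s r) b)))

Closed : ℕ → (ℤ → ℤ) → Set
Closed s f = ∀ x → f x ≡ 1ℤ → f (x - + s) ≡ 1ℤ

closed-mult : ∀ {s f} → Closed s f → ∀ k x → f x ≡ 1ℤ → f (x - + k * + s) ≡ 1ℤ
closed-mult {s} {f} c zero    x e = trans (cong f (+-identityʳ x)) e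
closed-mult {s} {f} c (suc k) x e =
  trans (cong f (((∀ x k s → x - (1ℤ + k) * s ≡ (x - k * s) - s) ∋ solve-∀) x (+ k) (+ s)))
      (c _ (closed-mult c k x e))

closed-∣ : ∀ {s f} → Closed s f → ∀ x y → + s ∣ x - y → y ≤ x → f x ≡ 1ℤ → f y ≡ 1ℤ
closed-∣ {s} {f} c x y (divides (+ k) e) y≤x fx =
  trans (cong f (trans (((∀ x y → y ≡ x - (x - y)) ∋ solve-∀) x y) (cong (λ z → x - z) e))) (closed-mult c k x fx)
closed-∣ {s} {f} c x y (divides -[1+ k ] e) y≤x fx = trans (cong f (ℤₚ.≤-antisym y≤x x≤y)) fx
  where
  x≤y : x ≤ y
  x≤y = ≤-by (+ suc k * + s) (0≤* {+ suc k} {+ s} 0≤+n 0≤+n)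
    (trans (((∀ x y → y - x ≡ - (x - y)) ∋ solve-∀) x y)
        (trans (cong -_ e) (((∀ k s → - (- k * s) ≡ k * s) ∋ solve-∀) (+ suc k) (+ s))))

1≰0 : ¬ (1ℤ ≤ 0ℤ)
1≰0 (ℤ.+≤+ ())

01-diff-≥0 : ∀ {a b} → a ≡ 1ℤ ⊎ b ≡ 0ℤ → a ≡ 0ℤ ⊎ a ≡ 1ℤ → b ≡ 0ℤ ⊎ b ≡ 1ℤ → 0ℤ ≤ a - b
01-diff-≥0 (inj₁ refl) _           (inj₁ refl) = 0≤+n
01-diff-≥0 (inj₁ refl) _           (inj₂ refl) = 0≤+n
01-diff-≥0 (inj₂ refl) (inj₁ refl) _           = 0≤+n
01-diff-≥0 (inj₂ refl) (inj₂ refl) _           = 0≤+n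

-- If x were a bead of f only, then in its class f would be full up to x and g empty above x. So f -
-- g would be nonnegative on the class and 1 at x, against charge zero.
core-⊆ : ∀ {s f g} → Is01 f → Is01 g → Closed s f → Closed s g → ZeroCharge s (λ x → f x - g x) → ∀ x → f x ≡ 1ℤ →
    g x ≡ 1ℤ
core-⊆ {s} {f} {g} f01 g01 cf cg z x fx with g01 x
... | inj₂ gx = gx
... | inj₁ gx = ⊥-elim (1≰0 (hs-1≤ (class-sum z x) nonneg x (≤-reflexive (sym at-x))))
  where
  at-x : on s x x * (f x - g x) ≡ 1ℤ
  at-x rewrite on-yes s x x (divides 0ℤ (ℤₚ.+-inverseʳ x)) | fx | gx = refl
  nonneg : ∀ y → 0ℤ ≤ on s x y * (f y - g y)
  nonneg y with + s ∣? y - x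
  ... | no _ = ≤-refl
  ... | yes d = subst (0ℤ ≤_) (sym (ℤₚ.*-identityˡ _)) (01-diff-≥0 side (f01 y) (g01 y))
    where
    side : f y ≡ 1ℤ ⊎ g y ≡ 0ℤ
    side with y ≤? x
    ... | yes y≤x = inj₁ (closed-∣ cf x y (∣-≡ (((∀ x y → - (y - x) ≡ x - y) ∋ solve-∀) x y) (∣m⇒∣-m d)) y≤x fx)
    ... | no  y≰x with g01 y
    ...   | inj₁ q = inj₂ q
    ...   | inj₂ q = ⊥-elim (0≢1 gx (closed-∣ cg y x d (ℤₚ.<⇒≤ (ℤₚ.≰⇒> y≰x)) q))

core-unique : ∀ {s f g} → Is01 f → Is01 g → Closed s f → Closed s g → ZeroCharge s (λ x → f x - g x) → ∀ x → f x ≡ g x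
core-unique {s} {f} {g} f01 g01 cf cg z x with f01 x | g01 x
... | inj₁ p | inj₁ q = trans p (sym q)
... | inj₂ p | inj₂ q = trans p (sym q)
... | inj₂ p | inj₁ q = ⊥-elim (0≢1 q (core-⊆ f01 g01 cf cg z x p))
... | inj₁ p | inj₂ q = ⊥-elim (0≢1 p
    (core-⊆ g01 f01 cg cf (zc-cong (λ x → ((∀ a b → - (a - b) ≡ b - a) ∋ solve-∀) (f x) (g x)) (zc-neg z)) x q))

-- Equality of s-cores without mention of hooks: the class numbers modulo s agree, and by
-- `core-unique` they determine the core.
record SEq (s : ℕ) (λ′ μ : Partition) : Set where
  constructor sameCharges
  field charges : ZeroCharge s (λ x → I λ′ x - I μ x)
open SEq

seq-refl : ∀ {s λ′} → SEq s λ′ λ′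
seq-refl {s} {λ′} = sameCharges $ zc-cong (λ x → sym (ℤₚ.+-inverseʳ (I λ′ x))) zc-0

seq-sym : ∀ {s λ′ μ} → SEq s λ′ μ → SEq s μ λ′
seq-sym {s} {λ′} {μ} z = sameCharges $ zc-cong (λ x → ((∀ a b → - (a - b) ≡ b - a) ∋ solve-∀) (I λ′ x) (I μ x))
    (zc-neg (charges z))

seq-trans : ∀ {s λ′ μ ν} → SEq s λ′ μ → SEq s μ ν → SEq s λ′ ν
seq-trans {s} {λ′} {μ} {ν} z w = sameCharges $ zc-cong (λ x → ((∀ a b c → (a - b) + (b - c) ≡ a - c) ∋ solve-∀)
    (I λ′ x) (I μ x) (I ν x)) (zc-+ (charges z) (charges w))

moved⇒seq : ∀ s λ′ μ → Moved s λ′ μ → SEq s λ′ μ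
moved⇒seq s λ′ μ (x , _ , _ , m) = sameCharges $ zc-cong
  (λ p → trans (((∀ i a b → a - b ≡ i - ((i - a) + b)) ∋ solve-∀) (I λ′ p) (δ x p) (δ (x - + s) p))
      (cong (λ z → I λ′ p - z) (sym (m p))))
  (zc-δ s x (x - + s) (divides 1ℤ (((∀ x s → x - (x - s) ≡ 1ℤ * s) ∋ solve-∀) x (+ s))))

opaque
  moveBead : ∀ λ′ x y → I λ′ x ≡ 1ℤ → I λ′ y ≡ 0ℤ → ∃[ μ ] (∀ p → I μ p ≡ (I λ′ p - δ x p) + δ y p)
  moveBead λ′ x y Ix Iy = fromBeads g g01
    (hs-cong (λ p → ((∀ i v a b → ((i - v) - a) + b ≡ ((i - a) + b) - v) ∋ solve-∀) (I λ′ p) (vac p) (δ x p) (δ y p))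
      (hs-+ (hs-∸ (hs-charge λ′) (hs-δ x)) (hs-δ y)))
    where
    g : ℤ → ℤ
    g p = (I λ′ p - δ x p) + δ y p
    g01 : Is01 g
    g01 p with p ≟ x | p ≟ y
    ... | yes refl | yes refl = ⊥-elim (0≢1 Iy Ix)
    ... | yes refl | no  _    rewrite Ix = inj₁ refl
    ... | no  _    | yes refl rewrite Iy = inj₂ refl
    ... | no  _    | no  _    with I-01 λ′ p
    ...   | inj₁ e rewrite e = inj₁ refl
    ...   | inj₂ e rewrite e = inj₂ refl

opaque
  hs-size-diff : ∀ λ′ μ → HasSum (λ x → x * (I λ′ x - I μ x)) (+ size λ′ - + size μ)
  hs-size-diff λ′ μ = hs-cong (λ x → ((∀ x a b v → x * (a - v) - x * (b - v) ≡ x * (a - b)) ∋ solve-∀) x (I λ′ x)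
      (I μ x) (vac x))
    (hs-∸ (hs-size λ′) (hs-size μ))

size-move : ∀ λ′ μ x y → (∀ p → I μ p ≡ (I λ′ p - δ x p) + δ y p) → + size μ ≡ (+ size λ′ + y) - x
size-move λ′ μ x y m = trans (((∀ a b → b ≡ a + (b - a)) ∋ solve-∀) (+ size λ′) (+ size μ))
  (trans (cong (λ z → + size λ′ + z) (hs-unique (hs-size-diff μ λ′)
     (hs-cong (λ p → trans (((∀ p i a b → p * b - p * a ≡ p * (((i - a) + b) - i)) ∋ solve-∀) p (I λ′ p) (δ x p)
         (δ y p)) (cong (λ z → p * (z - I λ′ p)) (sym (m p))))
       (hs-∸ (hs-mul-δ (λ p → p) y) (hs-mul-δ (λ p → p) x)))))
    (((∀ s x y → s + (y - x) ≡ (s + y) - x) ∋ solve-∀) (+ size λ′) x y))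

opaque
  I-bound : ∀ λ′ → ∃[ M ] ((∀ n → M ℕ.≤ n → I λ′ (+ n) ≡ 0ℤ) × (∀ n → M ℕ.≤ n → I λ′ -[1+ n ] ≡ 1ℤ))
  I-bound λ′ = HasSum.bound h , (λ n p → trans (sym (+-identityʳ (I λ′ (+ n)))) (proj₁ (HasSum.supp h) n p))
    , (λ n p → ℤₚ.i-j≡0⇒i≡j (I λ′ -[1+ n ]) 1ℤ (proj₂ (HasSum.supp h) n p))
    where
    h : HasSum (λ x → I λ′ x - vac x) 0ℤ
    h = hs-charge λ′

search : ∀ {P : ℤ → Set} → (∀ x → Dec (P x)) → ∀ M → ∃ P ⊎ (∀ n → n ℕ.< M → ¬ P (+ n) × ¬ P -[1+ n ])
search P? zero = inj₂ λ _ ()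
search {P} P? (suc M) with P? (+ M) | P? -[1+ M ] | search P? M
... | yes p | _     | _      = inj₁ (_ , p)
... | no  _ | yes p | _      = inj₁ (_ , p)
... | no  _ | no  _ | inj₁ r = inj₁ r
... | no  p | no  q | inj₂ r = inj₂ λ n n<M → go n n<M
  where
  go : ∀ n → n ℕ.< suc M → ¬ P (+ n) × ¬ P -[1+ n ]
  go n (s≤s n≤M) with ℕₚ.m≤n⇒m<n∨m≡n n≤M
  ... | inj₁ lt   = r n lt
  ... | inj₂ refl = p , q

opaque
  -- Above the bound M there are only gaps and below - M only beads, so a finite search decides.
  closed-or-inversion : ∀ s λ′ → Closed s (I λ′) ⊎ (∃[ x ] (I λ′ x ≡ 1ℤ × I λ′ (x - + s) ≡ 0ℤ))
  closed-or-inversion s λ′ with I-bound λ′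
  ... | M , hi , lo with search {λ x → I λ′ x ≡ 1ℤ × I λ′ (x - + s) ≡ 0ℤ} dec M
    where
    dec : ∀ x → Dec (I λ′ x ≡ 1ℤ × I λ′ (x - + s) ≡ 0ℤ)
    dec x with I λ′ x ≟ 1ℤ | I λ′ (x - + s) ≟ 0ℤ
    ... | yes p | yes q = yes (p , q)
    ... | no  p | _     = no (λ r → p (proj₁ r))
    ... | _     | no  q = no (λ r → q (proj₂ r))
  ...   | inj₁ r = inj₂ r
  ...   | inj₂ r = inj₁ closed
    where
    decide : ∀ x → ¬ (I λ′ x ≡ 1ℤ × I λ′ (x - + s) ≡ 0ℤ) → I λ′ x ≡ 1ℤ → I λ′ (x - + s) ≡ 1ℤ
    decide x n p = 01-≢0 (I-01 λ′) (x - + s) λ q → n (p , q)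
    closed : Closed s (I λ′)
    closed (+ n) e with n ℕ.<? M
    ... | yes p = decide (+ n) (proj₁ (r n p)) e
    ... | no  p = ⊥-elim (0≢1 (hi n (ℕₚ.≮⇒≥ p)) e)
    closed -[1+ n ] e with n ℕ.<? M
    ... | yes p = decide -[1+ n ] (proj₂ (r n p)) e
    ... | no  p = trans (cong (I λ′) (((∀ n s → - (1ℤ + n) - s ≡ - (1ℤ + (n + s))) ∋ solve-∀) (+ n) (+ s)))
                    (lo (n ℕ.+ s) (ℕₚ.≤-trans (ℕₚ.≮⇒≥ p) (ℕₚ.m≤m+n n s)))

opaque
  isCore⇒closed : ∀ s λ′ → IsCore s λ′ → Closed s (I λ′)
  isCore⇒closed s λ′ c with closed-or-inversion s λ′
  ... | inj₁ q = q
  ... | inj₂ (x , p , q) with moveBead λ′ x (x - + s) p q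
  ...   | μ , m = ⊥-elim (c (μ , moved⇒remove s λ′ μ (x , p , q , m)))

closed⇒isCore : ∀ s λ′ → 1 ℕ.≤ s → Closed s (I λ′) → IsCore s λ′
closed⇒isCore s λ′ 1≤s c (μ , r) with remove⇒moved s λ′ μ 1≤s r
... | x , p , q , _ = 0≢1 q (c x p)

star⇒seq : ∀ s {λ′ κ} → 1 ℕ.≤ s → Star (RemoveRimHook s) λ′ κ → SEq s λ′ κ
star⇒seq s {λ′} 1≤s ε = seq-refl
star⇒seq s {λ′} {κ} 1≤s (_◅_ {j = μ} r rs) =
  seq-trans (moved⇒seq s λ′ μ (remove⇒moved s λ′ μ 1≤s r)) (star⇒seq s 1≤s rs)

star-size : ∀ s {λ′ κ} → Star (RemoveRimHook s) λ′ κ → size κ ℕ.≤ size λ′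
star-size s ε = ℕₚ.≤-refl
star-size s {λ′} (_◅_ {j = μ} (_ , e , _) rs) = ℕₚ.≤-trans (star-size s rs)
    (subst (size μ ℕ.≤_) (sym e) (ℕₚ.m≤m+n (size μ) s))

star-size-≡ : ∀ s {λ′ κ} → 1 ℕ.≤ s → Star (RemoveRimHook s) λ′ κ → size λ′ ≡ size κ → λ′ ≡ κ
star-size-≡ s 1≤s ε e = refl
star-size-≡ s {λ′} {κ} 1≤s (_◅_ {j = μ} (_ , e , _) rs) e′ = ⊥-elim (ℕₚ.<-irrefl refl
  (ℕₚ.≤-trans (ℕₚ.≤-trans (ℕₚ.≤-reflexive (ℕₚ.+-comm 1 (size μ))) (ℕₚ.+-monoʳ-≤ (size μ) 1≤s))
    (ℕₚ.≤-trans (ℕₚ.≤-reflexive (trans (sym e) e′)) (star-size s rs))))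

opaque
  -- Inversions are removed as long as there are any, each lowering the size. The closed set reached
  -- has the class numbers of κ and so is κ.
  seq⇒coreOf : ∀ s λ′ κ → 1 ℕ.≤ s → SEq s λ′ κ → Closed s (I κ) → CoreOf s λ′ κ
  seq⇒coreOf s λ′ κ 1≤s z c = go λ′ (<-wellFounded (size λ′)) z , closed⇒isCore s κ 1≤s c
    where
    go : ∀ λ′ → Acc ℕ._<_ (size λ′) → SEq s λ′ κ → Star (RemoveRimHook s) λ′ κ
    go λ′ (acc rec) z with closed-or-inversion s λ′
    ... | inj₁ cl = subst (Star (RemoveRimHook s) λ′) (I-inj (core-unique {s} (I-01 λ′) (I-01 κ) cl c (charges z))) ε
    ... | inj₂ (x , p , q) with moveBead λ′ x (x - + s) p q
    ...   | μ , m = rm ◅ go μ (rec lt) (seq-trans (seq-sym (moved⇒seq s λ′ μ (x , p , q , m))) z)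
      where
      rm : RemoveRimHook s λ′ μ
      rm = moved⇒remove s λ′ μ (x , p , q , m)
      lt : size μ ℕ.< size λ′
      lt = subst (size μ ℕ.<_) (sym (proj₁ (proj₂ rm)))
          (ℕₚ.≤-trans (ℕₚ.≤-reflexive (ℕₚ.+-comm 1 (size μ))) (ℕₚ.+-monoʳ-≤ (size μ) 1≤s))

coreOf⇒seq : ∀ s λ′ κ → 1 ℕ.≤ s → CoreOf s λ′ κ → SEq s λ′ κ
coreOf⇒seq s λ′ κ 1≤s (st , _) = star⇒seq s 1≤s st

-- With `seq-size-≡`: the core is the only partition of smallest size among those with its class
-- numbers. The uniqueness proofs draw their inequalities from this.
seq-size-≤ : ∀ s λ′ κ → 1 ℕ.≤ s → SEq s λ′ κ → Closed s (I κ) → size κ ℕ.≤ size λ′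
seq-size-≤ s λ′ κ 1≤s z c = star-size s (proj₁ (seq⇒coreOf s λ′ κ 1≤s z c))

seq-size-≡ : ∀ s λ′ κ → 1 ℕ.≤ s → SEq s λ′ κ → Closed s (I κ) → size λ′ ≡ size κ → λ′ ≡ κ
seq-size-≡ s λ′ κ 1≤s z c = star-size-≡ s 1≤s (proj₁ (seq⇒coreOf s λ′ κ 1≤s z c))

-- Flipping beads of self-conjugate partitions

-- A self-conjugate partition has size Σ H x over the elements x ≥ 0 of its beta-set.
H : ℤ → ℤ
H x = x + x + 1ℤ

H-bar : ∀ x → H (bar x) ≡ - H x
H-bar = (∀ x → (-1ℤ - x) + (-1ℤ - x) + 1ℤ ≡ - (x + x + 1ℤ)) ∋ solve-∀

bar-inj : ∀ {x y} → bar x ≡ bar y → x ≡ y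
bar-inj {x} {y} e = trans (sym (bar-bar x)) (trans (cong bar e) (bar-bar y))

δ-bar : ∀ z p → δ z (bar p) ≡ δ (bar z) p
δ-bar z p = δ-inj (λ e → trans (sym (bar-bar p)) (cong bar e)) (λ e → trans (cong bar e) (bar-bar z))

fl : ℤ → ℤ → ℤ
fl z p = δ z p - δ (bar z) p

fl-bar : ∀ z p → fl (bar z) p ≡ - fl z p
fl-bar z p = trans (cong (λ w → δ (bar z) p - δ w p) (bar-bar z))
    (((∀ a b → a - b ≡ - (b - a)) ∋ solve-∀) (δ (bar z) p) (δ z p))

fl-0 : ∀ {z p} → p ≢ z → p ≢ bar z → fl z p ≡ 0ℤ
fl-0 a b = cong₂ _-_ (δ-≢ a) (δ-≢ b)

-- `H z` is `z - bar z`, so the divisibility puts both ends of the flip in one class.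
zc-fl : ∀ s z → + s ∣ H z → ZeroCharge s (fl z)
zc-fl s z d = zc-δ s z (bar z) (∣-≡ (((∀ z → z + z + 1ℤ ≡ z - (-1ℤ - z)) ∋ solve-∀) z) d)

zc-fl₂ : ∀ s z w → + s ∣ z - w → ZeroCharge s (λ p → fl z p - fl w p)
zc-fl₂ s z w d = zc-cong (λ p → ((∀ a b c d → (a - b) + (c - d) ≡ (a - d) - (b - c)) ∋ solve-∀) (δ z p) (δ w p)
    (δ (bar w) p) (δ (bar z) p))
  (zc-+ (zc-δ s z w d) (zc-δ s (bar w) (bar z) (∣-≡ (((∀ z w → z - w ≡ (-1ℤ - w) - (-1ℤ - z)) ∋ solve-∀) z w) d)))

flips : List ℤ → ℤ → ℤ
flips []       p = 0ℤ
flips (z ∷ zs) p = fl z p + flips zs p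

ΣH : List ℤ → ℤ
ΣH []       = 0ℤ
ΣH (z ∷ zs) = H z + ΣH zs

Gap : Partition → ℤ → Set
Gap λ′ z = I λ′ z ≡ 0ℤ

sym-gap : ∀ λ′ → Sym (I λ′) → ∀ {z} → I λ′ z ≡ 0ℤ → I λ′ (bar z) ≡ 1ℤ
sym-gap λ′ sy {z} e = trans (sy z) (cong (λ w → 1ℤ - w) e)

sym-bead : ∀ λ′ → Sym (I λ′) → ∀ {z} → I λ′ z ≡ 1ℤ → I λ′ (bar z) ≡ 0ℤ
sym-bead λ′ sy {z} e = trans (sy z) (cong (λ w → 1ℤ - w) e)

gap≢bar : ∀ λ′ → Sym (I λ′) → ∀ {z w} → Gap λ′ z → Gap λ′ w → z ≢ bar w
gap≢bar λ′ sy gz gw refl = 0≢1 gz (sym-gap λ′ sy gw)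

-- The mirror image of a gap is a bead, so among gaps p can never equal a `bar z`. This is why plain
-- distinctness of the gaps suffices for flipping all of them.
flips-0 : ∀ λ′ → Sym (I λ′) → ∀ {p} zs → Gap λ′ p → All (p ≢_) zs → All (Gap λ′) zs → flips zs p ≡ 0ℤ
flips-0 λ′ sy []       gp []       []       = refl
flips-0 λ′ sy (z ∷ zs) gp (n ∷ ns) (g ∷ gs) = cong₂ _+_ (fl-0 n (gap≢bar λ′ sy gp g)) (flips-0 λ′ sy zs gp ns gs)

-- A flip moves the bead at `bar z` to the gap z. Seen as a set of odd numbers, the partition gains
-- `H z` if z ≥ 0 and loses `- H z` if z < 0.
record Flipped (λ′ : Partition) (zs : List ℤ) : Set where
  field
    result    : Partition
    symmetric : Sym (I result)
    beads     : ∀ p → I result p ≡ I λ′ p + flips zs p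
    sizes     : + size result ≡ + size λ′ + ΣH zs
open Flipped

opaque
  flipAll : ∀ λ′ → Sym (I λ′) → ∀ zs → All (Gap λ′) zs → AllPairs _≢_ zs → Flipped λ′ zs
  flipAll λ′ sy [] [] [] = record
    { result = λ′ ; symmetric = sy ; beads = λ p → sym (+-identityʳ _) ; sizes = sym (+-identityʳ _) }
  flipAll λ′ sy (z ∷ zs) (g ∷ gs) (n ∷ ns) = record
    { result = proj₁ moved ; symmetric = sym′ ; beads = beads′ ; sizes = sizes′ }
    where
    rest : Flipped λ′ zs
    rest = flipAll λ′ sy zs gs ns
    μ : Partition
    μ = result rest
    gap-z : I μ z ≡ 0ℤ
    gap-z = trans (beads rest z) (cong₂ _+_ g (flips-0 λ′ sy zs g n gs))
    moved : ∃[ ν ] (∀ p → I ν p ≡ (I μ p - δ (bar z) p) + δ z p)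
    moved = moveBead μ (bar z) z (sym-gap μ (symmetric rest) gap-z) gap-z
    I-eq : ∀ p → I (proj₁ moved) p ≡ I μ p + fl z p
    I-eq p = trans (proj₂ moved p) (((∀ i a b → (i - b) + a ≡ i + (a - b)) ∋ solve-∀) (I μ p) (δ z p) (δ (bar z) p))
    beads′ : ∀ p → I (proj₁ moved) p ≡ I λ′ p + (fl z p + flips zs p)
    beads′ p = trans (I-eq p) (trans (cong (_+ fl z p) (beads rest p))
        (((∀ i a b → (i + b) + a ≡ i + (a + b)) ∋ solve-∀) (I λ′ p) (fl z p) (flips zs p)))
    sym′ : Sym (I (proj₁ moved))
    sym′ p = trans (I-eq (bar p)) (trans (cong₂ _+_ (symmetric rest p)
        (trans (cong₂ _-_ (δ-bar z p) (trans (δ-bar (bar z) p) (cong (λ w → δ w p) (bar-bar z))))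
            (((∀ a b → a - b ≡ - (b - a)) ∋ solve-∀) (δ (bar z) p) (δ z p))))
      (trans (((∀ i f → (1ℤ - i) + - f ≡ 1ℤ - (i + f)) ∋ solve-∀) (I μ p) (fl z p))
          (cong (λ w → 1ℤ - w) (sym (I-eq p)))))
    sizes′ : + size (proj₁ moved) ≡ + size λ′ + (H z + ΣH zs)
    sizes′ = trans (size-move μ (proj₁ moved) (bar z) z (proj₂ moved))
      (trans (cong (λ w → (w + z) - bar z) (sizes rest))
          (((∀ s t z → ((s + t) + z) - (-1ℤ - z) ≡ s + ((z + z + 1ℤ) + t)) ∋ solve-∀) (+ size λ′) (ΣH zs) z))

flipped-seq : ∀ {s λ′ zs} (F : Flipped λ′ zs) → ZeroCharge s (flips zs) → SEq s (result F) λ′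
flipped-seq {s} {λ′} {zs} F z = sameCharges (zc-cong
  (λ p → trans (((∀ i f → f ≡ (i + f) - i) ∋ solve-∀) (I λ′ p) (flips zs p)) (cong (_- I λ′ p) (sym (beads F p)))) z)

-- Choosing positions by counting in a residue class

count : List ℤ → ℤ → ℤ
count []       p = 0ℤ
count (z ∷ zs) p = δ z p + count zs p

hs-count : ∀ zs → HasSum (count zs) (+ length zs)
hs-count []       = hs-0
hs-count (z ∷ zs) = hs-+ (hs-δ z) (hs-count zs)

count-≥0 : ∀ zs p → 0ℤ ≤ count zs p
count-≥0 []       p = ≤-refl
count-≥0 (z ∷ zs) p = 0≤+ (δ-≥0 z p) (count-≥0 zs p)

count-∉ : ∀ {p} zs → All (p ≢_) zs → count zs p ≡ 0ℤ
count-∉ []       []       = refl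
count-∉ (z ∷ zs) (n ∷ ns) = cong₂ _+_ (δ-≢ n) (count-∉ zs ns)

all≢? : ∀ p zs → All (p ≢_) zs ⊎ 1ℤ ≤ count zs p
all≢? p [] = inj₁ []
all≢? p (z ∷ zs) with p ≟ z | all≢? p zs
... | yes refl | _      = inj₂ (≤-lin₁ (count-≥0 zs p) (((∀ c → (1ℤ + c) - 1ℤ ≡ c - 0ℤ) ∋ solve-∀) (count zs p)))
... | no  n    | inj₁ q = inj₁ (n ∷ q)
... | no  n    | inj₂ q = inj₂ (subst (1ℤ ≤_) (sym (+-identityˡ _)) q)

count-01 : ∀ {g : ℤ → ℤ} xs → AllPairs _≢_ xs → All (λ x → g x ≡ -1ℤ) xs → ∀ p → count xs p ≡ 0ℤ ⊎
    (count xs p ≡ 1ℤ × g p ≡ -1ℤ)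
count-01 []       []       []       p = inj₁ refl
count-01 (x ∷ xs) (n ∷ ns) (e ∷ es) p with p ≟ x
... | yes refl = inj₂ (cong (λ z → 1ℤ + z) (count-∉ xs n) , e)
... | no  _ with count-01 xs ns es p
...   | inj₁ q       = inj₁ (trans (+-identityˡ _) q)
...   | inj₂ (q , r) = inj₂ (trans (+-identityˡ _) q , r)

opaque
  -- A weighted pigeonhole principle. Adding 1 on `xs` cancels the values - 1 there, and subtracting
  -- 1 on `ys` outweighs any value there. The total stays positive, so some positive value survives
  -- outside `ys`.
  pick : ∀ {g v} → HasSum g v → (∀ p → g p ≤ 1ℤ) → ∀ xs ys → AllPairs _≢_ xs → All (λ x → g x ≡ -1ℤ) xs →
    1ℤ + + length ys ≤ v + + length xs → ∃[ y ] (1ℤ ≤ g y × All (y ≢_) ys)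
  pick {g} {v} h g≤1 xs ys nx gx len
    with hs-pos (hs-∸ (hs-+ h (hs-count xs)) (hs-count ys))
        (λ q → 1+≰ {a = + length ys} (≤-trans len
        (≤-lin₁ q (((∀ a l → l - a ≡ 0ℤ - (a - l)) ∋ solve-∀) (v + + length xs) (+ length ys)))))
  ... | y , pos-y with all≢? y ys | count-01 {g} xs nx gx y
  ...   | inj₂ q | inj₁ e = ⊥-elim (pos-y (subst (λ w → (g y + w) - count ys y ≤ 0ℤ) (sym e)
            (≤-lin (g≤1 y) q (((∀ a b → 0ℤ - ((a + 0ℤ) - b) ≡ (1ℤ - a) + (b - 1ℤ)) ∋ solve-∀) (g y) (count ys y)))))
  ...   | inj₁ n | inj₁ e = y , ≰⇒1+≤
      (λ q → pos-y (≤-trans (≤-reflexive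
      (trans (cong₂ (λ a b → (g y + a) - b) e (count-∉ ys n)) (((∀ a → (a + 0ℤ) - 0ℤ ≡ a) ∋ solve-∀) (g y)))) q)) , n
  ...   | _      | inj₂ (e , e′) = ⊥-elim (pos-y (subst₂ (λ a b → (a + b) - count ys y ≤ 0ℤ) (sym e′) (sym e)
            (≤-lin₁ (count-≥0 ys y) (((∀ b → 0ℤ - ((-1ℤ + 1ℤ) - b) ≡ b - 0ℤ) ∋ solve-∀) (count ys y)))))

vac-shift : ∀ c → HasSum (λ y → vac (y - + c) - vac y) (+ c)
vac-shift zero    = hs-cong (λ y → sym (trans (cong (λ w → vac w - vac y) (+-identityʳ y)) (ℤₚ.+-inverseʳ (vac y))))
    hs-0
vac-shift (suc c) = hs-val (cong +_ (ℕₚ.+-comm c 1)) (hs-cong split (hs-+ (vac-shift c) (hs-shift (- (+ c)) one)))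
  where
  pt : ∀ y → δ 0ℤ y ≡ vac (y - 1ℤ) - vac y
  pt (+ zero)  = refl
  pt (+ suc n) = refl
  pt -[1+ n ]  = refl
  one : HasSum (λ y → vac (y - 1ℤ) - vac y) 1ℤ
  one = hs-cong pt (hs-δ 0ℤ)
  split : ∀ y → (vac (y - + c) - vac y) + (vac (y - + c - 1ℤ) - vac (y - + c)) ≡ vac (y - + suc c) - vac y
  split y = trans (((∀ a b c → (a - b) + (c - a) ≡ c - b) ∋ solve-∀) (vac (y - + c)) (vac y) (vac (y - + c - 1ℤ)))
    (cong (λ w → vac w - vac y) (((∀ y c → (y - c) - 1ℤ ≡ y - (1ℤ + c)) ∋ solve-∀) y (+ c)))

opaque
  hs-self-shift : ∀ λ′ c → HasSum (λ y → I λ′ (y - + c) - I λ′ y) (+ c)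
  hs-self-shift λ′ c = hs-val (+-identityˡ _) (hs-cong
    (λ y → ((∀ a b v w → ((a - v) - (b - w)) + (v - w) ≡ a - b) ∋ solve-∀) (I λ′ (y - + c)) (I λ′ y) (vac (y - + c))
        (vac y))
    (hs-+ (hs-∸ (hs-shift (- (+ c)) (hs-charge λ′)) (hs-charge λ′)) (vac-shift c)))

-- Summed over y it counts, in the class of x modulo t, the reversed pairs minus the inversions at
-- distance c.
rowDiff : ℕ → Partition → ℕ → ℤ → ℤ → ℤ
rowDiff t λ′ c x y = on t x y * (I λ′ (y - + c) - I λ′ y)

opaque
  -- Passing from λ to τ changes the sum by the charges of `I λ′ - I τ` on the classes of x - c and
  -- of x, and both charges vanish.
  rowDiff-core : ∀ {t λ′ τ} → SEq t λ′ τ → ∀ c x → ∃[ v ] (HasSum (rowDiff t λ′ c x) v × HasSum (rowDiff t τ c x) v)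
  rowDiff-core {t} {λ′} {τ} sq c x with hs-mul (on t x) (hs-self-shift λ′ c)
  ... | v , h = v , h , hs-val (((∀ v → v - (0ℤ - 0ℤ) ≡ v) ∋ solve-∀) v)
    (hs-cong (λ y → ((∀ o a b a′ b′ → o * (a - b) - (o * (a - a′) - o * (b - b′)) ≡ o * (a′ - b′)) ∋ solve-∀)
       (on t x y) (I λ′ (y - + c)) (I λ′ y) (I τ (y - + c)) (I τ y))
     (hs-∸ h (hs-∸ shifted (ZeroCharge.class-sum (SEq.charges sq) x))))
    where
    shifted : HasSum (λ y → on t x y * (I λ′ (y - + c) - I τ (y - + c))) 0ℤ
    shifted = hs-cong (λ y → cong (_* (I λ′ (y - + c) - I τ (y - + c))) (on-shift y))
        (hs-shift (- (+ c)) (ZeroCharge.class-sum (SEq.charges sq) (x - + c)))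
      where
      on-shift : ∀ y → on t (x - + c) (y - + c) ≡ on t x y
      on-shift y with + t ∣? (y - + c) - (x - + c) | + t ∣? y - x
      ... | yes _ | yes _ = refl
      ... | no  _ | no  _ = refl
      ... | yes p | no  q = ⊥-elim (q (∣-≡ (((∀ x y c → (y - c) - (x - c) ≡ y - x) ∋ solve-∀) x y (+ c)) p))
      ... | no  p | yes q = ⊥-elim (p (∣-≡ (((∀ x y c → y - x ≡ (y - c) - (x - c)) ∋ solve-∀) x y (+ c)) q))

opaque
  class-top : ∀ t κ r → 1 ℕ.≤ t → ∃[ z ] (+ t ∣ z - r × I κ z ≡ 1ℤ × I κ (z + + t) ≡ 0ℤ)
  class-top t κ r 1≤t with I-bound κ
  ... | M , hi , lo = from-top (search-top e (λ j → I-01 κ _) (K ℕ.+ K) (- (+ K)) at-low at-high)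
    where
    e : ℤ → ℤ
    e j = I κ (r + j * + t)
    -- Chosen so that r - K t lies where all positions are beads and r + K t where all are gaps.
    K : ℕ
    K = suc (ℤ.∣ r ∣ ℕ.+ M)
    KT-≥ : + K ≤ + K * + t
    KT-≥ = ≤-by (+ K * (+ t - 1ℤ)) (0≤* {+ K} 0≤+n (≤⇒0≤ (ℤ.+≤+ 1≤t)))
        (((∀ k t → k * t - k ≡ k * (t - 1ℤ)) ∋ solve-∀) (+ K) (+ t))
    big : ∀ y → + M ≤ y → I κ y ≡ 0ℤ
    big (+ n) (ℤ.+≤+ p) = hi n p
    small : ∀ y → y ≤ -[1+ M ] → I κ y ≡ 1ℤ
    small -[1+ n ] (ℤ.-≤- p) = lo n p
    r≤ : r ≤ + ℤ.∣ r ∣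
    r≤ = ≤abs r
      where
      ≤abs : ∀ r → r ≤ + ℤ.∣ r ∣
      ≤abs (+ n)    = ≤-refl
      ≤abs -[1+ n ] = ℤ.-≤+
    -r≤ : - r ≤ + ℤ.∣ r ∣
    -r≤ = neg≤ r
      where
      neg≤ : ∀ r → - r ≤ + ℤ.∣ r ∣
      neg≤ (+ zero)  = ≤-refl
      neg≤ (+ suc n) = ℤ.-≤+
      neg≤ -[1+ n ]  = ≤-refl
    at-low : e (- (+ K)) ≡ 1ℤ
    at-low = small _ (≤-lin r≤ KT-≥
      (((∀ r a m t → - (1ℤ + m) - (r + (- (1ℤ + (a + m))) * t) ≡ (a - r) + ((1ℤ + (a + m)) * t - (1ℤ + (a + m)))) ∋
          solve-∀) r (+ ℤ.∣ r ∣) (+ M) (+ t)))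
    at-high : e (- (+ K) + + (K ℕ.+ K)) ≡ 0ℤ
    at-high = trans (cong (λ j → I κ (r + j * + t)) (((∀ k → - k + (k + k) ≡ k) ∋ solve-∀) (+ K)))
      (big _ (≤-trans (≤-lin₁ {c = 0ℤ} {d = 1ℤ} 0≤+n (((∀ m → (1ℤ + m) - m ≡ 1ℤ - 0ℤ) ∋ solve-∀) (+ M)))
        (≤-lin -r≤ KT-≥ (((∀ r a m t → (r + (1ℤ + (a + m)) * t) - (1ℤ + m) ≡ (a - - r) +
            ((1ℤ + (a + m)) * t - (1ℤ + (a + m)))) ∋ solve-∀) r (+ ℤ.∣ r ∣) (+ M) (+ t)))))
    from-top : ∃[ j ] (e j ≡ 1ℤ × e (j + 1ℤ) ≡ 0ℤ) → ∃[ z ] (+ t ∣ z - r × I κ z ≡ 1ℤ × I κ (z + + t) ≡ 0ℤ)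
    from-top (j , p , q) = r + j * + t , divides j (((∀ r j t → (r + j * t) - r ≡ j * t) ∋ solve-∀) r j (+ t)) , p ,
      trans (cong (I κ) (((∀ r j t → (r + j * t) + t ≡ r + (j + 1ℤ) * t) ∋ solve-∀) r j (+ t))) q

-- Rectangles in a unique partition

∣-lin₁ : ∀ {t a z} m → t ∣ a → z ≡ m * a → t ∣ z
∣-lin₁ m d e = ∣-≡ (sym e) (∣n⇒∣m*n m d)

∣-lin : ∀ {t a b z} m n → t ∣ a → t ∣ b → z ≡ m * a + n * b → t ∣ z
∣-lin m n d d′ e = ∣-≡ (sym e) (∣m∣n⇒∣m+n (∣n⇒∣m*n m d) (∣n⇒∣m*n n d′))

cop-cancel : ∀ {s t} → Coprime s t → ∀ z → + t ∣ z * + s → + t ∣ z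
cop-cancel {s} {t} cop z d = ∣ᵤ⇒∣ (coprime-divisor (Coprimality.sym cop)
  (subst (t ℕᵈ.∣_) (trans (ℤₚ.abs-* z (+ s)) (ℕₚ.*-comm ℤ.∣ z ∣ s)) (∣⇒∣ᵤ d)))

cop-∣ : ∀ {s t} → Coprime s t → ∀ {z} → + s ∣ z → + t ∣ z → + s * + t ∣ z
cop-∣ {s} {t} cop (divides q refl) d with cop-cancel cop q d
... | divides p refl = divides p (((∀ p s t → (p * t) * s ≡ p * (s * t)) ∋ solve-∀) p (+ s) (+ t))

pos-mult-≥ : ∀ {s z} → + s ∣ z → 1ℤ ≤ z → + s ≤ z
pos-mult-≥ {s} (divides (+ zero) refl) p = ⊥-elim (1≰0 p)
pos-mult-≥ {s} (divides (+ suc k) refl) p = ≤-by (+ k * + s) (0≤* {+ k} {+ s} 0≤+n 0≤+n)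
    (((∀ k s → (1ℤ + k) * s - s ≡ k * s) ∋ solve-∀) (+ k) (+ s))
pos-mult-≥ {s} (divides -[1+ k ] refl) p = ⊥-elim
    (1≰0 (≤-trans p (≤-by (+ suc k * + s) (0≤* {+ suc k} {+ s} 0≤+n 0≤+n)
    (((∀ k s → 0ℤ - (- k * s) ≡ k * s) ∋ solve-∀) (+ suc k) (+ s)))))

even≢odd : ∀ a b → a + a ≢ b + b + 1ℤ
even≢odd a b e = case (a - b) (trans (((∀ a b → (a - b) + (a - b) ≡ (a + a) - (b + b)) ∋ solve-∀) a b)
    (trans (cong (_- (b + b)) e) (((∀ b → (b + b + 1ℤ) - (b + b) ≡ 1ℤ) ∋ solve-∀) b)))
  where
  case : ∀ z → z + z ≢ 1ℤ
  case (+ zero) ()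
  case (+ suc n) q with ℤₚ.+-injective q
  ... | q′ rewrite ℕₚ.+-suc n n with q′
  ...   | ()
  case -[1+ n ] ()

parity : ∀ z → (∃[ a ] z ≡ a + a) ⊎ (∃[ a ] z ≡ H a)
parity (+ zero)  = inj₁ (0ℤ , refl)
parity (+ suc n) with parity (+ n)
... | inj₁ (a , e) = inj₂ (a , trans (cong (λ w → 1ℤ + w) e) (((∀ a → 1ℤ + (a + a) ≡ a + a + 1ℤ) ∋ solve-∀) a))
... | inj₂ (a , e) = inj₁ (a + 1ℤ , trans (cong (λ w → 1ℤ + w) e)
    (((∀ a → 1ℤ + (a + a + 1ℤ) ≡ (a + 1ℤ) + (a + 1ℤ)) ∋ solve-∀) a))
parity -[1+ zero ]  = inj₂ (-1ℤ , refl)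
parity -[1+ suc n ] with parity -[1+ n ]
... | inj₁ (a , e) = inj₂ (a - 1ℤ , trans (cong (λ w → -1ℤ + w) e)
    (((∀ a → -1ℤ + (a + a) ≡ (a - 1ℤ) + (a - 1ℤ) + 1ℤ) ∋ solve-∀) a))
... | inj₂ (a , e) = inj₁ (a , trans (cong (λ w → -1ℤ + w) e) (((∀ a → -1ℤ + (a + a + 1ℤ) ≡ a + a) ∋ solve-∀) a))

H-inj : ∀ {a b} → H a ≡ H b → a ≡ b
H-inj {a} {b} e = ℤₚ.*-cancelˡ-≡ (+ 2) a b
  (trans (((∀ a → + 2 * a ≡ (a + a + 1ℤ) - 1ℤ) ∋ solve-∀) a)
      (trans (cong (_- 1ℤ) e) (((∀ a → (a + a + 1ℤ) - 1ℤ ≡ + 2 * a) ∋ solve-∀) b)))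

-- A divisor of an odd number is odd, and so is the cofactor. As a consequence all positions on the
-- S-axis lie in one class modulo S, that of the position s′ with `H s′` equal to S.
odd-div : ∀ S p → S ∣ H p → ∃[ s′ ] (S ≡ H s′ × S ∣ p - s′)
odd-div S p (divides q e) with parity q | parity S
... | inj₁ (a , refl) | _ = ⊥-elim
    (even≢odd (a * S) p (trans (((∀ a s → a * s + a * s ≡ (a + a) * s) ∋ solve-∀) a S) (sym e)))
... | inj₂ (a , refl) | inj₁ (b , refl) = ⊥-elim
    (even≢odd (H a * b) p (trans (((∀ a b → a * b + a * b ≡ a * (b + b)) ∋ solve-∀) (H a) b) (sym e)))
... | inj₂ (a , refl) | inj₂ (b , refl) = b , refl , divides a (ℤₚ.*-cancelˡ-≡ (+ 2) (p - b) (a * H b)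
  (trans (((∀ p b → + 2 * (p - b) ≡ (p + p + 1ℤ) - (b + b + 1ℤ)) ∋ solve-∀) p b)
      (trans (cong (_- H b) e) (((∀ a b → (a + a + 1ℤ) * (b + b + 1ℤ) - (b + b + 1ℤ) ≡ + 2 * (a * (b + b + 1ℤ))) ∋
      solve-∀) a b))))

-- `T` has an odd multiple, so it is odd and the factor 2 cancels.
odd-∣2 : ∀ {T} x c → T ∣ H x → T ∣ c + c → T ∣ c
odd-∣2 x c d d′ = ∣-lin c (- x) d d′ (((∀ x c → c ≡ c * (x + x + 1ℤ) + - x * (c + c)) ∋ solve-∀) x c)

0≤⇒1≤H : ∀ {p} → 0ℤ ≤ p → 1ℤ ≤ H p
0≤⇒1≤H {p} q = ≤-lin q q (((∀ p → (p + p + 1ℤ) - 1ℤ ≡ (p - 0ℤ) + (p - 0ℤ)) ∋ solve-∀) p)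

0≤⊎0≤bar : ∀ p → 0ℤ ≤ p ⊎ 0ℤ ≤ bar p
0≤⊎0≤bar (+ n)    = inj₁ 0≤+n
0≤⊎0≤bar -[1+ n ] = inj₂ 0≤+n

¬both≥0 : ∀ {p} → 0ℤ ≤ p → ¬ (0ℤ ≤ bar p)
¬both≥0 {p} a b = 1≰0 (≤-lin a b (((∀ p → 0ℤ - 1ℤ ≡ (p - 0ℤ) + ((-1ℤ - p) - 0ℤ)) ∋ solve-∀) p))

∣H-bar : ∀ {T} x → T ∣ H x → T ∣ H (bar x)
∣H-bar x d = ∣-≡ (sym (H-bar x)) (∣m⇒∣-m d)

decide : ∀ {A B : Set} → Dec A → (A → B) → (¬ A → B) → B
decide (yes a) f g = f a
decide (no n)  f g = g n

module Rectangles
  (s t : ℕ) (1<s : 1 ℕ.< s) (1<t : 1 ℕ.< t) (cop : Coprime s t)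
  (λ′ : Partition) (sy : Sym (I λ′)) (τ : Partition) (sq : SEq t λ′ τ)
  (cs : Closed s (I τ)) (ct : Closed t (I τ))
  (uniq : ∀ μ → Sym (I μ) → SEq s μ λ′ → SEq t μ λ′ → size μ ≡ size λ′ → μ ≡ λ′) where

  InP InQ : ℕ → ℤ → Set
  InP c x = I λ′ x ≡ 1ℤ × I λ′ (x - + c) ≡ 0ℤ
  InQ c y = I λ′ y ≡ 0ℤ × I λ′ (y - + c) ≡ 1ℤ

  -- The swap fills the four gaps x - c, y, `bar x` and `bar (y - c)`. The constructors are the six
  -- ways in which two of them can coincide.
  data Overlap (c : ℕ) (x y : ℤ) : Set where
    centralˣ : x - + c ≡ bar x → Overlap c x y
    centralʸ : y - + c ≡ bar y → Overlap c x y
    across   : y ≡ bar x → Overlap c x y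
    across′  : x - + c ≡ bar (y - + c) → Overlap c x y
    same     : y ≡ x - + c → Overlap c x y
    same′    : x ≡ y - + c → Overlap c x y

  -- A rectangle x, x - c, y, y - c of alternating beads and gaps that avoids its mirror image
  -- can be swapped together with it, giving a second partition with the same invariants.
  opaque
    overlaps : ∀ c x y → + s ∣ + c → + t ∣ y - x → InP c x → InQ c y → Overlap c x y
    overlaps c x y s∣c t∣ (x∈ , x-c∉) (y∉ , y-c∈) =
      decide ((x - + c) ≟ bar x) centralˣ λ n₁ →
      decide ((y - + c) ≟ bar y) centralʸ λ n₂ →
      decide (y ≟ bar x) across λ n₃ →
      decide ((x - + c) ≟ bar (y - + c)) across′ λ n₄ →
      decide (y ≟ (x - + c)) same λ n₅ →
      decide (x ≟ (y - + c)) same′ λ n₆ → ⊥-elim (apart n₁ n₂ n₃ n₄ n₅ n₆)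
      where
      apart : x - + c ≢ bar x → y - + c ≢ bar y → y ≢ bar x → x - + c ≢ bar (y - + c) → y ≢ x - + c → x ≢ y - + c → ⊥
      apart n₁ n₂ n₃ n₄ n₅ n₆ = 0≢1 x-c∉ (subst (λ ν → I ν z₁ ≡ 1ℤ) same-λ I-z₁)
        where
        z₁ z₂ z₃ z₄ : ℤ
        z₁ = x - + c
        z₂ = y
        z₃ = bar x
        z₄ = bar (y - + c)
        gaps : All (Gap λ′) (z₁ ∷ z₂ ∷ z₃ ∷ z₄ ∷ [])
        gaps = x-c∉ ∷ y∉ ∷ sym-bead λ′ sy x∈ ∷ sym-bead λ′ sy y-c∈ ∷ []
        rest≢ : All (z₁ ≢_) (z₂ ∷ z₃ ∷ z₄ ∷ [])
        rest≢ = (λ e → n₅ (sym e)) ∷ n₁ ∷ n₄ ∷ []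
        F : Flipped λ′ (z₁ ∷ z₂ ∷ z₃ ∷ z₄ ∷ [])
        F = flipAll λ′ sy _ gaps
          ( rest≢
          ∷ (n₃ ∷ (λ e → n₂ (trans (sym (bar-bar (y - + c))) (cong bar (sym e)))) ∷ [])
          ∷ ((λ e → n₆ (bar-inj e)) ∷ []) ∷ [] ∷ [])
        fl-sum : ∀ p → (fl z₁ p - fl x p) + (fl y p - fl (y - + c) p) ≡ flips (z₁ ∷ z₂ ∷ z₃ ∷ z₄ ∷ []) p
        fl-sum p = trans (((∀ a b c d → (a - b) + (c - d) ≡ a + (c + (- b + (- d + 0ℤ)))) ∋ solve-∀) (fl z₁ p)
            (fl x p) (fl y p) (fl (y - + c) p))
          (cong₂ (λ u v → fl z₁ p + (fl y p + (u + (v + 0ℤ)))) (sym (fl-bar x p)) (sym (fl-bar (y - + c) p)))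
        seq-s : SEq s (Flipped.result F) λ′
        seq-s = flipped-seq F (zc-cong fl-sum (zc-+
          (zc-fl₂ s z₁ x (∣-lin₁ -1ℤ s∣c (((∀ x c → (x - c) - x ≡ -1ℤ * c) ∋ solve-∀) x (+ c))))
          (zc-fl₂ s y (y - + c) (∣-lin₁ 1ℤ s∣c (((∀ x c → x - (x - c) ≡ 1ℤ * c) ∋ solve-∀) y (+ c))))))
        seq-t : SEq t (Flipped.result F) λ′
        seq-t = flipped-seq F (zc-cong (λ p → trans (((∀ a b c d → (c - b) + (a - d) ≡ (a - b) + (c - d)) ∋ solve-∀)
            (fl z₁ p) (fl x p) (fl y p) (fl (y - + c) p)) (fl-sum p)) (zc-+
          (zc-fl₂ t y x t∣)
          (zc-fl₂ t z₁ (y - + c) (∣-lin₁ -1ℤ t∣ (((∀ x y c → (x - c) - (y - c) ≡ -1ℤ * (y - x)) ∋ solve-∀) x y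
              (+ c))))))
        same-size : size (Flipped.result F) ≡ size λ′
        same-size = ℤₚ.+-injective (trans (Flipped.sizes F)
          (((∀ n x y c → n + (((x - c) + (x - c) + 1ℤ) +
              ((y + y + 1ℤ) + (((-1ℤ - x) + (-1ℤ - x) + 1ℤ) + (((-1ℤ - (y - c)) + (-1ℤ - (y - c)) + 1ℤ) + 0ℤ)))) ≡ n)
              ∋ solve-∀) (+ size λ′) x y (+ c)))
        same-λ : Flipped.result F ≡ λ′
        same-λ = uniq _ (Flipped.symmetric F) seq-s seq-t same-size
        I-z₁ : I (Flipped.result F) z₁ ≡ 1ℤ
        I-z₁ = trans (Flipped.beads F z₁) (cong₂ _+_ x-c∉ (cong₂ _+_
          (cong₂ _-_ (δ-refl z₁) (δ-≢ (gap≢bar λ′ sy x-c∉ x-c∉)))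
          (flips-0 λ′ sy (z₂ ∷ z₃ ∷ z₄ ∷ []) x-c∉ rest≢ (All.tail gaps))))

  rowDiff-≤1 : ∀ c x p → rowDiff t λ′ c x p ≤ 1ℤ
  rowDiff-≤1 c x p with + t ∣? p - x
  ... | no _ = 0≤+n
  ... | yes _ with I-01 λ′ (p - + c) | I-01 λ′ p
  ...   | inj₁ a | inj₁ b rewrite a | b = 0≤+n
  ...   | inj₁ a | inj₂ b rewrite a | b = ℤ.-≤+
  ...   | inj₂ a | inj₁ b rewrite a | b = ≤-refl
  ...   | inj₂ a | inj₂ b rewrite a | b = 0≤+n

  rowDiff-P : ∀ c x p → InP c p → + t ∣ p - x → rowDiff t λ′ c x p ≡ -1ℤ
  rowDiff-P c x p (a , b) d rewrite on-yes t x p d | a | b = refl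

  rowDiff-Q : ∀ c x p → 1ℤ ≤ rowDiff t λ′ c x p → InQ c p × + t ∣ p - x
  rowDiff-Q c x p h with + t ∣? p - x
  ... | no _ = ⊥-elim (1≰0 h)
  ... | yes d with I-01 λ′ (p - + c) | I-01 λ′ p
  ...   | inj₁ a | inj₁ b rewrite a | b = ⊥-elim (1≰0 h)
  ...   | inj₁ a | inj₂ b rewrite a | b with h
  ...     | ()
  rowDiff-Q c x p h | yes d | inj₂ a | inj₁ b = (b , a) , d
  rowDiff-Q c x p h | yes d | inj₂ a | inj₂ b rewrite a | b = ⊥-elim (1≰0 h)

  τ-row-≥0 : ∀ c x → + s ∣ + c → ∀ y → 0ℤ ≤ rowDiff t τ c x y
  τ-row-≥0 c x s∣c y with + t ∣? y - x
  ... | no _ = 0≤+n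
  ... | yes _ = subst (0ℤ ≤_) (sym (ℤₚ.*-identityˡ _)) (01-diff-≥0 side (I-01 τ (y - + c)) (I-01 τ y))
    where
    side : I τ (y - + c) ≡ 1ℤ ⊎ I τ y ≡ 0ℤ
    side with I-01 τ y
    ... | inj₁ e = inj₂ e
    ... | inj₂ e = inj₁ (closed-∣ cs y (y - + c) (∣-lin₁ 1ℤ s∣c (((∀ y c → y - (y - c) ≡ 1ℤ * c) ∋ solve-∀) y (+ c)))
            (≤-lin₁ {c = 0ℤ} {d = + c} 0≤+n (((∀ y c → y - (y - c) ≡ c - 0ℤ) ∋ solve-∀) y (+ c))) e)

  Row : ℕ → ℤ → ℤ → Set
  Row c x p = InP c p × + t ∣ p - x

  opaque
    -- The row sum can be computed in τ, where all terms are nonnegative because c is a multiple of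
    -- s and τ is closed. So the row of λ has at least as many reversed pairs as inversions.
    pickQ : ∀ c x → + s ∣ + c → ∀ xs ys → AllPairs _≢_ xs → All (Row c x) xs → length ys ℕ.< length xs →
      ∃[ y ] (InQ c y × + t ∣ y - x × All (y ≢_) ys)
    pickQ c x s∣c xs ys nx rx len with rowDiff-core sq c x
    ... | v , hλ , hτ with pick hλ (rowDiff-≤1 c x) xs ys nx
        (All.map (λ {p} r → rowDiff-P c x p (proj₁ r) (proj₂ r)) rx)
        (≤-trans (ℤ.+≤+ len) (≤-lin₁ (hs-≥0 (τ-row-≥0 c x s∣c) hτ)
            (((∀ v l → (v + l) - l ≡ v - 0ℤ) ∋ solve-∀) v (+ length xs))))
    ...   | y , g , n = let (q , d) = rowDiff-Q c x y g in y , q , d , n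

  2t≤ : ∀ c → 1 ℕ.≤ c → + s ∣ + c → + t ∣ + c → + t + + t ≤ + c
  2t≤ c 1≤c s∣c t∣c = ≤-trans
    (≤-by ((+ s - + 2) * + t) (0≤* {+ s - + 2} {+ t} (≤⇒0≤ (ℤ.+≤+ 1<s)) 0≤+n)
        (((∀ s t → s * t - (t + t) ≡ (s - + 2) * t) ∋ solve-∀) (+ s) (+ t)))
    (subst (_≤ + c) (ℤₚ.pos-* s t) (pos-mult-≥ {s ℕ.* t} (subst (_∣ + c) (sym (ℤₚ.pos-* s t)) (cop-∣ cop s∣c t∣c))
        (ℤ.+≤+ 1≤c)))

  opaque
    -- When t divides c as well, the pairs stay in one class modulo t, which τ fills exactly up to
    -- its top z. Since c ≥ s t ≥ 2 t, the gaps z + t and z + 2 t both have beads c below them. So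
    -- the row has at least two more reversed pairs than inversions.
    pickQ₂ : ∀ c x → 1 ℕ.≤ c → + s ∣ + c → + t ∣ + c → ∀ ys → InP c x → length ys ℕ.≤ 2 →
      ∃[ y ] (InQ c y × + t ∣ y - x × All (y ≢_) ys)
    pickQ₂ c x 1≤c s∣c t∣c ys px len = from (rowDiff-core sq c x) (class-top t τ x (ℕₚ.<⇒≤ 1<t))
      where
      from : ∃[ v ] (HasSum (rowDiff t λ′ c x) v × HasSum (rowDiff t τ c x) v) → ∃[ z ]
          (+ t ∣ z - x × I τ z ≡ 1ℤ × I τ (z + + t) ≡ 0ℤ) →
        ∃[ y ] (InQ c y × + t ∣ y - x × All (y ≢_) ys)
      from (v , hλ , hτ) (z , t∣z , z∈ , z+t∉) = found
          (pick hλ (rowDiff-≤1 c x) (x ∷ []) ys ([] ∷ []) (rowDiff-P c x x px (divides 0ℤ (ℤₚ.+-inverseʳ x)) ∷ [])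
          (≤-trans (ℤ.+≤+ (s≤s len)) (≤-lin₁ (hs-mono below (hs-count (y₁ ∷ y₂ ∷ [])) hτ)
              (((∀ v → (v + 1ℤ) - + 3 ≡ v - + 2) ∋ solve-∀) v))))
        where
        found : ∃[ y ] (1ℤ ≤ rowDiff t λ′ c x y × All (y ≢_) ys) → ∃[ y ] (InQ c y × + t ∣ y - x × All (y ≢_) ys)
        found (y , g , n) = let (q , d) = rowDiff-Q c x y g in y , q , d , n
        y₁ y₂ : ℤ
        y₁ = z + + t
        y₂ = y₁ + + t
        val : ∀ j → + t + + t ≤ + c → (y : ℤ) → y ≡ z + j * + t → y ≤ z + (+ t + + t) → I τ y ≡ 0ℤ → 1ℤ ≤ rowDiff t τ
            c x y
        val j le y refl y≤ e rewrite on-yes t x (z + j * + t)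
            (∣-lin 1ℤ j t∣z (divides 1ℤ (sym (ℤₚ.*-identityˡ (+ t))))
            (((∀ z j t x → (z + j * t) - x ≡ 1ℤ * (z - x) + j * t) ∋ solve-∀) z j (+ t) x))
          | closed-∣ ct z ((z + j * + t) - + c) (∣-lin 1ℤ (- j) t∣c (divides 1ℤ (sym (ℤₚ.*-identityˡ (+ t))))
              (((∀ z j t c → z - ((z + j * t) - c) ≡ 1ℤ * c + - j * t) ∋ solve-∀) z j (+ t) (+ c)))
              (≤-lin y≤ le (((∀ y z c t → z - (y - c) ≡ ((z + (t + t)) - y) + (c - (t + t))) ∋ solve-∀)
                  (z + j * + t) z (+ c) (+ t))) z∈
          | e = ≤-refl
        y₂∉ : I τ y₂ ≡ 0ℤ
        y₂∉ with I-01 τ y₂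
        ... | inj₁ e = e
        ... | inj₂ e = ⊥-elim (0≢1 z+t∉ (trans (cong (I τ) (((∀ z t → z + t ≡ ((z + t) + t) - t) ∋ solve-∀) z (+ t)))
            (ct y₂ e)))
        below : ∀ p → count (y₁ ∷ y₂ ∷ []) p ≤ rowDiff t τ c x p
        below p with p ≟ y₁ | p ≟ y₂
        ... | yes refl | yes e = ⊥-elim
            (ℕₚ.<-irrefl (ℤₚ.+-injective (trans (((∀ y t → 0ℤ ≡ y - y) ∋ solve-∀) y₁ (+ t))
            (trans (cong (_- y₁) e) (((∀ y t → (y + t) - y ≡ t) ∋ solve-∀) y₁ (+ t))))) (ℕₚ.<⇒≤ 1<t))
        ... | yes refl | no _ = val 1ℤ (2t≤ c 1≤c s∣c t∣c) y₁ (cong (λ w → z + w) (sym (ℤₚ.*-identityˡ (+ t))))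
            (≤-lin₁ {c = 0ℤ} {d = + t} 0≤+n (((∀ z t → (z + (t + t)) - (z + t) ≡ t - 0ℤ) ∋ solve-∀) z (+ t))) z+t∉
        ... | no _ | yes refl = val (+ 2) (2t≤ c 1≤c s∣c t∣c) y₂
            (((∀ z t → (z + t) + t ≡ z + + 2 * t) ∋ solve-∀) z (+ t)) (≤-reflexive (ℤₚ.+-assoc z (+ t) (+ t))) y₂∉
        ... | no _ | no _ = τ-row-≥0 c x s∣c p

  -- The outcome of the overlap `across`: in its row x is the only inversion and `bar x` the only
  -- reversed pair.
  record Isolated (c : ℕ) (x : ℤ) : Set where
    field
      multiple : + t ∣ H x
      only-P   : ∀ x′ → Row c x x′ → x′ ≡ x
      only-Q   : ∀ y → InQ c y → + t ∣ y - x → y ≡ bar x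
      opposite : I λ′ (bar x - + c) ≡ 1ℤ

  shift↯ : ∀ c → ¬ (+ t ∣ + c) → ∀ x y → + t ∣ y - x → y ≢ x - + c
  shift↯ c t∤c x y d e = t∤c (∣-lin₁ -1ℤ d (trans (((∀ x c → c ≡ -1ℤ * ((x - c) - x)) ∋ solve-∀) x (+ c))
      (cong (λ w → -1ℤ * (w - x)) (sym e))))

  shift↯′ : ∀ c → ¬ (+ t ∣ + c) → ∀ x y → + t ∣ y - x → x ≢ y - + c
  shift↯′ c t∤c x y d e = t∤c (∣-lin₁ 1ℤ d (trans (((∀ y c → c ≡ 1ℤ * (y - (y - c))) ∋ solve-∀) y (+ c))
      (cong (λ w → 1ℤ * (y - w)) (sym e))))

  H-central : ∀ c y → y - + c ≡ bar y → H y ≡ + c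
  H-central c y e = trans (((∀ y c → y + y + 1ℤ ≡ ((y - c) - (-1ℤ - y)) + c) ∋ solve-∀) y (+ c))
    (trans (cong (λ w → (w - bar y) + + c) e) (((∀ a c → (a - a) + c ≡ c) ∋ solve-∀) (bar y) (+ c)))

  self-row : ∀ c x → InP c x → Row c x x
  self-row c x px = px , divides 0ℤ (ℤₚ.+-inverseʳ x)

  mirror : ∀ c x → bar (x - + c) - + c ≡ bar x
  mirror c x = ((∀ x c → (-1ℤ - (x - c)) - c ≡ -1ℤ - x) ∋ solve-∀) x (+ c)

  mirror-P : ∀ c x → InP c x → InP c (bar (x - + c))
  mirror-P c x (x∈ , x-c∉) = sym-gap λ′ sy x-c∉ , trans (cong (I λ′) (mirror c x)) (sym-bead λ′ sy x∈)

  -- A row that is its own mirror image has no non-central inversions: x and its mirror image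
  -- would both overlap every y, which forces all of Q to be the single central position.
  opaque
    self-mirror : ∀ c x → + s ∣ + c → ¬ (+ t ∣ + c) → InP c x → x - + c ≢ bar x → ¬ (+ t ∣ H x - + c)
    self-mirror c x s∣c t∤c px ¬central self =
      contra (pickQ c x s∣c (x ∷ []) [] ([] ∷ []) (self-row c x px ∷ []) (s≤s z≤n))
      where
      x̃ : ℤ
      x̃ = bar (x - + c)
      t∣x̃ : + t ∣ x̃ - x
      t∣x̃ = ∣-lin₁ -1ℤ self (((∀ x c → (-1ℤ - (x - c)) - x ≡ -1ℤ * ((x + x + 1ℤ) - c)) ∋ solve-∀) x (+ c))
      x≢x̃ : x ≢ x̃
      x≢x̃ e = ¬central (trans (sym (bar-bar (x - + c))) (cong bar (sym e)))
      central-y : ∀ y → InQ c y → + t ∣ y - x → H y ≡ + c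
      central-y y qy d = go (overlaps c x̃ y s∣c d̃ (mirror-P c x px) qy)
        where
        d̃ : + t ∣ y - x̃
        d̃ = ∣-lin 1ℤ -1ℤ d t∣x̃ (((∀ x x̃ y → y - x̃ ≡ 1ℤ * (y - x) + -1ℤ * (x̃ - x)) ∋ solve-∀) x x̃ y)
        go : Overlap c x̃ y → H y ≡ + c
        go (centralˣ e) = ⊥-elim (¬central (sym (trans (sym (mirror c x)) (trans e (bar-bar (x - + c))))))
        go (centralʸ e) = H-central c y e
        go (across e)   = ⊥-elim (shift↯ c t∤c x y d (trans e (bar-bar (x - + c))))
        go (across′ e)  = ⊥-elim (shift↯′ c t∤c x y d (bar-inj (trans (sym (mirror c x)) e)))
        go (same e)     = ⊥-elim (shift↯ c t∤c x̃ y d̃ e)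
        go (same′ e)    = ⊥-elim (shift↯′ c t∤c x̃ y d̃ e)
      contra : ∃[ y ] (InQ c y × + t ∣ y - x × All (y ≢_) []) → ⊥
      contra (y , qy , d , _) with pickQ c x s∣c (x ∷ x̃ ∷ []) (y ∷ []) ((x≢x̃ ∷ []) ∷ [] ∷ [])
          (self-row c x px ∷ (mirror-P c x px , t∣x̃) ∷ []) (s≤s (s≤s z≤n))
      ... | y′ , qy′ , d′ , (n ∷ []) = n (H-inj (trans (central-y y′ qy′ d′) (sym (central-y y qy d))))

  opaque
    -- For a partner y in the row, `same` and `same′` would give `t ∣ c`, and `centralʸ` would make
    -- the row its own mirror image, against `self-mirror`. There remain `across` and `across′`; the
    -- latter gives t ∣ H (x - c).
    inversion : ∀ c x → + s ∣ + c → ¬ (+ t ∣ + c) → InP c x → (x - + c ≡ bar x) ⊎ Isolated c x ⊎ + t ∣ H (x - + c)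
    inversion c x s∣c t∤c px with (x - + c) ≟ bar x
    ... | yes central = inj₁ central
    ... | no ¬central = inj₂ (go (pickQ c x s∣c (x ∷ []) [] ([] ∷ []) (self-row c x px ∷ []) (s≤s z≤n)))
      where
      shape : ∀ y → InQ c y → + t ∣ y - x → y ≡ bar x ⊎ + t ∣ H (x - + c)
      shape y qy d with overlaps c x y s∣c d px qy
      ... | centralˣ e = ⊥-elim (¬central e)
      ... | centralʸ e = ⊥-elim (self-mirror c x s∣c t∤c px ¬central
              (∣-lin₁ (- + 2) d (trans (cong (λ w → H x - w) (sym (H-central c y e)))
                  (((∀ x y → (x + x + 1ℤ) - (y + y + 1ℤ) ≡ (- + 2) * (y - x)) ∋ solve-∀) x y))))
      ... | across e   = inj₁ e
      ... | across′ e  = inj₂ (∣-lin₁ -1ℤ d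
          (trans (((∀ x y c → (x - c) + (x - c) + 1ℤ ≡ -1ℤ * ((y - x) + ((-1ℤ - (y - c)) - (x - c)))) ∋ solve-∀) x y
          (+ c))
              (cong (λ w → -1ℤ * w) (trans (cong (λ w → (y - x) + (w - (x - + c))) (sym e))
                  (((∀ a b → a + (b - b) ≡ a) ∋ solve-∀) (y - x) (x - + c))))))
      ... | same e     = ⊥-elim (shift↯ c t∤c x y d e)
      ... | same′ e    = ⊥-elim (shift↯′ c t∤c x y d e)
      go : ∃[ y ] (InQ c y × + t ∣ y - x × All (y ≢_) []) → Isolated c x ⊎ + t ∣ H (x - + c)
      go (y , qy , d , _) with shape y qy d
      ... | inj₂ d′ = inj₂ d′
      ... | inj₁ refl = inj₁ record
        { multiple = mult
        ; only-P   = λ x′ r → onlyP x′ r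
        ; only-Q   = onlyQ
        ; opposite = proj₂ qy }
        where
        mult : + t ∣ H x
        mult = ∣-lin₁ -1ℤ d (((∀ x → x + x + 1ℤ ≡ -1ℤ * ((-1ℤ - x) - x)) ∋ solve-∀) x)
        onlyQ : ∀ y → InQ c y → + t ∣ y - x → y ≡ bar x
        onlyQ y qy d with shape y qy d
        ... | inj₁ e = e
        ... | inj₂ d′ = ⊥-elim (t∤c (odd-∣2 x (+ c) mult
            (∣-lin 1ℤ -1ℤ mult d′ (((∀ x c → c + c ≡ 1ℤ * (x + x + 1ℤ) + -1ℤ * ((x - c) + (x - c) + 1ℤ)) ∋ solve-∀) x
            (+ c)))))
        onlyP : ∀ x′ → Row c x x′ → x′ ≡ x
        onlyP x′ r with x′ ≟ x
        ... | yes e = e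
        -- A second inversion would supply a second reversed pair, but all of them sit at `bar x`.
        ... | no ne with pickQ c x s∣c (x′ ∷ x ∷ []) (bar x ∷ []) ((ne ∷ []) ∷ [] ∷ []) (r ∷ self-row c x px ∷ [])
            (s≤s (s≤s z≤n))
        ...   | y′ , qy′ , d′ , (n ∷ []) = ⊥-elim (n (onlyQ y′ qy′ d′))

  opaque
    -- Here divisibility does not exclude `same` and `same′`. Instead y is chosen away from x - c
    -- and x + c, for which `pickQ₂` has enough reversed pairs.
    inversion-∣ : ∀ c x → 1 ℕ.≤ c → + s ∣ + c → + t ∣ + c → InP c x → (x - + c ≡ bar x) ⊎ + t ∣ H x
    inversion-∣ c x 1≤c s∣c t∣c px with (x - + c) ≟ bar x | + t ∣? H x
    ... | yes central | _     = inj₁ central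
    ... | no  _       | yes d = inj₂ d
    ... | no ¬central | no ¬d = ⊥-elim (go (pickQ₂ c x 1≤c s∣c t∣c ((x - + c) ∷ (x + + c) ∷ []) px ℕₚ.≤-refl))
      where
      go : ∃[ y ] (InQ c y × + t ∣ y - x × All (y ≢_) ((x - + c) ∷ (x + + c) ∷ [])) → ⊥
      go (y , qy , d , (n₁ ∷ n₂ ∷ [])) with overlaps c x y s∣c d px qy
      ... | centralˣ e = ¬central e
      ... | centralʸ e = ¬d (∣-lin 1ℤ (- + 2) t∣c d
          (trans (((∀ x y → x + x + 1ℤ ≡ 1ℤ * (y + y + 1ℤ) + (- + 2) * (y - x)) ∋ solve-∀) x y)
          (cong (λ w → 1ℤ * w + (- + 2) * (y - x)) (H-central c y e))))
      ... | across e   = ¬d (∣-lin₁ -1ℤ d (trans (((∀ x → x + x + 1ℤ ≡ -1ℤ * ((-1ℤ - x) - x)) ∋ solve-∀) x)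
          (cong (λ w → -1ℤ * (w - x)) (sym e))))
      ... | across′ e  = ¬d (∣-lin -1ℤ (+ 2) d t∣c
          (trans (((∀ x y c → x + x + 1ℤ ≡ -1ℤ * ((y - x) + ((-1ℤ - (y - c)) - (x - c))) + + 2 * c) ∋ solve-∀) x y
          (+ c))
              (cong (λ w → -1ℤ * w + + 2 * + c)
                  (trans (cong (λ w → (y - x) + (w - (x - + c))) (sym e))
                  (((∀ a b → a + (b - b) ≡ a) ∋ solve-∀) (y - x) (x - + c))))))
      ... | same e     = n₁ e
      ... | same′ e    = n₂ (trans (((∀ y c → y ≡ (y - c) + c) ∋ solve-∀) y (+ c)) (cong (_+ + c) (sym e)))

  inversion-any : ∀ c x → 1 ℕ.≤ c → + s ∣ + c → InP c x → (x - + c ≡ bar x) ⊎ + t ∣ H x ⊎ + t ∣ H (x - + c)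
  inversion-any c x 1≤c s∣c px with + t ∣? + c
  ... | yes t∣c with inversion-∣ c x 1≤c s∣c t∣c px
  ...   | inj₁ e = inj₁ e
  ...   | inj₂ d = inj₂ (inj₁ d)
  inversion-any c x 1≤c s∣c px | no t∤c with inversion c x s∣c t∤c px
  ... | inj₁ e        = inj₁ e
  ... | inj₂ (inj₁ d) = inj₂ (inj₁ (Isolated.multiple d))
  ... | inj₂ (inj₂ d) = inj₂ (inj₂ d)

-- Beads x with H x divisible by s or t

pos-id : ∀ {z} → 0ℤ ≤ z → + pos z ≡ z
pos-id {+ n} _ = refl

sub-pos : ∀ {a b} → b ≤ a → a - + pos (a - b) ≡ b
sub-pos {a} {b} le = trans (cong (λ w → a - w) (pos-id (≤⇒0≤ le))) (((∀ a b → a - (a - b) ≡ b) ∋ solve-∀) a b)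

pos≰0 : ∀ {n} → ¬ (+ suc n ≤ 0ℤ)
pos≰0 (ℤ.+≤+ ())

1≤H⇒0≤ : ∀ {p} → 1ℤ ≤ H p → 0ℤ ≤ p
1≤H⇒0≤ {p} h with 0≤⊎0≤bar p
... | inj₁ q = q
... | inj₂ q = ⊥-elim (pos≰0 {1}
    (≤-lin h (0≤⇒1≤H q) (((∀ p → 0ℤ - + 2 ≡ ((p + p + 1ℤ) - 1ℤ) + (((-1ℤ - p) + (-1ℤ - p) + 1ℤ) - 1ℤ)) ∋ solve-∀) p)))

≤-1+ : ∀ {a b} → 1ℤ + a ≤ b → a ≤ b
≤-1+ {a} {b} h = ≤-lin {c = 1ℤ + a} {b} {0ℤ} {1ℤ} h 0≤+n
    (((∀ a b → b - a ≡ (b - (1ℤ + a)) + (1ℤ - 0ℤ)) ∋ solve-∀) a b)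

H-cancel-≤ : ∀ {a b} → H a ≤ H b → a ≤ b
H-cancel-≤ {a} {b} h with a ≤? b
... | yes q = q
... | no  q = ≤-1+ (≤-lin (≰⇒1+≤ q) h
    (((∀ a b → b - (1ℤ + a) ≡ (a - (1ℤ + b)) + ((b + b + 1ℤ) - (a + a + 1ℤ))) ∋ solve-∀) a b))

≢⇒1≤pos : ∀ {a b} → b ≤ a → a ≢ b → 1 ℕ.≤ pos (a - b)
≢⇒1≤pos {a} {b} le ne with pos (a - b) | pos-id (≤⇒0≤ le)
... | zero  | e = ⊥-elim (ne (ℤₚ.i-j≡0⇒i≡j a b (sym e)))
... | suc n | e = s≤s z≤n

¬t∣s : ∀ {s t} → 1 ℕ.< t → Coprime s t → ¬ (+ t ∣ + s)
¬t∣s {s} {t} 1<t cop d with cop (∣⇒∣ᵤ d , ℕᵈ.∣-refl)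
... | refl = ℕₚ.<-irrefl refl 1<t

module Multiples
  (s t : ℕ) (1<s : 1 ℕ.< s) (1<t : 1 ℕ.< t) (cop : Coprime s t)
  (λ′ : Partition) (sy : Sym (I λ′)) (τ : Partition) (sq : SEq t λ′ τ)
  (cs : Closed s (I τ)) (ct : Closed t (I τ))
  (uniq : ∀ μ → Sym (I μ) → SEq s μ λ′ → SEq t μ λ′ → size μ ≡ size λ′ → μ ≡ λ′) where

  open Rectangles s t 1<s 1<t cop λ′ sy τ sq cs ct uniq public

  1≤s : 1ℤ ≤ + s
  1≤s = ℤ.+≤+ (ℕₚ.<⇒≤ 1<s)

  t∤s : ¬ (+ t ∣ + s)
  t∤s = ¬t∣s 1<t cop

  t∤-s : ∀ {h} → h ≡ + s ⊎ h ≡ - (+ s) → ¬ (+ t ∣ h)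
  t∤-s (inj₁ refl) d = t∤s d
  t∤-s (inj₂ refl) d = t∤s (∣-lin₁ -1ℤ d (((∀ s → s ≡ -1ℤ * - s) ∋ solve-∀) (+ s)))

  -- The two positions with H equal to s and - s are mirror images, so one of them is a gap, and
  -- both are congruent to p modulo s. This gap is the lower end of an inversion starting at p.
  gap-at-s : ∀ p → + s ∣ H p → ∃[ g ] (I λ′ g ≡ 0ℤ × + s ∣ p - g × (H g ≡ + s ⊎ H g ≡ - (+ s)))
  gap-at-s p d with odd-div (+ s) p d
  ... | s′ , es , d′ with I-01 λ′ s′
  ...   | inj₁ e = s′ , e , d′ , inj₁ (sym es)
  ...   | inj₂ e = bar s′ , sym-bead λ′ sy e ,
          ∣-lin 1ℤ 1ℤ d′ (∣-≡ es (divides 1ℤ (sym (ℤₚ.*-identityˡ (+ s)))))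
              (((∀ p s → p - (-1ℤ - s) ≡ 1ℤ * (p - s) + 1ℤ * (s + s + 1ℤ)) ∋ solve-∀) p s′) ,
          inj₂ (trans (H-bar s′) (cong -_ (sym es)))

  ±s-≤ : ∀ {h} → h ≡ + s ⊎ h ≡ - (+ s) → h ≤ + s
  ±s-≤ (inj₁ refl) = ≤-refl
  ±s-≤ (inj₂ refl) = ≤-lin {c = 0ℤ} {+ s} {0ℤ} {+ s} 0≤+n 0≤+n
      (((∀ s → s - - s ≡ (s - 0ℤ) + (s - 0ℤ)) ∋ solve-∀) (+ s))

  module Below (p : ℤ) (0≤p : 0ℤ ≤ p) (p∈ : I λ′ p ≡ 1ℤ) (s∣p : + s ∣ H p)
    (g : ℤ) (g∉ : I λ′ g ≡ 0ℤ) (s∣p-g : + s ∣ p - g) (hg : H g ≡ + s ⊎ H g ≡ - (+ s)) where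

    s≤Hp : + s ≤ H p
    s≤Hp = pos-mult-≥ s∣p (0≤⇒1≤H 0≤p)

    g≤p : g ≤ p
    g≤p = H-cancel-≤ (≤-trans (±s-≤ hg) s≤Hp)

    c : ℕ
    c = pos (p - g)

    c-eq : + c ≡ p - g
    c-eq = pos-id (≤⇒0≤ g≤p)

    p-c : p - + c ≡ g
    p-c = sub-pos g≤p

    s∣c : + s ∣ + c
    s∣c = ∣-≡ (sym c-eq) s∣p-g

    1≤c : 1 ℕ.≤ c
    1≤c = ≢⇒1≤pos g≤p λ e → 0≢1 (trans (cong (I λ′) e) g∉) p∈

    inP : InP c p
    inP = p∈ , trans (cong (I λ′) p-c) g∉

    H-at : p - + c ≡ bar p → - H p ≡ H g
    H-at e = trans (sym (H-bar p)) (cong H (trans (sym e) p-c))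

    central-size : H g ≡ + s ⊎ H g ≡ - (+ s) → p - + c ≡ bar p → H p ≡ + s
    central-size (inj₂ q) e = ℤₚ.neg-injective (trans (H-at e) q)
    central-size (inj₁ q) e = ⊥-elim (pos≰0 {1} (≤-lin (0≤⇒1≤H 0≤p) 1≤s
      (trans (((∀ h → 0ℤ - + 2 ≡ (h - 1ℤ) + (- h - 1ℤ)) ∋ solve-∀) (H p))
          (cong (λ w → (H p - 1ℤ) + (w - 1ℤ)) (trans (H-at e) q)))))

  -- In the inversion from p to g, t divides neither `H p` nor `H g`, which is s or - s. So the
  -- inversion must be central.
  single : ∀ p → 0ℤ ≤ p → I λ′ p ≡ 1ℤ → + s ∣ H p → ¬ (+ t ∣ H p) → H p ≡ + s
  single p 0≤p p∈ s∣p t∤p with gap-at-s p s∣p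
  ... | g , g∉ , s∣p-g , hg = go (inversion-any c p 1≤c s∣c inP)
    where
    open Below p 0≤p p∈ s∣p g g∉ s∣p-g hg
    go : (p - + c ≡ bar p) ⊎ + t ∣ H p ⊎ + t ∣ H (p - + c) → H p ≡ + s
    go (inj₁ e)        = central-size hg e
    go (inj₂ (inj₁ d)) = ⊥-elim (t∤p d)
    go (inj₂ (inj₂ d)) = ⊥-elim (t∤-s hg (∣-≡ (cong H p-c) d))

  -- If p differs from u, then p ≥ u + s t and the inversion from p to g is isolated. One of p - s t
  -- and its mirror image is a gap of the same row, but it is not the reversed pair at `bar p`, so
  -- the position c below it is a gap too. The mirror image of that gap is a bead whose H is
  -- divisible by s but not by t and is too large for `single`.
  double : ∀ p → 0ℤ ≤ p → I λ′ p ≡ 1ℤ → + s ∣ H p → + t ∣ H p → H p ≡ + s * + t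
  double p 0≤p p∈ s∣p t∣p with odd-div (+ s * + t) p (cop-∣ cop s∣p t∣p) | gap-at-s p s∣p
  ... | u , eu , st∣p-u | g , g∉ , s∣p-g , hg with p ≟ u
  ...   | yes refl = sym eu
  ...   | no p≢u = ⊥-elim (go (inversion c p s∣c t∤c inP))
    where
    open Below p 0≤p p∈ s∣p g g∉ s∣p-g hg
    S T ST : ℤ
    S = + s
    T = + t
    ST = S * T
    st≡ : + (s ℕ.* t) ≡ ST
    st≡ = ℤₚ.pos-* s t
    2S≤ST : S + S ≤ ST
    2S≤ST = ≤-by ((T - + 2) * S) (0≤* {T - + 2} {S} (≤⇒0≤ (ℤ.+≤+ 1<t)) 0≤+n)
        (((∀ s t → s * t - (s + s) ≡ (t - + 2) * s) ∋ solve-∀) S T)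
    S-mult : S ∣ ST
    S-mult = divides T (ℤₚ.*-comm S T)
    T-mult : T ∣ ST
    T-mult = divides S refl
    u≤p : u ≤ p
    u≤p = H-cancel-≤ (subst (_≤ H p) eu
        (subst (_≤ H p) st≡ (pos-mult-≥ {s ℕ.* t} (subst (_∣ H p) (sym st≡) (cop-∣ cop s∣p t∣p)) (0≤⇒1≤H 0≤p))))
    ST≤p-u : ST ≤ p - u
    ST≤p-u = subst (_≤ p - u) st≡ (pos-mult-≥ {s ℕ.* t} (subst (_∣ p - u) (sym st≡) st∣p-u)
      (subst (1ℤ ≤_) (pos-id (≤⇒0≤ u≤p)) (ℤ.+≤+ (≢⇒1≤pos u≤p p≢u))))
    0≤u : 0ℤ ≤ u
    0≤u = 1≤H⇒0≤ (subst (1ℤ ≤_) eu (≤-trans 1≤s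
        (≤-lin {c = S + S} {ST} {0ℤ} {S} 2S≤ST 0≤+n
        (((∀ s st → st - s ≡ (st - (s + s)) + (s - 0ℤ)) ∋ solve-∀) S ST))))
    w : ℤ
    w = p - ST
    0≤w : 0ℤ ≤ w
    0≤w = ≤-lin ST≤p-u 0≤u (((∀ p st u → (p - st) - 0ℤ ≡ ((p - u) - st) + (u - 0ℤ)) ∋ solve-∀) p ST u)
    Hw : H w ≡ H p - (ST + ST)
    Hw = ((∀ p st → (p - st) + (p - st) + 1ℤ ≡ (p + p + 1ℤ) - (st + st)) ∋ solve-∀) p ST
    2c : + c + + c ≡ H p - H g
    2c = trans (cong₂ _+_ c-eq c-eq) (((∀ p g → (p - g) + (p - g) ≡ (p + p + 1ℤ) - (g + g + 1ℤ)) ∋ solve-∀) p g)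
    t∤c : ¬ (T ∣ + c)
    t∤c d = t∤-s hg (∣-lin (- + 2) 1ℤ d t∣p (trans (((∀ h g → g ≡ -1ℤ * (h - g) + 1ℤ * h) ∋ solve-∀) (H p) (H g))
        (trans (cong (λ z → -1ℤ * z + 1ℤ * H p) (sym 2c))
        (((∀ c h → -1ℤ * (c + c) + 1ℤ * h ≡ - + 2 * c + 1ℤ * h) ∋ solve-∀) (+ c) (H p)))))
    S≤ST : S ≤ ST
    S≤ST = ≤-lin {c = S + S} {ST} {0ℤ} {S} 2S≤ST 0≤+n (((∀ s st → st - s ≡ (st - (s + s)) + (s - 0ℤ)) ∋ solve-∀) S ST)
    S∣g : S ∣ H g
    S∣g = ∣-lin 1ℤ (- + 2) s∣p s∣p-g (((∀ p g → g + g + 1ℤ ≡ 1ℤ * (p + p + 1ℤ) + - + 2 * (p - g)) ∋ solve-∀) p g)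
    small : ∀ v → I λ′ v ≡ 1ℤ → S ∣ H v → ¬ (T ∣ H v) → S + ST ≤ H v + H g → ⊥
    small v v∈ s∣v t∤v le = pos≰0 {0} (≤-trans 1≤s (≤-lin {c = S + ST} {S + S} {S + S} {ST}
      (≤-trans le (≤-lin {c = H v} {S} {H g} {S} (≤-reflexive (single v 0≤v v∈ s∣v t∤v)) (±s-≤ hg)
          (((∀ s v g → (s + s) - (v + g) ≡ (s - v) + (s - g)) ∋ solve-∀) S (H v) (H g)))) 2S≤ST
      (((∀ s st → 0ℤ - s ≡ ((s + s) - (s + st)) + (st - (s + s))) ∋ solve-∀) S ST)))
      where
      0≤v : 0ℤ ≤ v
      0≤v = 1≤H⇒0≤ (≤-trans 1≤s (≤-trans S≤ST
          (≤-lin le (±s-≤ hg) (((∀ s st v g → v - st ≡ ((v + g) - (s + st)) + (s - g)) ∋ solve-∀) S ST (H v) (H g)))))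
    impossible : Isolated c p → ⊥
    impossible iso with I-01 λ′ w
    ... | inj₁ w∉ = in-Q (I-01 λ′ (w - + c))
      where
      v : ℤ
      v = bar (w - + c)
      Hv : H v ≡ (ST + ST) - H g
      Hv = trans (((∀ w c → (-1ℤ - (w - c)) + (-1ℤ - (w - c)) + 1ℤ ≡ (c + c) - (w + w + 1ℤ)) ∋ solve-∀) w (+ c))
        (trans (cong₂ _-_ 2c Hw) (((∀ h g st → (h - g) - (h - st) ≡ st - g) ∋ solve-∀) (H p) (H g) (ST + ST)))
      in-Q : I λ′ (w - + c) ≡ 0ℤ ⊎ I λ′ (w - + c) ≡ 1ℤ → ⊥
      in-Q (inj₂ q) = ¬both≥0 0≤p (subst (0ℤ ≤_)
          (Isolated.only-Q iso w (w∉ , q) (∣-lin₁ -1ℤ T-mult (((∀ p st → (p - st) - p ≡ -1ℤ * st) ∋ solve-∀) p ST)))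
          0≤w)
      in-Q (inj₁ q) = small v (sym-gap λ′ sy q)
        (∣-lin (+ 2) -1ℤ S-mult S∣g (trans Hv (((∀ st g → (st + st) - g ≡ + 2 * st + -1ℤ * g) ∋ solve-∀) ST (H g))))
        (λ d → t∤-s hg (∣-lin (+ 2) -1ℤ T-mult d
            (trans (((∀ st g → g ≡ + 2 * st + -1ℤ * ((st + st) - g)) ∋ solve-∀) ST (H g))
            (cong (λ z → + 2 * ST + -1ℤ * z) (sym Hv)))))
        (≤-lin₁ S≤ST (trans (cong (λ z → (z + H g) - (S + ST)) Hv)
            (((∀ s st g → (((st + st) - g) + g) - (s + st) ≡ st - s) ∋ solve-∀) S ST (H g))))
    ... | inj₂ w∈ = in-Q (I-01 λ′ (bar w - + c))
      where
      v : ℤ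
      v = bar (bar w - + c)
      Hv : H v ≡ (H p - (ST + ST)) + (H p - H g)
      Hv = trans (((∀ w c → (-1ℤ - ((-1ℤ - w) - c)) + (-1ℤ - ((-1ℤ - w) - c)) + 1ℤ ≡ (w + w + 1ℤ) + (c + c)) ∋
          solve-∀) w (+ c)) (cong₂ _+_ Hw 2c)
      in-Q : I λ′ (bar w - + c) ≡ 0ℤ ⊎ I λ′ (bar w - + c) ≡ 1ℤ → ⊥
      in-Q (inj₂ q) = pos≰0 {0} (≤-trans 1≤s
          (≤-trans S≤ST (≤-reflexive (trans (((∀ p st → st ≡ p - (p - st)) ∋ solve-∀) p ST)
          (trans (cong (λ z → p - z) (bar-inj
              (Isolated.only-Q iso (bar w) (sym-bead λ′ sy w∈ , q)
              (∣-lin 1ℤ -1ℤ T-mult t∣p (((∀ p st → (-1ℤ - (p - st)) - p ≡ 1ℤ * st + -1ℤ * (p + p + 1ℤ)) ∋ solve-∀) p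
              ST))))) (ℤₚ.+-inverseʳ p))))))
      in-Q (inj₁ q) = small v (sym-gap λ′ sy q)
        (∣-≡ (sym Hv) (∣m∣n⇒∣m+n (∣m∣n⇒∣m-n s∣p (∣m∣n⇒∣m+n S-mult S-mult)) (∣m∣n⇒∣m-n s∣p S∣g)))
        (λ d → t∤-s hg (∣-≡ (trans (cong (λ z → ((H p + H p) - (ST + ST)) - z) Hv)
            (((∀ h st g → ((h + h) - st) - ((h - st) + (h - g)) ≡ g) ∋ solve-∀) (H p) (ST + ST) (H g)))
          (∣m∣n⇒∣m-n (∣m∣n⇒∣m-n (∣m∣n⇒∣m+n t∣p t∣p) (∣m∣n⇒∣m+n T-mult T-mult)) d)))
        (≤-lin {c = + 2} {H w + H w} {S} {ST + + 2}
            (≤-lin (0≤⇒1≤H 0≤w) (0≤⇒1≤H 0≤w) (((∀ h → (h + h) - + 2 ≡ (h - 1ℤ) + (h - 1ℤ)) ∋ solve-∀) (H w)))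
            (≤-trans S≤ST (≤-lin₁ {c = 0ℤ} {+ 2} 0≤+n (((∀ st → (st + + 2) - st ≡ + 2 - 0ℤ) ∋ solve-∀) ST)))
          (trans (cong (λ z → (z + H g) - (S + ST)) Hv)
              (trans (((∀ h st g s → (((h - (st + st)) + (h - g)) + g) - (s + st) ≡
              (((h - (st + st)) + (h - (st + st))) - + 2) + ((st + + 2) - s)) ∋ solve-∀) (H p) ST (H g) S)
            (cong (λ z → ((z + z) - + 2) + ((ST + + 2) - S)) (sym Hw)))))
    go : (p - + c ≡ bar p) ⊎ Isolated c p ⊎ T ∣ H (p - + c) → ⊥
    go (inj₁ e) = t∤s (∣-≡ (central-size hg e) t∣p)
    go (inj₂ (inj₁ iso)) = impossible iso
    go (inj₂ (inj₂ d)) = t∤-s hg (∣-≡ (cong H p-c) d)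

-- The origin of inversions, and the core below the special beads

Special : ℕ → ℕ → ℤ → Set
Special s t p = + s ∣ H p ⊎ + t ∣ H p

special? : ∀ s t p → Dec (Special s t p)
special? s t p with + s ∣? H p | + t ∣? H p
... | yes d | _     = yes (inj₁ d)
... | no  _ | yes d = yes (inj₂ d)
... | no  a | no  b = no [ a , b ]′

special-bar : ∀ {s t} p → Special s t p → Special s t (bar p)
special-bar p (inj₁ d) = inj₁ (∣H-bar p d)
special-bar p (inj₂ d) = inj₂ (∣H-bar p d)

special-bar⁻ : ∀ {s t} p → Special s t (bar p) → Special s t p
special-bar⁻ {s} {t} p d = subst (Special s t) (bar-bar p) (special-bar (bar p) d)

∣H-sub : ∀ {S} x c → S ∣ c → S ∣ H x → S ∣ H (x - c)
∣H-sub x c d d′ = ∣-lin (- + 2) 1ℤ d d′ (((∀ x c → (x - c) + (x - c) + 1ℤ ≡ - + 2 * c + 1ℤ * (x + x + 1ℤ)) ∋ solve-∀)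
    x c)

∣H-sub⁻ : ∀ {S} x c → S ∣ c → S ∣ H (x - c) → S ∣ H x
∣H-sub⁻ x c d d′ = ∣-lin (+ 2) 1ℤ d d′ (((∀ x c → x + x + 1ℤ ≡ + 2 * c + 1ℤ * ((x - c) + (x - c) + 1ℤ)) ∋ solve-∀) x
    c)

∣-self : ∀ {S} → S ∣ S
∣-self {S} = divides 1ℤ (sym (ℤₚ.*-identityˡ S))

0≤bar-sub : ∀ x c → 0ℤ ≤ bar x → 0ℤ ≤ bar (x - + c)
0≤bar-sub x c h = ≤-lin {c = 0ℤ} {bar x} {0ℤ} {+ c} h 0≤+n
    (((∀ x c → (-1ℤ - (x - c)) - 0ℤ ≡ ((-1ℤ - x) - 0ℤ) + (c - 0ℤ)) ∋ solve-∀) x (+ c))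

module Inversions
  (s t : ℕ) (1<s : 1 ℕ.< s) (1<t : 1 ℕ.< t) (cop : Coprime s t)
  (λ′ : Partition) (sy : Sym (I λ′)) (σ τ : Partition) (sqs : SEq s λ′ σ) (sqt : SEq t λ′ τ)
  (csσ : Closed s (I σ)) (ctσ : Closed t (I σ)) (csτ : Closed s (I τ)) (ctτ : Closed t (I τ))
  (uniq : ∀ μ → Sym (I μ) → SEq s μ λ′ → SEq t μ λ′ → size μ ≡ size λ′ → μ ≡ λ′) where

  module A = Multiples s t 1<s 1<t cop λ′ sy τ sqt csτ ctτ uniq
  module B = Multiples t s 1<t 1<s (Coprimality.sym cop) λ′ sy σ sqs ctσ csσ (λ μ a b c → uniq μ a c b)

  Sp : ℤ → Set
  Sp p = 0ℤ ≤ p × I λ′ p ≡ 1ℤ × Special s t p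

  source-central : ∀ c x → 1 ℕ.≤ c → + s ∣ + c → I λ′ x ≡ 1ℤ → x - + c ≡ bar x → Sp x
  source-central c x 1≤c s∣c x∈ e = 1≤H⇒0≤ (subst (1ℤ ≤_) (sym (A.H-central c x e)) (ℤ.+≤+ 1≤c)) , x∈ , inj₁
      (∣-≡ (sym (A.H-central c x e)) s∣c)

  source₁ : ∀ c x → 1 ℕ.≤ c → + s ∣ + c → A.InP c x → + t ∣ H x → Sp x ⊎ Sp (bar (x - + c))
  source₁ c x 1≤c s∣c px@(x∈ , x-c∉) t∣x with 0≤⊎0≤bar x
  ... | inj₁ 0≤x = inj₁ (0≤x , x∈ , inj₂ t∣x)
  ... | inj₂ 0≤x̄ with + t ∣? + c
  ...   | yes t∣c = inj₂ (0≤bar-sub x c 0≤x̄ , sym-gap λ′ sy x-c∉ , inj₂ (∣H-bar (x - + c) (∣H-sub x (+ c) t∣c t∣x)))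
  ...   | no  t∤c with A.inversion c x s∣c t∤c px
  ...     | inj₁ e = inj₁ (source-central c x 1≤c s∣c x∈ e)
  ...     | inj₂ (inj₂ d) = ⊥-elim
      (t∤c (odd-∣2 x (+ c) t∣x (∣-lin 1ℤ -1ℤ t∣x d
      (((∀ x c → c + c ≡ 1ℤ * (x + x + 1ℤ) + -1ℤ * ((x - c) + (x - c) + 1ℤ)) ∋ solve-∀) x (+ c)))))
  -- Since x is negative and isolated, `bar x - c` is a bead. It stands above the gap x - c at
  -- distance - H x, a multiple of t, so the trichotomy with s and t exchanged applies.
  ...     | inj₂ (inj₁ iso) = go (B.inversion-any k X 1≤k t∣k
      (A.Isolated.opposite iso , trans (cong (I λ′) X-k) x-c∉))
    where
    X : ℤ
    X = bar x - + c
    k : ℕ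
    k = pos (bar x - x)
    x≤x̄ : x ≤ bar x
    x≤x̄ = ≤-lin (0≤⇒1≤H 0≤x̄) (0≤+n {1})
        (((∀ x → (-1ℤ - x) - x ≡ (((-1ℤ - x) + (-1ℤ - x) + 1ℤ) - 1ℤ) + (1ℤ - 0ℤ)) ∋ solve-∀) x)
    k-eq : + k ≡ bar x - x
    k-eq = pos-id (≤⇒0≤ x≤x̄)
    1≤k : 1 ℕ.≤ k
    1≤k = ≢⇒1≤pos x≤x̄ (λ e → 0≢1 (sym-bead λ′ sy x∈) (trans (cong (I λ′) e) x∈))
    t∣k : + t ∣ + k
    t∣k = ∣-lin₁ -1ℤ t∣x (trans k-eq (((∀ x → (-1ℤ - x) - x ≡ -1ℤ * (x + x + 1ℤ)) ∋ solve-∀) x))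
    X-k : X - + k ≡ x - + c
    X-k = trans (cong (λ z → X - z) k-eq) (((∀ x c → ((-1ℤ - x) - c) - ((-1ℤ - x) - x) ≡ x - c) ∋ solve-∀) x (+ c))
    finish : + s ∣ H (x - + c) → Sp x ⊎ Sp (bar (x - + c))
    finish d = inj₂ (0≤bar-sub x c 0≤x̄ , sym-gap λ′ sy x-c∉ , inj₁ (∣H-bar (x - + c) d))
    go : (X - + k ≡ bar X) ⊎ + s ∣ H X ⊎ + s ∣ H (X - + k) → Sp x ⊎ Sp (bar (x - + c))
    go (inj₁ e) = ⊥-elim (t∤c (divides 0ℤ (ℤₚ.*-cancelˡ-≡ (+ 2) (+ c) 0ℤ
      (trans (((∀ x c → + 2 * c ≡ (-1ℤ - ((-1ℤ - x) - c)) - (x - c)) ∋ solve-∀) x (+ c))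
          (trans (cong (λ z → bar X - z) (trans (sym X-k) e)) (ℤₚ.+-inverseʳ (bar X)))))))
    go (inj₂ (inj₁ d)) = finish (∣H-sub x (+ c) s∣c
        (subst (λ z → + s ∣ H z) (bar-bar x) (∣H-bar (bar x) (∣H-sub⁻ (bar x) (+ c) s∣c d))))
    go (inj₂ (inj₂ d)) = finish (∣-≡ (cong H X-k) d)

  -- The special beads are thus the sole obstruction to being a core: an inversion or its mirror
  -- image starts at one of them.
  source : ∀ c x → 1 ℕ.≤ c → + s ∣ + c → A.InP c x → Sp x ⊎ Sp (bar (x - + c))
  source c x 1≤c s∣c px with A.inversion-any c x 1≤c s∣c px
  ... | inj₁ e        = inj₁ (source-central c x 1≤c s∣c (proj₁ px) e)
  ... | inj₂ (inj₁ d) = source₁ c x 1≤c s∣c px d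
  ... | inj₂ (inj₂ d) with source₁ c (bar (x - + c)) 1≤c s∣c (A.mirror-P c x px) (∣H-bar (x - + c) d)
  ...   | inj₁ q = inj₂ q
  ...   | inj₂ q = inj₁ (subst Sp (trans (cong bar (A.mirror c x)) (bar-bar x)) q)

module Base
  (s t : ℕ) (1<s : 1 ℕ.< s) (1<t : 1 ℕ.< t) (cop : Coprime s t)
  (λ′ : Partition) (sy : Sym (I λ′)) (σ τ : Partition) (sqs : SEq s λ′ σ) (sqt : SEq t λ′ τ)
  (csσ : Closed s (I σ)) (ctσ : Closed t (I σ)) (csτ : Closed s (I τ)) (ctτ : Closed t (I τ))
  (uniq : ∀ μ → Sym (I μ) → SEq s μ λ′ → SEq t μ λ′ → size μ ≡ size λ′ → μ ≡ λ′) where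

  open Inversions s t 1<s 1<t cop λ′ sy σ τ sqs sqt csσ ctσ csτ ctτ uniq public
  module Swapped = Inversions t s 1<t 1<s (Coprimality.sym cop) λ′ sy τ σ sqt sqs ctτ csτ ctσ csσ
      (λ μ a b c → uniq μ a c b)

  -- Moving all special beads to their negative mirror images leaves a set closed under x ↦ x - s.
  closed-base : ∀ f → Is01 f → (∀ x → Special s t x → f x ≡ vac x) → (∀ x → ¬ Special s t x → f x ≡ I λ′ x) →
      Closed s f
  closed-base f f01 f-special f-other y fy with f01 (y - + s)
  ... | inj₂ q = q
  ... | inj₁ q = ⊥-elim (no-inversion y fy q)
    where
    1≤s : 1 ℕ.≤ s
    1≤s = ℕₚ.<⇒≤ 1<s
    vac-neg : ∀ y → vac y ≡ 1ℤ → vac (y - + s) ≡ 1ℤ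
    vac-neg -[1+ n ] e = cong vac (((∀ n s → - (1ℤ + n) - s ≡ - (1ℤ + (n + s))) ∋ solve-∀) (+ n) (+ s))
    vac⇒neg : ∀ y → vac y ≡ 1ℤ → 0ℤ ≤ bar y
    vac⇒neg -[1+ n ] e = 0≤+n
    -- A special bead y of f is negative by the choice of f, although λ itself may have a gap there;
    -- the two possibilities are treated separately.
    special-first : ∀ y → f y ≡ 1ℤ → f (y - + s) ≡ 0ℤ → Special s t y → ⊥
    special-first y fy fz sp with special? s t (y - + s)
    ... | yes sp′ = 0≢1 fz (trans (f-special (y - + s) sp′) (vac-neg y (trans (sym (f-special y sp)) fy)))
    special-first y fy fz (inj₁ d) | no nsp = nsp (inj₁ (∣H-sub y (+ s) ∣-self d))
    special-first y fy fz (inj₂ d) | no nsp with I-01 λ′ y | I-01 λ′ (bar y - + s)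
    ... | inj₂ y∈ | _ = src (source s y 1≤s ∣-self (y∈ , z∉))
      where
      z∉ : I λ′ (y - + s) ≡ 0ℤ
      z∉ = trans (sym (f-other _ nsp)) fz
      src : Sp y ⊎ Sp (bar (y - + s)) → ⊥
      src (inj₁ (0≤y , _)) = ¬both≥0 0≤y (vac⇒neg y (trans (sym (f-special y (inj₂ d))) fy))
      src (inj₂ (_ , _ , sp)) = nsp (special-bar⁻ (y - + s) sp)
    ... | inj₁ y∉ | inj₁ q = cls (A.inversion s (bar y) ∣-self A.t∤s (sym-gap λ′ sy y∉ , q))
      where
      cls : (bar y - + s ≡ bar (bar y)) ⊎ A.Isolated s (bar y) ⊎ + t ∣ H (bar y - + s) → ⊥
      cls (inj₁ e) = nsp (inj₁ (∣H-sub y (+ s) ∣-self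
          (divides -1ℤ (trans (((∀ y s → y + y + 1ℤ ≡ (y - ((-1ℤ - y) - s)) + -1ℤ * s) ∋ solve-∀) y (+ s))
        (trans (cong (λ z → (y - z) + -1ℤ * + s) (trans e (bar-bar y)))
            (((∀ y s → (y - y) + -1ℤ * s ≡ -1ℤ * s) ∋ solve-∀) y (+ s)))))))
      cls (inj₂ (inj₁ iso)) = 0≢1 (trans (sym (f-other _ nsp)) fz)
          (trans (cong (λ z → I λ′ (z - + s)) (sym (bar-bar y))) (A.Isolated.opposite iso))
      cls (inj₂ (inj₂ d′)) = A.t∤s (odd-∣2 y (+ s) d
          (∣-lin -1ℤ -1ℤ d d′ (((∀ y s → s + s ≡ -1ℤ * (y + y + 1ℤ) + -1ℤ * (((-1ℤ - y) - s) + ((-1ℤ - y) - s) + 1ℤ))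
          ∋ solve-∀) y (+ s))))
    -- The bead `bar y - s` stands above the gap y - s at distance `bar y - y`, a multiple of t. So
    -- `source` with s and t exchanged applies, and neither end is special.
    ... | inj₁ y∉ | inj₂ X∈ = src (Swapped.source k X 1≤k t∣k
        (X∈ , trans (cong (I λ′) X-k) (trans (sym (f-other _ nsp)) fz)))
      where
      0≤ȳ : 0ℤ ≤ bar y
      0≤ȳ = vac⇒neg y (trans (sym (f-special y (inj₂ d))) fy)
      X : ℤ
      X = bar y - + s
      k : ℕ
      k = pos (bar y - y)
      y≤ȳ : y ≤ bar y
      y≤ȳ = ≤-lin (0≤⇒1≤H 0≤ȳ) (0≤+n {1})
          (((∀ x → (-1ℤ - x) - x ≡ (((-1ℤ - x) + (-1ℤ - x) + 1ℤ) - 1ℤ) + (1ℤ - 0ℤ)) ∋ solve-∀) y)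
      k-eq : + k ≡ bar y - y
      k-eq = pos-id (≤⇒0≤ y≤ȳ)
      1≤k : 1 ℕ.≤ k
      1≤k = ≢⇒1≤pos y≤ȳ (λ e → 0≢1 y∉ (trans (cong (I λ′) (sym e)) (sym-gap λ′ sy y∉)))
      t∣k : + t ∣ + k
      t∣k = ∣-lin₁ -1ℤ d (trans k-eq (((∀ x → (-1ℤ - x) - x ≡ -1ℤ * (x + x + 1ℤ)) ∋ solve-∀) y))
      X-k : X - + k ≡ y - + s
      X-k = trans (cong (λ z → X - z) k-eq) (((∀ x c → ((-1ℤ - x) - c) - ((-1ℤ - x) - x) ≡ x - c) ∋ solve-∀) y (+ s))
      nspX : ¬ Special t s X
      nspX (inj₁ d′) = A.t∤s (odd-∣2 y (+ s) d
          (∣-lin -1ℤ -1ℤ d d′ (((∀ y s → s + s ≡ -1ℤ * (y + y + 1ℤ) + -1ℤ * (((-1ℤ - y) - s) + ((-1ℤ - y) - s) + 1ℤ))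
          ∋ solve-∀) y (+ s))))
      nspX (inj₂ d′) = nsp (inj₁ (∣H-sub y (+ s) ∣-self
          (subst (λ z → + s ∣ H z) (bar-bar y) (∣H-bar (bar y) (∣H-sub⁻ (bar y) (+ s) ∣-self d′)))))
      src : Swapped.Sp X ⊎ Swapped.Sp (bar (X - + k)) → ⊥
      src (inj₁ (_ , _ , sp)) = nspX sp
      src (inj₂ (_ , _ , sp)) = nsp ([ inj₂ , inj₁ ]′ (subst (Special t s) X-k (special-bar⁻ (X - + k) sp)))
    no-inversion : ∀ y → f y ≡ 1ℤ → f (y - + s) ≡ 0ℤ → ⊥
    no-inversion y fy fz with special? s t y | special? s t (y - + s)
    ... | yes sp | _ = special-first y fy fz sp
    ... | no nsp | no nsp′ = src (source s y 1≤s ∣-self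
        (trans (sym (f-other y nsp)) fy , trans (sym (f-other _ nsp′)) fz))
      where
      src : Sp y ⊎ Sp (bar (y - + s)) → ⊥
      src (inj₁ (_ , _ , sp)) = nsp sp
      src (inj₂ (_ , _ , sp)) = nsp′ (special-bar⁻ (y - + s) sp)
    -- The mirror image of this inversion starts at a special position.
    ... | no nsp | yes sp′ = special-first (bar (y - + s)) fz̄ fȳ (special-bar (y - + s) sp′)
      where
      vac-bar : ∀ x → vac x ≡ 0ℤ → vac (bar x) ≡ 1ℤ
      vac-bar (+ n) e = cong vac (bar-+ n)
      fz̄ : f (bar (y - + s)) ≡ 1ℤ
      fz̄ = trans (f-special _ (special-bar (y - + s) sp′)) (vac-bar _ (trans (sym (f-special _ sp′)) fz))
      fȳ : f (bar (y - + s) - + s) ≡ 0ℤ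
      fȳ = trans (cong f (A.mirror s y)) (trans (f-other (bar y) (λ sp → nsp (special-bar⁻ y sp)))
          (sym-bead λ′ sy (trans (sym (f-other y nsp)) fy)))

-- Bounds on simultaneous cores

opaque
  bezout : ∀ {s t} → Coprime s t → ∃[ u ] ∃[ v ] (u * + s + v * + t ≡ 1ℤ)
  bezout {s} {t} cop with Coprimality.coprime-Bézout cop
  ... | Bézout.+- x y e = + x , - (+ y) , trans (cong (λ z → z + - (+ y) * + t)
          (trans (sym (ℤₚ.pos-* x s)) (trans (cong +_ (sym e)) (cong (λ z → 1ℤ + z) (ℤₚ.pos-* y t)))))
          (((∀ y t → (1ℤ + y * t) + - y * t ≡ 1ℤ) ∋ solve-∀) (+ y) (+ t))
  ... | Bézout.-+ x y e = - (+ x) , + y , trans (cong (λ z → - (+ x) * + s + z)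
          (trans (sym (ℤₚ.pos-* y t)) (trans (cong +_ (sym e)) (cong (λ z → 1ℤ + z) (ℤₚ.pos-* x s)))))
          (((∀ x s → - x * s + (1ℤ + x * s) ≡ 1ℤ) ∋ solve-∀) (+ x) (+ s))

opaque
  residue : ∀ t → 1 ℕ.≤ t → ∀ x → ∃[ r ] (r ℕ.< t × + t ∣ x - + r)
  residue t@(suc _) _ x = x %ℕ t , n%ℕd<d x t , divides (x /ℕ t)
    (trans (cong (_- + (x %ℕ t)) (a≡a%ℕn+[a/ℕn]*n x t))
        (((∀ a b → (a + b) - a ≡ b) ∋ solve-∀) (+ (x %ℕ t)) ((x /ℕ t) * + t)))

¬∣small : ∀ {t} a b → a ℕ.< t → b ℕ.< a → ¬ (+ t ∣ + a - + b)
¬∣small {t} a b a<t b<a d = ℕₚ.<-irrefl refl (ℕₚ.≤-trans a<t (ℤₚ.drop‿+≤+ (≤-trans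
  (pos-mult-≥ d (≤-lin₁ (ℤ.+≤+ b<a) (((∀ a b → (a - b) - 1ℤ ≡ a - (1ℤ + b)) ∋ solve-∀) (+ a) (+ b))))
  (≤-lin₁ {c = 0ℤ} {+ b} 0≤+n (((∀ a b → a - (a - b) ≡ b - 0ℤ) ∋ solve-∀) (+ a) (+ b))))))

residue-unique : ∀ {t r r′} → r ℕ.< t → r′ ℕ.< t → + t ∣ + r - + r′ → r ≡ r′
residue-unique {t} {r} {r′} r<t r′<t d with ℕₚ.<-cmp r r′
... | tri< lt _ _ = ⊥-elim (¬∣small r′ r r′<t lt
    (∣-lin₁ -1ℤ d (((∀ r r′ → r′ - r ≡ -1ℤ * (r - r′)) ∋ solve-∀) (+ r) (+ r′))))
... | tri≈ _ e _ = e
... | tri> _ _ gt = ⊥-elim (¬∣small r r′ r<t gt d)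

opaque
  solve-class : ∀ {s t} → 1 ℕ.≤ t → Coprime s t → ∀ x → ∃[ k ] (k ℕ.< t × + t ∣ x - + k * + s)
  solve-class {s} {t} 1≤t cop x with bezout cop
  ... | u , v , e with residue t 1≤t (x * u)
  ...   | k , k<t , d = k , k<t , ∣-lin (+ s) (x * v) d ∣-self
    (trans (cong (λ z → z - + k * + s) (trans (sym (ℤₚ.*-identityʳ x)) (cong (x *_) (sym e))))
      (((∀ x u v s t k → x * (u * s + v * t) - k * s ≡ s * (x * u - k) + (x * v) * t) ∋ solve-∀) x u v (+ s) (+ t)
          (+ k)))

SymCore : ℕ → ℕ → Partition → Set
SymCore s t σ = Sym (I σ) × Closed s (I σ) × Closed t (I σ)

frob : ℕ → ℕ → ℤ
frob s t = (+ s * + t - + s) - + t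

-- Beyond the Frobenius number H x = a s + b t, and then bar x = x - a s - b t is also in the core.
core-bound : ∀ {s t} → 1 ℕ.≤ s → Coprime s t → ∀ σ → SymCore s t σ → ∀ x → I σ x ≡ 1ℤ → H x ≤ frob s t
core-bound {s} {t} 1≤s cop σ (sy , cs , ct) x x∈ with H x ≤? frob s t
... | yes q = q
... | no ¬q with solve-class 1≤s (Coprimality.sym cop) (H x)
...   | b , b<s , divides a e = ⊥-elim (0≢1 (sym-bead σ sy x∈) (trans (cong (I σ) (sym to-bar)) (by-sign a e)))
  where
  to-bar : (x - + b * + t) - (H x - + b * + t) ≡ bar x
  to-bar = ((∀ x bt → (x - bt) - ((x + x + 1ℤ) - bt) ≡ -1ℤ - x) ∋ solve-∀) x (+ b * + t)
  by-sign : ∀ a → H x - + b * + t ≡ a * + s → I σ ((x - + b * + t) - (H x - + b * + t)) ≡ 1ℤ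
  by-sign (+ a) e = trans (cong (λ z → I σ ((x - + b * + t) - z)) e) (closed-mult cs a _ (closed-mult ct b x x∈))
  -- As b ≤ s - 1 and H x > s t - s - t, the left side is at least 1 - s, so it is no negative
  -- multiple of s.
  by-sign -[1+ a ] e = ⊥-elim (pos≰0 {0} (≤-lin {c = 1ℤ - + s} {d = - (+ suc a * + s)} {e = + s} {f = + suc a * + s}
    (≤-trans (≤-lin {c = 1ℤ + frob s t} {H x} {0ℤ} {(+ s - (1ℤ + + b)) * + t} (≰⇒1+≤ ¬q)
        (0≤* {+ s - (1ℤ + + b)} {+ t} (≤⇒0≤ (ℤ.+≤+ b<s)) 0≤+n)
        (((∀ h s t b → (h - b * t) - (1ℤ - s) ≡ (h - (1ℤ + ((s * t - s) - t))) + ((s - (1ℤ + b)) * t - 0ℤ)) ∋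
            solve-∀) (H x) (+ s) (+ t) (+ b)))
      (≤-reflexive (trans e (((∀ a s → - a * s ≡ - (a * s)) ∋ solve-∀) (+ suc a) (+ s)))))
    (≤-by (+ a * + s) (0≤* {+ a} {+ s} 0≤+n 0≤+n) (((∀ a s → (1ℤ + a) * s - s ≡ a * s) ∋ solve-∀) (+ a) (+ s)))
    (((∀ s as → 0ℤ - 1ℤ ≡ (- as - (1ℤ - s)) + (as - s)) ∋ solve-∀) (+ s) (+ suc a * + s))))

Σ< : ℕ → (ℕ → ℤ) → ℤ
Σ< zero    f = 0ℤ
Σ< (suc n) f = Σ< n f + f n

Σ<-cong : ∀ n {f g} → (∀ i → f i ≡ g i) → Σ< n f ≡ Σ< n g
Σ<-cong zero    e = refl
Σ<-cong (suc n) e = cong₂ _+_ (Σ<-cong n e) (e n)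

Σ<-+ : ∀ n f g → Σ< n (λ i → f i + g i) ≡ Σ< n f + Σ< n g
Σ<-+ zero    f g = refl
Σ<-+ (suc n) f g = trans (cong (_+ (f n + g n)) (Σ<-+ n f g))
  (((∀ a b c d → (a + b) + (c + d) ≡ (a + c) + (b + d)) ∋ solve-∀) (Σ< n f) (Σ< n g) (f n) (g n))

Σ<-* : ∀ n k f → Σ< n (λ i → k * f i) ≡ k * Σ< n f
Σ<-* zero    k f = sym (ℤₚ.*-zeroʳ k)
Σ<-* (suc n) k f = trans (cong (_+ k * f n) (Σ<-* n k f)) (sym (ℤₚ.*-distribˡ-+ k (Σ< n f) (f n)))

Σ<-const : ∀ n k → Σ< n (λ _ → k) ≡ + n * k
Σ<-const zero    k = refl
Σ<-const (suc n) k = trans (cong (_+ k) (Σ<-const n k)) (((∀ n k → n * k + k ≡ (1ℤ + n) * k) ∋ solve-∀) (+ n) k)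

Σ<-0 : ∀ n {f} → (∀ i → i ℕ.< n → f i ≡ 0ℤ) → Σ< n f ≡ 0ℤ
Σ<-0 zero    z = refl
Σ<-0 (suc n) z = cong₂ _+_ (Σ<-0 n (λ i p → z i (ℕₚ.≤-trans p (ℕₚ.n≤1+n n)))) (z n ℕₚ.≤-refl)

Σ<-single : ∀ n {f v} i → i ℕ.< n → f i ≡ v → (∀ j → j ℕ.< n → j ≢ i → f j ≡ 0ℤ) → Σ< n f ≡ v
Σ<-single (suc n) {f} i (s≤s i≤n) e z with ℕₚ.m≤n⇒m<n∨m≡n i≤n
... | inj₁ i<n  = trans (cong₂ _+_ (Σ<-single n i i<n e (λ j p → z j (ℕₚ.≤-trans p (ℕₚ.n≤1+n n))))
    (z n ℕₚ.≤-refl (λ q → ℕₚ.<-irrefl (sym q) i<n))) (+-identityʳ _)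
... | inj₂ refl = trans (cong₂ _+_ (Σ<-0 n (λ j p → z j (ℕₚ.≤-trans p (ℕₚ.n≤1+n n)) (λ q → ℕₚ.<-irrefl q p))) e)
    (+-identityˡ _)

Σ<-≥0 : ∀ n {f} → (∀ i → 0ℤ ≤ f i) → 0ℤ ≤ Σ< n f
Σ<-≥0 zero    p = ≤-refl
Σ<-≥0 (suc n) p = 0≤+ (Σ<-≥0 n p) (p n)

Σ<-zero : ∀ n {f} → (∀ i → 0ℤ ≤ f i) → Σ< n f ≤ 0ℤ → ∀ i → i ℕ.< n → f i ≡ 0ℤ
Σ<-zero (suc n) {f} p q i (s≤s i≤n) with ℕₚ.m≤n⇒m<n∨m≡n i≤n
... | inj₁ i<n  = Σ<-zero n p (≤-lin q (p n) (((∀ a b → 0ℤ - a ≡ (0ℤ - (a + b)) + (b - 0ℤ)) ∋ solve-∀) (Σ< n f)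
    (f n))) i i<n
... | inj₂ refl = ℤₚ.≤-antisym (≤-lin q (Σ<-≥0 n p) (((∀ a b → 0ℤ - b ≡ (0ℤ - (a + b)) + (a - 0ℤ)) ∋ solve-∀)
    (Σ< n f) (f n))) (p n)

Σ<-front : ∀ n f → Σ< (suc n) f ≡ f 0 + Σ< n (λ i → f (suc i))
Σ<-front zero    f = ℤₚ.+-comm 0ℤ (f 0)
Σ<-front (suc n) f = trans (cong (_+ f (suc n)) (Σ<-front n f))
    (ℤₚ.+-assoc (f 0) (Σ< n (λ i → f (suc i))) (f (suc n)))

+-cancelˡ : ∀ a {b c} → a + b ≡ a + c → b ≡ c
+-cancelˡ a {b} {c} e = trans (((∀ a b → b ≡ (a + b) - a) ∋ solve-∀) a b)
    (trans (cong (_- a) e) (((∀ a b → (a + b) - a ≡ b) ∋ solve-∀) a c))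

Periodic : ℕ → (ℤ → ℤ) → Set
Periodic t G = ∀ x → G (x + + t) ≡ G x

Σ<-rotate : ∀ t G → Periodic t G → ∀ k → Σ< t (λ r → G (+ r + + k)) ≡ Σ< t (λ r → G (+ r))
Σ<-rotate t G per zero    = Σ<-cong t (λ r → cong G (+-identityʳ (+ r)))
Σ<-rotate t G per (suc k) = trans (+-cancelˡ (G (+ 0 + + k))
    (trans (sym (trans (Σ<-front t (λ r → G (+ r + + k)))
        (cong (λ z → G (+ 0 + + k) + z)
        (Σ<-cong t (λ r → cong G (((∀ r k → (1ℤ + r) + k ≡ r + (1ℤ + k)) ∋ solve-∀) (+ r) (+ k)))))))
      (trans (cong (λ z → Σ< t (λ r → G (+ r + + k)) + z)
          (trans (cong G (((∀ t k → t + k ≡ (0ℤ + k) + t) ∋ solve-∀) (+ t) (+ k))) (per (+ 0 + + k))))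
        (ℤₚ.+-comm (Σ< t (λ r → G (+ r + + k))) (G (+ 0 + + k))))))
  (Σ<-rotate t G per k)

hs-Σ< : ∀ n (f : ℕ → ℤ → ℤ) (v : ℕ → ℤ) → (∀ i → HasSum (f i) (v i)) → HasSum (λ x → Σ< n (λ i → f i x)) (Σ< n v)
hs-Σ< zero    f v h = hs-0
hs-Σ< (suc n) f v h = hs-+ (hs-Σ< n f v h) (h n)

-- The largest simultaneous core

Σ<-swap : ∀ m n (f : ℕ → ℕ → ℤ) → Σ< m (λ i → Σ< n (f i)) ≡ Σ< n (λ j → Σ< m (λ i → f i j))
Σ<-swap zero    n f = sym (trans (Σ<-const n 0ℤ) (ℤₚ.*-zeroʳ (+ n)))
Σ<-swap (suc m) n f = trans (cong (_+ Σ< n (f m)) (Σ<-swap m n f)) (sym (Σ<-+ n (λ j → Σ< m (λ i → f i j)) (f m)))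

module Tops (t : ℕ) (1≤t : 1 ℕ.≤ t) (κ : Partition) (ct : Closed t (I κ)) where

  u : ℤ → ℤ
  u x = proj₁ (class-top t κ x 1≤t)

  u-class : ∀ x → + t ∣ u x - x
  u-class x = proj₁ (proj₂ (class-top t κ x 1≤t))

  u-in : ∀ x → I κ (u x) ≡ 1ℤ
  u-in x = proj₁ (proj₂ (proj₂ (class-top t κ x 1≤t)))

  u-out : ∀ x → I κ (u x + + t) ≡ 0ℤ
  u-out x = proj₂ (proj₂ (proj₂ (class-top t κ x 1≤t)))

  below-gap : ∀ {z y} → I κ (y + + t) ≡ 0ℤ → I κ z ≡ 1ℤ → + t ∣ z - y → z ≤ y
  below-gap {z} {y} out z∈ d with z ≤? y
  ... | yes q = q
  ... | no ¬q = ⊥-elim (0≢1 out (closed-∣ ct z (y + + t)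
      (∣-lin 1ℤ -1ℤ d ∣-self (((∀ z y t → z - (y + t) ≡ 1ℤ * (z - y) + -1ℤ * t) ∋ solve-∀) z y (+ t)))
      (≤-lin₁ (pos-mult-≥ d (≤-lin₁ (≰⇒1+≤ ¬q) (((∀ z y → (z - y) - 1ℤ ≡ z - (1ℤ + y)) ∋ solve-∀) z y)))
          (((∀ z y t → z - (y + t) ≡ (z - y) - t) ∋ solve-∀) z y (+ t))) z∈))

  u-max : ∀ {z} x → I κ z ≡ 1ℤ → + t ∣ z - x → z ≤ u x
  u-max {z} x z∈ d = below-gap (u-out x) z∈
      (∣-lin 1ℤ -1ℤ d (u-class x) (((∀ z u x → z - u ≡ 1ℤ * (z - x) + -1ℤ * (u - x)) ∋ solve-∀) z (u x) x))

  u-unique : ∀ {z} x → + t ∣ z - x → I κ z ≡ 1ℤ → I κ (z + + t) ≡ 0ℤ → u x ≡ z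
  u-unique {z} x d z∈ out = ℤₚ.≤-antisym
    (below-gap out (u-in x) (∣-lin 1ℤ -1ℤ (u-class x) d
        (((∀ z u x → u - z ≡ 1ℤ * (u - x) + -1ℤ * (z - x)) ∋ solve-∀) z (u x) x)))
    (u-max x z∈ d)

  u-cong : ∀ x y → + t ∣ x - y → u x ≡ u y
  u-cong x y d = u-unique x (∣-lin 1ℤ -1ℤ (u-class y) d (((∀ u x y → u - x ≡ 1ℤ * (u - y) + -1ℤ * (x - y)) ∋ solve-∀)
      (u y) x y)) (u-in y) (u-out y)

  u-periodic : Periodic t u
  u-periodic x = u-cong (x + + t) x (∣-lin₁ 1ℤ ∣-self (((∀ x t → (x + t) - x ≡ 1ℤ * t) ∋ solve-∀) x (+ t)))

  -- Each class is filled exactly up to its top, so the right side is the indicator of the set of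
  -- tops.
  descents : ∀ x → Σ< t (λ r → δ (u (+ r)) x) ≡ I κ x - I κ (x + + t)
  descents x with I-01 κ x | I-01 κ (x + + t)
  ... | inj₁ a | inj₁ b rewrite a | b = Σ<-0 t (λ r _ → δ-≢ λ { refl → 0≢1 a (u-in (+ r)) })
  ... | inj₁ a | inj₂ b = ⊥-elim (0≢1 a (trans (cong (I κ) (((∀ x t → x ≡ (x + t) - t) ∋ solve-∀) x (+ t))) (ct _ b)))
  ... | inj₂ a | inj₂ b rewrite a | b = Σ<-0 t (λ r _ → δ-≢ λ { refl → 0≢1 (u-out (+ r)) b })
  ... | inj₂ a | inj₁ b rewrite a | b with residue t 1≤t x
  ...   | r , r<t , d = Σ<-single t r r<t (δ-≡ (sym (u-unique (+ r) d a b)))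
    (λ j j<t j≢r → δ-≢ λ { refl → j≢r
        (residue-unique j<t r<t (∣-lin 1ℤ -1ℤ d (u-class (+ j))
        (((∀ u j r → j - r ≡ 1ℤ * (u - r) + -1ℤ * (u - j)) ∋ solve-∀) (u (+ j)) (+ j) (+ r)))) })

  A B : ℤ
  A = Σ< t (λ r → u (+ r) * u (+ r))
  B = Σ< t (λ r → u (+ r))

module Compare (t : ℕ) (1≤t : 1 ℕ.≤ t) (μ κ : Partition) (ctμ : Closed t (I μ)) (ctκ : Closed t (I κ)) where

  module M = Tops t 1≤t μ ctμ
  module K = Tops t 1≤t κ ctκ

  f : ℤ → ℤ
  f x = I μ x - I κ x

  hs-f : HasSum f 0ℤ
  hs-f = hs-cong (λ x → ((∀ a b v → (a - v) - (b - v) ≡ a - b) ∋ solve-∀) (I μ x) (I κ x) (vac x))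
      (hs-∸ (hs-charge μ) (hs-charge κ))

  -- Summation by parts in steps of t turns sums over tops into weighted sums over all positions.
  -- The weights x and x² give the sum of the tops and the size.
  moment : ∀ (φ : ℤ → ℤ) → HasSum (λ x → (φ x - φ (x - + t)) * f x)
      (Σ< t (λ r → φ (M.u (+ r))) - Σ< t (λ r → φ (K.u (+ r))))
  moment φ with hs-mul φ hs-f | hs-mul (λ x → φ (x - + t)) hs-f
  ... | w , h | w′ , h′ = hs-val total
      (hs-cong (λ x → ((∀ a b f → a * f - b * f ≡ (a - b) * f) ∋ solve-∀) (φ x) (φ (x - + t)) (f x)) (hs-∸ h h′))
    where
    weighted : ∀ (u : ℤ → ℤ) → HasSum (λ x → φ x * Σ< t (λ r → δ (u (+ r)) x)) (Σ< t (λ r → φ (u (+ r))))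
    weighted u = hs-cong (λ x → Σ<-* t (φ x) (λ r → δ (u (+ r)) x))
        (hs-Σ< t (λ r x → φ x * δ (u (+ r)) x) _ (λ r → hs-mul-δ φ (u (+ r))))
    total : w - w′ ≡ Σ< t (λ r → φ (M.u (+ r))) - Σ< t (λ r → φ (K.u (+ r)))
    total = hs-unique
      (hs-∸ h (hs-cong (λ x → cong (λ z → φ z * f (x + + t)) (((∀ x t → (x + t) - t ≡ x) ∋ solve-∀) x (+ t)))
          (hs-shift (+ t) h′)))
      (hs-cong (λ x → trans (cong₂ (λ a b → φ x * a - φ x * b) (M.descents x) (K.descents x))
          (((∀ p a a′ b b′ → p * (a - a′) - p * (b - b′) ≡ p * (a - b) - p * (a′ - b′)) ∋ solve-∀) (φ x) (I μ x)
              (I μ (x + + t)) (I κ x) (I κ (x + + t))))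
        (hs-∸ (weighted M.u) (weighted K.u)))

  same-B : M.B ≡ K.B
  same-B = ℤₚ.i-j≡0⇒i≡j M.B K.B (sym (hs-unique
    (hs-val (ℤₚ.*-zeroʳ (+ t)) (hs-cong (λ x → cong (_* f x) (((∀ x t → t ≡ x - (x - t)) ∋ solve-∀) x (+ t)))
        (hs-* (+ t) hs-f)))
    (moment (λ x → x))))

  size-squares : (+ 2 * + t) * (+ size μ - + size κ) ≡ M.A - K.A
  size-squares = hs-unique
    (hs-val (((∀ t d → (+ 2 * t) * d - (t * t) * 0ℤ ≡ (+ 2 * t) * d) ∋ solve-∀) (+ t) (+ size μ - + size κ))
      (hs-cong (λ x → ((∀ x t f → (+ 2 * t) * (x * f) - (t * t) * f ≡ (x * x - (x - t) * (x - t)) * f) ∋ solve-∀) x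
          (+ t) (f x))
        (hs-∸ (hs-* (+ 2 * + t) (hs-size-diff μ κ)) (hs-* (+ t * + t) hs-f))))
    (moment (λ x → x * x))

module Defect (s t : ℕ) (1<s : 1 ℕ.< s) (1<t : 1 ℕ.< t) (cop : Coprime s t) where

  1≤t : 1 ℕ.≤ t
  1≤t = ℕₚ.<⇒≤ 1<t

  k : ℕ → ℕ
  k q = proj₁ (solve-class 1≤t cop (+ q))

  k<t : ∀ q → k q ℕ.< t
  k<t q = proj₁ (proj₂ (solve-class 1≤t cop (+ q)))

  k-class : ∀ q → + t ∣ + q - + k q * + s
  k-class q = proj₂ (proj₂ (solve-class 1≤t cop (+ q)))

  -- The part of the defect shared by all cores: the terms of the expanded products that do not
  -- involve the tops.
  bound : ℤ
  bound = Σ< t (λ q → + t * (((+ t - + k q) * + k q) * (+ s * + s)))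

  module Of (μ : Partition) (cs : Closed s (I μ)) (ct : Closed t (I μ)) where
    open Tops t 1≤t μ ct public

    w : ℕ → ℕ → ℤ
    w q r = u (+ r + + q) - u (+ r)

    w-hi : ∀ q r → 0ℤ ≤ + k q * + s - w q r
    w-hi q r = ≤⇒0≤ {w q r} {+ k q * + s} (≤-lin₁ (u-max (+ r) (closed-mult cs (k q) _ (u-in (+ r + + q)))
        (∣-lin 1ℤ 1ℤ (u-class (+ r + + q)) (k-class q)
            (((∀ u r q ks → (u - ks) - r ≡ 1ℤ * (u - (r + q)) + 1ℤ * (q - ks)) ∋ solve-∀) (u (+ r + + q)) (+ r) (+ q)
            (+ k q * + s))))
      (((∀ a b c → c - (a - b) ≡ b - (a - c)) ∋ solve-∀) (u (+ r + + q)) (u (+ r)) (+ k q * + s)))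

    w-lo : ∀ q r → 0ℤ ≤ w q r + (+ t - + k q) * + s
    w-lo q r = subst (0ℤ ≤_) (((∀ a b c → a - (b - c) ≡ (a - b) + c) ∋ solve-∀) (u (+ r + + q)) (u (+ r))
        ((+ t - + k q) * + s))
      (≤⇒0≤ (u-max (+ r + + q) step-down
        (∣-lin 1ℤ 1ℤ (u-class (+ r)) (∣-lin (- (+ s)) -1ℤ ∣-self (k-class q) refl)
          (((∀ u r q k s t → (u - (t - k) * s) - (r + q) ≡ 1ℤ * (u - r) + 1ℤ * (- s * t + -1ℤ * (q - k * s))) ∋
              solve-∀) (u (+ r)) (+ r) (+ q) (+ k q) (+ s) (+ t)))))
      where
      step-down : I μ (u (+ r) - (+ t - + k q) * + s) ≡ 1ℤ
      step-down = subst (λ z → I μ (u (+ r) - z * + s) ≡ 1ℤ) (pos-id (≤⇒0≤ (ℤ.+≤+ (ℕₚ.<⇒≤ (k<t q)))))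
          (closed-mult cs (pos (+ t - + k q)) _ (u-in (+ r)))

    -- The product of the two slacks in - (t - k) s ≤ w ≤ k s, zero exactly when w is an endpoint.
    -- Being quadratic in w, it sums to an expression in the squares of the tops.
    term : ℕ → ℕ → ℤ
    term q r = (w q r + (+ t - + k q) * + s) * (+ k q * + s - w q r)

    defect : ℤ
    defect = Σ< t (λ q → Σ< t (term q))

    term-≥0 : ∀ q r → 0ℤ ≤ term q r
    term-≥0 q r = 0≤* (w-lo q r) (w-hi q r)

    rotate : ∀ (G : ℤ → ℤ) → Periodic t G → ∀ q → Σ< t (λ r → G (+ r + + q)) ≡ Σ< t (λ r → G (+ r))
    rotate G per q = Σ<-rotate t G per q

    Σw : ∀ q → Σ< t (w q) ≡ 0ℤ
    Σw q = trans (Σ<-+ t (λ r → u (+ r + + q)) (λ r → - u (+ r)))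
      (trans (cong₂ _+_ (rotate u u-periodic q)
          (trans (Σ<-cong t (λ r → sym (ℤₚ.-1*i≡-i (u (+ r))))) (trans (Σ<-* t -1ℤ (λ r → u (+ r))) (ℤₚ.-1*i≡-i B))))
          (ℤₚ.+-inverseʳ B))

    X : ℕ → ℤ
    X q = Σ< t (λ r → u (+ r + + q) * u (+ r))

    ΣX : Σ< t X ≡ B * B
    ΣX = trans (Σ<-swap t t (λ q r → u (+ r + + q) * u (+ r)))
      (trans (Σ<-cong t (λ r → trans (Σ<-cong t (λ q → trans (cong (λ z → u z * u (+ r)) (ℤₚ.+-comm (+ r) (+ q)))
          (ℤₚ.*-comm (u (+ q + + r)) (u (+ r)))))
          (trans (Σ<-* t (u (+ r)) (λ q → u (+ q + + r)))
              (trans (cong (u (+ r) *_) (rotate u u-periodic r)) (ℤₚ.*-comm (u (+ r)) B)))))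
        (Σ<-* t B (λ r → u (+ r))))

    row : ∀ q → Σ< t (term q) ≡ + t * (((+ t - + k q) * + k q) * (+ s * + s)) + (- + 2 * A + + 2 * X q)
    row q = trans (Σ<-cong t expand)
      (trans (Σ<-+ t (λ _ → c₀) (λ r → c₁ * w q r +
          (-1ℤ * sq (+ r + + q) + (-1ℤ * sq (+ r) + + 2 * (u (+ r + + q) * u (+ r))))))
      (cong₂ _+_ (Σ<-const t c₀)
      (trans (Σ<-+ t (λ r → c₁ * w q r)
          (λ r → -1ℤ * sq (+ r + + q) + (-1ℤ * sq (+ r) + + 2 * (u (+ r + + q) * u (+ r)))))
      (trans (cong₂ _+_ (trans (Σ<-* t c₁ (w q)) (trans (cong (c₁ *_) (Σw q)) (ℤₚ.*-zeroʳ c₁)))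
         (trans (Σ<-+ t (λ r → -1ℤ * sq (+ r + + q)) (λ r → -1ℤ * sq (+ r) + + 2 * (u (+ r + + q) * u (+ r))))
           (cong₂ _+_ (trans (Σ<-* t -1ℤ (λ r → sq (+ r + + q)))
               (cong (-1ℤ *_) (rotate sq (λ x → cong (λ z → z * z) (u-periodic x)) q)))
             (trans (Σ<-+ t (λ r → -1ℤ * sq (+ r)) (λ r → + 2 * (u (+ r + + q) * u (+ r))))
               (cong₂ _+_ (Σ<-* t -1ℤ (λ r → sq (+ r))) (Σ<-* t (+ 2) (λ r → u (+ r + + q) * u (+ r))))))))
       (((∀ a x → 0ℤ + (-1ℤ * a + (-1ℤ * a + + 2 * x)) ≡ - + 2 * a + + 2 * x) ∋ solve-∀) A (X q))))))
      where
      sq : ℤ → ℤ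
      sq x = u x * u x
      c₀ c₁ : ℤ
      c₀ = ((+ t - + k q) * + k q) * (+ s * + s)
      c₁ = + s * (+ 2 * + k q - + t)
      expand : ∀ r → term q r ≡ c₀ + (c₁ * w q r +
          (-1ℤ * sq (+ r + + q) + (-1ℤ * sq (+ r) + + 2 * (u (+ r + + q) * u (+ r)))))
      expand r = ((∀ a b k s t → ((a - b) + (t - k) * s) * (k * s - (a - b)) ≡
        ((t - k) * k) * (s * s) + ((s * (+ 2 * k - t)) * (a - b) +
            (-1ℤ * (a * a) + (-1ℤ * (b * b) + + 2 * (a * b))))) ∋ solve-∀) (u (+ r + + q)) (u (+ r)) (+ k q) (+ s)
            (+ t)

    defect-eq : defect ≡ bound + (- + 2 * (+ t * A) + + 2 * (B * B))
    defect-eq = trans (Σ<-cong t row)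
      (trans (Σ<-+ t (λ q → + t * (((+ t - + k q) * + k q) * (+ s * + s))) (λ q → - + 2 * A + + 2 * X q))
        (cong (λ z → bound + z) (trans (Σ<-+ t (λ _ → - + 2 * A) (λ q → + 2 * X q))
          (cong₂ _+_ (trans (Σ<-const t (- + 2 * A)) (((∀ t a → t * (- + 2 * a) ≡ - + 2 * (t * a)) ∋ solve-∀)
              (+ t) A))
            (trans (Σ<-* t (+ 2) X) (cong (+ 2 *_) ΣX))))))

  -- The sum of the tops is the same for all cores, so the defect depends only on the sum of their
  -- squares, with a negative coefficient, while the size grows with that sum.
  defect-diff : ∀ μ κ (csμ : Closed s (I μ)) (ctμ : Closed t (I μ)) (csκ : Closed s (I κ)) (ctκ : Closed t (I κ)) →
    ((+ 2 * + t) * (+ 2 * + t)) * (+ size κ - + size μ) ≡ Of.defect μ csμ ctμ - Of.defect κ csκ ctκ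
  defect-diff μ κ csμ ctμ csκ ctκ = begin
    ((+ 2 * + t) * (+ 2 * + t)) * (+ size κ - + size μ)
      ≡⟨ ((∀ a d e → (a * a) * (e - d) ≡ - (a * (a * (d - e)))) ∋ solve-∀) (+ 2 * + t) (+ size μ) (+ size κ) ⟩
    - ((+ 2 * + t) * ((+ 2 * + t) * (+ size μ - + size κ)))
      ≡⟨ cong (λ z → - ((+ 2 * + t) * z)) Cmp.size-squares ⟩
    - ((+ 2 * + t) * (M.A - K.A))
      ≡⟨ ((∀ b t a a′ bb → - ((+ 2 * t) * (a - a′)) ≡ (b + (- + 2 * (t * a) + + 2 * (bb * bb))) -
          (b + (- + 2 * (t * a′) + + 2 * (bb * bb)))) ∋ solve-∀) bound (+ t) M.A K.A K.B ⟩
    (bound + (- + 2 * (+ t * M.A) + + 2 * (K.B * K.B))) - (bound + (- + 2 * (+ t * K.A) + + 2 * (K.B * K.B)))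
      ≡⟨ cong (λ z → (bound + (- + 2 * (+ t * M.A) + + 2 * (z * z))) -
          (bound + (- + 2 * (+ t * K.A) + + 2 * (K.B * K.B)))) (sym Cmp.same-B) ⟩
    (bound + (- + 2 * (+ t * M.A) + + 2 * (M.B * M.B))) - (bound + (- + 2 * (+ t * K.A) + + 2 * (K.B * K.B)))
      ≡⟨ cong₂ _-_ (sym M.defect-eq) (sym K.defect-eq) ⟩
    M.defect - K.defect ∎
    where
    open ≡-Reasoning
    module M = Of μ csμ ctμ
    module K = Of κ csκ ctκ
    module Cmp = Compare t 1≤t μ κ ctμ ctκ

  module Extremal (x₀ : ℤ) (e₀ : H x₀ ≡ frob s t) where

    -- A gap whenever x₀ is a bead of a symmetric core. The gaps v₀ + a s with a < t, one in each
    -- class modulo t, then determine the core.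
    v₀ : ℤ
    v₀ = bar x₀

    S T : ℤ
    S = + s
    T = + t

    v₀-eq : v₀ + v₀ ≡ (T - 1ℤ) - (T - 1ℤ) * S
    v₀-eq = trans (((∀ x → (-1ℤ - x) + (-1ℤ - x) ≡ - (x + x + 1ℤ) - 1ℤ) ∋ solve-∀) x₀)
      (trans (cong (λ z → - z - 1ℤ) e₀) (((∀ s t → - ((s * t - s) - t) - 1ℤ ≡ (t - 1ℤ) - (t - 1ℤ) * s) ∋ solve-∀) S
          T))

    opp : ∀ {a} → a ℕ.< t → ∃[ b ] (b ℕ.< t × + b ≡ (T - 1ℤ) - + a)
    opp {a} a<t = pos z , ℤₚ.drop‿+≤+
        (≤-lin₁ {c = 0ℤ} {+ a} 0≤+n (trans (cong (λ w → T - (1ℤ + w)) e)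
        (((∀ t a → t - (1ℤ + ((t - 1ℤ) - a)) ≡ a - 0ℤ) ∋ solve-∀) T (+ a)))) , e
      where
      z : ℤ
      z = (T - 1ℤ) - + a
      e : + pos z ≡ z
      e = pos-id (≤-lin₁ (ℤ.+≤+ a<t) (((∀ t a → ((t - 1ℤ) - a) - 0ℤ ≡ t - (1ℤ + a)) ∋ solve-∀) T (+ a)))

    module Tight (σ : Partition) (sy : Sym (I σ)) (cs : Closed s (I σ)) (ct : Closed t (I σ)) (x₀∈ : I σ x₀ ≡ 1ℤ) where

      open Of σ cs ct

      gap-at : ∀ a → I σ (v₀ + + a * S) ≡ 0ℤ
      gap-at a with I-01 σ (v₀ + + a * S)
      ... | inj₁ e = e
      ... | inj₂ e = ⊥-elim (0≢1 (sym-bead σ sy x₀∈)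
          (trans (cong (I σ) (((∀ v as → v ≡ (v + as) - as) ∋ solve-∀) v₀ (+ a * S))) (closed-mult cs a _ e)))

      -- The mirror image of the gap v₀ + (t - 1 - a) s is v₀ + a s - t. So v₀ + a s is the lowest
      -- gap of its class.
      bead-at : ∀ a → a ℕ.< t → I σ ((v₀ + + a * S) - T) ≡ 1ℤ
      bead-at a a<t with opp a<t
      ... | b , _ , eb = trans (cong (I σ) (sym same)) (sym-gap σ sy (gap-at b))
        where
        same : bar (v₀ + + b * S) ≡ (v₀ + + a * S) - T
        same = trans (cong (λ z → -1ℤ - (v₀ + z * S)) eb)
            (trans (((∀ v a s t → -1ℤ - (v + ((t - 1ℤ) - a) * s) ≡ (v - (v + v)) + (a * s + (-1ℤ - (t - 1ℤ) * s))) ∋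
            solve-∀) v₀ (+ a) S T)
          (trans (cong (λ z → (v₀ - z) + (+ a * S + (-1ℤ - (T - 1ℤ) * S))) v₀-eq)
              (((∀ v a s t → (v - ((t - 1ℤ) - (t - 1ℤ) * s)) + (a * s + (-1ℤ - (t - 1ℤ) * s)) ≡ (v + a * s) - t) ∋
              solve-∀) v₀ (+ a) S T)))

      u-at : ∀ x a → a ℕ.< t → T ∣ (x - v₀) - + a * S → u x ≡ (v₀ + + a * S) - T
      u-at x a a<t d = u-unique x (∣-lin -1ℤ -1ℤ d ∣-self
          (((∀ v as t x → ((v + as) - t) - x ≡ -1ℤ * ((x - v) - as) + -1ℤ * t) ∋ solve-∀) v₀ (+ a * S) T x))
        (bead-at a a<t) (trans (cong (I σ) (((∀ a t → (a - t) + t ≡ a) ∋ solve-∀) (v₀ + + a * S) T)) (gap-at a))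

      -- All tops have the form v₀ + a s - t with a < t. Going from r to r + q adds k to a, or k - t
      -- after reduction, so the difference of the tops is k s or - (t - k) s.
      term-0 : ∀ q r → term q r ≡ 0ℤ
      term-0 q r with solve-class 1≤t cop (+ r - v₀)
      ... | a , a<t , d with (a ℕ.+ k q) ℕ.<? t
      ...   | yes lt = trans (cong (λ z → (w q r + (T - + k q) * S) * (+ k q * S - z))
          (cong₂ _-_ (u-at (+ r + + q) (a ℕ.+ k q) lt d′) (u-at (+ r) a a<t d)))
                (((∀ w k s v a t → w * (k * s - (((v + (a + k) * s) - t) - ((v + a * s) - t))) ≡ 0ℤ) ∋ solve-∀)
                    (w q r + (T - + k q) * S) (+ k q) S v₀ (+ a) T)
        where
        d′ : T ∣ ((+ r + + q) - v₀) - (+ a + + k q) * S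
        d′ = ∣-lin 1ℤ 1ℤ d (k-class q) (((∀ r q v a k s → ((r + q) - v) - (a + k) * s ≡ 1ℤ * ((r - v) - a * s) + 1ℤ *
            (q - k * s)) ∋ solve-∀) (+ r) (+ q) v₀ (+ a) (+ k q) S)
      ...   | no ¬lt = trans (cong (λ z → (z + (T - + k q) * S) * (+ k q * S - w q r))
          (cong₂ _-_ (u-at (+ r + + q) a″ a″<t d′) (u-at (+ r) a a<t d)))
                (trans (cong (λ z → ((((v₀ + z * S) - T) - ((v₀ + + a * S) - T)) + (T - + k q) * S) *
                    (+ k q * S - w q r)) a″-eq)
                (((∀ w k s v a t → ((((v + ((a + k) - t) * s) - t) - ((v + a * s) - t)) + (t - k) * s) * w ≡ 0ℤ) ∋
                    solve-∀) (+ k q * S - w q r) (+ k q) S v₀ (+ a) T))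
        where
        a″ : ℕ
        a″ = (a ℕ.+ k q) ∸ t
        a″-eq : + a″ ≡ (+ a + + k q) - T
        a″-eq = trans (((∀ x t → x ≡ (x + t) - t) ∋ solve-∀) (+ a″) T)
            (cong (λ z → + z - T) (ℕₚ.m∸n+n≡m (ℕₚ.≮⇒≥ ¬lt)))
        a″<t : a″ ℕ.< t
        a″<t = ℤₚ.drop‿+≤+ (≤-lin {c = 1ℤ + + a} {T} {+ k q} {T} (ℤ.+≤+ a<t) (ℤ.+≤+ (ℕₚ.<⇒≤ (k<t q)))
          (trans (cong (λ z → T - (1ℤ + z)) a″-eq)
              (((∀ a k t → t - (1ℤ + ((a + k) - t)) ≡ (t - (1ℤ + a)) + (t - k)) ∋ solve-∀) (+ a) (+ k q) T)))
        d′ : T ∣ ((+ r + + q) - v₀) - + a″ * S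
        d′ = subst (λ z → T ∣ ((+ r + + q) - v₀) - z * S) (sym a″-eq)
          (∣-lin 1ℤ 1ℤ d (∣-lin 1ℤ S (k-class q) ∣-self refl)
              (((∀ r q v a k s t → ((r + q) - v) - ((a + k) - t) * s ≡ 1ℤ * ((r - v) - a * s) + 1ℤ *
              (1ℤ * (q - k * s) + s * t)) ∋ solve-∀) (+ r) (+ q) v₀ (+ a) (+ k q) S T))

      defect-0 : defect ≡ 0ℤ
      defect-0 = Σ<-0 t (λ q _ → Σ<-0 t (λ r _ → term-0 q r))

    cancel-≥0 : ∀ {c d} → 1ℤ ≤ c → 0ℤ ≤ c * d → 0ℤ ≤ d
    cancel-≥0 {c} {+ n}      p q = 0≤+n
    cancel-≥0 {c} { -[1+ n ]} p q = ⊥-elim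
        (pos≰0 {0} (≤-trans p (≤-lin {c = 0ℤ} {c * -[1+ n ]} {0ℤ} {c * + n} q (0≤* {c} {+ n} (≤-trans 0≤+n p) 0≤+n)
      (((∀ c n → 0ℤ - c ≡ (c * - (1ℤ + n) - 0ℤ) + (c * n - 0ℤ)) ∋ solve-∀) c (+ n)))))

    1≤4tt : 1ℤ ≤ (+ 2 * T) * (+ 2 * T)
    1≤4tt = ≤-trans 1≤2T (≤-by ((+ 2 * T) * (+ 2 * T - 1ℤ))
        (0≤* {+ 2 * T} {+ 2 * T - 1ℤ} (≤-trans 0≤+n 1≤2T) (≤⇒0≤ 1≤2T))
        (((∀ a → a * a - a ≡ a * (a - 1ℤ)) ∋ solve-∀) (+ 2 * T)))
      where
      1≤2T : 1ℤ ≤ + 2 * T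
      1≤2T = ≤-lin {c = 1ℤ} {T} {0ℤ} {T} (ℤ.+≤+ 1≤t) 0≤+n (((∀ t → + 2 * t - 1ℤ ≡ (t - 1ℤ) + (t - 0ℤ)) ∋ solve-∀) T)

    -- The defect of σ is zero, that of μ is nonnegative, and a larger core has a smaller defect.
    tight-max : ∀ σ → SymCore s t σ → I σ x₀ ≡ 1ℤ → ∀ μ → Closed s (I μ) → Closed t (I μ) → size μ ℕ.≤ size σ
    tight-max σ (sy , cs , ct) x₀∈ μ csμ ctμ = ℤₚ.drop‿+≤+
        (ℤₚ.0≤i-j⇒j≤i (cancel-≥0 1≤4tt (subst (0ℤ ≤_) (sym (defect-diff μ σ csμ ctμ cs ct))
      (subst (λ z → 0ℤ ≤ Of.defect μ csμ ctμ - z) (sym (Tight.defect-0 σ sy cs ct x₀∈))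
        (subst (0ℤ ≤_) (sym (+-identityʳ _)) (Σ<-≥0 t (λ q → Σ<-≥0 t (λ r → Of.term-≥0 μ csμ ctμ q r))))))))

    a : ℤ → ℕ
    a x = proj₁ (solve-class 1≤t cop (x - v₀))

    a<t : ∀ x → a x ℕ.< t
    a<t x = proj₁ (proj₂ (solve-class 1≤t cop (x - v₀)))

    a-class : ∀ x → T ∣ (x - v₀) - + a x * S
    a-class x = proj₂ (proj₂ (solve-class 1≤t cop (x - v₀)))

    a-unique : ∀ x b → b ℕ.< t → T ∣ (x - v₀) - + b * S → a x ≡ b
    a-unique x b b<t d = residue-unique (a<t x) b<t (cop-cancel cop (+ a x - + b)
      (∣-lin -1ℤ 1ℤ (a-class x) d (((∀ x a b s → (a - b) * s ≡ -1ℤ * (x - a * s) + 1ℤ * (x - b * s)) ∋ solve-∀)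
          (x - v₀) (+ a x) (+ b) S)))

    -- The largest simultaneous core: the gaps are v₀ + i s + j t with i, j ≥ 0.
    f : ℤ → ℤ
    f x with (1ℤ + x) ≤? (v₀ + + a x * S)
    ... | yes _ = 1ℤ
    ... | no  _ = 0ℤ

    f-bead : ∀ x b → b ℕ.< t → T ∣ (x - v₀) - + b * S → 1ℤ + x ≤ v₀ + + b * S → f x ≡ 1ℤ
    f-bead x b b<t d le with (1ℤ + x) ≤? (v₀ + + a x * S)
    ... | yes _ = refl
    ... | no n = ⊥-elim (n (subst (λ z → 1ℤ + x ≤ v₀ + + z * S) (sym (a-unique x b b<t d)) le))

    f-gap : ∀ x b → b ℕ.< t → T ∣ (x - v₀) - + b * S → v₀ + + b * S ≤ x → f x ≡ 0ℤ
    f-gap x b b<t d le with (1ℤ + x) ≤? (v₀ + + a x * S)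
    ... | no _ = refl
    ... | yes p = ⊥-elim (1+≰ (≤-trans p (subst (λ z → v₀ + + z * S ≤ x) (sym (a-unique x b b<t d)) le)))

    f-inv : ∀ x → f x ≡ 1ℤ → 1ℤ + x ≤ v₀ + + a x * S
    f-inv x e with (1ℤ + x) ≤? (v₀ + + a x * S)
    ... | yes p = p

    f-inv₀ : ∀ x → f x ≡ 0ℤ → v₀ + + a x * S ≤ x
    f-inv₀ x e with (1ℤ + x) ≤? (v₀ + + a x * S)
    ... | no n = ≤-lin₁ (≰⇒1+≤ n) (((∀ x y → x - y ≡ (1ℤ + x) - (1ℤ + y)) ∋ solve-∀) x (v₀ + + a x * S))

    f01 : Is01 f
    f01 x with (1ℤ + x) ≤? (v₀ + + a x * S)
    ... | yes _ = inj₂ refl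
    ... | no  _ = inj₁ refl

    f-sym : Sym f
    f-sym x with opp (a<t x)
    ... | b , b<t , eb = by-value (f01 x)
      where
      d : T ∣ (bar x - v₀) - + b * S
      d = ∣-lin -1ℤ -1ℤ (a-class x) ∣-self (trans (cong (λ z → (bar x - v₀) - z * S) eb)
        (trans (((∀ x v a s t → ((-1ℤ - x) - v) - ((t - 1ℤ) - a) * s ≡ (-1ℤ * ((x - v) - a * s) - (v + v)) +
            (-1ℤ - (t - 1ℤ) * s)) ∋ solve-∀) x v₀ (+ a x) S T)
        (trans (cong (λ z → (-1ℤ * ((x - v₀) - + a x * S) - z) + (-1ℤ - (T - 1ℤ) * S)) v₀-eq)
          (((∀ y s t → (-1ℤ * y - ((t - 1ℤ) - (t - 1ℤ) * s)) + (-1ℤ - (t - 1ℤ) * s) ≡ -1ℤ * y + -1ℤ * t) ∋ solve-∀)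
              ((x - v₀) - + a x * S) S T))))
      -- Relates the distances of x and `bar x` to their thresholds. If x is below its own, it is so
      -- by at least t, being congruent to it modulo t, which puts `bar x` above its threshold.
      thr : (v₀ + + b * S) - (1ℤ + bar x) ≡ (x - (v₀ + + a x * S)) + (T - 1ℤ)
      thr = trans (cong (λ z → (v₀ + z * S) - (1ℤ + bar x)) eb)
        (trans (((∀ x v a s t → (v + ((t - 1ℤ) - a) * s) - (1ℤ + (-1ℤ - x)) ≡ (x - (v + a * s)) +
            ((v + v) + (t - 1ℤ) * s)) ∋ solve-∀) x v₀ (+ a x) S T)
        (trans (cong (λ z → (x - (v₀ + + a x * S)) + (z + (T - 1ℤ) * S)) v₀-eq)
          (((∀ y s t → y + (((t - 1ℤ) - (t - 1ℤ) * s) + (t - 1ℤ) * s) ≡ y + (t - 1ℤ)) ∋ solve-∀)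
              (x - (v₀ + + a x * S)) S T)))
      by-value : f x ≡ 0ℤ ⊎ f x ≡ 1ℤ → f (bar x) ≡ 1ℤ - f x
      by-value (inj₁ e) = trans (f-bead (bar x) b b<t d (≤-by _ (0≤+ (≤⇒0≤ (f-inv₀ x e)) (≤⇒0≤ (ℤ.+≤+ 1≤t))) thr))
          (cong (λ z → 1ℤ - z) (sym e))
      by-value (inj₂ e) = trans (f-gap (bar x) b b<t d (≤-lin₁ far
          (trans (((∀ w b → b - w ≡ - (w - (1ℤ + b)) - 1ℤ) ∋ solve-∀) (v₀ + + b * S) (bar x))
            (trans (cong (λ z → - z - 1ℤ) thr)
                (((∀ x th t → - ((x - th) + (t - 1ℤ)) - 1ℤ ≡ (th - x) - t) ∋ solve-∀) x (v₀ + + a x * S) T)))))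
          (cong (λ z → 1ℤ - z) (sym e))
        where
        far : T ≤ (v₀ + + a x * S) - x
        far = pos-mult-≥ (∣-lin₁ -1ℤ (a-class x) (((∀ x v as → (v + as) - x ≡ -1ℤ * ((x - v) - as)) ∋ solve-∀) x v₀
            (+ a x * S)))
          (≤-lin₁ (f-inv x e) (((∀ x th → (th - x) - 1ℤ ≡ th - (1ℤ + x)) ∋ solve-∀) x (v₀ + + a x * S)))

    f-closed-t : Closed t f
    f-closed-t x e = f-bead (x - T) (a x) (a<t x)
      (∣-lin 1ℤ -1ℤ (a-class x) ∣-self (((∀ x v as t → ((x - t) - v) - as ≡ 1ℤ * ((x - v) - as) + -1ℤ * t) ∋ solve-∀)
          x v₀ (+ a x * S) T))
      (≤-lin {c = 1ℤ + x} {v₀ + + a x * S} {0ℤ} {T} (f-inv x e) 0≤+n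
          (((∀ th x t → th - (1ℤ + (x - t)) ≡ (th - (1ℤ + x)) + (t - 0ℤ)) ∋ solve-∀) (v₀ + + a x * S) x T))

    f-closed-s : Closed s f
    f-closed-s x e = by-a (a x) (a<t x) (a-class x) (f-inv x e)
      where
      by-a : ∀ b → b ℕ.< t → T ∣ (x - v₀) - + b * S → 1ℤ + x ≤ v₀ + + b * S → f (x - S) ≡ 1ℤ
      by-a (suc b) lt d le = f-bead (x - S) b (ℕₚ.<⇒≤ lt)
          (∣-≡ (((∀ x v b s → (x - v) - (1ℤ + b) * s ≡ ((x - s) - v) - b * s) ∋ solve-∀) x v₀ (+ b) S) d)
        (≤-lin₁ le (((∀ x v b s → (v + b * s) - (1ℤ + (x - s)) ≡ (v + (1ℤ + b) * s) - (1ℤ + x)) ∋ solve-∀) x v₀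
            (+ b) S))
      -- From a = 0 the index wraps around to t - 1, so the threshold rises by (t - 1) s instead of
      -- falling by s.
      by-a zero lt d le with opp lt
      ... | b , b<t , eb = f-bead (x - S) b b<t
        (∣-lin 1ℤ (- S) d ∣-self (trans (cong (λ z → ((x - S) - v₀) - z * S) eb)
            (((∀ x v s t → ((x - s) - v) - ((t - 1ℤ) - 0ℤ) * s ≡ 1ℤ * ((x - v) - 0ℤ * s) + - s * t) ∋ solve-∀) x v₀ S
            T)))
        (≤-lin {c = 1ℤ + x} {v₀ + 0ℤ * S} {0ℤ} {T * S} le (0≤* {T} {S} 0≤+n 0≤+n)
          (trans (cong (λ z → (v₀ + z * S) - (1ℤ + (x - S))) eb)
              (((∀ x v s t → (v + ((t - 1ℤ) - 0ℤ) * s) - (1ℤ + (x - s)) ≡ ((v + 0ℤ * s) - (1ℤ + x)) + (t * s - 0ℤ)) ∋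
              solve-∀) x v₀ S T)))

    f-high : ∃[ M ] (∀ n → M ℕ.≤ n → f (+ n) ≡ 0ℤ)
    f-high = ℤ.∣ v₀ ∣ ℕ.+ t ℕ.* s , λ n p → f-gap (+ n) (a (+ n)) (a<t (+ n)) (a-class (+ n))
      (≤-trans (≤-lin {c = v₀} {+ ℤ.∣ v₀ ∣} {0ℤ} {(T - + a (+ n)) * S} (≤abs v₀)
          (0≤* {T - + a (+ n)} {S} (≤⇒0≤ (ℤ.+≤+ (ℕₚ.<⇒≤ (a<t (+ n))))) 0≤+n)
          (trans (cong (λ z → (+ ℤ.∣ v₀ ∣ + z) - (v₀ + + a (+ n) * S)) (ℤₚ.pos-* t s))
              (((∀ m v a s t → (m + t * s) - (v + a * s) ≡ (m - v) + ((t - a) * s - 0ℤ)) ∋ solve-∀) (+ ℤ.∣ v₀ ∣) v₀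
              (+ a (+ n)) S T)))
        (ℤ.+≤+ p))
      where
      ≤abs : ∀ r → r ≤ + ℤ.∣ r ∣
      ≤abs (+ n)    = ≤-refl
      ≤abs -[1+ n ] = ℤ.-≤+

    f-x₀ : f x₀ ≡ 1ℤ
    f-x₀ = trans (cong f (sym (bar-bar x₀))) (trans (f-sym v₀) (cong (λ z → 1ℤ - z)
      (f-gap v₀ 0 1≤t (divides 0ℤ (((∀ v s → (v - v) - 0ℤ * s ≡ 0ℤ) ∋ solve-∀) v₀ S))
          (≤-reflexive (((∀ v s → v + 0ℤ * s ≡ v) ∋ solve-∀) v₀ S)))))

    opaque
      κ₀ : ∃[ κ ] (SymCore s t κ × I κ x₀ ≡ 1ℤ)
      κ₀ with fromSym f f01 f-sym (proj₁ f-high) (proj₂ f-high)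
      ... | κ , e = κ , ((λ x → trans (e (bar x)) (trans (f-sym x) (cong (λ z → 1ℤ - z) (sym (e x)))))
        , (λ x p → trans (e (x - S)) (f-closed-s x (trans (sym (e x)) p)))
        , (λ x p → trans (e (x - T)) (f-closed-t x (trans (sym (e x)) p)))) , trans (e x₀) f-x₀

    all-or : ∀ n {P Q : ℕ → Set} → (∀ i → i ℕ.< n → P i ⊎ Q i) → (∀ i → i ℕ.< n → P i) ⊎ (∃[ i ] (i ℕ.< n × Q i))
    all-or zero    h = inj₁ λ _ ()
    all-or (suc n) {P} h with all-or n (λ i p → h i (ℕₚ.≤-trans p (ℕₚ.n≤1+n n))) | h n ℕₚ.≤-refl
    ... | inj₂ (i , p , q) | _      = inj₂ (i , ℕₚ.≤-trans p (ℕₚ.n≤1+n n) , q)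
    ... | inj₁ _           | inj₂ q = inj₂ (n , ℕₚ.≤-refl , q)
    ... | inj₁ g           | inj₁ p = inj₁ upto
      where
      upto : ∀ i → i ℕ.< suc n → P i
      upto i (s≤s i≤n) with ℕₚ.m≤n⇒m<n∨m≡n i≤n
      ... | inj₁ lt   = g i lt
      ... | inj₂ refl = p

    Σ<-cong< : ∀ n {f g} → (∀ i → i ℕ.< n → f i ≡ g i) → Σ< n f ≡ Σ< n g
    Σ<-cong< zero    e = refl
    Σ<-cong< (suc n) e = cong₂ _+_ (Σ<-cong< n (λ i p → e i (ℕₚ.≤-trans p (ℕₚ.n≤1+n n)))) (e n ℕₚ.≤-refl)

    module Maximal (σ : Partition) (sy : Sym (I σ)) (cs : Closed s (I σ)) (ct : Closed t (I σ))
      (κ : Partition) (syκ : Sym (I κ)) (csκ : Closed s (I κ)) (ctκ : Closed t (I κ)) (x₀∈ : I κ x₀ ≡ 1ℤ) (le : size κ ℕ.≤ size σ) where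

      open Of σ cs ct

      defect≤0 : defect ≤ 0ℤ
      defect≤0 = ≤-lin₁ {c = 0ℤ} {((+ 2 * T) * (+ 2 * T)) * (+ size σ - + size κ)}
        (0≤* (≤-trans 0≤+n 1≤4tt) (≤⇒0≤ (ℤ.+≤+ (le))))
        (trans (((∀ d → 0ℤ - d ≡ - (d - 0ℤ)) ∋ solve-∀) defect)
            (trans (cong (λ z → - (defect - z)) (sym (Tight.defect-0 κ syκ csκ ctκ x₀∈)))
          (trans (cong -_ (sym (defect-diff σ κ cs ct csκ ctκ)))
              (((∀ c a b → - (c * (a - b)) ≡ c * (b - a) - 0ℤ) ∋ solve-∀) ((+ 2 * T) * (+ 2 * T)) (+ size κ)
              (+ size σ)))))

      -- The residue of s, so that k = 1 and the endpoints are s and - (t - 1) s.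
      q : ℕ
      q = proj₁ (residue t 1≤t S)

      q<t : q ℕ.< t
      q<t = proj₁ (proj₂ (residue t 1≤t S))

      k≡1 : k q ≡ 1
      k≡1 = residue-unique (k<t q) 1<t
          (cop-cancel cop (+ k q - 1ℤ) (∣-lin -1ℤ -1ℤ (k-class q) (proj₂ (proj₂ (residue t 1≤t S)))
        (((∀ k s q → (k - 1ℤ) * s ≡ -1ℤ * (q - k * s) + -1ℤ * (s - q)) ∋ solve-∀) (+ k q) S (+ q))))

      term≡0 : ∀ r → r ℕ.< t → term q r ≡ 0ℤ
      term≡0 r r<t = Σ<-zero t (term-≥0 q) (≤-reflexive (Σ<-zero t (λ q → Σ<-≥0 t (term-≥0 q)) defect≤0 q q<t)) r r<t

      split : ∀ r → r ℕ.< t → (w q r ≡ S) ⊎ (w q r ≡ - ((T - 1ℤ) * S))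
      split r r<t = choose (ℤₚ.i*j≡0⇒i≡0∨j≡0 (w q r + (T - + k q) * S) {+ k q * S - w q r} (term≡0 r r<t))
        where
        choose : w q r + (T - + k q) * S ≡ 0ℤ ⊎ + k q * S - w q r ≡ 0ℤ → (w q r ≡ S) ⊎ (w q r ≡ - ((T - 1ℤ) * S))
        choose (inj₁ e) = inj₂ (trans (((∀ w z → w ≡ (w + z) - z) ∋ solve-∀) (w q r) ((T - + k q) * S))
            (trans (cong₂ (λ z n → z - (T - + n) * S) e k≡1)
            (((∀ s t → 0ℤ - (t - 1ℤ) * s ≡ - ((t - 1ℤ) * s)) ∋ solve-∀) S T)))
        choose (inj₂ e) = inj₁ (trans (((∀ w z → w ≡ z - (z - w)) ∋ solve-∀) (w q r) (+ k q * S))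
            (trans (cong₂ (λ z n → + n * S - z) e k≡1) (((∀ s → 1ℤ * s - 0ℤ ≡ s) ∋ solve-∀) S)))

      from-row : (∀ r → r ℕ.< t → w q r ≡ S) ⊎ (∃[ r ] (r ℕ.< t × w q r ≡ - ((T - 1ℤ) * S))) → I σ x₀ ≡ 1ℤ
      -- The differences along a row sum to zero, so they cannot all be s.
      from-row (inj₁ all) = ⊥-elim (pos≰0 {0}
          (≤-trans 1≤TS (≤-reflexive (trans (sym (Σ<-const t S)) (trans (sym (Σ<-cong< t all)) (Σw q))))))
        where
        1≤TS : 1ℤ ≤ T * S
        1≤TS = ≤-lin {c = 0ℤ} {(T - 1ℤ) * S} {1ℤ} {S} (0≤* {T - 1ℤ} {S} (≤⇒0≤ (ℤ.+≤+ 1≤t)) 0≤+n) (ℤ.+≤+ (ℕₚ.<⇒≤ 1<s))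
            (((∀ s t → t * s - 1ℤ ≡ ((t - 1ℤ) * s - 0ℤ) + (s - 1ℤ)) ∋ solve-∀) S T)
      -- The top and the mirror image of the gap Y are both beads, and their values of H add up to
      -- twice the bound of `core-bound`. So the top attains the bound and is x₀.
      from-row (inj₂ (r , _ , e)) = trans (cong (I σ) (H-inj (trans e₀ (sym HX)))) (u-in (+ r))
        where
        X-in Y : ℤ
        X-in = u (+ r)
        Y = u (+ r + + q) + T
        Y-eq : Y ≡ (X-in - (T - 1ℤ) * S) + T
        Y-eq = cong (_+ T) (trans (((∀ y x → y ≡ x + (y - x)) ∋ solve-∀) (u (+ r + + q)) X-in)
            (cong (λ z → X-in + z) e))
        hiY : H (bar Y) ≤ frob s t
        hiY = core-bound (ℕₚ.<⇒≤ 1<s) cop σ (sy , cs , ct) (bar Y) (sym-gap σ sy (u-out (+ r + + q)))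
        HX : H X-in ≡ frob s t
        HX = ℤₚ.≤-antisym (core-bound (ℕₚ.<⇒≤ 1<s) cop σ (sy , cs , ct) X-in (u-in (+ r)))
          (≤-lin₁ hiY (trans (((∀ x s t → (x + x + 1ℤ) - ((s * t - s) - t) ≡ ((s * t - s) - t) -
              ((-1ℤ - ((x - (t - 1ℤ) * s) + t)) + (-1ℤ - ((x - (t - 1ℤ) * s) + t)) + 1ℤ)) ∋ solve-∀) X-in S T)
            (cong (λ z → frob s t - H (bar z)) (sym Y-eq))))

    max-tight : ∀ σ → SymCore s t σ → (∀ μ → SymCore s t μ → size μ ℕ.≤ size σ) → I σ x₀ ≡ 1ℤ
    max-tight σ (sy , cs , ct) mx = from κ₀
      where
      from : ∃[ κ ] (SymCore s t κ × I κ x₀ ≡ 1ℤ) → I σ x₀ ≡ 1ℤ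
      from (κ , (syκ , csκ , ctκ) , x₀∈) = from-row (all-or t split)
        where open Maximal σ sy cs ct κ syκ csκ ctκ x₀∈ (mx κ (syκ , csκ , ctκ))

-- Sufficiency

on-bar : ∀ s r x → on s (bar r) (bar x) ≡ on s r x
on-bar s r x with + s ∣? bar x - bar r | + s ∣? x - r
... | yes _ | yes _ = refl
... | no  _ | no  _ = refl
... | yes p | no  q = ⊥-elim (q (∣-lin₁ -1ℤ p (((∀ x r → x - r ≡ -1ℤ * ((-1ℤ - x) - (-1ℤ - r))) ∋ solve-∀) x r)))
... | no  p | yes q = ⊥-elim (p (∣-lin₁ -1ℤ q (((∀ x r → (-1ℤ - x) - (-1ℤ - r) ≡ -1ℤ * (x - r)) ∋ solve-∀) x r)))

zc-bar : ∀ {s f} → ZeroCharge s f → ZeroCharge s (λ x → f (bar x))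
zc-bar {s} {f} z = zeroCharge λ r → hs-cong (λ x → cong (_* f (bar x)) (on-bar s r x))
    (hs-bar (ZeroCharge.class-sum z (bar r)))

opaque
  -- The function g is the bead set of the conjugate of σ. It is again closed and has the class
  -- numbers of the symmetric λ, so it is σ by uniqueness of the core.
  core-symmetric : ∀ s λ′ σ → Sym (I λ′) → SEq s λ′ σ → Closed s (I σ) → Sym (I σ)
  core-symmetric s λ′ σ sy sq cs x = trans (((∀ a → a ≡ 1ℤ - (1ℤ - a)) ∋ solve-∀) (I σ (bar x)))
    (cong (λ z → 1ℤ - z) (sym (core-unique {s} (I-01 σ) g01 cs gcs charge x)))
    where
    g : ℤ → ℤ
    g x = 1ℤ - I σ (bar x)
    g01 : Is01 g
    g01 x with I-01 σ (bar x)
    ... | inj₁ e = inj₂ (cong (λ z → 1ℤ - z) e)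
    ... | inj₂ e = inj₁ (cong (λ z → 1ℤ - z) e)
    gcs : Closed s g
    gcs x e with I-01 σ (bar (x - + s))
    ... | inj₁ q = cong (λ z → 1ℤ - z) q
    ... | inj₂ q = ⊥-elim (0≢1 (cong (λ z → 1ℤ - z)
        (trans (cong (I σ) (((∀ x s → -1ℤ - x ≡ (-1ℤ - (x - s)) - s) ∋ solve-∀) x (+ s))) (cs _ q))) e)
    charge : ZeroCharge s (λ x → I σ x - g x)
    charge = zc-cong (λ x → trans (cong (λ z → - (I λ′ x - I σ x) + - (z - I σ (bar x))) (sy x))
        (((∀ a b c → - (a - b) + - ((1ℤ - a) - c) ≡ b - (1ℤ - c)) ∋ solve-∀) (I λ′ x) (I σ x) (I σ (bar x))))
      (zc-+ (zc-neg (SEq.charges sq)) (zc-neg (zc-bar (SEq.charges sq))))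

-- Otherwise `bar x`, which is x - H x, would be a bead as well.
core-gap : ∀ s σ → Sym (I σ) → Closed s (I σ) → ∀ x → 0ℤ ≤ x → + s ∣ H x → I σ x ≡ 0ℤ
core-gap s σ sy cs x 0≤x d with I-01 σ x
... | inj₁ e = e
... | inj₂ e = ⊥-elim (0≢1 (sym-bead σ sy e)
    (closed-∣ cs x (bar x) (∣-≡ (((∀ x → x + x + 1ℤ ≡ x - (-1ℤ - x)) ∋ solve-∀) x) d)
    (≤-trans (≤-lin {c = 0ℤ} {x} {0ℤ} {1ℤ} 0≤x 0≤+n (((∀ x → 0ℤ - (-1ℤ - x) ≡ (x - 0ℤ) + (1ℤ - 0ℤ)) ∋ solve-∀) x))
        0≤x) e))

module Single {κ : Partition} (sy : Sym (I κ)) {w : ℤ} (gap : Gap κ w) (F : Flipped κ (w ∷ [])) where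

  at-w : I (Flipped.result F) w ≡ 1ℤ
  at-w = trans (Flipped.beads F w) (cong₂ _+_ gap (cong (_+ 0ℤ) (cong₂ _-_ (δ-refl w) (δ-≢ (gap≢bar κ sy gap gap)))))

  at-bar : I (Flipped.result F) (bar w) ≡ 0ℤ
  at-bar = trans (Flipped.symmetric F w) (cong (λ z → 1ℤ - z) at-w)

  elsewhere : ∀ x → x ≢ w → x ≢ bar w → I (Flipped.result F) x ≡ I κ x
  elsewhere x a b = trans (Flipped.beads F x) (trans (cong (λ z → I κ x + (z + 0ℤ)) (fl-0 a b)) (+-identityʳ _))

flip₁ : ∀ κ → Sym (I κ) → ∀ w → Gap κ w → Flipped κ (w ∷ [])
flip₁ κ sy w g = flipAll κ sy (w ∷ []) (g ∷ []) ([] ∷ [])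

-- Removing the top of the class of z keeps this class closed. In the other class `bar z` can be
-- added, because `bar z - s` is the mirror image of the gap z + s.
top-flip-closed : ∀ s κ → 1 ℕ.≤ s → (sy : Sym (I κ)) → Closed s (I κ) → ∀ z → I κ z ≡ 1ℤ → I κ (z + + s) ≡ 0ℤ → ¬
    (+ s ∣ H z) →
  (F : Flipped κ (bar z ∷ [])) → Closed s (I (Flipped.result F))
top-flip-closed s κ 1≤s sy cs z z∈ z+s∉ s∤z F y y∈ with y ≟ bar z
... | yes refl = trans (elsewhere (bar z - + s) (λ e → shifted (bar z) e) (λ e → s∤z (divides -1ℤ (on-axis e)))) below
  where
  open Single sy (sym-bead κ sy z∈) F
  shifted : ∀ x → x - + s ≢ x
  shifted x e = ℕₚ.<-irrefl (sub-inj x {0} {s} (trans (+-identityʳ x) (sym e))) 1≤s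
  below : I κ (bar z - + s) ≡ 1ℤ
  below = trans (cong (I κ) (((∀ z s → (-1ℤ - z) - s ≡ -1ℤ - (z + s)) ∋ solve-∀) z (+ s))) (sym-gap κ sy z+s∉)
  on-axis : bar z - + s ≡ bar (bar z) → H z ≡ -1ℤ * + s
  on-axis e = trans (((∀ z s → z + z + 1ℤ ≡ (z - ((-1ℤ - z) - s)) + -1ℤ * s) ∋ solve-∀) z (+ s))
    (trans (cong (λ w → (z - w) + -1ℤ * + s) (trans e (bar-bar z)))
        (((∀ z s → (z - z) + -1ℤ * s ≡ -1ℤ * s) ∋ solve-∀) z (+ s)))
... | no y≢ with y ≟ z
...   | yes refl = ⊥-elim (0≢1 (trans (cong (I (Flipped.result F)) (sym (bar-bar z)))
    (Single.at-bar sy (sym-bead κ sy z∈) F)) y∈)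
...   | no y≢z = trans (elsewhere (y - + s) (λ e → 0≢1 (trans (cong (I κ) e) (sym-bead κ sy z∈)) below)
          (λ e → 0≢1 (trans (cong (I κ) (trans (((∀ y s → y ≡ (y - s) + s) ∋ solve-∀) y (+ s))
              (cong (_+ + s) (trans e (bar-bar z))))) z+s∉) y∈κ)) below
  where
  open Single sy (sym-bead κ sy z∈) F
  y∈κ : I κ y ≡ 1ℤ
  y∈κ = trans (sym (elsewhere y y≢ (λ e → y≢z (trans e (bar-bar z))))) y∈
  below : I κ (y - + s) ≡ 1ℤ
  below = cs y y∈κ

-- Without beads on the axis, t-hooks are removed from a self-conjugate partition in mirror pairs.
opaque
  even-weight : ∀ t τ → 1 ℕ.≤ t → Closed t (I τ) → ∀ μ → Sym (I μ) → SEq t μ τ →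
    (∀ q → 0ℤ ≤ q → I μ q ≡ 1ℤ → ¬ (+ t ∣ H q)) → ∃[ w ] (+ size μ ≡ + size τ + (w + w) * + t)
  even-weight t τ 1≤t ct μ sy sq none = go μ (<-wellFounded (size μ)) sy sq none
    where
    go : ∀ μ → Acc ℕ._<_ (size μ) → Sym (I μ) → SEq t μ τ → (∀ q → 0ℤ ≤ q → I μ q ≡ 1ℤ → ¬ (+ t ∣ H q)) → ∃[ w ]
        (+ size μ ≡ + size τ + (w + w) * + t)
    go μ (acc rec) sy sq none with closed-or-inversion t μ
    ... | inj₁ cl = 0ℤ , trans (cong (λ ν → + size ν)
        (I-inj (core-unique {t} (I-01 μ) (I-01 τ) cl ct (SEq.charges sq)))) (sym (+-identityʳ _))
    ... | inj₂ (x , x∈ , x-t∉) = step-up (go ν (rec lt) (Flipped.symmetric F) (seq-trans seq-ν sq) none′)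
      where
      gaps : All (Gap μ) ((x - + t) ∷ bar x ∷ [])
      gaps = x-t∉ ∷ sym-bead μ sy x∈ ∷ []
      ≢axis : x - + t ≢ bar x
      ≢axis e = none x (1≤H⇒0≤ (subst (1ℤ ≤_) (sym Hx) (ℤ.+≤+ 1≤t))) x∈
          (divides 1ℤ (trans Hx (sym (ℤₚ.*-identityˡ (+ t)))))
        where
        Hx : H x ≡ + t
        Hx = trans (((∀ y c → y + y + 1ℤ ≡ ((y - c) - (-1ℤ - y)) + c) ∋ solve-∀) x (+ t))
            (trans (cong (λ w → (w - bar x) + + t) e) (((∀ a c → (a - a) + c ≡ c) ∋ solve-∀) (bar x) (+ t)))
      F : Flipped μ ((x - + t) ∷ bar x ∷ [])
      F = flipAll μ sy _ gaps ((≢axis ∷ []) ∷ [] ∷ [])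
      ν : Partition
      ν = Flipped.result F
      size-ν : + size ν ≡ + size μ - (+ t + + t)
      size-ν = trans (Flipped.sizes F)
          (((∀ n x t → n + (((x - t) + (x - t) + 1ℤ) + (((-1ℤ - x) + (-1ℤ - x) + 1ℤ) + 0ℤ)) ≡ n - (t + t)) ∋ solve-∀)
          (+ size μ) x (+ t))
      lt : size ν ℕ.< size μ
      lt = ℤₚ.drop‿+≤+ (≤-lin {c = 1ℤ} {+ t} {0ℤ} {+ t} (ℤ.+≤+ 1≤t) 0≤+n
          (trans (cong (λ z → + size μ - (1ℤ + z)) size-ν)
          (((∀ n t → n - (1ℤ + (n - (t + t))) ≡ (t - 1ℤ) + (t - 0ℤ)) ∋ solve-∀) (+ size μ) (+ t))))
      seq-ν : SEq t ν μ
      seq-ν = flipped-seq F (zc-cong (λ p → trans (((∀ a b → a - b ≡ a + (- b + 0ℤ)) ∋ solve-∀) (fl (x - + t) p)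
          (fl x p)) (cong (λ z → fl (x - + t) p + (z + 0ℤ)) (sym (fl-bar x p))))
        (zc-fl₂ t (x - + t) x (divides -1ℤ (((∀ x t → (x - t) - x ≡ -1ℤ * t) ∋ solve-∀) x (+ t)))))
      -- No axis bead arises: the new beads x - t and `bar x` lie t below the old beads x and
      -- `bar (x - t)`, in the same classes.
      none′ : ∀ q → 0ℤ ≤ q → I ν q ≡ 1ℤ → ¬ (+ t ∣ H q)
      none′ q 0≤q q∈ d = by (I-01 μ q) (q ≟ (x - + t)) (q ≟ bar x)
        where
        by : I μ q ≡ 0ℤ ⊎ I μ q ≡ 1ℤ → Dec (q ≡ x - + t) → Dec (q ≡ bar x) → ⊥
        by (inj₂ e) _ _ = none q 0≤q e d
        by (inj₁ e) (yes p) _ = none x (≤-trans 0≤q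
            (≤-lin₁ {c = 0ℤ} {+ t} 0≤+n (trans (cong (λ z → x - z) p)
            (((∀ x t → x - (x - t) ≡ t - 0ℤ) ∋ solve-∀) x (+ t))))) x∈
            (∣H-sub⁻ x (+ t) ∣-self (subst (λ z → + t ∣ H z) p d))
        by (inj₁ e) (no _) (yes p) = none (bar (x - + t)) (0≤bar-sub x t (subst (0ℤ ≤_) p 0≤q)) (sym-gap μ sy x-t∉)
          (∣H-bar (x - + t) (∣H-sub x (+ t) ∣-self (subst (λ z → + t ∣ H z) (trans (cong bar p) (bar-bar x))
              (∣H-bar q d))))
        by (inj₁ e) (no n₁) (no n₂) = 0≢1
            (trans (Flipped.beads F q) (cong₂ _+_ e (flips-0 μ sy _ e (n₁ ∷ n₂ ∷ []) gaps))) q∈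
      step-up : ∃[ w ] (+ size ν ≡ + size τ + (w + w) * + t) → ∃[ w ] (+ size μ ≡ + size τ + (w + w) * + t)
      step-up (w , e) = w + 1ℤ , trans (((∀ n t → n ≡ (n - (t + t)) + (t + t)) ∋ solve-∀) (+ size μ) (+ t))
        (trans (cong (_+ (+ t + + t)) (trans (sym size-ν) e))
            (((∀ n w t → (n + (w + w) * t) + (t + t) ≡ n + ((w + 1ℤ) + (w + 1ℤ)) * t) ∋ solve-∀) (+ size τ) w (+ t)))

opaque
  axis-bead? : ∀ t μ → (∃[ q ] (0ℤ ≤ q × I μ q ≡ 1ℤ × + t ∣ H q)) ⊎ (∀ q → 0ℤ ≤ q → I μ q ≡ 1ℤ → ¬ (+ t ∣ H q))
  axis-bead? t μ with I-bound μ
  ... | M , hi , lo = from (search {λ q → 0ℤ ≤ q × I μ q ≡ 1ℤ × + t ∣ H q} dec M)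
    where
    dec : ∀ q → Dec (0ℤ ≤ q × I μ q ≡ 1ℤ × + t ∣ H q)
    dec q with 0ℤ ≤? q | I μ q ≟ 1ℤ | + t ∣? H q
    ... | yes a | yes b | yes c = yes (a , b , c)
    ... | no  a | _     | _     = no λ r → a (proj₁ r)
    ... | yes _ | no  b | _     = no λ r → b (proj₁ (proj₂ r))
    ... | yes _ | yes _ | no  c = no λ r → c (proj₂ (proj₂ r))
    from : ∃ (λ q → 0ℤ ≤ q × I μ q ≡ 1ℤ × + t ∣ H q) ⊎
        (∀ n → n ℕ.< M → ¬ (0ℤ ≤ + n × I μ (+ n) ≡ 1ℤ × + t ∣ H (+ n)) × ¬
        (0ℤ ≤ -[1+ n ] × I μ -[1+ n ] ≡ 1ℤ × + t ∣ H -[1+ n ])) →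
      (∃[ q ] (0ℤ ≤ q × I μ q ≡ 1ℤ × + t ∣ H q)) ⊎ (∀ q → 0ℤ ≤ q → I μ q ≡ 1ℤ → ¬ (+ t ∣ H q))
    from (inj₁ r) = inj₁ r
    from (inj₂ r) = inj₂ none
      where
      none : ∀ q → 0ℤ ≤ q → I μ q ≡ 1ℤ → ¬ (+ t ∣ H q)
      none (+ n) p e d with n ℕ.<? M
      ... | yes n<M = proj₁ (r n n<M) (p , e , d)
      ... | no  n≥M = 0≢1 (hi n (ℕₚ.≮⇒≥ n≥M)) e

opaque
  odd-weight : ∀ t τ → 1 ℕ.≤ t → Closed t (I τ) → ∀ μ → Sym (I μ) → SEq t μ τ → ∀ w → + size μ ≡ + size τ + H w * + t
      →
    ∃[ q ] (0ℤ ≤ q × I μ q ≡ 1ℤ × + t ∣ H q)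
  odd-weight t τ 1≤t ct μ sy sq w e with axis-bead? t μ
  ... | inj₁ r = r
  ... | inj₂ none = contra (even-weight t τ 1≤t ct μ sy sq none)
    where
    contra : ∃[ w′ ] (+ size μ ≡ + size τ + (w′ + w′) * + t) → ∃[ q ] (0ℤ ≤ q × I μ q ≡ 1ℤ × + t ∣ H q)
    contra (w′ , e′) = ⊥-elim (even≢odd w′ w (ℤₚ.*-cancelʳ-≡ (w′ + w′) (H w) (+ t) {{ℕ.>-nonZero 1≤t}}
        (+-cancelˡ (+ size τ) (trans (sym e′) e))))

-- Removing p (on the s-axis) and q (on the t-axis) from μ leaves a partition whose s-core is
-- obtained from σ by flipping the largest bead in the class of q.
opaque
  removal-bound : ∀ s t → 1 ℕ.≤ s → ∀ σ → SymCore s t σ → ∀ μ → Sym (I μ) → SEq s μ σ →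
    ∀ p → I μ p ≡ 1ℤ → + s ∣ H p → ∀ q → 0ℤ ≤ q → I μ q ≡ 1ℤ → + t ∣ H q → ¬ (+ s ∣ H q) → ∀ t′ → + t ≡ H t′ →
    ∃[ z ] (I σ z ≡ 1ℤ × + s ∣ z - t′ × ((+ size σ - H z) + H p) + + t ≤ + size μ)
  removal-bound s t 1≤s σ (syσ , cs , ct) μ sy sq p p∈ s∣p q 0≤q q∈ t∣q s∤q t′ et with class-top s σ q 1≤s | odd-div
      (+ t) q t∣q
  ... | z , s∣z , z∈ , z+s∉ | t″ , et″ , t∣q-t″ = z′ , z′∈ , s∣z′ , bound
    where
    t″≡ : t″ ≡ t′
    t″≡ = H-inj (trans (sym et″) et)
    d : ℤ
    d = q - t′
    t∣d : + t ∣ d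
    t∣d = subst (λ w → + t ∣ q - w) t″≡ t∣q-t″
    t′≤q : t′ ≤ q
    t′≤q = H-cancel-≤ (subst (_≤ H q) et (pos-mult-≥ t∣q (0≤⇒1≤H 0≤q)))
    -- The top z of the class of q is moved down by q - t′, a multiple of t, into the class of t′.
    -- This makes the class in the bound independent of q.
    z′ : ℤ
    z′ = z - d
    z′∈ : I σ z′ ≡ 1ℤ
    z′∈ = closed-∣ ct z z′ (∣-≡ (((∀ z d → d ≡ z - (z - d)) ∋ solve-∀) z d) t∣d)
        (≤-lin₁ t′≤q (((∀ z q t → z - (z - (q - t)) ≡ q - t) ∋ solve-∀) z q t′)) z∈
    s∣z′ : + s ∣ z′ - t′
    s∣z′ = ∣-≡ (((∀ z q t → z - q ≡ (z - (q - t)) - t) ∋ solve-∀) z q t′) s∣z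
    s∤z : ¬ (+ s ∣ H z)
    s∤z e = s∤q (∣-lin 1ℤ (- + 2) e s∣z (((∀ z q → q + q + 1ℤ ≡ 1ℤ * (z + z + 1ℤ) + - + 2 * (z - q)) ∋ solve-∀) z q))
    Fσ : Flipped σ (bar z ∷ [])
    Fσ = flip₁ σ syσ (bar z) (sym-bead σ syσ z∈)
    p≢q : p ≢ q
    p≢q refl = s∤q s∣p
    Fμ : Flipped μ (bar p ∷ bar q ∷ [])
    Fμ = flipAll μ sy _ (sym-bead μ sy p∈ ∷ sym-bead μ sy q∈ ∷ []) (((λ e → p≢q (bar-inj e)) ∷ []) ∷ [] ∷ [])
    sq″ : SEq s (Flipped.result Fμ) (Flipped.result Fσ)
    sq″ = sameCharges (zc-cong (λ x → trans
        (((∀ m g a b c → (m - g) + (- a + - (b - c)) ≡ (m + (- a + (- b + 0ℤ))) - (g + (- c + 0ℤ))) ∋ solve-∀)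
            (I μ x) (I σ x) (fl p x) (fl q x) (fl z x))
        (sym (cong₂ _-_ (trans (Flipped.beads Fμ x)
            (cong₂ (λ a b → I μ x + (a + (b + 0ℤ))) (fl-bar p x) (fl-bar q x)))
            (trans (Flipped.beads Fσ x) (cong (λ a → I σ x + (a + 0ℤ)) (fl-bar z x))))))
      (zc-+ (SEq.charges sq) (zc-+ (zc-neg (zc-fl s p s∣p))
          (zc-neg (zc-fl₂ s q z (∣-lin₁ -1ℤ s∣z (((∀ q z → q - z ≡ -1ℤ * (z - q)) ∋ solve-∀) q z)))))))
    sizes-≤ : + size (Flipped.result Fσ) ≤ + size (Flipped.result Fμ)
    sizes-≤ = ℤ.+≤+ (seq-size-≤ s _ _ 1≤s sq″ (top-flip-closed s σ 1≤s syσ cs z z∈ z+s∉ s∤z Fσ))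
    bound : ((+ size σ - H z′) + H p) + + t ≤ + size μ
    bound = ≤-lin₁ (subst₂ _≤_ (Flipped.sizes Fσ) (Flipped.sizes Fμ) sizes-≤)
      (trans (cong (λ w → + size μ - (((+ size σ - H z′) + H p) + w)) et)
        (((∀ m g z p q t → m - (((g - ((z - (q - t)) + (z - (q - t)) + 1ℤ)) + (p + p + 1ℤ)) + (t + t + 1ℤ)) ≡
           (m + (((-1ℤ - p) + (-1ℤ - p) + 1ℤ) + (((-1ℤ - q) + (-1ℤ - q) + 1ℤ) + 0ℤ))) -
               (g + (((-1ℤ - z) + (-1ℤ - z) + 1ℤ) + 0ℤ))) ∋ solve-∀) (+ size μ) (+ size σ) z p q t′))

-- The five cases in terms of beads, and their uniqueness

cong⇒∣ : ∀ p b z w → z ≡ H w → (bar b - b) ≡ z [modℤ (2 ℕ.* p) ] → + p ∣ bar b - w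
cong⇒∣ p b z w refl d with ∣ᵤ⇒∣ d
... | divides k e = divides k (ℤₚ.*-cancelˡ-≡ (+ 2) (bar b - w) (k * + p)
  (trans (((∀ b w → + 2 * ((-1ℤ - b) - w) ≡ ((-1ℤ - b) - b) - (w + w + 1ℤ)) ∋ solve-∀) b w)
      (trans e (trans (cong (k *_) (ℤₚ.pos-* 2 p)) (((∀ k p → k * (+ 2 * p) ≡ + 2 * (k * p)) ∋ solve-∀) k (+ p))))))

-- `bar b - b` is `H (bar b)`, and a difference of two values of H is twice the difference of the
-- positions. This is the origin of the modulus 2 p.
∣⇒cong : ∀ p b z w → z ≡ H w → + p ∣ bar b - w → (bar b - b) ≡ z [modℤ (2 ℕ.* p) ]
∣⇒cong p b z w refl (divides k e) = ∣⇒∣ᵤ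
    (divides k (trans (((∀ b w → ((-1ℤ - b) - b) - (w + w + 1ℤ) ≡ + 2 * ((-1ℤ - b) - w)) ∋ solve-∀) b w)
  (trans (cong (+ 2 *_) e) (trans (((∀ k p → + 2 * (k * p) ≡ k * (+ 2 * p)) ∋ solve-∀) k (+ p))
      (cong (k *_) (sym (ℤₚ.pos-* 2 p)))))))

∉B⇒I : ∀ λ′ x → ¬ (x ∈B λ′) → I λ′ x ≡ 0ℤ
∉B⇒I λ′ x n with I-01 λ′ x
... | inj₁ e = e
... | inj₂ e = ⊥-elim (n (I⇒∈B λ′ x e))

I⇒∉B : ∀ λ′ x → I λ′ x ≡ 0ℤ → ¬ (x ∈B λ′)
I⇒∉B λ′ x e m = 0≢1 e (∈B⇒I λ′ x m)

Swap : Partition → Partition → ℤ → Set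
Swap α β b = ∀ x → x ∈B α ⇔ ((x ∈B β × x ≢ b) ⊎ x ≡ bar b)

swap⇒I : ∀ α β b → Sym (I β) → I β b ≡ 1ℤ → Swap α β b → ∀ x → I α x ≡ I β x + fl (bar b) x
swap⇒I α β b sy b∈ sw x = go (x ≟ bar b) (x ≟ b)
  where
  same : x ≢ bar b → x ≢ b → I α x ≡ I β x
  same n₁ n₂ with I-01 β x
  ... | inj₂ e = trans (∈B⇒I α x (Equivalence.from (sw x) (inj₁ (I⇒∈B β x e , n₂)))) (sym e)
  ... | inj₁ e = trans (∉B⇒I α x (λ m → [ (λ q → I⇒∉B β x e (proj₁ q)) , n₁ ]′ (Equivalence.to (sw x) m))) (sym e)
  go : Dec (x ≡ bar b) → Dec (x ≡ b) → I α x ≡ I β x + fl (bar b) x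
  go (yes refl) _ = trans (∈B⇒I α x (Equivalence.from (sw x) (inj₂ refl)))
    (sym (cong₂ _+_ (sym-bead β sy b∈)
        (cong₂ _-_ (δ-refl (bar b)) (δ-≢ (gap≢bar β sy (sym-bead β sy b∈) (sym-bead β sy b∈))))))
  go (no n) (yes refl) = trans (∉B⇒I α x (λ m → [ (λ q → proj₂ q refl) , n ]′ (Equivalence.to (sw x) m)))
    (sym (cong₂ _+_ b∈ (cong₂ _-_ (δ-≢ n) (δ-≡ (sym (bar-bar x))))))
  go (no n₁) (no n₂) = trans (same n₁ n₂)
      (sym (trans (cong (λ z → I β x + z) (fl-0 n₁ (λ e → n₂ (trans e (bar-bar b))))) (+-identityʳ _)))

I⇒swap : ∀ α β b → Sym (I β) → I β b ≡ 1ℤ → (∀ x → I α x ≡ I β x + fl (bar b) x) → Swap α β b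
I⇒swap α β b sy b∈ e x = mk⇔ to from
  where
  b̄≢b : bar b ≢ bar (bar b)
  b̄≢b = gap≢bar β sy (sym-bead β sy b∈) (sym-bead β sy b∈)
  to : x ∈B α → (x ∈B β × x ≢ b) ⊎ x ≡ bar b
  to m with x ≟ bar b | x ≟ b
  ... | yes q | _ = inj₂ q
  ... | no n | yes refl = ⊥-elim (0≢1 (trans (e x) (cong₂ _+_ b∈ (cong₂ _-_ (δ-≢ n) (δ-≡ (sym (bar-bar x))))))
      (∈B⇒I α x m))
  ... | no n₁ | no n₂ = inj₁ (I⇒∈B β x
      (trans (sym (trans (e x) (trans (cong (λ z → I β x + z) (fl-0 n₁ (λ q → n₂ (trans q (bar-bar b)))))
      (+-identityʳ _)))) (∈B⇒I α x m)) , n₂)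
  from : (x ∈B β × x ≢ b) ⊎ x ≡ bar b → x ∈B α
  from (inj₂ refl) = I⇒∈B α x (trans (e x) (cong₂ _+_ (sym-bead β sy b∈) (cong₂ _-_ (δ-refl (bar b)) (δ-≢ b̄≢b))))
  from (inj₁ (m , n₂)) = I⇒∈B α x
      (trans (e x) (trans (cong (λ z → I β x + z) (fl-0 n₁ (λ q → n₂ (trans q (bar-bar b)))))
      (trans (+-identityʳ _) (∈B⇒I β x m))))
    where
    n₁ : x ≢ bar b
    n₁ q = 0≢1 (trans (cong (I β) q) (sym-bead β sy b∈)) (∈B⇒I β x m)

opaque
  odd⇒H : ∀ t → Odd t → ∃[ t′ ] (+ t ≡ H t′)
  odd⇒H t o with parity (+ t)
  ... | inj₂ r = r
  ... | inj₁ (a , e) = ⊥-elim (o (∣⇒∣ᵤ {+ 2} {+ t} (divides a (trans e (((∀ a → a + a ≡ a * + 2) ∋ solve-∀) a)))))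

H⇒odd : ∀ t t′ → + t ≡ H t′ → Odd t
H⇒odd t t′ e d with ∣ᵤ⇒∣ {+ 2} {+ t} d
... | divides a q = even≢odd a t′ (trans (((∀ a → a + a ≡ a * + 2) ∋ solve-∀) a) (trans (sym q) e))

Good : ℕ → ℕ → Partition → Partition → ℕ → Partition → Set
Good s t σ τ n λ′ = size λ′ ≡ n × SEq s λ′ σ × SEq t λ′ τ × Sym (I λ′)

Unique : ℕ → ℕ → Partition → Partition → ℕ → Set
Unique s t σ τ n = Σ Partition λ λ′ → Good s t σ τ n λ′ × (∀ μ → Good s t σ τ n μ → μ ≡ λ′)

good-swap : ∀ {s t σ τ n λ′} → Good s t σ τ n λ′ → Good t s τ σ n λ′
good-swap (a , b , c , d) = a , c , b , d

unique-swap : ∀ {s t σ τ n} → Unique s t σ τ n → Unique t s τ σ n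
unique-swap (λ′ , g , h) = λ′ , good-swap g , λ μ g′ → h μ (good-swap g′)

-- Moving r to its mirror image keeps the class numbers modulo s, so what remains is at least as
-- large as the core σ.
unflip-axis : ∀ s σ → 1 ℕ.≤ s → Closed s (I σ) → ∀ μ → Sym (I μ) → SEq s μ σ → ∀ r → I μ r ≡ 1ℤ → + s ∣ H r →
    + size σ + H r ≤ + size μ
unflip-axis s σ 1≤s cs μ sy sq r r∈ d = ≤-lin₁
    (subst (+ size σ ≤_) (Flipped.sizes F) (ℤ.+≤+ (seq-size-≤ s _ σ 1≤s (seq-trans seq-F sq) cs)))
    (((∀ m g r → m - (g + (r + r + 1ℤ)) ≡ (m + (((-1ℤ - r) + (-1ℤ - r) + 1ℤ) + 0ℤ)) - g) ∋ solve-∀) (+ size μ)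
        (+ size σ) r)
  where
  F : Flipped μ (bar r ∷ [])
  F = flip₁ μ sy (bar r) (sym-bead μ sy r∈)
  seq-F : SEq s (Flipped.result F) μ
  seq-F = flipped-seq F (zc-cong (λ p → sym (trans (+-identityʳ _) (fl-bar r p))) (zc-neg (zc-fl s r d)))

unflip-axis-≡ : ∀ s σ → 1 ℕ.≤ s → Closed s (I σ) → ∀ μ → Sym (I μ) → SEq s μ σ → ∀ r → I μ r ≡ 1ℤ → + s ∣ H r →
    + size μ ≡ + size σ + H r →
  ∀ x → I μ x ≡ I σ x + fl r x
unflip-axis-≡ s σ 1≤s cs μ sy sq r r∈ d e x = trans (((∀ m f → m ≡ (m + (- f + 0ℤ)) + f) ∋ solve-∀) (I μ x) (fl r x))
  (cong (_+ fl r x) (trans (cong (λ z → I μ x + (z + 0ℤ)) (sym (fl-bar r x)))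
      (trans (sym (Flipped.beads F x)) (cong (λ ν → I ν x) same))))
  where
  F : Flipped μ (bar r ∷ [])
  F = flip₁ μ sy (bar r) (sym-bead μ sy r∈)
  seq-F : SEq s (Flipped.result F) μ
  seq-F = flipped-seq F (zc-cong (λ p → sym (trans (+-identityʳ _) (fl-bar r p))) (zc-neg (zc-fl s r d)))
  same : Flipped.result F ≡ σ
  same = seq-size-≡ s _ σ 1≤s (seq-trans seq-F sq) cs (ℤₚ.+-injective (trans (Flipped.sizes F)
    (trans (cong (λ z → z + (H (bar r) + 0ℤ)) e)
        (((∀ g r → (g + (r + r + 1ℤ)) + (((-1ℤ - r) + (-1ℤ - r) + 1ℤ) + 0ℤ) ≡ g) ∋ solve-∀) (+ size σ) r))))

flip-seq : ∀ {s β w} → (F : Flipped β (w ∷ [])) → ∀ σ → ∀ b → + s ∣ w - b → (∀ x → I σ x ≡ I β x + fl b x) → SEq s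
    (Flipped.result F) σ
flip-seq {s} {β} {w} F σ b d e = sameCharges
    (zc-cong (λ x → trans (((∀ i a b → a - b ≡ (i + (a + 0ℤ)) - (i + b)) ∋ solve-∀) (I β x) (fl w x) (fl b x))
    (sym (cong₂ _-_ (Flipped.beads F x) (e x))))
  (zc-fl₂ s w b d))

0≤half : ∀ {t t′} → 1 ℕ.≤ t → + t ≡ H t′ → 0ℤ ≤ t′
0≤half 1≤t e = 1≤H⇒0≤ (subst (1ℤ ≤_) e (ℤ.+≤+ 1≤t))

∣-half : ∀ {t} t′ → + t ≡ H t′ → + t ∣ H t′
∣-half t′ e = ∣-≡ e ∣-self

back-C2 : ∀ s t → 1 ℕ.≤ t → ∀ σ τ → SymCore s t τ → C2 s t σ τ (size τ ℕ.+ t) → Unique s t σ τ (size τ ℕ.+ t)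
back-C2 s t 1≤t σ τ (sy , cs , ct) (odd , (b , b∈B , _ , cg , sw) , _) with odd⇒H t odd
... | t′ , et = Flipped.result F ,
    (size-F , flip-seq F σ (bar b) (∣-lin₁ -1ℤ s∣ (((∀ a b → a - b ≡ -1ℤ * (b - a)) ∋ solve-∀) t′ (bar b)))
    (swap⇒I σ τ b sy b∈ sw) , seq-t , Flipped.symmetric F) , unique
  where
  b∈ : I τ b ≡ 1ℤ
  b∈ = ∈B⇒I τ b b∈B
  s∣ : + s ∣ bar b - t′
  s∣ = cong⇒∣ s b (+ t) t′ et cg
  F : Flipped τ (t′ ∷ [])
  F = flip₁ τ sy t′ (core-gap t τ sy ct t′ (0≤half 1≤t et) (∣-half t′ et))
  size-F : size (Flipped.result F) ≡ size τ ℕ.+ t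
  size-F = ℤₚ.+-injective (trans (Flipped.sizes F) (cong (λ z → + size τ + z) (trans (+-identityʳ (H t′)) (sym et))))
  seq-t : SEq t (Flipped.result F) τ
  seq-t = flipped-seq F (zc-cong (λ p → sym (+-identityʳ (fl t′ p))) (zc-fl t t′ (∣-half t′ et)))
  unique : ∀ μ → Good s t σ τ (size τ ℕ.+ t) μ → μ ≡ Flipped.result F
  -- The t-weight is 1, written as `H 0ℤ`. The axis bead that it forces has H ≤ t and so is t′, and
  -- flipping it back leaves τ.
  unique μ (sz , _ , sq , syμ) = from
      (odd-weight t τ 1≤t ct μ syμ sq 0ℤ
      (trans (cong +_ sz) (cong (λ z → + size τ + z) (sym (ℤₚ.*-identityˡ (+ t))))))
    where
    from : ∃[ q ] (0ℤ ≤ q × I μ q ≡ 1ℤ × + t ∣ H q) → μ ≡ Flipped.result F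
    from (q , 0≤q , q∈ , d) = I-inj λ x → trans
        (unflip-axis-≡ t τ 1≤t ct μ syμ sq q q∈ d (trans (cong +_ sz) (cong (λ z → + size τ + z) (sym Hq))) x)
        (trans (cong (λ z → I τ x + fl z x) q≡t′)
            (sym (trans (Flipped.beads F x) (cong (λ z → I τ x + z) (+-identityʳ (fl t′ x))))))
      where
      Hq : H q ≡ + t
      Hq = ℤₚ.≤-antisym (≤-lin₁ (unflip-axis t τ 1≤t ct μ syμ sq q q∈ d)
          (trans (((∀ t h n → t - h ≡ (n + t) - (n + h)) ∋ solve-∀) (+ t) (H q) (+ size τ))
          (cong (λ z → z - (+ size τ + H q)) (cong +_ (sym sz)))))
        (pos-mult-≥ d (0≤⇒1≤H 0≤q))
      q≡t′ : q ≡ t′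
      q≡t′ = H-inj (trans Hq et)

isKappa-max : ∀ s t → 1 ℕ.≤ s → 1 ℕ.≤ t → ∀ σ → IsKappa s t σ → ∀ μ → SymCore s t μ → size μ ℕ.≤ size σ
isKappa-max s t 1≤s 1≤t σ (_ , _ , mx) μ (_ , cs , ct) = mx μ (closed⇒isCore s μ 1≤s cs) (closed⇒isCore t μ 1≤t ct)

frob-odd : ∀ s t s′ t′ → + s ≡ H s′ → + t ≡ H t′ → H (+ 2 * (s′ * t′) - 1ℤ) ≡ frob s t
frob-odd s t s′ t′ es et = trans
    (((∀ a b → (+ 2 * (a * b) - 1ℤ) + (+ 2 * (a * b) - 1ℤ) + 1ℤ ≡ ((a + a + 1ℤ) * (b + b + 1ℤ) - (a + a + 1ℤ)) -
    (b + b + 1ℤ)) ∋ solve-∀) s′ t′)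
  (sym (cong₂ (λ a b → (a * b - a) - b) es et))

prod-odd : ∀ s t s′ t′ → + s ≡ H s′ → + t ≡ H t′ → H (+ 2 * (s′ * t′) + s′ + t′) ≡ + s * + t
prod-odd s t s′ t′ es et = trans
    (((∀ a b → (+ 2 * (a * b) + a + b) + (+ 2 * (a * b) + a + b) + 1ℤ ≡ (a + a + 1ℤ) * (b + b + 1ℤ)) ∋ solve-∀) s′
    t′) (sym (cong₂ _*_ es et))

st-≤ : ∀ {s t} → Coprime s t → ∀ {z} → + s ∣ z → + t ∣ z → 1ℤ ≤ z → + s * + t ≤ z
st-≤ {s} {t} cop {z} a b c = subst (_≤ z) (ℤₚ.pos-* s t)
    (pos-mult-≥ {s ℕ.* t} (subst (_∣ z) (sym (ℤₚ.pos-* s t)) (cop-∣ cop a b)) c)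

module AddProduct (s t : ℕ) (1<s : 1 ℕ.< s) (1<t : 1 ℕ.< t) (σ : Partition) (sc : SymCore s t σ) (u : ℤ) (eu : H u ≡ + s * + t) where

  s∣u : + s ∣ H u
  s∣u = divides (+ t) (trans eu (ℤₚ.*-comm (+ s) (+ t)))

  t∣u : + t ∣ H u
  t∣u = divides (+ s) eu

  0≤u : 0ℤ ≤ u
  0≤u = 1≤H⇒0≤ (subst (1ℤ ≤_) (sym eu)
      (≤-lin {c = 0ℤ} {(+ s - 1ℤ) * + t} {1ℤ} {+ t} (0≤* {+ s - 1ℤ} {+ t} (≤⇒0≤ (ℤ.+≤+ (ℕₚ.<⇒≤ 1<s))) 0≤+n)
      (ℤ.+≤+ (ℕₚ.<⇒≤ 1<t))
    (((∀ s t → s * t - 1ℤ ≡ ((s - 1ℤ) * t - 0ℤ) + (t - 1ℤ)) ∋ solve-∀) (+ s) (+ t))))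

  F : Flipped σ (u ∷ [])
  F = flip₁ σ (proj₁ sc) u (core-gap s σ (proj₁ sc) (proj₁ (proj₂ sc)) u 0≤u s∣u)

  beads-F : ∀ x → I (Flipped.result F) x ≡ I σ x + fl u x
  beads-F x = trans (Flipped.beads F x) (cong (λ z → I σ x + z) (+-identityʳ (fl u x)))

  seq-F : ∀ {r} → + r ∣ H u → SEq r (Flipped.result F) σ
  seq-F {r} d = flipped-seq F (zc-cong (λ p → sym (+-identityʳ (fl u p))) (zc-fl r u d))

  size-F : size (Flipped.result F) ≡ size σ ℕ.+ s ℕ.* t
  size-F = ℤₚ.+-injective (trans (Flipped.sizes F)
      (cong (λ z → + size σ + z) (trans (+-identityʳ (H u)) (trans eu (sym (ℤₚ.pos-* s t))))))

  good : ∀ {n} → n ≡ size σ ℕ.+ s ℕ.* t → Good s t σ σ n (Flipped.result F)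
  good e = trans size-F (sym e) , seq-F s∣u , seq-F t∣u , Flipped.symmetric F

module ProductUnique (s t : ℕ) (1<s : 1 ℕ.< s) (1<t : 1 ℕ.< t) (cop : Coprime s t) (σ : Partition)
    (sc : SymCore s t σ)
  (s′ t′ u x₀ : ℤ) (es : + s ≡ H s′) (et : + t ≡ H t′) (eu : H u ≡ + s * + t) (e₀ : H x₀ ≡ frob s t) (d₀ : + s ∣ t′ - bar x₀) (x₀∈ : I σ x₀ ≡ 1ℤ) where

  open AddProduct s t 1<s 1<t σ sc u eu

  sy : Sym (I σ)
  sy = proj₁ sc
  cs : Closed s (I σ)
  cs = proj₁ (proj₂ sc)
  ct : Closed t (I σ)
  ct = proj₂ (proj₂ sc)
  1≤s : 1 ℕ.≤ s
  1≤s = ℕₚ.<⇒≤ 1<s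
  1≤t : 1 ℕ.≤ t
  1≤t = ℕₚ.<⇒≤ 1<t

  -- The weights t and s are odd, so μ has a bead p on the s-axis and a bead q on the t-axis. If q
  -- is on both, it accounts for all of s t. Otherwise `removal-bound` gives a bead z ≥ `bar x₀` of
  -- σ in the class of `bar x₀` modulo s, and then `bar x₀` is a bead together with x₀.
  unique : ∀ μ → Good s t σ σ (size σ ℕ.+ s ℕ.* t) μ → μ ≡ Flipped.result F
  unique μ (sz , sqs , sqt , syμ) = by-axes
      (odd-weight s σ 1≤s cs μ syμ sqs t′
          (trans szℤ (cong (λ z → + size σ + z) (trans (ℤₚ.*-comm (+ s) (+ t)) (cong (_* + s) et)))))
      (odd-weight t σ 1≤t ct μ syμ sqt s′ (trans szℤ (cong (λ z → + size σ + z) (cong (_* + t) es))))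
    where
    szℤ : + size μ ≡ + size σ + + s * + t
    szℤ = trans (cong +_ sz) (cong (λ z → + size σ + z) (ℤₚ.pos-* s t))
    common : ∀ r → 0ℤ ≤ r → I μ r ≡ 1ℤ → + s ∣ H r → + t ∣ H r → μ ≡ Flipped.result F
    common r 0≤r r∈ s∣r t∣r = I-inj λ x → trans
        (unflip-axis-≡ s σ 1≤s cs μ syμ sqs r r∈ s∣r (trans szℤ (cong (λ z → + size σ + z) (sym Hr))) x)
        (trans (cong (λ z → I σ x + fl z x) (H-inj (trans Hr (sym eu)))) (sym (beads-F x)))
      where
      Hr : H r ≡ + s * + t
      Hr = ℤₚ.≤-antisym (≤-lin₁ (unflip-axis s σ 1≤s cs μ syμ sqs r r∈ s∣r)
          (trans (((∀ t h n → t - h ≡ (n + t) - (n + h)) ∋ solve-∀) (+ s * + t) (H r) (+ size σ))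
          (cong (λ z → z - (+ size σ + H r)) (sym szℤ))))
        (st-≤ cop s∣r t∣r (0≤⇒1≤H 0≤r))
    by-axes : ∃[ p ] (0ℤ ≤ p × I μ p ≡ 1ℤ × + s ∣ H p) → ∃[ q ] (0ℤ ≤ q × I μ q ≡ 1ℤ × + t ∣ H q) →
        μ ≡ Flipped.result F
    by-axes (p , 0≤p , p∈ , s∣p) (q , 0≤q , q∈ , t∣q) = choose (+ s ∣? H q)
      where
      contra : ∃[ z ] (I σ z ≡ 1ℤ × + s ∣ z - t′ × ((+ size σ - H z) + H p) + + t ≤ + size μ) → ⊥
      contra (z , z∈ , s∣z , le) = 0≢1 (sym-bead σ sy x₀∈) (closed-∣ cs z (bar x₀)
          (∣-lin 1ℤ 1ℤ s∣z d₀ (((∀ z t x → z - x ≡ 1ℤ * (z - t) + 1ℤ * (t - x)) ∋ solve-∀) z t′ (bar x₀)))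
          (H-cancel-≤ (≤-lin {c = ((+ size σ - H z) + H p) + + t} {+ size σ + + s * + t} {+ s} {H p}
              (≤-trans le (≤-reflexive szℤ)) (pos-mult-≥ s∣p (0≤⇒1≤H 0≤p))
            (trans (cong (λ w → H z - w) (trans (H-bar x₀) (cong -_ e₀)))
                (((∀ n z p s t → z - - ((s * t - s) - t) ≡ ((n + s * t) - (((n - z) + p) + t)) + (p - s)) ∋ solve-∀)
                (+ size σ) (H z) (H p) (+ s) (+ t))))) z∈)
      choose : Dec (+ s ∣ H q) → μ ≡ Flipped.result F
      choose (yes s∣q) = common q 0≤q q∈ s∣q t∣q
      choose (no s∤q) = ⊥-elim (contra (removal-bound s t 1≤s σ sc μ syμ sqs p p∈ s∣p q 0≤q q∈ t∣q s∤q t′ et))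

back-C5 : ∀ s t → 1 ℕ.< s → 1 ℕ.< t → Coprime s t → ∀ σ → SymCore s t σ → Odd s → Odd t → IsKappa s t σ →
    Unique s t σ σ (size σ ℕ.+ s ℕ.* t)
back-C5 s t 1<s 1<t cop σ sc odds oddt isκ = from (odd⇒H s odds) (odd⇒H t oddt)
  where
  from : ∃[ s′ ] (+ s ≡ H s′) → ∃[ t′ ] (+ t ≡ H t′) → Unique s t σ σ (size σ ℕ.+ s ℕ.* t)
  from (s′ , es) (t′ , et) = Flipped.result (AddProduct.F s t 1<s 1<t σ sc u eu) , AddProduct.good s t 1<s 1<t σ sc u
      eu refl ,
      ProductUnique.unique s t 1<s 1<t cop σ sc s′ t′ u x₀ es et eu e₀
        (∣-lin₁ t′ (∣-half s′ es) (((∀ a b → b - (-1ℤ - (+ 2 * (a * b) - 1ℤ)) ≡ b * (a + a + 1ℤ)) ∋ solve-∀) s′ t′))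
        (Defect.Extremal.max-tight s t 1<s 1<t cop x₀ e₀ σ sc (isKappa-max s t (ℕₚ.<⇒≤ 1<s) (ℕₚ.<⇒≤ 1<t) σ isκ))
    where
    -- The positions with H equal to s t and to s t - s - t, for s = 2 s′ + 1 and t = 2 t′ + 1.
    u x₀ : ℤ
    u = + 2 * (s′ * t′) + s′ + t′
    x₀ = + 2 * (s′ * t′) - 1ℤ
    eu : H u ≡ + s * + t
    eu = prod-odd s t s′ t′ es et
    e₀ : H x₀ ≡ frob s t
    e₀ = frob-odd s t s′ t′ es et

-- The relation of (C4) seen from ρ = σ ⋆ τ, from which σ and τ arise by flipping one bead each.
-- Here c is the mirror image of the c in the definition of the relation, which makes the data
-- symmetric in s and t.
record Crossing (s t : ℕ) (σ τ ρ : Partition) (s′ t′ b c : ℤ) : Set where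
  field
    es   : + s ≡ H s′
    et   : + t ≡ H t′
    symρ : Sym (I ρ)
    b∈   : I ρ b ≡ 1ℤ
    c∈   : I ρ c ≡ 1ℤ
    b≢c  : b ≢ c
    σ-eq : ∀ x → I σ x ≡ I ρ x + fl (bar b) x
    τ-eq : ∀ x → I τ x ≡ I ρ x + fl (bar c) x
    s∣   : + s ∣ bar b - t′
    t∣   : + t ∣ bar c - s′

crossing-swap : ∀ {s t σ τ ρ s′ t′ b c} → Crossing s t σ τ ρ s′ t′ b c → Crossing t s τ σ ρ t′ s′ c b
crossing-swap X = record { es = et ; et = es ; symρ = symρ ; b∈ = c∈ ; c∈ = b∈ ; b≢c = λ e → b≢c (sym e) ; σ-eq =
    τ-eq ; τ-eq = σ-eq ; s∣ = t∣ ; t∣ = s∣ }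
  where open Crossing X

small-multiple : ∀ {s t} → Coprime s t → ∀ V → + s ∣ V → + t ∣ V → 1ℤ - + s * + t ≤ V → V ≢ 0ℤ → + s * + t ≤ V
small-multiple {s} {t} cop V a b lo ne with 1ℤ ≤? V
... | yes p = st-≤ cop a b p
... | no ¬p = ⊥-elim (pos≰0 {0}
    (≤-lin lo (st-≤ cop (∣m⇒∣-m a) (∣m⇒∣-m b) 1≤-V) (((∀ st v → 0ℤ - 1ℤ ≡ (v - (1ℤ - st)) + (- v - st)) ∋ solve-∀)
    (+ s * + t) V)))
  where
  1≤-V : 1ℤ ≤ - V
  1≤-V = ≰⇒1+≤ {b = 0ℤ} λ q → ne (ℤₚ.≤-antisym (≤-lin₁ (≰⇒1+≤ ¬p) (((∀ v → 0ℤ - v ≡ 1ℤ - (1ℤ + v)) ∋ solve-∀) V))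
      (≤-lin₁ q (((∀ v → v - 0ℤ ≡ 0ℤ - - v) ∋ solve-∀) V)))

swap-size : ∀ ρ σ b → Sym (I ρ) → I ρ b ≡ 1ℤ → (∀ x → I σ x ≡ I ρ x + fl (bar b) x) → + size σ ≡ + size ρ - H b
swap-size ρ σ b sy b∈ e = trans
    (cong (λ ν → + size ν) (I-inj {σ} {Flipped.result F}
    (λ x → trans (e x) (sym (trans (Flipped.beads F x) (cong (λ z → I ρ x + z) (+-identityʳ (fl (bar b) x))))))))
  (trans (Flipped.sizes F) (((∀ n b → n + (((-1ℤ - b) + (-1ℤ - b) + 1ℤ) + 0ℤ) ≡ n - (b + b + 1ℤ)) ∋ solve-∀)
      (+ size ρ) b))
  where
  F : Flipped ρ (bar b ∷ [])
  F = flip₁ ρ sy (bar b) (sym-bead ρ sy b∈)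

module CrossingFacts (s t : ℕ) (1<s : 1 ℕ.< s) (1<t : 1 ℕ.< t) (cop : Coprime s t) (σ τ ρ : Partition)
    (scσ : SymCore s t σ) (scτ : SymCore s t τ)
  (s′ t′ b c : ℤ) (X : Crossing s t σ τ ρ s′ t′ b c) where

  open Crossing X public

  1≤s : 1 ℕ.≤ s
  1≤s = ℕₚ.<⇒≤ 1<s

  S T : ℤ
  S = + s
  T = + t

  s∤t : ¬ (S ∣ T)
  s∤t = ¬t∣s 1<s (Coprimality.sym cop)

  s∣Hb+t : S ∣ H b + T
  s∣Hb+t = ∣-lin₁ (- + 2) s∣ (trans (cong (λ z → H b + z) et)
      (((∀ b t → (b + b + 1ℤ) + (t + t + 1ℤ) ≡ - + 2 * ((-1ℤ - b) - t)) ∋ solve-∀) b t′))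

  s∤b : ¬ (S ∣ H b)
  s∤b d = s∤t (∣-lin 1ℤ -1ℤ s∣Hb+t d (((∀ b t → t ≡ 1ℤ * (b + t) + -1ℤ * b) ∋ solve-∀) (H b) T))

  σ-elsewhere : ∀ x → x ≢ b → x ≢ bar b → I σ x ≡ I ρ x
  σ-elsewhere x n m = trans (σ-eq x) (trans (cong (λ z → I ρ x + z) (fl-0 m (λ e → n (trans e (bar-bar b)))))
      (+-identityʳ _))

  b∉σ : I σ b ≡ 0ℤ
  b∉σ = trans (σ-eq b) (cong₂ _+_ b∈ (cong₂ _-_ (δ-≢ (λ e → 0≢1 (trans (cong (I ρ) e) (sym-bead ρ symρ b∈)) b∈))
      (δ-≡ (sym (bar-bar b)))))

  b̄∈σ : I σ (bar b) ≡ 1ℤ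
  b̄∈σ = sym-gap σ (proj₁ scσ) b∉σ

  c∈σ : I σ c ≡ 1ℤ
  c∈σ = trans (σ-elsewhere c (λ e → b≢c (sym e)) (λ e → 0≢1 (trans (cong (I ρ) e) (sym-bead ρ symρ b∈)) c∈)) c∈

  Hb̄≤ : - H b ≤ frob s t
  Hb̄≤ = subst (_≤ frob s t) (H-bar b) (core-bound 1≤s cop σ scσ (bar b) b̄∈σ)

  Hc≤ : H c ≤ frob s t
  Hc≤ = core-bound 1≤s cop σ scσ c c∈σ

  size-σ : + size σ ≡ + size ρ - H b
  size-σ = swap-size ρ σ b symρ b∈ σ-eq

  gap-s′ : I ρ s′ ≡ 0ℤ
  gap-s′ = trans (sym (σ-elsewhere s′ (λ { refl → s∤b (∣-half s′ es) })
      (λ { refl → s∤b (subst (λ z → S ∣ H z) (bar-bar b) (∣H-bar (bar b) (∣-half s′ es))) })))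
    (core-gap s σ (proj₁ scσ) (proj₁ (proj₂ scσ)) s′ (0≤half 1≤s es) (∣-half s′ es))

module CrossingTop (s t : ℕ) (1<s : 1 ℕ.< s) (1<t : 1 ℕ.< t) (cop : Coprime s t) (σ τ ρ : Partition)
    (scσ : SymCore s t σ) (scτ : SymCore s t τ)
  (s′ t′ b c : ℤ) (X : Crossing s t σ τ ρ s′ t′ b c) where

  open CrossingFacts s t 1<s 1<t cop σ τ ρ scσ scτ s′ t′ b c X public
  module Y = CrossingFacts t s 1<t 1<s (Coprimality.sym cop) τ σ ρ
      (proj₁ scτ , proj₂ (proj₂ scτ) , proj₁ (proj₂ scτ)) (proj₁ scσ , proj₂ (proj₂ scσ) , proj₁ (proj₂ scσ)) t′ s′ c
      b (crossing-swap X)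

  csσ : Closed s (I σ)
  csσ = proj₁ (proj₂ scσ)

  frob-swap : frob t s ≡ frob s t
  frob-swap = ((∀ s t → (t * s - t) - s ≡ (s * t - s) - t) ∋ solve-∀) S T

  Hb≤ : H b ≤ frob s t
  Hb≤ = subst (H b ≤_) frob-swap Y.Hc≤

  -- Otherwise b - s would lie in τ but not in σ, hence equal bar c, and then the multiple
  -- H (bar c) + t - s of s t would be odd and smaller than s t in absolute value.
  top : I σ (bar b + S) ≡ 0ℤ
  top with I-01 σ (bar b + S)
  ... | inj₁ e = e
  ... | inj₂ e = ⊥-elim (contra ((b - S) ≟ bar c))
    where
    mir : bar (bar b + S) ≡ b - S
    mir = ((∀ b s → -1ℤ - ((-1ℤ - b) + s) ≡ b - s) ∋ solve-∀) b S
    y∉σ : I σ (b - S) ≡ 0ℤ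
    y∉σ = trans (cong (I σ) (sym mir)) (sym-bead σ (proj₁ scσ) e)
    y∈τ : I τ (b - S) ≡ 1ℤ
    y∈τ = proj₁ (proj₂ scτ) b Y.c∈σ
    shift≢ : b - S ≢ b
    shift≢ q = ℕₚ.<-irrefl (sub-inj b {0} {s} (trans (+-identityʳ b) (sym q))) 1≤s
    contra : Dec (b - S ≡ bar c) → ⊥
    contra (no n) = in-ρ (I-01 ρ (b - S))
      where
      in-ρ : I ρ (b - S) ≡ 0ℤ ⊎ I ρ (b - S) ≡ 1ℤ → ⊥
      in-ρ (inj₁ q) = 0≢1 (trans (Y.σ-elsewhere (b - S) (λ { w → c-case w }) n) q) y∈τ
        where
        c-case : b - S ≢ c
        c-case w = 0≢1 q (trans (cong (I ρ) w) c∈)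
      in-ρ (inj₂ q) = 0≢1 y∉σ (trans (σ-elsewhere (b - S) shift≢
          (λ w → 0≢1 (trans (cong (I ρ) w) (sym-bead ρ symρ b∈)) q)) q)
    contra (yes q) = pos≰0 {0} (≤-trans (ℤ.+≤+ 1≤s)
        (≤-lin {c = + 4 * S} {0ℤ} {0ℤ} {+ 3 * S} 4S≤0 (0≤* {+ 3} {S} 0≤+n 0≤+n)
        (((∀ s → 0ℤ - s ≡ (0ℤ - + 4 * s) + (+ 3 * s - 0ℤ)) ∋ solve-∀) S)))
      where
      V : ℤ
      V = ((H b - (S + S)) + T) - S
      Hc̄ : H b - (S + S) ≡ - H c
      Hc̄ = trans (((∀ b s → (b + b + 1ℤ) - (s + s) ≡ (b - s) + (b - s) + 1ℤ) ∋ solve-∀) b S)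
          (trans (cong H q) (H-bar c))
      sV : S ∣ V
      sV = ∣-lin 1ℤ (- + 3) s∣Hb+t ∣-self (((∀ b s t → ((b - (s + s)) + t) - s ≡ 1ℤ * (b + t) + - + 3 * s) ∋ solve-∀)
          (H b) S T)
      tV : T ∣ V
      tV = ∣-lin -1ℤ 1ℤ Y.s∣Hb+t ∣-self
          (trans (cong (λ z → (z + T) - S) Hc̄) (((∀ c s t → (- c + t) - s ≡ -1ℤ * (c + s) + 1ℤ * t) ∋ solve-∀)
          (H c) S T))
      lo : 1ℤ - S * T ≤ V
      lo = ≤-lin {c = H c} {frob s t} {1ℤ} {T + T} Hc≤ 1≤2T
        (trans (cong (λ z → ((z + T) - S) - (1ℤ - S * T)) Hc̄)
            (((∀ c s t → ((- c + t) - s) - (1ℤ - s * t) ≡ (((s * t - s) - t) - c) + ((t + t) - 1ℤ)) ∋ solve-∀)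
            (H c) S T))
        where
        1≤2T : 1ℤ ≤ T + T
        1≤2T = ≤-lin {c = 1ℤ} {T} {0ℤ} {T} (ℤ.+≤+ (ℕₚ.<⇒≤ 1<t)) 0≤+n
            (((∀ t → (t + t) - 1ℤ ≡ (t - 1ℤ) + (t - 0ℤ)) ∋ solve-∀) T)
      V≢0 : V ≢ 0ℤ
      V≢0 z = even≢odd 0ℤ (((b + t′) - + 3 * s′) - 1ℤ)
          (trans (sym z) (trans (cong₂ (λ a d → ((H b - (a + a)) + d) - a) es et)
        (((∀ b s t → (((b + b + 1ℤ) - ((s + s + 1ℤ) + (s + s + 1ℤ))) + (t + t + 1ℤ)) - (s + s + 1ℤ) ≡
            (((b + t) - + 3 * s) - 1ℤ) + (((b + t) - + 3 * s) - 1ℤ) + 1ℤ) ∋ solve-∀) b s′ t′)))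
      4S≤0 : + 4 * S ≤ 0ℤ
      4S≤0 = ≤-lin {c = S * T} {V} {H b} {frob s t} (small-multiple cop V sV tV lo V≢0) Hb≤
        (((∀ b s t → 0ℤ - + 4 * s ≡ ((((b - (s + s)) + t) - s) - s * t) + (((s * t - s) - t) - b)) ∋ solve-∀)
            (H b) S T)

  -- ρ comes back from σ by flipping `bar b`, and `top` shows that this is the largest bead of its
  -- class modulo s.
  closed-ρ : Closed s (I ρ)
  closed-ρ = subst (λ ν → Closed s (I ν)) (I-inj {Flipped.result F} {ρ} λ x → trans (Flipped.beads F x)
      (trans (cong₂ (λ i f → i + (f + 0ℤ)) (σ-eq x) (fl-bar (bar b) x))
      (((∀ i f → (i + f) + (- f + 0ℤ) ≡ i) ∋ solve-∀) (I ρ x) (fl (bar b) x))))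
    (top-flip-closed s σ 1≤s (proj₁ scσ) csσ (bar b) b̄∈σ top
        (λ d → s∤b (subst (λ z → S ∣ H z) (bar-bar b) (∣H-bar (bar b) d))) F)
    where
    F : Flipped σ (bar (bar b) ∷ [])
    F = flip₁ σ (proj₁ scσ) (bar (bar b)) (sym-bead σ (proj₁ scσ) b̄∈σ)

  -- The excess over σ is H b + s + t, in which H b + t is an even multiple of s.
  odd-weight-s : ∃[ w ] ((+ size ρ + S) + T ≡ + size σ + H w * S)
  odd-weight-s = from s∣
    where
    from : S ∣ bar b - t′ → ∃[ w ] ((+ size ρ + S) + T ≡ + size σ + H w * S)
    from (divides j e) = - j , trans
        (cong₂ (λ n t → (n + S) + t) (trans (((∀ n h → n ≡ (n - h) + h) ∋ solve-∀) (+ size ρ) (H b))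
        (cong (_+ H b) (sym size-σ))) et)
      (trans (((∀ n b s t → ((n + (b + b + 1ℤ)) + s) + (t + t + 1ℤ) ≡ n + (s - + 2 * ((-1ℤ - b) - t))) ∋ solve-∀)
          (+ size σ) b S t′)
        (trans (cong (λ z → + size σ + (S - + 2 * z)) e)
            (((∀ n j s → n + (s - + 2 * (j * s)) ≡ n + (- j + - j + 1ℤ) * s) ∋ solve-∀) (+ size σ) j S)))

  -- The bead z given by `removal-bound` lies in the class of `bar b` modulo s, whose top is
  -- `bar b`. With z ≤ `bar b` the bound reduces to H p ≤ s.
  axis-s : ∀ μ → + size μ ≡ (+ size ρ + S) + T → SEq s μ σ → Sym (I μ) →
    ∀ p → 0ℤ ≤ p → I μ p ≡ 1ℤ → S ∣ H p → ∀ q → 0ℤ ≤ q → I μ q ≡ 1ℤ → T ∣ H q → ¬ (S ∣ H q) → p ≡ s′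
  axis-s μ sz sq sy p 0≤p p∈ s∣p q 0≤q q∈ t∣q s∤q = H-inj
      (trans (ℤₚ.≤-antisym (from (removal-bound s t 1≤s σ scσ μ sy sq p p∈ s∣p q 0≤q q∈ t∣q s∤q t′ et))
      (pos-mult-≥ s∣p (0≤⇒1≤H 0≤p))) es)
    where
    from : ∃[ z ] (I σ z ≡ 1ℤ × S ∣ z - t′ × ((+ size σ - H z) + H p) + T ≤ + size μ) → H p ≤ S
    from (z , z∈ , s∣z , le) = ≤-lin {c = ((+ size σ - H z) + H p) + T} {(+ size ρ + S) + T} {z + z} {bar b + bar b}
        (≤-trans le (≤-reflexive sz)) (ℤₚ.+-mono-≤ z≤ z≤)
      (trans (((∀ n b z p s t → s - p ≡ ((n + s) + t) - ((((n - (b + b + 1ℤ)) - (z + z + 1ℤ)) + p) + t) +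
          (((-1ℤ - b) + (-1ℤ - b)) - (z + z))) ∋ solve-∀) (+ size ρ) b z (H p) S T)
        (cong (λ w → ((+ size ρ + S) + T) - (((w - H z) + H p) + T) + ((bar b + bar b) - (z + z))) (sym size-σ)))
      where
      z≤ : z ≤ bar b
      z≤ with z ≤? bar b
      ... | yes r = r
      ... | no ¬r = ⊥-elim (0≢1 top (closed-∣ csσ z (bar b + S)
          (∣-lin 1ℤ -1ℤ d ∣-self (((∀ z b s → z - (b + s) ≡ 1ℤ * (z - b) + -1ℤ * s) ∋ solve-∀) z (bar b) S))
          (≤-lin₁ (pos-mult-≥ d (≤-lin₁ (≰⇒1+≤ ¬r) (((∀ z b → (z - b) - 1ℤ ≡ z - (1ℤ + b)) ∋ solve-∀) z (bar b))))
              (((∀ z b s → z - (b + s) ≡ (z - b) - s) ∋ solve-∀) z (bar b) S)) z∈))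
        where
        d : S ∣ z - bar b
        d = ∣-lin 1ℤ -1ℤ s∣z s∣ (((∀ z b t → z - b ≡ 1ℤ * (z - t) + -1ℤ * (b - t)) ∋ solve-∀) z (bar b) t′)

  -- A bead on both axes has H at least s t but contributes at most H b + s + t, so H b reaches the
  -- bound for cores. With s and t exchanged the same follows for c, and b = c is excluded.
  no-common : ∀ μ → + size μ ≡ (+ size ρ + S) + T → SEq s μ σ → Sym (I μ) → ∀ r → 0ℤ ≤ r → I μ r ≡ 1ℤ → S ∣ H r →
      T ∣ H r → H b ≡ frob s t
  no-common μ sz sq sy r 0≤r r∈ s∣r t∣r = ℤₚ.≤-antisym Hb≤
    (≤-lin {c = + size σ + H r} {(+ size ρ + S) + T} {S * T} {H r}
        (≤-trans (unflip-axis s σ 1≤s csσ μ sy sq r r∈ s∣r) (≤-reflexive sz)) (st-≤ cop s∣r t∣r (0≤⇒1≤H 0≤r))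
      (trans (((∀ n b r s t → b - ((s * t - s) - t) ≡ ((n + s) + t) - ((n - b) + r) + (r - s * t)) ∋ solve-∀)
          (+ size ρ) (H b) (H r) S T) (cong (λ w → ((+ size ρ + S) + T) - (w + H r) + (H r - S * T)) (sym size-σ))))

back-C4 : ∀ s t → 1 ℕ.< s → 1 ℕ.< t → Coprime s t → ∀ σ τ ρ → SymCore s t σ → SymCore s t τ → ∀ s′ t′ b c →
    Crossing s t σ τ ρ s′ t′ b c →
  Unique s t σ τ (size ρ ℕ.+ s ℕ.+ t)
back-C4 s t 1<s 1<t cop σ τ ρ scσ scτ s′ t′ b c X = Flipped.result F , (size-F , seq-s , seq-t , Flipped.symmetric F)
    , unique
  where
  open CrossingTop s t 1<s 1<t cop σ τ ρ scσ scτ s′ t′ b c X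
  module Z = CrossingTop t s 1<t 1<s (Coprimality.sym cop) τ σ ρ (proj₁ scτ , proj₂ (proj₂ scτ) , proj₁ (proj₂ scτ))
      (proj₁ scσ , proj₂ (proj₂ scσ) , proj₁ (proj₂ scσ)) t′ s′ c b (crossing-swap X)
  gaps : All (Gap ρ) (s′ ∷ t′ ∷ [])
  gaps = gap-s′ ∷ Y.gap-s′ ∷ []
  s′≢t′ : s′ ≢ t′
  s′≢t′ refl = s∤t (divides 1ℤ (trans et (trans (sym es) (sym (ℤₚ.*-identityˡ S)))))
  F : Flipped ρ (s′ ∷ t′ ∷ [])
  F = flipAll ρ symρ _ gaps ((s′≢t′ ∷ []) ∷ [] ∷ [])
  size-F : size (Flipped.result F) ≡ size ρ ℕ.+ s ℕ.+ t
  size-F = ℤₚ.+-injective (trans (Flipped.sizes F)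
      (trans (cong₂ (λ a d → + size ρ + (a + (d + 0ℤ))) (sym es) (sym et))
      (((∀ n s t → n + (s + (t + 0ℤ)) ≡ (n + s) + t) ∋ solve-∀) (+ size ρ) S T)))
  seq-s : SEq s (Flipped.result F) σ
  seq-s = sameCharges (zc-cong (λ x → trans (((∀ i a d e → a + (d - e) ≡ (i + (a + (d + 0ℤ))) - (i + e)) ∋ solve-∀)
      (I ρ x) (fl s′ x) (fl t′ x) (fl (bar b) x)) (sym (cong₂ _-_ (Flipped.beads F x) (σ-eq x))))
    (zc-+ (zc-fl s s′ (∣-half s′ es))
        (zc-fl₂ s t′ (bar b) (∣-lin₁ -1ℤ s∣ (((∀ t b → t - b ≡ -1ℤ * (b - t)) ∋ solve-∀) t′ (bar b))))))
  seq-t : SEq t (Flipped.result F) τ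
  seq-t = sameCharges (zc-cong (λ x → trans (((∀ i a d e → d + (a - e) ≡ (i + (a + (d + 0ℤ))) - (i + e)) ∋ solve-∀)
      (I ρ x) (fl s′ x) (fl t′ x) (fl (bar c) x)) (sym (cong₂ _-_ (Flipped.beads F x) (τ-eq x))))
    (zc-+ (zc-fl t t′ (∣-half t′ et))
        (zc-fl₂ t s′ (bar c) (∣-lin₁ -1ℤ t∣ (((∀ t b → t - b ≡ -1ℤ * (b - t)) ∋ solve-∀) s′ (bar c))))))
  unique : ∀ μ → Good s t σ τ (size ρ ℕ.+ s ℕ.+ t) μ → μ ≡ Flipped.result F
  unique μ (sz , sqs , sqt , syμ) = by-axes
      (odd-weight s σ 1≤s csσ μ syμ sqs (proj₁ odd-weight-s) (trans szℤ (proj₂ odd-weight-s)))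
      (odd-weight t τ (ℕₚ.<⇒≤ 1<t) Z.csσ μ syμ sqt (proj₁ Z.odd-weight-s) (trans szℤ′ (proj₂ Z.odd-weight-s)))
    where
    szℤ : + size μ ≡ (+ size ρ + S) + T
    szℤ = cong +_ sz
    szℤ′ : + size μ ≡ (+ size ρ + T) + S
    szℤ′ = trans szℤ (((∀ n s t → (n + s) + t ≡ (n + t) + s) ∋ solve-∀) (+ size ρ) S T)
    common : ∀ r → 0ℤ ≤ r → I μ r ≡ 1ℤ → S ∣ H r → T ∣ H r → ⊥
    common r 0≤r r∈ s∣r t∣r = b≢c (H-inj
        (trans (no-common μ szℤ sqs syμ r 0≤r r∈ s∣r t∣r)
        (sym (trans (Z.no-common μ szℤ′ sqt syμ r 0≤r r∈ t∣r s∣r) frob-swap))))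
    by-axes : ∃[ p ] (0ℤ ≤ p × I μ p ≡ 1ℤ × S ∣ H p) → ∃[ q ] (0ℤ ≤ q × I μ q ≡ 1ℤ × T ∣ H q) → μ ≡ Flipped.result F
    by-axes (p , 0≤p , p∈ , s∣p) (q , 0≤q , q∈ , t∣q) = I-inj λ x → trans
        (((∀ m a d → m ≡ (m + (- a + (- d + 0ℤ))) + (a + (d + 0ℤ))) ∋ solve-∀) (I μ x) (fl p x) (fl q x))
        (trans (cong (_+ (fl p x + (fl q x + 0ℤ)))
            (trans (sym (trans (Flipped.beads G x)
            (cong₂ (λ a d → I μ x + (a + (d + 0ℤ))) (fl-bar p x) (fl-bar q x)))) (cong (λ ν → I ν x) G≡ρ)))
          (trans (cong₂ (λ a d → I ρ x + (fl a x + (fl d x + 0ℤ))) p≡ q≡) (sym (Flipped.beads F x))))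
      where
      p≡ : p ≡ s′
      p≡ = axis-s μ szℤ sqs syμ p 0≤p p∈ s∣p q 0≤q q∈ t∣q (λ s∣q → common q 0≤q q∈ s∣q t∣q)
      q≡ : q ≡ t′
      q≡ = Z.axis-s μ szℤ′ sqt syμ q 0≤q q∈ t∣q p 0≤p p∈ s∣p (λ t∣p → common p 0≤p p∈ s∣p t∣p)
      G : Flipped μ (bar p ∷ bar q ∷ [])
      G = flipAll μ syμ _ (sym-bead μ syμ p∈ ∷ sym-bead μ syμ q∈ ∷ [])
          (((λ e → s′≢t′ (trans (sym p≡) (trans (bar-inj e) q≡))) ∷ []) ∷ [] ∷ [])
      seq-G : SEq s (Flipped.result G) ρ
      seq-G = sameCharges (zc-cong (λ x → trans (cong (λ z → (I μ x - z) + (- fl p x + - (fl q x - fl (bar b) x)))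
          (σ-eq x))
          (trans (((∀ m i e a d → (m - (i + e)) + (- a + - (d - e)) ≡ (m + (- a + (- d + 0ℤ))) - i) ∋ solve-∀)
              (I μ x) (I ρ x) (fl (bar b) x) (fl p x) (fl q x))
            (cong (_- I ρ x) (sym (trans (Flipped.beads G x)
                (cong₂ (λ a d → I μ x + (a + (d + 0ℤ))) (fl-bar p x) (fl-bar q x)))))))
        (zc-+ (SEq.charges sqs) (zc-+ (zc-neg (zc-fl s p s∣p))
            (zc-neg (zc-fl₂ s q (bar b) (∣-lin₁ -1ℤ s∣
            (trans (cong (_- bar b) q≡) (((∀ t b → t - b ≡ -1ℤ * (b - t)) ∋ solve-∀) t′ (bar b)))))))))
      -- Without p and q, μ has the size of ρ and its class numbers modulo s, and ρ is closed, so
      -- the minimality of cores identifies them.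
      G≡ρ : Flipped.result G ≡ ρ
      G≡ρ = seq-size-≡ s _ ρ 1≤s seq-G closed-ρ
          (ℤₚ.+-injective (trans (Flipped.sizes G) (trans (cong₂ (λ a d → + size μ + (a + (d + 0ℤ)))
          (trans (H-bar p) (cong -_ (trans (cong H p≡) (sym es))))
              (trans (H-bar q) (cong -_ (trans (cong H q≡) (sym et)))))
        (trans (cong (λ z → z + (- S + (- T + 0ℤ))) szℤ)
            (((∀ n s t → ((n + s) + t) + (- s + (- t + 0ℤ)) ≡ n) ∋ solve-∀) (+ size ρ) S T)))))

-- Necessity

flips-count : ∀ zs p → flips zs p ≡ count zs p - count zs (bar p)
flips-count []       p = refl
flips-count (z ∷ zs) p = trans (cong (λ w → fl z p + w) (flips-count zs p))
  (trans (((∀ a b c d → (a - b) + (c - d) ≡ (a + c) - (b + d)) ∋ solve-∀) (δ z p) (δ (bar z) p) (count zs p)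
      (count zs (bar p)))
    (cong (λ w → (δ z p + count zs p) - (w + count zs (bar p))) (sym (δ-bar z p))))

bead-or-gap : ∀ λ′ N → (∃[ p ] (N ≡ H p × I λ′ p ≡ 1ℤ)) ⊎ (∀ p → N ≡ H p → I λ′ p ≡ 0ℤ)
bead-or-gap λ′ N with parity N
... | inj₁ (a , e) = inj₂ λ p q → ⊥-elim (even≢odd a p (trans (sym e) q))
... | inj₂ (a , e) with I-01 λ′ a
...   | inj₂ q = inj₁ (a , e , q)
...   | inj₁ q = inj₂ λ p w → trans (cong (I λ′) (H-inj (trans (sym w) e))) q

-- λ has the class numbers of β with t′ flipped. Flipping instead at the top b of the class of
-- `bar t′` gives the same numbers and a closed set, hence the core. Here H b ≡ - t modulo s, so b
-- is off the s-axis.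
core-of-flip : ∀ s t → 1 ℕ.< s → Coprime s t → ∀ β → Sym (I β) → Closed s (I β) → ∀ λ′ σ → SEq s λ′ σ → Closed s
    (I σ) →
  ∀ t′ → + t ≡ H t′ → ZeroCharge s (λ x → (I λ′ x - I β x) - fl t′ x) →
  ∃[ b ] (I β b ≡ 1ℤ × + s ∣ bar b - t′ × (∀ x → I σ x ≡ I β x + fl (bar b) x))
core-of-flip s t 1<s cop β sy cs λ′ σ sq csσ t′ et z = from (class-top s β (bar t′) (ℕₚ.<⇒≤ 1<s))
  where
  from : ∃[ b ] (+ s ∣ b - bar t′ × I β b ≡ 1ℤ × I β (b + + s) ≡ 0ℤ) → ∃[ b ]
      (I β b ≡ 1ℤ × + s ∣ bar b - t′ × (∀ x → I σ x ≡ I β x + fl (bar b) x))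
  from (b , d , b∈ , out) = b , b∈ , d′ , λ x → trans
      (core-unique {s} (I-01 σ) (I-01 (Flipped.result F)) csσ (top-flip-closed s β (ℕₚ.<⇒≤ 1<s) sy cs b b∈ out s∤b F)
      charge x)
      (trans (Flipped.beads F x) (cong (λ w → I β x + w) (+-identityʳ (fl (bar b) x))))
    where
    d′ : + s ∣ bar b - t′
    d′ = ∣-lin₁ -1ℤ d (((∀ b t → (-1ℤ - b) - t ≡ -1ℤ * (b - (-1ℤ - t))) ∋ solve-∀) b t′)
    s∤b : ¬ (+ s ∣ H b)
    s∤b q = ¬t∣s 1<s (Coprimality.sym cop)
        (∣-lin -1ℤ (- + 2) q d′ (trans et
        (((∀ b t → t + t + 1ℤ ≡ -1ℤ * (b + b + 1ℤ) + - + 2 * ((-1ℤ - b) - t)) ∋ solve-∀) b t′)))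
    F : Flipped β (bar b ∷ [])
    F = flip₁ β sy (bar b) (sym-bead β sy b∈)
    charge : ZeroCharge s (λ x → I σ x - I (Flipped.result F) x)
    charge = zc-cong (λ x → trans (((∀ l g i a e → - (l - g) + (((l - i) - a) + (a - e)) ≡ g - (i + (e + 0ℤ))) ∋
        solve-∀) (I λ′ x) (I σ x) (I β x) (fl t′ x) (fl (bar b) x))
        (cong (λ w → I σ x - w) (sym (Flipped.beads F x))))
      (zc-+ (zc-neg (SEq.charges sq))
          (zc-+ z (zc-fl₂ s t′ (bar b) (∣-lin₁ -1ℤ d′ (((∀ t b → t - b ≡ -1ℤ * (b - t)) ∋ solve-∀) t′ (bar b))))))

core-≡ : ∀ s β λ′ σ → SEq s λ′ σ → Closed s (I σ) → Closed s (I β) → SEq s λ′ β → σ ≡ β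
core-≡ s β λ′ σ sq cσ cβ sβ = I-inj
    (core-unique {s} (I-01 σ) (I-01 β) cσ cβ (SEq.charges (seq-trans (seq-sym sq) sβ)))

module ProductBead
  (s t : ℕ) (1<s : 1 ℕ.< s) (1<t : 1 ℕ.< t) (cop : Coprime s t)
  (λ′ : Partition) (sy : Sym (I λ′)) (σ τ : Partition) (sqs : SEq s λ′ σ) (sqt : SEq t λ′ τ)
  (csσ : Closed s (I σ)) (ctσ : Closed t (I σ)) (csτ : Closed s (I τ)) (ctτ : Closed t (I τ))
  (uniq : ∀ μ → Sym (I μ) → SEq s μ λ′ → SEq t μ λ′ → size μ ≡ size λ′ → μ ≡ λ′)
  (β : Partition) (scβ : SymCore s t β) (β-other : ∀ x → ¬ Special s t x → I β x ≡ I λ′ x)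
  (u : ℤ) (eu : + s * + t ≡ H u) (u∈ : I λ′ u ≡ 1ℤ) where

  open Inversions s t 1<s 1<t cop λ′ sy σ τ sqs sqt csσ ctσ csτ ctτ uniq

  S T : ℤ
  S = + s
  T = + t

  0≤u : 0ℤ ≤ u
  0≤u = AddProduct.0≤u s t 1<s 1<t β scβ u (sym eu)

  s∣u : S ∣ H u
  s∣u = AddProduct.s∣u s t 1<s 1<t β scβ u (sym eu)

  t∣u : T ∣ H u
  t∣u = AddProduct.t∣u s t 1<s 1<t β scβ u (sym eu)

  s∤t : ¬ (S ∣ T)
  s∤t = ¬t∣s 1<s (Coprimality.sym cop)

  T≢ST : T ≢ S * T
  T≢ST e = 1+≰ {a = T} (≤-trans (≤-lin {c = 0ℤ} {(S - + 2) * T} {1ℤ} {T} (0≤* {S - + 2} {T} (≤⇒0≤ (ℤ.+≤+ 1<s)) 0≤+n)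
      (ℤ.+≤+ (ℕₚ.<⇒≤ 1<t))
    (((∀ s t → s * t - (1ℤ + t) ≡ ((s - + 2) * t - 0ℤ) + (t - 1ℤ)) ∋ solve-∀) S T)) (≤-reflexive (sym e)))

  module AtGap (g : ℤ) (g∉ : I λ′ g ≡ 0ℤ) (s∣u-g : S ∣ u - g) (hg : H g ≡ S ⊎ H g ≡ - S) where

    open A.Below u 0≤u u∈ s∣u g g∉ s∣u-g hg public

    2c : + c + + c ≡ S * T - H g
    2c = trans (cong₂ _+_ c-eq c-eq)
        (trans (((∀ p g → (p - g) + (p - g) ≡ (p + p + 1ℤ) - (g + g + 1ℤ)) ∋ solve-∀) u g) (cong (_- H g) (sym eu)))

    T-mult : T ∣ S * T
    T-mult = divides S refl

    S-mult : S ∣ S * T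
    S-mult = divides T (ℤₚ.*-comm S T)

    S∣g : S ∣ H g
    S∣g = ∣-lin 1ℤ (- + 2) s∣u s∣u-g (((∀ p g → g + g + 1ℤ ≡ 1ℤ * (p + p + 1ℤ) + - + 2 * (p - g)) ∋ solve-∀) u g)

    t∤c : ¬ (T ∣ + c)
    t∤c d = A.t∤-s hg (∣-lin 1ℤ (- + 2) T-mult d (trans (((∀ st g → g ≡ st - (st - g)) ∋ solve-∀) (S * T) (H g))
        (trans (cong (λ w → S * T - w) (sym 2c)) (((∀ st c → st - (c + c) ≡ 1ℤ * st + - + 2 * c) ∋ solve-∀) (S * T)
        (+ c)))))

    isolated : A.Isolated c u
    isolated = from (A.inversion c u s∣c t∤c inP)
      where
      from : (u - + c ≡ bar u) ⊎ A.Isolated c u ⊎ T ∣ H (u - + c) → A.Isolated c u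
      from (inj₁ e) = ⊥-elim (A.t∤s (∣-≡ (central-size hg e) t∣u))
      from (inj₂ (inj₁ i)) = i
      from (inj₂ (inj₂ d)) = ⊥-elim (A.t∤-s hg (∣-≡ (cong H p-c) d))

    -- y lies in the row of u, whose only reversed pair is at `bar u`, so y - c is a gap. Its mirror
    -- image is not special and therefore survives in β, where the bound for cores applies.
    mirror-bead : ∀ y → I λ′ y ≡ 0ℤ → T ∣ H y → ¬ (S ∣ H y) → y ≢ bar u → I β (bar (y - + c)) ≡ 1ℤ × H
        (bar (y - + c)) ≡ (S * T - H g) - H y
    mirror-bead y y∉ t∣y s∤y y≢ = trans (β-other _ nsp) (sym-gap λ′ sy y-c∉) , Hv
      where
      Hv : H (bar (y - + c)) ≡ (S * T - H g) - H y
      Hv = trans (((∀ y c → (-1ℤ - (y - c)) + (-1ℤ - (y - c)) + 1ℤ ≡ (c + c) - (y + y + 1ℤ)) ∋ solve-∀) y (+ c))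
          (cong (_- H y) 2c)
      t∣y-u : T ∣ y - u
      t∣y-u = odd-∣2 u (y - u) t∣u (∣-lin 1ℤ -1ℤ t∣y t∣u
          (((∀ y u → (y - u) + (y - u) ≡ 1ℤ * (y + y + 1ℤ) + -1ℤ * (u + u + 1ℤ)) ∋ solve-∀) y u))
      y-c∉ : I λ′ (y - + c) ≡ 0ℤ
      y-c∉ with I-01 λ′ (y - + c)
      ... | inj₁ e = e
      ... | inj₂ e = ⊥-elim (y≢ (A.Isolated.only-Q isolated y (y∉ , e) t∣y-u))
      nsp : ¬ Special s t (bar (y - + c))
      nsp (inj₂ d) = A.t∤-s hg (∣-≡ (trans (cong (λ w → (S * T - w) - H y) Hv)
          (((∀ st g h → (st - ((st - g) - h)) - h ≡ g) ∋ solve-∀) (S * T) (H g) (H y)))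
        (∣m∣n⇒∣m-n (∣m∣n⇒∣m-n T-mult d) t∣y))
      nsp (inj₁ d) = s∤y (∣-≡ (trans (cong (λ w → (S * T - H g) - w) Hv)
          (((∀ a h → a - (a - h) ≡ h) ∋ solve-∀) (S * T - H g) (H y)))
        (∣m∣n⇒∣m-n (∣m∣n⇒∣m-n S-mult S∣g) d))

  -- Taking y = `bar t′` gives a bead of β with H = s t - H g + t. As H g ≤ s, this exceeds s t - s
  -- - t.
  no-t : ∀ t′ → T ≡ H t′ → I λ′ t′ ≡ 1ℤ → ⊥
  no-t t′ et t′∈ = from (A.gap-at-s u s∣u)
    where
    Hy : H (bar t′) ≡ - T
    Hy = trans (H-bar t′) (cong -_ (sym et))
    from : ∃[ g ] (I λ′ g ≡ 0ℤ × S ∣ u - g × (H g ≡ S ⊎ H g ≡ - S)) → ⊥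
    from (g , g∉ , d , hg) = pos≰0 {1}
        (≤-trans 2≤2T (≤-lin {c = (S * T - H g) - - T} {frob s t} {H g} {S}
        (subst (_≤ frob s t) (trans (proj₂ mb) (cong (λ w → (S * T - H g) - w) Hy))
        (core-bound (ℕₚ.<⇒≤ 1<s) cop β scβ _ (proj₁ mb))) (A.±s-≤ hg)
        (((∀ s t g → 0ℤ - (t + t) ≡ (((s * t - s) - t) - ((s * t - g) - - t)) + (s - g)) ∋ solve-∀) S T (H g))))
      where
      open AtGap g g∉ d hg
      mb : I β (bar (bar t′ - + c)) ≡ 1ℤ × H (bar (bar t′ - + c)) ≡ (S * T - H g) - H (bar t′)
      mb = mirror-bead (bar t′) (sym-bead λ′ sy t′∈) (∣-≡ (sym Hy) (∣m⇒∣-m ∣-self))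
          (λ q → s∤t (∣-lin₁ -1ℤ q (trans (((∀ t → t ≡ -1ℤ * - t) ∋ solve-∀) T) (cong (-1ℤ *_) (sym Hy)))))
        (λ q → T≢ST (trans et (trans (cong H (bar-inj {t′} {u} q)) (sym eu))))
      2≤2T : + 2 ≤ T + T
      2≤2T = ℤₚ.+-mono-≤ (ℤ.+≤+ (ℕₚ.<⇒≤ 1<t)) (ℤ.+≤+ (ℕₚ.<⇒≤ 1<t))

  -- Taking g = s′ and y = t′ gives a bead with H = s t - s - t, the one that identifies κ.
  frob-bead : ∀ s′ → S ≡ H s′ → I λ′ s′ ≡ 0ℤ → ∀ t′ → T ≡ H t′ → I λ′ t′ ≡ 0ℤ → ∃[ x₀ ]
      (H x₀ ≡ frob s t × I β x₀ ≡ 1ℤ)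
  frob-bead s′ es s′∉ t′ et t′∉ = bar (t′ - + c) , trans (proj₂ mb)
      (cong₂ (λ a d → (S * T - a) - d) (sym es) (sym et)) , proj₁ mb
    where
    s∣u-s′ : S ∣ u - s′
    s∣u-s′ = odd-∣2 u (u - s′) s∣u (∣-lin 1ℤ -1ℤ s∣u (∣-half s′ es)
        (((∀ y u → (y - u) + (y - u) ≡ 1ℤ * (y + y + 1ℤ) + -1ℤ * (u + u + 1ℤ)) ∋ solve-∀) u s′))
    open AtGap s′ s′∉ s∣u-s′ (inj₁ (sym es))
    mb : I β (bar (t′ - + c)) ≡ 1ℤ × H (bar (t′ - + c)) ≡ (S * T - H s′) - H t′
    mb = mirror-bead t′ t′∉ (∣-half t′ et) (λ q → s∤t (∣-≡ (sym et) q))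
        (λ q → ¬both≥0 0≤u (subst (0ℤ ≤_) q (0≤half (ℕₚ.<⇒≤ 1<t) et)))

size-flip : ∀ β λ′ w → Sym (I β) → Gap β w → (∀ x → I λ′ x ≡ I β x + fl w x) → + size λ′ ≡ + size β + H w
size-flip β λ′ w sy g e = trans
    (cong (λ ν → + size ν) (I-inj {λ′} {Flipped.result F}
    (λ x → trans (e x) (sym (trans (Flipped.beads F x) (cong (λ z → I β x + z) (+-identityʳ (fl w x))))))))
  (trans (Flipped.sizes F) (cong (λ z → + size β + z) (+-identityʳ (H w))))
  where
  F : Flipped β (w ∷ [])
  F = flip₁ β sy w g

make-C2 : ∀ s t → 1 ℕ.< s → 1 ℕ.< t → Coprime s t → ∀ β → SymCore s t β → ∀ λ′ σ τ → SEq s λ′ σ → SEq t λ′ τ →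
    Closed s (I σ) → Closed t (I τ) →
  ∀ t′ → + t ≡ H t′ → (∀ x → I λ′ x ≡ I β x + fl t′ x) → C2 s t σ τ (size λ′)
make-C2 s t 1<s 1<t cop β (sy , cs , ct) λ′ σ τ sqs sqt csσ ctτ t′ et e =
  subst (λ ν → C2 s t σ ν (size λ′)) (sym τ≡β)
      (H⇒odd t t′ et , rh (core-of-flip s t 1<s cop β sy cs λ′ σ sqs csσ t′ et charge-s) , sz)
  where
  τ≡β : τ ≡ β
  τ≡β = core-≡ t β λ′ τ sqt ctτ ct
      (sameCharges (zc-cong (λ x → trans (((∀ i f → f ≡ (i + f) - i) ∋ solve-∀) (I β x) (fl t′ x))
      (cong (_- I β x) (sym (e x)))) (zc-fl t t′ (∣-half t′ et))))
  charge-s : ZeroCharge s (λ x → (I λ′ x - I β x) - fl t′ x)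
  charge-s = zc-cong (λ x → sym (trans (cong (λ w → (w - I β x) - fl t′ x) (e x))
      (((∀ i f → ((i + f) - i) - f ≡ 0ℤ) ∋ solve-∀) (I β x) (fl t′ x)))) zc-0
  sz : size λ′ ≡ size β ℕ.+ t
  sz = ℤₚ.+-injective (trans (size-flip β λ′ t′ sy (core-gap t β sy ct t′ (0≤half (ℕₚ.<⇒≤ 1<t) et) (∣-half t′ et)) e)
      (cong (λ z → + size β + z) (sym et)))
  rh : ∃[ b ] (I β b ≡ 1ℤ × + s ∣ bar b - t′ × (∀ x → I σ x ≡ I β x + fl (bar b) x)) → Rharp s t σ β
  rh (b , b∈ , d , q) = b , I⇒∈B β b b∈ , I⇒∉B σ b b∉σ , ∣⇒cong s b (+ t) t′ et d , I⇒swap σ β b sy b∈ q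
    where
    b∉σ : I σ b ≡ 0ℤ
    b∉σ = trans (q b) (cong₂ _+_ b∈ (cong₂ _-_ (δ-≢ (λ w → 0≢1 (trans (cong (I β) w) (sym-bead β sy b∈)) b∈))
        (δ-≡ (sym (bar-bar b)))))

crossing⇒C4 : ∀ s t → 1 ℕ.< s → 1 ℕ.< t → Coprime s t → ∀ σ τ ρ → SymCore s t σ → SymCore s t τ → ∀ s′ t′ b c →
    Crossing s t σ τ ρ s′ t′ b c →
  ∀ n → n ≡ size ρ ℕ.+ s ℕ.+ t → C4 s t σ τ n
crossing⇒C4 s t 1<s 1<t cop σ τ ρ scσ scτ s′ t′ b c X n sz = H⇒odd s s′ es , H⇒odd t t′ et , b , bar c ,
    ( (λ q → 0≢1 (trans (cong (I ρ) q) (sym-bead ρ symρ c∈)) b∈) , I⇒∈B τ b Y.c∈σ , I⇒∉B σ b b∉σ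
    , I⇒∈B τ (bar c) Y.b̄∈σ , I⇒∉B σ (bar c) (sym-bead σ (proj₁ scσ) c∈σ)
    , ∣⇒cong s b (+ t) t′ et s∣
    , ∣⇒cong t (bar c) (- (+ s)) (bar s′) (trans (cong -_ es) (sym (H-bar s′)))
        (∣-lin₁ -1ℤ t∣ (((∀ c s → (-1ℤ - (-1ℤ - c)) - (-1ℤ - s) ≡ -1ℤ * ((-1ℤ - c) - s)) ∋ solve-∀) c s′))
    , char ) , ρ , star , sz
  where
  open CrossingTop s t 1<s 1<t cop σ τ ρ scσ scτ s′ t′ b c X
  swσ : Swap σ ρ b
  swσ = I⇒swap σ ρ b symρ b∈ σ-eq
  star : Swap ρ τ (bar c)
  star = I⇒swap ρ τ (bar c) (proj₁ scτ) Y.b̄∈σ λ x → trans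
      (((∀ i f → i ≡ (i + f) + - f) ∋ solve-∀) (I ρ x) (fl (bar c) x))
      (cong₂ _+_ (sym (τ-eq x)) (sym (fl-bar (bar c) x)))
  char : ∀ x → x ∈B σ ⇔ ((x ∈B τ × x ≢ b × x ≢ bar c) ⊎ (x ≡ bar b ⊎ x ≡ bar (bar c)))
  char x = mk⇔ to from
    where
    to : x ∈B σ → (x ∈B τ × x ≢ b × x ≢ bar c) ⊎ (x ≡ bar b ⊎ x ≡ bar (bar c))
    to m with Equivalence.to (swσ x) m
    ... | inj₂ q = inj₂ (inj₁ q)
    ... | inj₁ (mρ , n₁) with Equivalence.to (star x) mρ
    ...   | inj₂ q = inj₂ (inj₂ q)
    ...   | inj₁ (mτ , n₂) = inj₁ (mτ , n₁ , n₂)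
    from : (x ∈B τ × x ≢ b × x ≢ bar c) ⊎ (x ≡ bar b ⊎ x ≡ bar (bar c)) → x ∈B σ
    from (inj₁ (mτ , n₁ , n₂)) = Equivalence.from (swσ x) (inj₁ (Equivalence.from (star x) (inj₁ (mτ , n₂)) , n₁))
    from (inj₂ (inj₁ q)) = Equivalence.from (swσ x) (inj₂ q)
    from (inj₂ (inj₂ q)) = Equivalence.from (swσ x)
        (inj₁ (Equivalence.from (star x) (inj₂ q) , λ w → b≢c (trans (sym w) (trans q (bar-bar c)))))

C4⇒crossing : ∀ s t σ τ → Sym (I τ) → ∀ s′ → + s ≡ H s′ → ∀ t′ → + t ≡ H t′ → ∀ b c → LRharpWith s t σ τ b c → ∀ ρ →
    IsStar τ c ρ → Crossing s t σ τ ρ s′ t′ b (bar c)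
C4⇒crossing s t σ τ syτ s′ es t′ et b c (b≢c , bτ , b∉ , cτ , c∉ , cgb , cgc , char) ρ star = record
  { es = es ; et = et ; symρ = syρ ; b∈ = b∈ρ ; c∈ = c̄∈ρ ; b≢c = b≢c̄ ; σ-eq = swap⇒I σ ρ b syρ b∈ρ swσ
  ; τ-eq = λ x → trans (((∀ i f → i ≡ (i + f) + - f) ∋ solve-∀) (I τ x) (fl (bar c) x))
      (cong₂ _+_ (sym (ρ-eq x)) (sym (fl-bar (bar c) x)))
  ; s∣ = cong⇒∣ s b (+ t) t′ et cgb
  ; t∣ = ∣-lin₁ -1ℤ (cong⇒∣ t c (- (+ s)) (bar s′) (trans (cong -_ es) (sym (H-bar s′))) cgc)
      (((∀ c s → (-1ℤ - (-1ℤ - c)) - s ≡ -1ℤ * ((-1ℤ - c) - (-1ℤ - s))) ∋ solve-∀) c s′) }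
  where
  b∈τ : I τ b ≡ 1ℤ
  b∈τ = ∈B⇒I τ b bτ
  c∈τ : I τ c ≡ 1ℤ
  c∈τ = ∈B⇒I τ c cτ
  ρ-eq : ∀ x → I ρ x ≡ I τ x + fl (bar c) x
  ρ-eq = swap⇒I ρ τ c syτ c∈τ star
  F : Flipped τ (bar c ∷ [])
  F = flip₁ τ syτ (bar c) (sym-bead τ syτ c∈τ)
  syρ : Sym (I ρ)
  syρ = subst (λ ν → Sym (I ν)) (I-inj {Flipped.result F} {ρ} λ x → trans (Flipped.beads F x)
      (trans (cong (λ z → I τ x + z) (+-identityʳ (fl (bar c) x))) (sym (ρ-eq x)))) (Flipped.symmetric F)
  b≢c̄ : b ≢ bar c
  b≢c̄ q = 0≢1 (trans (cong (I τ) q) (sym-bead τ syτ c∈τ)) b∈τ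
  b∈ρ : I ρ b ≡ 1ℤ
  b∈ρ = ∈B⇒I ρ b (Equivalence.from (star b) (inj₁ (bτ , b≢c)))
  c̄∈ρ : I ρ (bar c) ≡ 1ℤ
  c̄∈ρ = ∈B⇒I ρ (bar c) (Equivalence.from (star (bar c)) (inj₂ refl))
  swσ : Swap σ ρ b
  swσ x = mk⇔ to from
    where
    to : x ∈B σ → (x ∈B ρ × x ≢ b) ⊎ x ≡ bar b
    to m with Equivalence.to (char x) m
    ... | inj₁ (mτ , n₁ , n₂) = inj₁ (Equivalence.from (star x) (inj₁ (mτ , n₂)) , n₁)
    ... | inj₂ (inj₁ q) = inj₂ q
    ... | inj₂ (inj₂ q) = inj₁ (Equivalence.from (star x) (inj₂ q) , λ w → b≢c̄ (trans (sym w) q))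
    from : (x ∈B ρ × x ≢ b) ⊎ x ≡ bar b → x ∈B σ
    from (inj₂ q) = Equivalence.from (char x) (inj₂ (inj₁ q))
    from (inj₁ (mρ , n₁)) with Equivalence.to (star x) mρ
    ... | inj₁ (mτ , n₂) = Equivalence.from (char x) (inj₁ (mτ , n₁ , n₂))
    ... | inj₂ q = Equivalence.from (char x) (inj₂ (inj₂ q))

swap-core : ∀ {s t σ} → SymCore s t σ → SymCore t s σ
swap-core (a , b , c) = a , c , b

vac-01 : Is01 vac
vac-01 (+ n)    = inj₁ refl
vac-01 -[1+ n ] = inj₂ refl

vac-sym : Sym vac
vac-sym (+ n)    = cong vac (bar-+ n)
vac-sym -[1+ n ] = refl

vac-≥0 : ∀ {p} → 0ℤ ≤ p → vac p ≡ 0ℤ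
vac-≥0 {+ n} _ = refl

-- λ after its special beads x ≥ 0 have moved to their mirror images, written without listing these
-- beads.
base : ℕ → ℕ → Partition → ℤ → ℤ
base s t λ′ x with special? s t x
... | yes _ = vac x
... | no  _ = I λ′ x

base-special : ∀ s t λ′ x → Special s t x → base s t λ′ x ≡ vac x
base-special s t λ′ x sp with special? s t x
... | yes _ = refl
... | no n  = ⊥-elim (n sp)

base-other : ∀ s t λ′ x → ¬ Special s t x → base s t λ′ x ≡ I λ′ x
base-other s t λ′ x n with special? s t x
... | yes sp = ⊥-elim (n sp)
... | no _   = refl

base-partition : ∀ s t λ′ → Sym (I λ′) → ∃[ β ] (∀ x → I β x ≡ base s t λ′ x)
base-partition s t λ′ sy = fromSym (base s t λ′) b01 bsym (proj₁ (I-bound λ′)) high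
  where
  b01 : Is01 (base s t λ′)
  b01 x with special? s t x
  ... | yes _ = vac-01 x
  ... | no  _ = I-01 λ′ x
  bsym : Sym (base s t λ′)
  bsym x = by (special? s t x)
    where
    by : Dec (Special s t x) → base s t λ′ (bar x) ≡ 1ℤ - base s t λ′ x
    by (yes sp) = trans (base-special s t λ′ (bar x) (special-bar x sp))
        (trans (vac-sym x) (cong (λ z → 1ℤ - z) (sym (base-special s t λ′ x sp))))
    by (no n) = trans (base-other s t λ′ (bar x) (λ sp → n (special-bar⁻ x sp)))
        (trans (sy x) (cong (λ z → 1ℤ - z) (sym (base-other s t λ′ x n))))
  high : ∀ n → proj₁ (I-bound λ′) ℕ.≤ n → base s t λ′ (+ n) ≡ 0ℤ
  high n p with special? s t (+ n)
  ... | yes _ = refl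
  ... | no  _ = proj₁ (proj₂ (I-bound λ′)) n p

module Forward
  (s t : ℕ) (1<s : 1 ℕ.< s) (1<t : 1 ℕ.< t) (cop : Coprime s t)
  (λ′ : Partition) (sy : Sym (I λ′)) (σ τ : Partition) (sqs : SEq s λ′ σ) (sqt : SEq t λ′ τ)
  (scσ : SymCore s t σ) (scτ : SymCore s t τ)
  (uniq : ∀ μ → Sym (I μ) → SEq s μ λ′ → SEq t μ λ′ → size μ ≡ size λ′ → μ ≡ λ′)
  (β : Partition) (β-eq : ∀ x → I β x ≡ base s t λ′ x) where

  csσ = proj₁ (proj₂ scσ)
  ctσ = proj₂ (proj₂ scσ)
  csτ = proj₁ (proj₂ scτ)
  ctτ = proj₂ (proj₂ scτ)

  open Base s t 1<s 1<t cop λ′ sy σ τ sqs sqt csσ ctσ csτ ctτ uniq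
  module BaseSwapped = Base t s 1<t 1<s (Coprimality.sym cop) λ′ sy τ σ sqt sqs ctτ csτ ctσ csσ
      (λ μ a b c → uniq μ a c b)

  S T : ℤ
  S = + s
  T = + t

  β-special : ∀ x → Special s t x → I β x ≡ vac x
  β-special x sp = trans (β-eq x) (base-special s t λ′ x sp)

  β-other : ∀ x → ¬ Special s t x → I β x ≡ I λ′ x
  β-other x n = trans (β-eq x) (base-other s t λ′ x n)

  scβ : SymCore s t β
  scβ = β-sym , closed-base (I β) (I-01 β) β-special β-other
      , BaseSwapped.closed-base (I β) (I-01 β) (λ x sp → β-special x ([ inj₂ , inj₁ ]′ sp))
          (λ x n → β-other x (λ sp → n ([ inj₂ , inj₁ ]′ sp)))
    where
    β-sym : Sym (I β)
    β-sym x = by (special? s t x)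
      where
      by : Dec (Special s t x) → I β (bar x) ≡ 1ℤ - I β x
      by (yes sp) = trans (β-special (bar x) (special-bar x sp))
          (trans (vac-sym x) (cong (λ z → 1ℤ - z) (sym (β-special x sp))))
      by (no n) = trans (β-other (bar x) (λ sp → n (special-bar⁻ x sp)))
          (trans (sy x) (cong (λ z → 1ℤ - z) (sym (β-other x n))))

  special-values : ∀ p → 0ℤ ≤ p → I λ′ p ≡ 1ℤ → Special s t p → (S ≡ H p) ⊎ (T ≡ H p) ⊎ (S * T ≡ H p)
  special-values p 0≤p p∈ sp = by (S ∣? H p) (T ∣? H p) sp
    where
    by : Dec (S ∣ H p) → Dec (T ∣ H p) → Special s t p → (S ≡ H p) ⊎ (T ≡ H p) ⊎ (S * T ≡ H p)
    by (yes a) (yes b) _ = inj₂ (inj₂ (sym (A.double p 0≤p p∈ a b)))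
    by (yes a) (no b)  _ = inj₁ (sym (A.single p 0≤p p∈ a b))
    by (no a)  (yes b) _ = inj₂ (inj₁ (sym (B.single p 0≤p p∈ b a)))
    by (no a)  (no b)  (inj₁ d) = ⊥-elim (a d)
    by (no a)  (no b)  (inj₂ d) = ⊥-elim (b d)

  Axis : ℤ → Set
  Axis z = 0ℤ ≤ z × Special s t z × I λ′ z ≡ 1ℤ

  -- At a special x ≥ 0, β has a gap and λ is given by `count zs`. Symmetry covers the negative
  -- positions, and elsewhere λ and β agree.
  decompose : ∀ zs → All Axis zs → (∀ p → 0ℤ ≤ p → Special s t p → I λ′ p ≡ 1ℤ → count zs p ≡ 1ℤ) → ∀ x → I
      λ′ x ≡ I β x + flips zs x
  decompose zs az full x = trans (by (special? s t x) (0≤⊎0≤bar x)) (cong (λ z → I β x + z) (sym (flips-count zs x)))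
    where
    off : ∀ p → I λ′ p ≡ 0ℤ ⊎ ¬ Special s t p ⊎ 0ℤ ≤ bar p → count zs p ≡ 0ℤ
    off p h = count-∉ zs (All.map (λ {z} a → ne z a h) az)
      where
      ne : ∀ z → Axis z → I λ′ p ≡ 0ℤ ⊎ ¬ Special s t p ⊎ 0ℤ ≤ bar p → p ≢ z
      ne z (_ , _ , z∈) (inj₁ q) refl = 0≢1 q z∈
      ne z (_ , sp , _) (inj₂ (inj₁ n)) refl = n sp
      ne z (0≤z , _) (inj₂ (inj₂ q)) refl = ¬both≥0 0≤z q
    at-≥0 : ∀ p → 0ℤ ≤ p → Special s t p → I λ′ p ≡ count zs p
    at-≥0 p 0≤p sp = from (I-01 λ′ p)
      where
      from : I λ′ p ≡ 0ℤ ⊎ I λ′ p ≡ 1ℤ → I λ′ p ≡ count zs p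
      from (inj₁ q) = trans q (sym (off p (inj₁ q)))
      from (inj₂ q) = trans q (sym (full p 0≤p sp q))
    by : Dec (Special s t x) → 0ℤ ≤ x ⊎ 0ℤ ≤ bar x → I λ′ x ≡ I β x + (count zs x - count zs (bar x))
    by (no n) _ = trans (sym (β-other x n))
        (sym (trans (cong₂ (λ a b → I β x + (a - b)) (off x (inj₂ (inj₁ n)))
        (off (bar x) (inj₂ (inj₁ (λ sp → n (special-bar⁻ x sp)))))) (+-identityʳ _)))
    by (yes sp) (inj₁ 0≤x) = trans (at-≥0 x 0≤x sp)
        (sym (trans (cong₂ (λ a b → a + (count zs x - b)) (trans (β-special x sp) (vac-≥0 0≤x))
        (off (bar x) (inj₂ (inj₂ (subst (0ℤ ≤_) (sym (bar-bar x)) 0≤x)))))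
      (((∀ c → 0ℤ + (c - 0ℤ) ≡ c) ∋ solve-∀) (count zs x))))
    by (yes sp) (inj₂ 0≤x̄) = trans
        (trans (cong (I λ′) (sym (bar-bar x)))
        (trans (sy (bar x)) (cong (λ z → 1ℤ - z) (at-≥0 (bar x) 0≤x̄ (special-bar x sp)))))
      (sym (trans (cong₂ (λ a b → a + (b - count zs (bar x)))
          (trans (β-special x sp) (trans (cong vac (sym (bar-bar x)))
          (trans (vac-sym (bar x)) (cong (λ z → 1ℤ - z) (vac-≥0 0≤x̄))))) (off x (inj₂ (inj₂ 0≤x̄))))
        (((∀ c → 1ℤ + (0ℤ - c) ≡ 1ℤ - c) ∋ solve-∀) (count zs (bar x)))))

  axis-s : ∀ s′ → S ≡ H s′ → I λ′ s′ ≡ 1ℤ → Axis s′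
  axis-s s′ es q = 0≤half (ℕₚ.<⇒≤ 1<s) es , inj₁ (∣-half s′ es) , q

  axis-t : ∀ t′ → T ≡ H t′ → I λ′ t′ ≡ 1ℤ → Axis t′
  axis-t t′ et q = 0≤half (ℕₚ.<⇒≤ 1<t) et , inj₂ (∣-half t′ et) , q

  count-one : ∀ z p → p ≡ z → count (z ∷ []) p ≡ 1ℤ
  count-one z p e = cong (_+ 0ℤ) (δ-≡ e)

  gap↯ : ∀ {N} → (∀ p → N ≡ H p → I λ′ p ≡ 0ℤ) → ∀ {p} → I λ′ p ≡ 1ℤ → N ≢ H p
  gap↯ g p∈ e = 0≢1 (g _ e) p∈

  Conclusion : Set
  Conclusion = C1 s t σ τ (size λ′) ⊎ C2 s t σ τ (size λ′) ⊎ C3 s t σ τ (size λ′) ⊎ C4 s t σ τ (size λ′) ⊎ C5 s t σ τ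
      (size λ′)

  ST-gap ST-bead S-gap T-gap : Set
  S-gap = ∀ p → S ≡ H p → I λ′ p ≡ 0ℤ
  T-gap = ∀ p → T ≡ H p → I λ′ p ≡ 0ℤ
  ST-gap = ∀ p → S * T ≡ H p → I λ′ p ≡ 0ℤ
  ST-bead = ∃[ u ] (S * T ≡ H u × I λ′ u ≡ 1ℤ)

  case-C1 : S-gap → T-gap → ST-gap → Conclusion
  case-C1 gs gt gst = inj₁ (cong parts (trans σ≡ (sym τ≡)) , cong size (trans λ≡ (sym σ≡)))
    where
    λ≡ : λ′ ≡ β
    λ≡ = I-inj λ x → trans (decompose [] []
        (λ p 0≤p sp p∈ → ⊥-elim ([ gap↯ gs p∈ , [ gap↯ gt p∈ , gap↯ gst p∈ ]′ ]′ (special-values p 0≤p p∈ sp))) x)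
        (+-identityʳ _)
    σ≡ : σ ≡ β
    σ≡ = core-≡ s β λ′ σ sqs csσ (proj₁ (proj₂ scβ)) (subst (SEq s λ′) λ≡ seq-refl)
    τ≡ : τ ≡ β
    τ≡ = core-≡ t β λ′ τ sqt ctτ (proj₂ (proj₂ scβ)) (subst (SEq t λ′) λ≡ seq-refl)

  case-C2 : S-gap → ST-gap → ∀ t′ → T ≡ H t′ → I λ′ t′ ≡ 1ℤ → Conclusion
  case-C2 gs gst t′ et t′∈ = inj₂
      (inj₁ (make-C2 s t 1<s 1<t cop β scβ λ′ σ τ sqs sqt csσ ctτ t′ et λ x → trans
      (decompose (t′ ∷ []) (axis-t t′ et t′∈ ∷ []) full x) (cong (λ z → I β x + z) (+-identityʳ (fl t′ x)))))
    where
    full : ∀ p → 0ℤ ≤ p → Special s t p → I λ′ p ≡ 1ℤ → count (t′ ∷ []) p ≡ 1ℤ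
    full p 0≤p sp p∈ = [ (λ e → ⊥-elim (gap↯ gs p∈ e)) , [ (λ e → count-one t′ p (H-inj (trans (sym e) et))) ,
        (λ e → ⊥-elim (gap↯ gst p∈ e)) ]′ ]′ (special-values p 0≤p p∈ sp)

  case-C3 : T-gap → ST-gap → ∀ s′ → S ≡ H s′ → I λ′ s′ ≡ 1ℤ → Conclusion
  case-C3 gt gst s′ es s′∈ = inj₂
      (inj₂ (inj₁ (make-C2 t s 1<t 1<s (Coprimality.sym cop) β (swap-core scβ) λ′ τ σ sqt sqs ctτ csσ s′ es λ x →
      trans (decompose (s′ ∷ []) (axis-s s′ es s′∈ ∷ []) full x) (cong (λ z → I β x + z) (+-identityʳ (fl s′ x))))))
    where
    full : ∀ p → 0ℤ ≤ p → Special s t p → I λ′ p ≡ 1ℤ → count (s′ ∷ []) p ≡ 1ℤ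
    full p 0≤p sp p∈ = [ (λ e → count-one s′ p (H-inj (trans (sym e) es))) , [ (λ e → ⊥-elim (gap↯ gt p∈ e)) ,
        (λ e → ⊥-elim (gap↯ gst p∈ e)) ]′ ]′ (special-values p 0≤p p∈ sp)

  module Both (gst : ST-gap) (s′ : ℤ) (es : S ≡ H s′) (s′∈ : I λ′ s′ ≡ 1ℤ) (t′ : ℤ) (et : T ≡ H t′) (t′∈ : I λ′ t′ ≡ 1ℤ) where

    s∤t : ¬ (S ∣ T)
    s∤t = ¬t∣s 1<s (Coprimality.sym cop)

    s′≢t′ : s′ ≢ t′
    s′≢t′ refl = s∤t (divides 1ℤ (trans et (trans (sym es) (sym (ℤₚ.*-identityˡ S)))))

    full : ∀ p → 0ℤ ≤ p → Special s t p → I λ′ p ≡ 1ℤ → count (s′ ∷ t′ ∷ []) p ≡ 1ℤ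
    full p 0≤p sp p∈ = [ at-s , [ at-t , (λ e → ⊥-elim (gap↯ gst p∈ e)) ]′ ]′ (special-values p 0≤p p∈ sp)
      where
      at-s : S ≡ H p → count (s′ ∷ t′ ∷ []) p ≡ 1ℤ
      at-s e = cong₂ _+_ (δ-≡ p≡) (cong (_+ 0ℤ) (δ-≢ (λ q → s′≢t′ (trans (sym p≡) q))))
        where
        p≡ : p ≡ s′
        p≡ = H-inj (trans (sym e) es)
      at-t : T ≡ H p → count (s′ ∷ t′ ∷ []) p ≡ 1ℤ
      at-t e = cong₂ _+_ (δ-≢ (λ q → s′≢t′ (trans (sym q) p≡))) (cong (_+ 0ℤ) (δ-≡ p≡))
        where
        p≡ : p ≡ t′
        p≡ = H-inj (trans (sym e) et)

    λ-eq : ∀ x → I λ′ x ≡ I β x + (fl s′ x + (fl t′ x + 0ℤ))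
    λ-eq = decompose (s′ ∷ t′ ∷ []) (axis-s s′ es s′∈ ∷ axis-t t′ et t′∈ ∷ []) full

    size-λ : + size λ′ ≡ (+ size β + S) + T
    size-λ = trans (cong (λ ν → + size ν)
        (I-inj {λ′} {Flipped.result F} λ x → trans (λ-eq x) (sym (Flipped.beads F x))))
      (trans (Flipped.sizes F) (trans (cong₂ (λ a d → + size β + (a + (d + 0ℤ))) (sym es) (sym et))
          (((∀ n s t → n + (s + (t + 0ℤ)) ≡ (n + s) + t) ∋ solve-∀) (+ size β) S T)))
      where
      F : Flipped β (s′ ∷ t′ ∷ [])
      F = flipAll β (proj₁ scβ) _
        (core-gap s β (proj₁ scβ) (proj₁ (proj₂ scβ)) s′ (0≤half (ℕₚ.<⇒≤ 1<s) es) (∣-half s′ es) ∷ core-gap t β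
            (proj₁ scβ) (proj₂ (proj₂ scβ)) t′ (0≤half (ℕₚ.<⇒≤ 1<t) et) (∣-half t′ et) ∷ [])
        ((s′≢t′ ∷ []) ∷ [] ∷ [])

    Ends : ℕ → Partition → ℤ → ℤ → Set
    Ends r κ z b = I β b ≡ 1ℤ × + r ∣ bar b - z × (∀ x → I κ x ≡ I β x + fl (bar b) x)

    ends-s : ∃[ b ] Ends s σ t′ b
    ends-s = core-of-flip s t 1<s cop β (proj₁ scβ) (proj₁ (proj₂ scβ)) λ′ σ sqs csσ t′ et
      (zc-cong (λ x → sym (trans (cong (λ w → (w - I β x) - fl t′ x) (λ-eq x))
          (((∀ i a d → ((i + (a + (d + 0ℤ))) - i) - d ≡ a) ∋ solve-∀) (I β x) (fl s′ x) (fl t′ x))))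
          (zc-fl s s′ (∣-half s′ es)))

    ends-t : ∃[ c ] Ends t τ s′ c
    ends-t = core-of-flip t s 1<t (Coprimality.sym cop) β (proj₁ scβ) (proj₂ (proj₂ scβ)) λ′ τ sqt ctτ s′ es
      (zc-cong (λ x → sym (trans (cong (λ w → (w - I β x) - fl s′ x) (λ-eq x))
          (((∀ i a d → ((i + (a + (d + 0ℤ))) - i) - a ≡ d) ∋ solve-∀) (I β x) (fl s′ x) (fl t′ x))))
          (zc-fl t t′ (∣-half t′ et)))

    -- If b = c then σ = τ and σ with the bead of size s t added is a second solution.
    distinct : ∀ b → Ends s σ t′ b → ¬ Ends t τ s′ b
    distinct b (b∈ , s∣ , σ-eq) (_ , t∣ , τ-eq) = 0≢1 (gst u (sym eu))
        (subst (λ ν → I ν u ≡ 1ℤ) μ≡λ (Single.at-w (proj₁ scσ) (core-gap s σ (proj₁ scσ) csσ u 0≤u s∣u) F))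
      where
      -- The excess of the size of λ over that of σ. It is an odd multiple of s t, greater than - s
      -- t and at most s t, hence equal to s t.
      V : ℤ
      V = (H b + S) + T
      σ≡τ : σ ≡ τ
      σ≡τ = I-inj λ x → trans (σ-eq x) (sym (τ-eq x))
      b̄∈σ : I σ (bar b) ≡ 1ℤ
      b̄∈σ = trans (σ-eq (bar b)) (cong₂ _+_ (sym-bead β (proj₁ scβ) b∈)
          (cong₂ _-_ (δ-refl (bar b)) (δ-≢
          (gap≢bar β (proj₁ scβ) (sym-bead β (proj₁ scβ) b∈) (sym-bead β (proj₁ scβ) b∈)))))
      sV : S ∣ V
      sV = ∣-lin (- + 2) 1ℤ s∣ ∣-self
          (trans (cong (λ z → (H b + S) + z) et)
          (((∀ b s t → ((b + b + 1ℤ) + s) + (t + t + 1ℤ) ≡ - + 2 * ((-1ℤ - b) - t) + 1ℤ * s) ∋ solve-∀) b S t′))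
      tV : T ∣ V
      tV = ∣-lin (- + 2) 1ℤ t∣ ∣-self
          (trans (cong (λ z → (H b + z) + T) es)
          (((∀ b s t → ((b + b + 1ℤ) + (s + s + 1ℤ)) + t ≡ - + 2 * ((-1ℤ - b) - s) + 1ℤ * t) ∋ solve-∀) b s′ T))
      V≢0 : V ≢ 0ℤ
      V≢0 z = even≢odd 0ℤ ((b + s′ + t′) + 1ℤ)
          (trans (sym z) (trans (cong₂ (λ a d → (H b + a) + d) es et)
          (((∀ b s t → ((b + b + 1ℤ) + (s + s + 1ℤ)) + (t + t + 1ℤ) ≡ ((b + s + t) + 1ℤ) + ((b + s + t) + 1ℤ) + 1ℤ) ∋
          solve-∀) b s′ t′)))
      lo : 1ℤ - S * T ≤ V
      lo = ≤-lin {c = - H b} {frob s t} {1ℤ} {+ 2 * S + + 2 * T}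
          (subst (_≤ frob s t) (H-bar b) (core-bound (ℕₚ.<⇒≤ 1<s) cop σ scσ (bar b) b̄∈σ))
        (≤-lin {c = 1ℤ} {S} {0ℤ} {S + + 2 * T} (ℤ.+≤+ (ℕₚ.<⇒≤ 1<s))
            (0≤+ {S} {+ 2 * T} 0≤+n (0≤* {+ 2} {T} 0≤+n 0≤+n))
            (((∀ s t → (+ 2 * s + + 2 * t) - 1ℤ ≡ (s - 1ℤ) + ((s + + 2 * t) - 0ℤ)) ∋ solve-∀) S T))
        (((∀ b s t → ((b + s) + t) - (1ℤ - s * t) ≡ (((s * t - s) - t) - - b) + ((+ 2 * s + + 2 * t) - 1ℤ)) ∋
            solve-∀) (H b) S T)
      V≡ : V ≡ S * T
      V≡ = ℤₚ.≤-antisym (≤-lin₁ (core-bound (ℕₚ.<⇒≤ 1<s) cop β scβ b b∈)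
          (((∀ b s t → s * t - ((b + s) + t) ≡ ((s * t - s) - t) - b) ∋ solve-∀) (H b) S T))
          (small-multiple cop V sV tV lo V≢0)
      u : ℤ
      u = + 2 * (s′ * t′) + s′ + t′
      eu : H u ≡ S * T
      eu = prod-odd s t s′ t′ es et
      open AddProduct s t 1<s 1<t σ scσ u eu
      n≡ : size λ′ ≡ size σ ℕ.+ s ℕ.* t
      n≡ = ℤₚ.+-injective (trans size-λ
          (trans (((∀ n b s t → (n + s) + t ≡ (n - b) + ((b + s) + t)) ∋ solve-∀) (+ size β) (H b) S T)
        (cong₂ _+_ (sym (swap-size β σ b (proj₁ scβ) b∈ σ-eq)) (trans V≡ (sym (ℤₚ.pos-* s t))))))
      μ≡λ : Flipped.result F ≡ λ′
      μ≡λ = uniq _ (Flipped.symmetric F) (seq-trans (seq-F s∣u) (seq-sym sqs))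
          (seq-trans (seq-F t∣u) (seq-sym (subst (SEq t λ′) (sym σ≡τ) sqt))) (trans size-F (sym n≡))

    conclude : ∃[ b ] Ends s σ t′ b → ∃[ c ] Ends t τ s′ c → Conclusion
    conclude (b , b∈ , s∣ , σ-eq) (c , c∈ , t∣ , τ-eq) = inj₂
        (inj₂ (inj₂ (inj₁ (crossing⇒C4 s t 1<s 1<t cop σ τ β scσ scτ s′ t′ b c
      (record { es = es ; et = et ; symρ = proj₁ scβ ; b∈ = b∈ ; c∈ = c∈ ; b≢c =
          λ { refl → distinct b (b∈ , s∣ , σ-eq) (c∈ , t∣ , τ-eq) } ; σ-eq = σ-eq ; τ-eq = τ-eq ; s∣ = s∣ ; t∣ = t∣ })
      (size λ′) (ℤₚ.+-injective size-λ)))))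

  module Product (u : ℤ) (eu : S * T ≡ H u) (u∈ : I λ′ u ≡ 1ℤ) where

    module P = ProductBead s t 1<s 1<t cop λ′ sy σ τ sqs sqt csσ ctσ csτ ctτ uniq β scβ β-other u eu u∈
    module Q = ProductBead t s 1<t 1<s (Coprimality.sym cop) λ′ sy τ σ sqt sqs ctτ csτ ctσ csσ
        (λ μ a b c → uniq μ a c b) β (swap-core scβ)
      (λ x n → β-other x (λ sp → n ([ inj₂ , inj₁ ]′ sp))) u (trans (ℤₚ.*-comm T S) eu) u∈

    gt : T-gap
    gt p e with I-01 λ′ p
    ... | inj₁ q = q
    ... | inj₂ q = ⊥-elim (P.no-t p e q)

    gs : S-gap
    gs p e with I-01 λ′ p
    ... | inj₁ q = q
    ... | inj₂ q = ⊥-elim (Q.no-t p e q)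

    full : ∀ p → 0ℤ ≤ p → Special s t p → I λ′ p ≡ 1ℤ → count (u ∷ []) p ≡ 1ℤ
    full p 0≤p sp p∈ = [ (λ e → ⊥-elim (gap↯ gs p∈ e)) , [ (λ e → ⊥-elim (gap↯ gt p∈ e)) ,
        (λ e → count-one u p (H-inj (trans (sym e) eu))) ]′ ]′ (special-values p 0≤p p∈ sp)

    λ-eq : ∀ x → I λ′ x ≡ I β x + fl u x
    λ-eq x = trans (decompose (u ∷ []) ((P.0≤u , inj₁ P.s∣u , u∈) ∷ []) full x)
        (cong (λ z → I β x + z) (+-identityʳ (fl u x)))

    seq-β : ∀ {r} → + r ∣ H u → SEq r λ′ β
    seq-β {r} d = sameCharges (zc-cong (λ x → trans (((∀ i f → f ≡ (i + f) - i) ∋ solve-∀) (I β x) (fl u x))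
        (cong (_- I β x) (sym (λ-eq x)))) (zc-fl r u d))

    σ≡ : σ ≡ β
    σ≡ = core-≡ s β λ′ σ sqs csσ (proj₁ (proj₂ scβ)) (seq-β P.s∣u)

    τ≡ : τ ≡ β
    τ≡ = core-≡ t β λ′ τ sqt ctτ (proj₂ (proj₂ scβ)) (seq-β P.t∣u)

    conclude : Conclusion
    conclude = from (odd-div S u P.s∣u) (odd-div T u P.t∣u)
      where
      from : ∃[ s′ ] (S ≡ H s′ × S ∣ u - s′) → ∃[ t′ ] (T ≡ H t′ × T ∣ u - t′) → Conclusion
      from (s′ , es , _) (t′ , et , _) = inj₂
          (inj₂ (inj₂ (inj₂ (H⇒odd s s′ es , H⇒odd t t′ et , cong parts (trans σ≡ (sym τ≡)) , isκ , sz))))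
        where
        fb : ∃[ x₀ ] (H x₀ ≡ frob s t × I β x₀ ≡ 1ℤ)
        fb = P.frob-bead s′ es (gs s′ es) t′ et (gt t′ et)
        -- Maximality comes from the bead `fb`, which makes the defect of β zero.
        isκ : IsKappa s t σ
        isκ = closed⇒isCore s σ (ℕₚ.<⇒≤ 1<s) csσ , closed⇒isCore t σ (ℕₚ.<⇒≤ 1<t) ctσ , λ μ cμ dμ →
          subst (λ ν → size μ ℕ.≤ size ν) (sym σ≡)
              (Defect.Extremal.tight-max s t 1<s 1<t cop (proj₁ fb) (proj₁ (proj₂ fb)) β scβ (proj₂ (proj₂ fb)) μ
              (isCore⇒closed s μ cμ) (isCore⇒closed t μ dμ))
        sz : size λ′ ≡ size σ ℕ.+ s ℕ.* t
        sz = ℤₚ.+-injective (trans (size-flip β λ′ u (proj₁ scβ)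
            (core-gap s β (proj₁ scβ) (proj₁ (proj₂ scβ)) u P.0≤u P.s∣u) λ-eq)
          (cong₂ _+_ (cong (λ ν → + size ν) (sym σ≡)) (trans (sym eu) (sym (ℤₚ.pos-* s t)))))

  conclusion : Conclusion
  conclusion = by (bead-or-gap λ′ (S * T)) (bead-or-gap λ′ S) (bead-or-gap λ′ T)
    where
    by : ST-bead ⊎ ST-gap → (∃[ p ] (S ≡ H p × I λ′ p ≡ 1ℤ)) ⊎ S-gap → (∃[ p ] (T ≡ H p × I λ′ p ≡ 1ℤ)) ⊎ T-gap →
        Conclusion
    by (inj₁ (u , eu , u∈)) _ _ = Product.conclude u eu u∈
    by (inj₂ gst) (inj₂ gs) (inj₂ gt) = case-C1 gs gt gst
    by (inj₂ gst) (inj₂ gs) (inj₁ (t′ , et , t′∈)) = case-C2 gs gst t′ et t′∈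
    by (inj₂ gst) (inj₁ (s′ , es , s′∈)) (inj₂ gt) = case-C3 gt gst s′ es s′∈
    by (inj₂ gst) (inj₁ (s′ , es , s′∈)) (inj₁ (t′ , et , t′∈)) = Both.conclude gst s′ es s′∈ t′ et t′∈
        (Both.ends-s gst s′ es s′∈ t′ et t′∈) (Both.ends-t gst s′ es s′∈ t′ et t′∈)

-- Return from bead sets to hooks and diagrams

good⇒goodSC : ∀ {s t σ τ n} → 1 ℕ.≤ s → 1 ℕ.≤ t → Closed s (I σ) → Closed t (I τ) → ∀ λ′ → Good s t σ τ n λ′ →
    GoodSC s t σ τ n λ′
good⇒goodSC {s} {t} {σ} {τ} 1≤s 1≤t cs ct λ′ (sz , sqs , sqt , sy) =
  sz , seq⇒coreOf s λ′ σ 1≤s sqs cs , seq⇒coreOf t λ′ τ 1≤t sqt ct , Sym⇒selfConj λ′ sy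

goodSC⇒good : ∀ {s t σ τ n} → 1 ℕ.≤ s → 1 ℕ.≤ t → ∀ λ′ → GoodSC s t σ τ n λ′ → Good s t σ τ n λ′
goodSC⇒good {s} {t} {σ} {τ} 1≤s 1≤t λ′ (sz , cs , ct , sc) =
  sz , coreOf⇒seq s λ′ σ 1≤s cs , coreOf⇒seq t λ′ τ 1≤t ct , selfConj⇒Sym λ′ sc

unique⇒exactlyOne : ∀ {s t σ τ n} → 1 ℕ.≤ s → 1 ℕ.≤ t → Closed s (I σ) → Closed t (I τ) → Unique s t σ τ n →
    ExactlyOneSC s t σ τ n
unique⇒exactlyOne 1≤s 1≤t cs ct (λ′ , g , u) =
  λ′ , good⇒goodSC 1≤s 1≤t cs ct λ′ g , λ μ g′ → cong parts (u μ (goodSC⇒good 1≤s 1≤t μ g′))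

back-C1 : ∀ s t → 1 ℕ.≤ s → ∀ σ → SymCore s t σ → Unique s t σ σ (size σ)
back-C1 s t 1≤s σ (sy , cs , _) = σ , (refl , seq-refl , seq-refl , sy) , λ μ (sz , sq , _) → seq-size-≡ s μ σ 1≤s sq
    cs sz

exactlyOne⇒cases : ∀ s t → 1 ℕ.< s → 1 ℕ.< t → Coprime s t → ∀ σ τ → IsCore s σ → IsCore t σ → IsCore s τ →
    IsCore t τ → ∀ n → ExactlyOneSC s t σ τ n →
  SelfConj σ × SelfConj τ × (C1 s t σ τ n ⊎ C2 s t σ τ n ⊎ C3 s t σ τ n ⊎ C4 s t σ τ n ⊎ C5 s t σ τ n)
exactlyOne⇒cases s t 1<s 1<t cop σ τ sσ tσ sτ tτ n (λ′ , g , u) = from (goodSC⇒good 1≤s 1≤t λ′ g)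
  where
  1≤s : 1 ℕ.≤ s
  1≤s = ℕₚ.<⇒≤ 1<s
  1≤t : 1 ℕ.≤ t
  1≤t = ℕₚ.<⇒≤ 1<t
  csσ : Closed s (I σ)
  csσ = isCore⇒closed s σ sσ
  ctτ : Closed t (I τ)
  ctτ = isCore⇒closed t τ tτ
  from : Good s t σ τ n λ′ → SelfConj σ × SelfConj τ ×
      (C1 s t σ τ n ⊎ C2 s t σ τ n ⊎ C3 s t σ τ n ⊎ C4 s t σ τ n ⊎ C5 s t σ τ n)
  from (refl , sqs , sqt , sy) = Sym⇒selfConj σ syσ , Sym⇒selfConj τ syτ ,
      Forward.conclusion s t 1<s 1<t cop λ′ sy σ τ sqs sqt (syσ , csσ , isCore⇒closed t σ tσ)
          (syτ , isCore⇒closed s τ sτ , ctτ) uniq (proj₁ β) (proj₂ β)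
    where
    syσ : Sym (I σ)
    syσ = core-symmetric s λ′ σ sy sqs csσ
    syτ : Sym (I τ)
    syτ = core-symmetric t λ′ τ sy sqt ctτ
    β : ∃[ β ] (∀ x → I β x ≡ base s t λ′ x)
    β = base-partition s t λ′ sy
    uniq : ∀ μ → Sym (I μ) → SEq s μ λ′ → SEq t μ λ′ → size μ ≡ size λ′ → μ ≡ λ′
    uniq μ syμ a b sz = parts-inj (u μ (good⇒goodSC 1≤s 1≤t csσ ctτ μ (sz , seq-trans a sqs , seq-trans b sqt , syμ)))

cases⇒exactlyOne : ∀ s t → 1 ℕ.< s → 1 ℕ.< t → Coprime s t → ∀ σ τ → IsCore s σ → IsCore t σ → IsCore s τ →
    IsCore t τ → ∀ n →
  SelfConj σ × SelfConj τ × (C1 s t σ τ n ⊎ C2 s t σ τ n ⊎ C3 s t σ τ n ⊎ C4 s t σ τ n ⊎ C5 s t σ τ n) →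
      ExactlyOneSC s t σ τ n
cases⇒exactlyOne s t 1<s 1<t cop σ τ sσ tσ sτ tτ n (scσ , scτ , cases) = unique⇒exactlyOne 1≤s 1≤t
    (proj₁ (proj₂ coreσ)) (proj₂ (proj₂ coreτ)) (from cases)
  where
  1≤s : 1 ℕ.≤ s
  1≤s = ℕₚ.<⇒≤ 1<s
  1≤t : 1 ℕ.≤ t
  1≤t = ℕₚ.<⇒≤ 1<t
  coreσ : SymCore s t σ
  coreσ = selfConj⇒Sym σ scσ , isCore⇒closed s σ sσ , isCore⇒closed t σ tσ
  coreτ : SymCore s t τ
  coreτ = selfConj⇒Sym τ scτ , isCore⇒closed s τ sτ , isCore⇒closed t τ tτ
  from : C1 s t σ τ n ⊎ C2 s t σ τ n ⊎ C3 s t σ τ n ⊎ C4 s t σ τ n ⊎ C5 s t σ τ n → Unique s t σ τ n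
  from (inj₁ (e , refl)) = subst (λ ν → Unique s t σ ν (size σ)) (parts-inj e) (back-C1 s t 1≤s σ coreσ)
  from (inj₂ (inj₁ c@(_ , _ , refl))) = back-C2 s t 1≤t σ τ coreτ c
  from (inj₂ (inj₂ (inj₁ c@(_ , _ , refl)))) = unique-swap (back-C2 t s 1≤s τ σ (swap-core coreσ) c)
  from (inj₂ (inj₂ (inj₂ (inj₁ (odds , oddt , b , c , lr , ρ , star , refl))))) = crossing (odd⇒H s odds)
      (odd⇒H t oddt)
    where
    crossing : ∃[ s′ ] (+ s ≡ H s′) → ∃[ t′ ] (+ t ≡ H t′) → Unique s t σ τ (size ρ ℕ.+ s ℕ.+ t)
    crossing (s′ , es) (t′ , et) = back-C4 s t 1<s 1<t cop σ τ ρ coreσ coreτ s′ t′ b (bar c)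
        (C4⇒crossing s t σ τ (proj₁ coreτ) s′ es t′ et b c lr ρ star)
  from (inj₂ (inj₂ (inj₂ (inj₂ (odds , oddt , e , isκ , refl))))) = subst (λ ν → Unique s t σ ν (size σ ℕ.+ s ℕ.* t))
      (parts-inj e) (back-C5 s t 1<s 1<t cop σ coreσ odds oddt isκ)

theorem4p3 : (s t : ℕ) → 1 < s → 1 < t → Coprime s t →
  (σ τ : Partition) → IsCore s σ → IsCore t σ → IsCore s τ → IsCore t τ →
  (n : ℕ) →
  ExactlyOneSC s t σ τ n ⇔
    (SelfConj σ × SelfConj τ ×
      (C1 s t σ τ n ⊎ C2 s t σ τ n ⊎ C3 s t σ τ n ⊎ C4 s t σ τ n ⊎ C5 s t σ τ n))
theorem4p3 s t 1<s 1<t cop σ τ sσ tσ sτ tτ n = mk⇔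
  (exactlyOne⇒cases s t 1<s 1<t cop σ τ sσ tσ sτ tτ n)
  (cases⇒exactlyOne s t 1<s 1<t cop σ τ sσ tσ sτ tτ n)
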